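{- Let $\beta\ge5$ and $\epsilon\in\{1,-1\}$. Let $\Lambda_3$ be the quotient of $[4,2^{\beta-1},2^\beta]^+$ by the relations $\sigma_2^{ -1}\sigma_1=\sigma_1^{ -1}\sigma_2^{1+2^{\beta-2}}$, $\sigma_3^{ -1}\sigma_2=\sigma_2^{ -1+2^{\beta-2}}\sigma_3^{ -3+\epsilon2^{\beta-2}}$, $\sigma_3\sigma_2^{ -1}=\sigma_2^{1+2^{\beta-2}}\sigma_3^{3+\epsilon2^{\beta-2}}$. Then $\Lambda_3$ is the automorphism group, with standard generators $\sigma_1,\sigma_2,\sigma_3$, of an atomic chiral $4$-polytope of type $\{4,2^{\beta-1},2^\beta\}$.
   Context: $[p,q,r]^+=\langle\sigma_1,\sigma_2,\sigma_3\mid\sigma_1^p=\sigma_2^q=\sigma_3^r=(\sigma_1\sigma_2)^2=(\sigma_2\sigma_3)^2=(\sigma_1\sigma_2\sigma_3)^2=1\rangle$. Standard generators of a chiral polytope with base flag $\Phi$: $\Phi\sigma_i=\Phi^{i(i-1)}$, $\Phi^j$ the flag differing from $\Phi$ only in its $j$-face. Tight: type $\{p,q,r\}$ with exactly $2pqr$ flags. A tight chiral $4$-polytope is atomic if it does not properly cover any tight chiral polytope. -}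

module Defs where

open import Algebra.Bundles using (Group)
open import Algebra.Morphism.Structures using (module GroupMorphisms)
open import Data.Fin as Fin using (Fin; zero; suc; toℕ; inject₁)
open import Data.Integer as ℤ using (ℤ; +_; -[1+_]; 1ℤ; -1ℤ)
open import Data.List using (List; []; _∷_; _++_)
open import Data.List.Membership.Propositional using () renaming (_∈_ to _∈ₗ_)
open import Data.Nat as ℕ using (ℕ; zero; suc; _∸_)
open import Data.Product using (Σ; ∃-syntax; ∃₂; _×_; _,_; proj₁; proj₂)
open import Data.Sum using (_⊎_)
open import Function using (_∘_)
open import Function.Bundles using (Inverse; _⇔_)
open import Level using (0ℓ)
open import Relation.Binary.Bundles using (Setoid)
open import Relation.Binary.Construct.Closure.ReflexiveTransitive using (Star)
import Relation.Binary.Construct.On as On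
open import Relation.Binary.Core using (Rel)
open import Relation.Binary.Definitions using (Minimum; Maximum)
import Relation.Binary.Morphism.Construct.Composition as Comp
import Relation.Binary.Morphism.Construct.Identity as Id
open import Relation.Binary.Morphism.Structures using (IsOrderIsomorphism)
open import Relation.Binary.PropositionalEquality
  using (_≡_; _≢_; refl; sym; trans; cong; subst₂; setoid)
open import Relation.Binary.Structures using (IsDecPartialOrder)
open import Relation.Nullary using (¬_)
open import Relation.Unary using (Pred; Decidable; _∈_)

HasSize : Setoid 0ℓ 0ℓ → ℕ → Set
HasSize S n = Inverse (setoid (Fin n)) S

-- Ranks are shifted by one: a j-face, -1 ≤ j ≤ d, has `rank` j + 1.
-- Decidability of equality, of order and of subsets is automatic classically.
record RankedPoset (d : ℕ) : Set₁ where
  infix 4 _≤_ _<_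
  field
    Face              : Set
    _≤_               : Rel Face 0ℓ
    isDecPartialOrder : IsDecPartialOrder _≡_ _≤_
    rank              : Face → Fin (2 ℕ.+ d)

  _<_ : Rel Face 0ℓ
  F < G = F ≤ G × F ≢ G

  field
    rank-strictMono : ∀ {F G} → F < G → rank F Fin.< rank G

  IsChain : Pred (Pred Face 0ℓ) 0ℓ
  IsChain C = ∀ {F G} → F ∈ C → G ∈ C → F ≤ G ⊎ G ≤ F

  IsMaximalChain : Pred (Pred Face 0ℓ) 0ℓ
  IsMaximalChain C =
    IsChain C × (∀ H → (∀ {F} → F ∈ C → F ≤ H ⊎ H ≤ F) → H ∈ C)

  -- A chain with d + 2 faces, listed by rank.
  record Flag : Set where
    field
      face      : Fin (2 ℕ.+ d) → Face
      rank-face : ∀ i → rank (face i) ≡ i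
      face-mono : ∀ {i j} → i Fin.≤ j → face i ≤ face j

  open Flag public

  infix 4 _≈_
  _≈_ : Rel Flag 0ℓ
  Φ ≈ Ψ = ∀ i → face Φ i ≡ face Ψ i

  flagSetoid : Setoid 0ℓ 0ℓ
  flagSetoid = record
    { Carrier       = Flag
    ; _≈_           = _≈_
    ; isEquivalence = record
      { refl  = λ _ → refl
      ; sym   = λ e i → sym (e i)
      ; trans = λ e f i → trans (e i) (f i)
      }
    }

  -- The flags differ in the face of (shifted) rank j and nowhere else.
  Adjacent : Fin (2 ℕ.+ d) → Rel Flag 0ℓ
  Adjacent j Φ Ψ =
    face Φ j ≢ face Ψ j × (∀ i → i ≢ j → face Φ i ≡ face Ψ i)

  -- Faces common to two flags have the same rank, so Φ ∩ Ψ ⊆ Χ′ may be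
  -- tested index by index.
  AdjacentAbove : Flag → Flag → Rel Flag 0ℓ
  AdjacentAbove Φ Ψ Χ Χ′ =
    (∃[ j ] Adjacent j Χ Χ′) ×
    (∀ i → face Φ i ≡ face Ψ i → face Χ′ i ≡ face Φ i)

  StronglyFlagConnected : Set
  StronglyFlagConnected =
    ∀ Φ Ψ → ∃[ Χ ] (Star (AdjacentAbove Φ Ψ) Φ Χ × Χ ≈ Ψ)

  DiamondCondition : Set
  DiamondCondition =
    ∀ {F G} → F < G → toℕ (rank G) ≡ 2 ℕ.+ toℕ (rank F) →
    ∃₂ λ H₁ H₂ → H₁ ≢ H₂ × (F < H₁ × H₁ < G) × (F < H₂ × H₂ < G) ×
      (∀ H → F < H → H < G → H ≡ H₁ ⊎ H ≡ H₂)

  -- Every maximal chain has exactly d + 2 faces.  Since `rank` is injective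
  -- on chains, there is then one face of each rank.
  MaximalChainsAreFlags : Set₁
  MaximalChainsAreFlags =
    (C : Pred Face 0ℓ) → Decidable C → IsMaximalChain C →
    Σ Flag λ Φ → ∀ F → F ∈ C ⇔ (∃[ i ] face Φ i ≡ F)

record Polytope (d : ℕ) : Set₁ where
  field
    rankedPoset : RankedPoset d

  open RankedPoset rankedPoset public

  field
    least                 : Face
    least-minimum         : Minimum _≤_ least
    greatest              : Face
    greatest-maximum      : Maximum _≤_ greatest
    maximalChainsAreFlags : MaximalChainsAreFlags
    diamond               : DiamondCondition
    stronglyFlagConnected : StronglyFlagConnected

open Polytope using (Flag)

module _ {d : ℕ} (P Q : Polytope d) where
  private
    module P = Polytope P
    module Q = Polytope Q

  record Isomorphism : Set where
    field
      to                 : P.Face → Q.Face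
      isOrderIsomorphism : IsOrderIsomorphism _≡_ _≡_ P._≤_ Q._≤_ to
      rank-preserving    : ∀ F → Q.rank (to F) ≡ P.rank F

    open IsOrderIsomorphism isOrderIsomorphism public
      using (mono; cancel; surjective)

  mapFlag : (f : P.Face → Q.Face) →
            (∀ {F G} → F P.≤ G → f F Q.≤ f G) →
            (∀ F → Q.rank (f F) ≡ P.rank F) →
            P.Flag → Q.Flag
  mapFlag f mono rank-pres Φ = record
    { face      = f ∘ P.face Φ
    ; rank-face = λ i → trans (rank-pres _) (P.rank-face Φ i)
    ; face-mono = mono ∘ P.face-mono Φ
    }

  record Covering : Set where
    field
      to                   : P.Face → Q.Face
      surjective           : ∀ G → ∃[ F ] to F ≡ G
      mono                 : ∀ {F G} → F P.≤ G → to F Q.≤ to G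
      rank-preserving      : ∀ F → Q.rank (to F) ≡ P.rank F
      adjacency-preserving : ∀ j {Φ Ψ} → P.Adjacent j Φ Ψ →
        Q.Adjacent j (mapFlag to mono rank-preserving Φ)
                     (mapFlag to mono rank-preserving Ψ)

  ProperlyCovers : Set
  ProperlyCovers = Covering × ¬ Isomorphism

module _ {d : ℕ} (P : Polytope d) where
  private module P = Polytope P
  open Isomorphism

  private
    idA : Isomorphism P P
    idA = record
      { to                 = λ F → F
      ; isOrderIsomorphism = Id.isOrderIsomorphism _≡_ P._≤_ refl
      ; rank-preserving    = λ _ → refl
      }

    -- `g ⨾ h` applies g first.
    _⨾_ : Isomorphism P P → Isomorphism P P → Isomorphism P P
    g ⨾ h = record
      { to                 = to h ∘ to g
      ; isOrderIsomorphism =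
          Comp.isOrderIsomorphism trans
            (isOrderIsomorphism g) (isOrderIsomorphism h)
      ; rank-preserving    =
          λ F → trans (rank-preserving h (to g F)) (rank-preserving g F)
      }

    from : Isomorphism P P → P.Face → P.Face
    from g F = proj₁ (surjective g F)

    to-from : ∀ g F → to g (from g F) ≡ F
    to-from g F = proj₂ (surjective g F) refl

    from-to : ∀ g F → from g (to g F) ≡ F
    from-to g F =
      IsOrderIsomorphism.injective (isOrderIsomorphism g) (to-from g (to g F))

    invA : Isomorphism P P → Isomorphism P P
    invA g = record
      { to                 = from g
      ; isOrderIsomorphism = record
        { isOrderMonomorphism = record
          { isOrderHomomorphism = record
            { cong = cong (from g)
            ; mono = λ F≤G → cancel g
                (subst₂ P._≤_ (sym (to-from g _)) (sym (to-from g _)) F≤G)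
            }
          ; injective = λ e →
              trans (sym (to-from g _)) (trans (cong (to g) e) (to-from g _))
          ; cancel    = λ le →
              subst₂ P._≤_ (to-from g _) (to-from g _) (mono g le)
          }
        ; surjective = λ F → to g F , λ { refl → from-to g F }
        }
      ; rank-preserving    = λ F →
          trans (sym (rank-preserving g (from g F)))
                (cong P.rank (to-from g F))
      }

  -- Automorphisms act on the right: g ∙ h is g followed by h.
  Aut : Group 0ℓ 0ℓ
  Aut = record
    { Carrier = Isomorphism P P
    ; _≈_     = λ g h → ∀ F → to g F ≡ to h F
    ; _∙_     = _⨾_
    ; ε       = idA
    ; _⁻¹     = invA
    ; isGroup = record
      { isMonoid = record
        { isSemigroup = record
          { isMagma = record
            { isEquivalence = record
              { refl  = λ _ → refl
              ; sym   = λ e F → sym (e F)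
              ; trans = λ e f F → trans (e F) (f F)
              }
            ; ∙-cong = λ {g} {g′} {h} {h′} e f F →
                trans (cong (to h) (e F)) (f (to g′ F))
            }
          ; assoc = λ _ _ _ _ → refl
          }
        ; identity = (λ _ _ → refl) , (λ _ _ → refl)
        }
      ; inverse = to-from , from-to
      ; ⁻¹-cong = λ {g} {h} e F →
          IsOrderIsomorphism.injective (isOrderIsomorphism g)
            (trans (to-from g F)
              (trans (sym (to-from h F)) (sym (e (from h F)))))
      }
    }

  infixl 7 _·_
  _·_ : P.Flag → Isomorphism P P → P.Flag
  Φ · g = mapFlag P P (to g) (mono g) (rank-preserving g) Φ

  SameOrbit : Rel P.Flag 0ℓ
  SameOrbit Φ Ψ = ∃[ g ] Φ · g P.≈ Ψ

  -- Exactly two flag orbits, with adjacent flags in distinct orbits.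
  IsChiral : Set
  IsChiral =
    (∃₂ λ Φ₁ Φ₂ → ¬ SameOrbit Φ₁ Φ₂ ×
      (∀ Ψ → SameOrbit Φ₁ Ψ ⊎ SameOrbit Φ₂ Ψ)) ×
    (∀ j {Φ Ψ} → P.Adjacent j Φ Ψ → ¬ SameOrbit Φ Ψ)

  -- The vertices of the section G / F, where G is three ranks above F.
  sectionVertices : P.Face → P.Face → Setoid 0ℓ 0ℓ
  sectionVertices F G = On.setoid {B = Vertex} (setoid P.Face) proj₁
    where
    Vertex : Set
    Vertex = ∃[ H ] (F P.< H × H P.< G × toℕ (P.rank H) ≡ 1 ℕ.+ toℕ (P.rank F))

entry : ℕ → ℕ → ℕ → Fin 3 → ℕ
entry p q r zero             = p
entry p q r (suc zero)       = q
entry p q r (suc (suc zero)) = r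

module _ (P : Polytope 4) where
  private module P = Polytope P

  -- Whenever F is an (i-2)-face and G an incident (i+1)-face (i = 1, 2, 3),
  -- the section G / F is a pᵢ-gon, i.e. this polytope of rank 2 has pᵢ
  -- vertices.  With k = i - 1, the shifted ranks are k and k + 3.
  HasType : ℕ → ℕ → ℕ → Set
  HasType p q r =
    ∀ (k : Fin 3) F G → F P.< G →
    toℕ (P.rank F) ≡ toℕ k → toℕ (P.rank G) ≡ 3 ℕ.+ toℕ k →
    HasSize (sectionVertices P F G) (entry p q r k)

  IsTight : Set
  IsTight =
    ∃[ p ] ∃[ q ] ∃[ r ]
      (HasType p q r × HasSize P.flagSetoid (2 ℕ.* (p ℕ.* q ℕ.* r)))

  -- Φ σᵢ = Φ^{i(i-1)} = (Φ^i)^{i-1} for i = 1, 2, 3.  With k = i - 1, the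
  -- shifted ranks of an i-face and an (i-1)-face are k + 2 and k + 1.
  IsStandardGenerators : P.Flag → (Fin 3 → Isomorphism P P) → Set
  IsStandardGenerators Φ σ =
    ∀ k → ∃[ Φⁱ ]
      ( P.Adjacent (suc (suc (inject₁ k))) Φ Φⁱ
      × P.Adjacent (suc (inject₁ (inject₁ k))) Φⁱ (_·_ P Φ (σ k)))

IsAtomicChiral : Polytope 4 → Set₁
IsAtomicChiral P =
  IsTight P × IsChiral P ×
  (∀ Q → IsTight Q → IsChiral Q → ¬ ProperlyCovers P Q)

infixl 7 _∙_
infix  8 _⁻¹

data Word (n : ℕ) : Set where
  gen : Fin n → Word n
  ε   : Word n
  _∙_ : Word n → Word n → Word n
  _⁻¹ : Word n → Word n

pow : ∀ {n} → Word n → ℕ → Word n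
pow w zero    = ε
pow w (suc m) = w ∙ pow w m

infixr 9 _^ᶻ_

_^ᶻ_ : ∀ {n} → Word n → ℤ → Word n
w ^ᶻ (+ m)    = pow w m
w ^ᶻ -[1+ m ] = pow w (suc m) ⁻¹

infix 4 _≐_

_≐_ : ∀ {n} → Word n → Word n → Word n × Word n
u ≐ v = u , v

-- The congruence generated by the group axioms and the equations R.
data Derivable {n} (R : List (Word n × Word n)) : Rel (Word n) 0ℓ where
  relation  : ∀ {u v} → (u , v) ∈ₗ R → Derivable R u v
  ≐-refl    : ∀ {u} → Derivable R u u
  ≐-sym     : ∀ {u v} → Derivable R u v → Derivable R v u
  ≐-trans   : ∀ {u v w} → Derivable R u v → Derivable R v w → Derivable R u w
  ∙-cong    : ∀ {u u′ v v′} → Derivable R u u′ → Derivable R v v′ →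
              Derivable R (u ∙ v) (u′ ∙ v′)
  ⁻¹-cong   : ∀ {u v} → Derivable R u v → Derivable R (u ⁻¹) (v ⁻¹)
  assoc     : ∀ u v w → Derivable R ((u ∙ v) ∙ w) (u ∙ (v ∙ w))
  identityˡ : ∀ u → Derivable R (ε ∙ u) u
  identityʳ : ∀ u → Derivable R (u ∙ ε) u
  inverseˡ  : ∀ u → Derivable R (u ⁻¹ ∙ u) ε
  inverseʳ  : ∀ u → Derivable R (u ∙ u ⁻¹) ε

Presented : ∀ n → List (Word n × Word n) → Group 0ℓ 0ℓ
Presented n R = record
  { Carrier = Word n
  ; _≈_     = Derivable R
  ; _∙_     = _∙_
  ; ε       = ε
  ; _⁻¹     = _⁻¹
  ; isGroup = record
    { isMonoid = record
      { isSemigroup = record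
        { isMagma = record
          { isEquivalence = record
            { refl = ≐-refl ; sym = ≐-sym ; trans = ≐-trans }
          ; ∙-cong        = ∙-cong
          }
        ; assoc = assoc
        }
      ; identity = identityˡ , identityʳ
      }
    ; inverse = inverseˡ , inverseʳ
    ; ⁻¹-cong = ⁻¹-cong
    }
  }

σ₁ σ₂ σ₃ : Word 3
σ₁ = gen zero
σ₂ = gen (suc zero)
σ₃ = gen (suc (suc zero))

-- The defining relations of [p,q,r]⁺.
rotationRelations : ℕ → ℕ → ℕ → List (Word 3 × Word 3)
rotationRelations p q r =
    (σ₁ ^ᶻ (+ p) ≐ ε)
  ∷ (σ₂ ^ᶻ (+ q) ≐ ε)
  ∷ (σ₃ ^ᶻ (+ r) ≐ ε)
  ∷ ((σ₁ ∙ σ₂) ^ᶻ (+ 2) ≐ ε)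
  ∷ ((σ₂ ∙ σ₃) ^ᶻ (+ 2) ≐ ε)
  ∷ ((σ₁ ∙ σ₂ ∙ σ₃) ^ᶻ (+ 2) ≐ ε)
  ∷ []

Λ₃ : ℕ → ℤ → Group 0ℓ 0ℓ
Λ₃ β ϵ = Presented 3
  (rotationRelations 4 (2 ℕ.^ (β ∸ 1)) (2 ℕ.^ β) ++
    ( (σ₂ ⁻¹ ∙ σ₁ ≐ σ₁ ⁻¹ ∙ σ₂ ^ᶻ (1ℤ ℤ.+ q))
    ∷ (σ₃ ⁻¹ ∙ σ₂ ≐ σ₂ ^ᶻ (-1ℤ ℤ.+ q) ∙ σ₃ ^ᶻ (ℤ.- (+ 3) ℤ.+ ϵ ℤ.* q))
    ∷ (σ₃ ∙ σ₂ ⁻¹ ≐ σ₂ ^ᶻ (1ℤ ℤ.+ q) ∙ σ₃ ^ᶻ (+ 3 ℤ.+ ϵ ℤ.* q))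
    ∷ []))
  where
  q : ℤ
  q = + (2 ℕ.^ (β ∸ 2))

-- G is the automorphism group of P, with σ the standard generators relative
-- to some base flag.
IsAutGroupWithGenerators :
  (G : Group 0ℓ 0ℓ) → (Fin 3 → Group.Carrier G) → Polytope 4 → Set
IsAutGroupWithGenerators G σ P =
  Σ (Flag P) λ Φ → Σ (Group.Carrier G → Isomorphism P P) λ h →
    GroupMorphisms.IsGroupIsomorphism
      (Group.rawGroup G) (Group.rawGroup (Aut P)) h ×
    IsStandardGenerators P Φ (h ∘ σ)

{-# OPTIONS --safe #-}
module Submission where

-- With N = 2^(β - 2), e = ϵ N / 4 and h = 2 e, the polytope is given by coordinates:
-- the vertices are ℤ/4, the edges and the facets are ℤ/4 × ℤ/N, and a 2-face is a pair
-- of facets, one of even and one of odd class in ℤ/4.  Faces whose ranks differ by two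
-- or more are always incident, and the 2-face (κ, b, c) has one side of each edge class,
-- at a position affine in c - b.  The rotations α, χ, υ act affinely on the coordinates,
-- so relations and incidences reduce to identities between forms in the coordinates,
-- 1, h and e, decided by comparing coefficients with 2 h = h² = h e = e³ = 0 modulo N.
--
-- An automorphism moving only the vertex of the base flag would fix all facets, hence all
-- 2-faces, and this forces h = 0; so the polytope is chiral.  If a covering onto a chiral
-- polytope is not injective, then υ⁴ ^ h, that is σ₃ ^ 2^(β - 1), becomes trivial there;
-- but modulo this element the polytope has a reflection.  Finally the relations of Λ₃
-- bring every word to the form σ₁ ^ a σ₂ ^ x σ₃ ^ y, which acts trivially only if the
-- orders of the three rotations divide a, x and y.

open import Defs
open import Algebra.Bundles using (Group)
open import Algebra.Morphism.Structures using (module GroupMorphisms)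
open import Data.Bool using (Bool; true; false; if_then_else_)
open import Data.Empty using (⊥)
open import Data.Fin as Fin using (Fin; zero; suc; toℕ; fromℕ<; inject₁)
open import Data.Fin.Patterns
open import Data.Fin.Properties as Fin using (toℕ<n; toℕ-injective; toℕ-fromℕ<)
open import Data.Integer as ℤ using (ℤ; +_; -[1+_]; 0ℤ; 1ℤ; -1ℤ)
open import Data.Integer.Divisibility.Signed as ℤ∣
  using (divides; ∣m∣n⇒∣m+n; ∣m⇒∣-m; ∣n⇒∣m*n; ∣m⇒∣m*n)
  renaming (_∣_ to _∣ℤ_)
open import Data.Integer.DivMod using (n%ℕd<d; a≡a%ℕn+[a/ℕn]*n)
import Data.Integer.Properties as ℤ
open import Data.Integer.Tactic.RingSolver using (solve-∀)
open import Data.List using (List; []; _∷_; _++_; map; replicate)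
open import Data.List.Membership.Propositional using () renaming (_∈_ to _∈ₗ_)
open import Data.List.Properties using (++-assoc)
open import Data.List.Relation.Unary.Any using (here; there)
open import Data.Maybe using (Maybe; just; nothing; from-just)
open import Data.Nat as ℕ using (ℕ; zero; suc; z≤n; s≤s; _≤_; _^_; _∸_)
import Data.Nat.Divisibility as ℕ
import Data.Nat.DivMod as ℕ
import Data.Nat.Properties as ℕ
open import Data.Nat.Tactic.RingSolver using () renaming (solve-∀ to ℕ-solve-∀)
open import Data.Product using (Σ; ∃-syntax; ∃₂; _×_; _,_; proj₁; proj₂)
import Data.Product.Properties as Product
open import Data.Product.Function.NonDependent.Propositional using (_×-↔_)
open import Data.Sum using (_⊎_; inj₁; inj₂; [_,_]′)
open import Data.Unit using (⊤; tt)
open import Function using (_∘_)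
open import Function.Bundles using (Inverse; _↔_; mk⇔; mk↔ₛ′)
open import Function.Construct.Composition using (_↔-∘_)
open import Level using (0ℓ)
open import Relation.Binary.Bundles using (Setoid)
open import Relation.Binary.Construct.Closure.ReflexiveTransitive using (Star; ε; _◅_)
open import Relation.Binary.Definitions using (tri<; tri≈; tri>)
open import Relation.Binary.Morphism.Structures using (IsOrderIsomorphism)
open import Relation.Binary.PropositionalEquality
  using (_≡_; _≢_; refl; sym; trans; cong; cong₂; subst; subst₂; isEquivalence; module ≡-Reasoning)
import Relation.Binary.Reasoning.Setoid as SetoidReasoning
open import Relation.Binary.Structures using (IsDecPartialOrder)
open import Relation.Nullary using (¬_; Dec; yes; no; contradiction)
open import Relation.Nullary.Decidable using (T?; True; toWitness; map′; ¬?; _×-dec_; _⊎-dec_)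
open import Relation.Unary using (Pred; Decidable; _∈_)

-- Arithmetic modulo N

-- The coordinates list those cosets as if the product of the cyclic groups of `σ₁`, `σ₂`, `σ₃` were
-- already known to have 4 · 2N · 4N elements; this gives 4 vertices, 4N edges, 4N² faces of rank 2
-- and 4N facets. The constants come from the relations: `σ₃ ^ (ϵ N)` translates every facet by
-- ϵN/4, which is e, and `σ₂ ^ N` translates every edge by h. Atomicity rests on N/2 being the only
-- element of order two in ℤ/N. Identified edges or facets yield an element whose suitable power is
-- a translation by h, and identified vertices make α² trivial, which again produces such a
-- translation. So one central element lies in the kernel of every covering that is not injective,
-- and only this element has to be shown indispensable.

module Residues (j : ℕ) (ϵ : ℤ) (ϵ-unit : ϵ ≡ 1ℤ ⊎ ϵ ≡ -1ℤ) where

  N : ℕ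
  N = 2 ^ (3 ℕ.+ j)

  instance
    N-nonZero : ℕ.NonZero N
    N-nonZero = ℕ.m^n≢0 2 (3 ℕ.+ j)

  Z : Set
  Z = Fin N

  -- The bound 5 on β enters here: N is at least 8, so `e₀` is even and h e vanishes modulo N. For N
  -- = 4 one would have e = 1 or -1, and h e = 2 would survive.
  N/8 e₀ h₀ : ℤ
  N/8 = + (2 ^ j)
  e₀  = ϵ ℤ.* (+ 2 ℤ.* N/8)
  h₀  = + 2 ℤ.* e₀

  infix 4 _≋_
  -- A record, not a synonym for divisibility of the difference, so that `a` and `b` can be inferred
  -- from the type.
  record _≋_ (a b : ℤ) : Set where
    constructor mod
    field difference : + N ∣ℤ a ℤ.- b

  N≡8* : + N ≡ + 8 ℤ.* N/8
  N≡8* = begin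
    + N             ≡⟨ cong +_ (ℕ.^-distribˡ-+-* 2 3 j) ⟩
    + (8 ℕ.* 2 ^ j) ≡⟨ ℤ.pos-* 8 (2 ^ j) ⟩
    + 8 ℤ.* N/8 ∎
    where open ≡-Reasoning

  by-N/8 : ∀ {a} k → a ≡ k ℤ.* (+ 8 ℤ.* N/8) → + N ∣ℤ a
  by-N/8 k eq = divides k (trans eq (cong (k ℤ.*_) (sym N≡8*)))

  N∣2h : + N ∣ℤ + 2 ℤ.* h₀
  N∣2h = by-N/8 ϵ (lemma ϵ N/8)
    where
    lemma : ∀ s m → + 2 ℤ.* (+ 2 ℤ.* (s ℤ.* (+ 2 ℤ.* m))) ≡ s ℤ.* (+ 8 ℤ.* m)
    lemma = solve-∀

  N∣he : + N ∣ℤ h₀ ℤ.* e₀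
  N∣he = by-N/8 (ϵ ℤ.* ϵ ℤ.* N/8) (lemma ϵ N/8)
    where
    lemma : ∀ s m → + 2 ℤ.* (s ℤ.* (+ 2 ℤ.* m)) ℤ.* (s ℤ.* (+ 2 ℤ.* m))
                  ≡ s ℤ.* s ℤ.* m ℤ.* (+ 8 ℤ.* m)
    lemma = solve-∀

  N∣hh : + N ∣ℤ h₀ ℤ.* h₀
  N∣hh = subst (+ N ∣ℤ_) (lemma h₀ e₀) (∣n⇒∣m*n (+ 2) N∣he)
    where
    lemma : ∀ h e → + 2 ℤ.* (h ℤ.* e) ≡ h ℤ.* (+ 2 ℤ.* e)
    lemma = solve-∀

  -- The cube is needed: e² = N²/16 equals 4 for N = 8, which does not vanish modulo 8.
  N∣eee : + N ∣ℤ e₀ ℤ.* e₀ ℤ.* e₀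
  N∣eee = by-N/8 (ϵ ℤ.* ϵ ℤ.* ϵ ℤ.* N/8 ℤ.* N/8) (lemma ϵ N/8)
    where
    lemma : ∀ s m →
      (s ℤ.* (+ 2 ℤ.* m)) ℤ.* (s ℤ.* (+ 2 ℤ.* m)) ℤ.* (s ℤ.* (+ 2 ℤ.* m))
        ≡ s ℤ.* s ℤ.* s ℤ.* m ℤ.* m ℤ.* (+ 8 ℤ.* m)
    lemma = solve-∀

  ≋-reflexive : ∀ {a b} → a ≡ b → a ≋ b
  ≋-reflexive {a} refl = mod (divides 0ℤ (ℤ.+-inverseʳ a))

  ≋-sym : ∀ {a b} → a ≋ b → b ≋ a
  ≋-sym {a} {b} (mod p) = mod (subst (+ N ∣ℤ_) (lemma a b) (∣m⇒∣-m p))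
    where
    lemma : ∀ a b → ℤ.- (a ℤ.- b) ≡ b ℤ.- a
    lemma = solve-∀

  ≋-trans : ∀ {a b c} → a ≋ b → b ≋ c → a ≋ c
  ≋-trans {a} {b} {c} (mod p) (mod q) = mod (subst (+ N ∣ℤ_) (lemma a b c) (∣m∣n⇒∣m+n p q))
    where
    lemma : ∀ a b c → (a ℤ.- b) ℤ.+ (b ℤ.- c) ≡ a ℤ.- c
    lemma = solve-∀

  ≋-+ : ∀ {a b c d} → a ≋ b → c ≋ d → a ℤ.+ c ≋ b ℤ.+ d
  ≋-+ {a} {b} {c} {d} (mod p) (mod q) =
    mod (subst (+ N ∣ℤ_) (lemma a b c d) (∣m∣n⇒∣m+n p q))
    where
    lemma : ∀ a b c d → (a ℤ.- b) ℤ.+ (c ℤ.- d) ≡ (a ℤ.+ c) ℤ.- (b ℤ.+ d)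
    lemma = solve-∀

  ≋-*ˡ : ∀ k {a b} → a ≋ b → k ℤ.* a ≋ k ℤ.* b
  ≋-*ˡ k {a} {b} (mod p) = mod (subst (+ N ∣ℤ_) (lemma k a b) (∣n⇒∣m*n k p))
    where
    lemma : ∀ k a b → k ℤ.* (a ℤ.- b) ≡ k ℤ.* a ℤ.- k ℤ.* b
    lemma = solve-∀

  ι : Z → ℤ
  ι z = + toℕ z

  abstract
    red : ℤ → Z
    red a = fromℕ< (n%ℕd<d a N)

    ι-red : ∀ a → ι (red a) ≋ a
    ι-red a = ≋-sym (mod (divides (a ℤ./ℕ N) (begin
      a ℤ.- ι (red a)    ≡⟨ cong (λ r → a ℤ.- + r) (toℕ-fromℕ< _) ⟩
      a ℤ.- + (a ℤ.%ℕ N) ≡⟨ cong (ℤ._- + (a ℤ.%ℕ N)) (a≡a%ℕn+[a/ℕn]*n a N) ⟩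
      + (a ℤ.%ℕ N) ℤ.+ (a ℤ./ℕ N) ℤ.* + N ℤ.- + (a ℤ.%ℕ N)
                         ≡⟨ lemma (+ (a ℤ.%ℕ N)) ((a ℤ./ℕ N) ℤ.* + N) ⟩
      (a ℤ./ℕ N) ℤ.* + N               ∎)))
      where
      open ≡-Reasoning
      lemma : ∀ r q → r ℤ.+ q ℤ.- r ≡ q
      lemma = solve-∀

  residue-unique : ∀ {m n} → m ℕ.< N → n ℕ.< N → + m ≋ + n → m ≡ n
  residue-unique {m} {n} m<N n<N (mod p) = ℤ.+-injective (ℤ.i-j≡0⇒i≡j (+ m) (+ n)
    (ℤ.∣i∣≡0⇒i≡0 (small-multiple (ℤ∣.∣⇒∣ᵤ p) bound)))
    where
    small-multiple : ∀ {k} → N ℕ.∣ k → k ℕ.< N → k ≡ 0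
    small-multiple {zero}  _ _   = refl
    small-multiple {suc k} d k<N = contradiction (ℕ.∣⇒≤ d) (ℕ.<⇒≱ k<N)
    bound : ℤ.∣ + m ℤ.- + n ∣ ℕ.< N
    bound = subst (ℕ._< N) (sym (cong ℤ.∣_∣ (ℤ.m-n≡m⊖n m n)))
      (ℕ.≤-<-trans (ℤ.∣m⊝n∣≤m⊔n m n) (ℕ.⊔-lub m<N n<N))

  red-cong : ∀ {a b} → a ≋ b → red a ≡ red b
  red-cong {a} {b} p = toℕ-injective (residue-unique (toℕ<n _) (toℕ<n _)
    (≋-trans (ι-red a) (≋-trans p (≋-sym (ι-red b)))))

  red-ι : ∀ z → red (ι z) ≡ z
  red-ι z = toℕ-injective (residue-unique (toℕ<n _) (toℕ<n z) (ι-red (ι z)))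

  red-injective : ∀ {a b} → red a ≡ red b → a ≋ b
  red-injective {a} {b} eq =
    ≋-trans (≋-sym (ι-red a)) (subst (λ z → ι z ≋ b) (sym eq) (ι-red b))

  infixl 6 _⊕_ _⊖_

  -- Opaque, so that coordinate formulas are compared as terms instead of unfolding to remainders
  -- modulo a variable `N`. Outside this block only the equations ending in `-red` are used.
  abstract
    _⊕_ : Z → Z → Z
    x ⊕ y = red (ι x ℤ.+ ι y)

    ⊝_ h·_ : Z → Z
    ⊝ x  = red (-1ℤ ℤ.* ι x)
    h· x = red (h₀ ℤ.* ι x)

    𝟘 𝟙 𝕖 : Z
    𝟘 = red 0ℤ
    𝟙 = red 1ℤ
    𝕖 = red e₀

    ⊕-red : ∀ a b → red a ⊕ red b ≡ red (a ℤ.+ b)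
    ⊕-red a b = red-cong (≋-+ (ι-red a) (ι-red b))

    ⊝-red : ∀ a → ⊝ red a ≡ red (-1ℤ ℤ.* a)
    ⊝-red a = red-cong (≋-*ˡ -1ℤ (ι-red a))

    h·-red : ∀ a → h· red a ≡ red (h₀ ℤ.* a)
    h·-red a = red-cong (≋-*ˡ h₀ (ι-red a))

    𝟘-red : 𝟘 ≡ red 0ℤ
    𝟘-red = refl

    𝟙-red : 𝟙 ≡ red 1ℤ
    𝟙-red = refl

    𝕖-red : 𝕖 ≡ red e₀
    𝕖-red = refl

  _⊖_ : Z → Z → Z
  x ⊖ y = x ⊕ ⊝ y

  -- The formulas for faces and rotations are written once over `Ops` and used twice: with residues
  -- they define the polytope, with `Expr` they describe generic faces on which identities can be
  -- decided.
  record Ops (A : Set) : Set where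
    infixl 6 _+_ _-_
    field
      _+_     : A → A → A
      neg h*_ : A → A
      0# 1# e : A
    _-_ : A → A → A
    x - y = x + neg y

  data Expr : Set where
    var₁ var₂ var₃ zer one ee : Expr
    _:+_ : Expr → Expr → Expr
    :-_ :h_ : Expr → Expr

  ops : Ops Z
  ops = record { _+_ = _⊕_ ; neg = ⊝_ ; h*_ = h·_ ; 0# = 𝟘 ; 1# = 𝟙 ; e = 𝕖 }

  exprOps : Ops Expr
  exprOps = record { _+_ = _:+_ ; neg = :-_ ; h*_ = :h_ ; 0# = zer ; 1# = one ; e = ee }

  ⟦_⟧ : Expr → Z → Z → Z → Z
  ⟦ var₁ ⟧   x y z = x
  ⟦ var₂ ⟧   x y z = y
  ⟦ var₃ ⟧   x y z = z
  ⟦ zer ⟧    x y z = 𝟘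
  ⟦ one ⟧    x y z = 𝟙
  ⟦ ee ⟧     x y z = 𝕖
  ⟦ a :+ b ⟧ x y z = ⟦ a ⟧ x y z ⊕ ⟦ b ⟧ x y z
  ⟦ :- a ⟧   x y z = ⊝ ⟦ a ⟧ x y z
  ⟦ :h a ⟧   x y z = h· ⟦ a ⟧ x y z

  ⟦_⟧ℤ : Expr → ℤ → ℤ → ℤ → ℤ
  ⟦ var₁ ⟧ℤ   x y z = x
  ⟦ var₂ ⟧ℤ   x y z = y
  ⟦ var₃ ⟧ℤ   x y z = z
  ⟦ zer ⟧ℤ    x y z = 0ℤ
  ⟦ one ⟧ℤ    x y z = 1ℤ
  ⟦ ee ⟧ℤ     x y z = e₀
  ⟦ a :+ b ⟧ℤ x y z = ⟦ a ⟧ℤ x y z ℤ.+ ⟦ b ⟧ℤ x y z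
  ⟦ :- a ⟧ℤ   x y z = -1ℤ ℤ.* ⟦ a ⟧ℤ x y z
  ⟦ :h a ⟧ℤ   x y z = h₀ ℤ.* ⟦ a ⟧ℤ x y z

  ⟦⟧-red : ∀ E x y z → ⟦ E ⟧ x y z ≡ red (⟦ E ⟧ℤ (ι x) (ι y) (ι z))
  ⟦⟧-red var₁ x y z = sym (red-ι x)
  ⟦⟧-red var₂ x y z = sym (red-ι y)
  ⟦⟧-red var₃ x y z = sym (red-ι z)
  ⟦⟧-red zer x y z = 𝟘-red
  ⟦⟧-red one x y z = 𝟙-red
  ⟦⟧-red ee  x y z = 𝕖-red
  ⟦⟧-red (a :+ b) x y z =
    trans (cong₂ _⊕_ (⟦⟧-red a x y z) (⟦⟧-red b x y z)) (⊕-red _ _)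
  ⟦⟧-red (:- a) x y z = trans (cong ⊝_ (⟦⟧-red a x y z)) (⊝-red _)
  ⟦⟧-red (:h a) x y z = trans (cong h·_ (⟦⟧-red a x y z)) (h·-red _)

  -- The linear form (a₁ + b₁ h) x + (a₂ + b₂ h) y + (a₃ + b₃ h) z + c + k e.
  record Form : Set where
    constructor form
    field a₁ b₁ a₂ b₂ a₃ b₃ c k : ℤ

  value : Form → ℤ → ℤ → ℤ → ℤ
  value (form a₁ b₁ a₂ b₂ a₃ b₃ c k) x y z =
    (a₁ ℤ.+ b₁ ℤ.* h₀) ℤ.* x ℤ.+ (a₂ ℤ.+ b₂ ℤ.* h₀) ℤ.* y
      ℤ.+ (a₃ ℤ.+ b₃ ℤ.* h₀) ℤ.* z ℤ.+ c ℤ.+ k ℤ.* e₀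

  normalise : Expr → Form
  normalise var₁ = form 1ℤ 0ℤ 0ℤ 0ℤ 0ℤ 0ℤ 0ℤ 0ℤ
  normalise var₂ = form 0ℤ 0ℤ 1ℤ 0ℤ 0ℤ 0ℤ 0ℤ 0ℤ
  normalise var₃ = form 0ℤ 0ℤ 0ℤ 0ℤ 1ℤ 0ℤ 0ℤ 0ℤ
  normalise zer  = form 0ℤ 0ℤ 0ℤ 0ℤ 0ℤ 0ℤ 0ℤ 0ℤ
  normalise one  = form 0ℤ 0ℤ 0ℤ 0ℤ 0ℤ 0ℤ 1ℤ 0ℤ
  normalise ee   = form 0ℤ 0ℤ 0ℤ 0ℤ 0ℤ 0ℤ 0ℤ 1ℤ
  normalise (E :+ E′) with normalise E | normalise E′
  ... | form a₁ b₁ a₂ b₂ a₃ b₃ c k | form a₁′ b₁′ a₂′ b₂′ a₃′ b₃′ c′ k′ =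
    form (a₁ ℤ.+ a₁′) (b₁ ℤ.+ b₁′) (a₂ ℤ.+ a₂′) (b₂ ℤ.+ b₂′)
         (a₃ ℤ.+ a₃′) (b₃ ℤ.+ b₃′) (c ℤ.+ c′) (k ℤ.+ k′)
  normalise (:- E) with normalise E
  ... | form a₁ b₁ a₂ b₂ a₃ b₃ c k =
    form (ℤ.- a₁) (ℤ.- b₁) (ℤ.- a₂) (ℤ.- b₂) (ℤ.- a₃) (ℤ.- b₃) (ℤ.- c) (ℤ.- k)
  -- From h² = h e = 0, multiplication by h turns a + b h into a h and kills the term in e; the
  -- constant c becomes h c = 2 c e.
  normalise (:h E) with normalise E
  ... | form a₁ b₁ a₂ b₂ a₃ b₃ c k = form 0ℤ a₁ 0ℤ a₂ 0ℤ a₃ 0ℤ (+ 2 ℤ.* c)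

  normalise-sound : ∀ E x y z → ⟦ E ⟧ℤ x y z ≋ value (normalise E) x y z
  normalise-sound var₁ x y z = ≋-reflexive (lemma x y z h₀ e₀)
    where
    lemma : ∀ x y z h e → x ≡ (1ℤ ℤ.+ 0ℤ ℤ.* h) ℤ.* x ℤ.+ (0ℤ ℤ.+ 0ℤ ℤ.* h) ℤ.* y
      ℤ.+ (0ℤ ℤ.+ 0ℤ ℤ.* h) ℤ.* z ℤ.+ 0ℤ ℤ.+ 0ℤ ℤ.* e
    lemma = solve-∀
  normalise-sound var₂ x y z = ≋-reflexive (lemma x y z h₀ e₀)
    where
    lemma : ∀ x y z h e → y ≡ (0ℤ ℤ.+ 0ℤ ℤ.* h) ℤ.* x ℤ.+ (1ℤ ℤ.+ 0ℤ ℤ.* h) ℤ.* y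
      ℤ.+ (0ℤ ℤ.+ 0ℤ ℤ.* h) ℤ.* z ℤ.+ 0ℤ ℤ.+ 0ℤ ℤ.* e
    lemma = solve-∀
  normalise-sound var₃ x y z = ≋-reflexive (lemma x y z h₀ e₀)
    where
    lemma : ∀ x y z h e → z ≡ (0ℤ ℤ.+ 0ℤ ℤ.* h) ℤ.* x ℤ.+ (0ℤ ℤ.+ 0ℤ ℤ.* h) ℤ.* y
      ℤ.+ (1ℤ ℤ.+ 0ℤ ℤ.* h) ℤ.* z ℤ.+ 0ℤ ℤ.+ 0ℤ ℤ.* e
    lemma = solve-∀
  normalise-sound zer x y z = ≋-reflexive (lemma x y z h₀ e₀)
    where
    lemma : ∀ x y z h e → 0ℤ ≡ (0ℤ ℤ.+ 0ℤ ℤ.* h) ℤ.* x ℤ.+ (0ℤ ℤ.+ 0ℤ ℤ.* h) ℤ.* y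
      ℤ.+ (0ℤ ℤ.+ 0ℤ ℤ.* h) ℤ.* z ℤ.+ 0ℤ ℤ.+ 0ℤ ℤ.* e
    lemma = solve-∀
  normalise-sound one x y z = ≋-reflexive (lemma x y z h₀ e₀)
    where
    lemma : ∀ x y z h e → 1ℤ ≡ (0ℤ ℤ.+ 0ℤ ℤ.* h) ℤ.* x ℤ.+ (0ℤ ℤ.+ 0ℤ ℤ.* h) ℤ.* y
      ℤ.+ (0ℤ ℤ.+ 0ℤ ℤ.* h) ℤ.* z ℤ.+ 1ℤ ℤ.+ 0ℤ ℤ.* e
    lemma = solve-∀
  normalise-sound ee x y z = ≋-reflexive (lemma x y z h₀ e₀)
    where
    lemma : ∀ x y z h e → e ≡ (0ℤ ℤ.+ 0ℤ ℤ.* h) ℤ.* x ℤ.+ (0ℤ ℤ.+ 0ℤ ℤ.* h) ℤ.* y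
      ℤ.+ (0ℤ ℤ.+ 0ℤ ℤ.* h) ℤ.* z ℤ.+ 0ℤ ℤ.+ 1ℤ ℤ.* e
    lemma = solve-∀
  normalise-sound (E :+ E′) x y z
    with normalise E | normalise E′ | normalise-sound E x y z | normalise-sound E′ x y z
  ... | form a₁ b₁ a₂ b₂ a₃ b₃ c k | form a₁′ b₁′ a₂′ b₂′ a₃′ b₃′ c′ k′ | p | p′ =
    ≋-trans (≋-+ p p′)
      (≋-reflexive (lemma a₁ b₁ a₂ b₂ a₃ b₃ c k a₁′ b₁′ a₂′ b₂′ a₃′ b₃′ c′ k′ x y z h₀ e₀))
    where
    lemma : ∀ a₁ b₁ a₂ b₂ a₃ b₃ c k a₁′ b₁′ a₂′ b₂′ a₃′ b₃′ c′ k′ x y z h e →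
      ((a₁ ℤ.+ b₁ ℤ.* h) ℤ.* x ℤ.+ (a₂ ℤ.+ b₂ ℤ.* h) ℤ.* y
        ℤ.+ (a₃ ℤ.+ b₃ ℤ.* h) ℤ.* z ℤ.+ c ℤ.+ k ℤ.* e) ℤ.+
      ((a₁′ ℤ.+ b₁′ ℤ.* h) ℤ.* x ℤ.+ (a₂′ ℤ.+ b₂′ ℤ.* h) ℤ.* y
        ℤ.+ (a₃′ ℤ.+ b₃′ ℤ.* h) ℤ.* z ℤ.+ c′ ℤ.+ k′ ℤ.* e)
      ≡ (a₁ ℤ.+ a₁′ ℤ.+ (b₁ ℤ.+ b₁′) ℤ.* h) ℤ.* x ℤ.+ (a₂ ℤ.+ a₂′ ℤ.+ (b₂ ℤ.+ b₂′) ℤ.* h) ℤ.* y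
        ℤ.+ (a₃ ℤ.+ a₃′ ℤ.+ (b₃ ℤ.+ b₃′) ℤ.* h) ℤ.* z ℤ.+ (c ℤ.+ c′) ℤ.+ (k ℤ.+ k′) ℤ.* e
    lemma = solve-∀
  normalise-sound (:- E) x y z with normalise E | normalise-sound E x y z
  ... | form a₁ b₁ a₂ b₂ a₃ b₃ c k | p =
    ≋-trans (≋-*ˡ -1ℤ p) (≋-reflexive (lemma a₁ b₁ a₂ b₂ a₃ b₃ c k x y z h₀ e₀))
    where
    lemma : ∀ a₁ b₁ a₂ b₂ a₃ b₃ c k x y z h e →
      -1ℤ ℤ.* ((a₁ ℤ.+ b₁ ℤ.* h) ℤ.* x ℤ.+ (a₂ ℤ.+ b₂ ℤ.* h) ℤ.* y
        ℤ.+ (a₃ ℤ.+ b₃ ℤ.* h) ℤ.* z ℤ.+ c ℤ.+ k ℤ.* e)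
      ≡ (ℤ.- a₁ ℤ.+ (ℤ.- b₁) ℤ.* h) ℤ.* x ℤ.+ (ℤ.- a₂ ℤ.+ (ℤ.- b₂) ℤ.* h) ℤ.* y
        ℤ.+ (ℤ.- a₃ ℤ.+ (ℤ.- b₃) ℤ.* h) ℤ.* z ℤ.+ (ℤ.- c) ℤ.+ (ℤ.- k) ℤ.* e
    lemma = solve-∀
  normalise-sound (:h E) x y z with normalise E | normalise-sound E x y z
  ... | form a₁ b₁ a₂ b₂ a₃ b₃ c k | p =
    ≋-trans (≋-*ˡ h₀ p) (mod (subst (+ N ∣ℤ_) (lemma a₁ b₁ a₂ b₂ a₃ b₃ c k x y z e₀)
      (∣m∣n⇒∣m+n (∣m⇒∣m*n (b₁ ℤ.* x ℤ.+ b₂ ℤ.* y ℤ.+ b₃ ℤ.* z) N∣hh) (∣m⇒∣m*n k N∣he))))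
    where
    lemma : ∀ a₁ b₁ a₂ b₂ a₃ b₃ c k x y z e →
      (+ 2 ℤ.* e) ℤ.* (+ 2 ℤ.* e) ℤ.* (b₁ ℤ.* x ℤ.+ b₂ ℤ.* y ℤ.+ b₃ ℤ.* z)
        ℤ.+ (+ 2 ℤ.* e) ℤ.* e ℤ.* k
      ≡ (+ 2 ℤ.* e) ℤ.* ((a₁ ℤ.+ b₁ ℤ.* (+ 2 ℤ.* e)) ℤ.* x ℤ.+ (a₂ ℤ.+ b₂ ℤ.* (+ 2 ℤ.* e)) ℤ.* y
          ℤ.+ (a₃ ℤ.+ b₃ ℤ.* (+ 2 ℤ.* e)) ℤ.* z ℤ.+ c ℤ.+ k ℤ.* e)
        ℤ.- ((0ℤ ℤ.+ a₁ ℤ.* (+ 2 ℤ.* e)) ℤ.* x ℤ.+ (0ℤ ℤ.+ a₂ ℤ.* (+ 2 ℤ.* e)) ℤ.* y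
          ℤ.+ (0ℤ ℤ.+ a₃ ℤ.* (+ 2 ℤ.* e)) ℤ.* z ℤ.+ 0ℤ ℤ.+ (+ 2 ℤ.* c) ℤ.* e)
    lemma = solve-∀

  -- Coefficients of h count modulo 2 and those of e modulo 4, because 4 e = 2 h = 0. The remaining
  -- ones must be zero as integers, since the same check has to serve every `N`.
  Vanishes : Form → Set
  Vanishes (form a₁ b₁ a₂ b₂ a₃ b₃ c k) =
    (a₁ ≡ 0ℤ × a₂ ≡ 0ℤ × a₃ ≡ 0ℤ × c ≡ 0ℤ) ×
    (+ 2 ∣ℤ b₁ × + 2 ∣ℤ b₂ × + 2 ∣ℤ b₃ × + 4 ∣ℤ k)

  vanishes? : ∀ f → Dec (Vanishes f)
  vanishes? (form a₁ b₁ a₂ b₂ a₃ b₃ c k) =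
    (a₁ ℤ.≟ 0ℤ ×-dec a₂ ℤ.≟ 0ℤ ×-dec a₃ ℤ.≟ 0ℤ ×-dec c ℤ.≟ 0ℤ) ×-dec
    (+ 2 ℤ∣.∣? b₁ ×-dec + 2 ℤ∣.∣? b₂ ×-dec + 2 ℤ∣.∣? b₃ ×-dec + 4 ℤ∣.∣? k)

  vanishes-sound : ∀ f x y z → Vanishes f → value f x y z ≋ 0ℤ
  vanishes-sound (form a₁ b₁ a₂ b₂ a₃ b₃ c k) x y z
    ((refl , refl , refl , refl) , (divides p refl , divides q refl , divides r refl , divides s refl)) =
    mod (subst (+ N ∣ℤ_) (lemma p q r s x y z e₀)
      (∣m⇒∣m*n (p ℤ.* x ℤ.+ q ℤ.* y ℤ.+ r ℤ.* z ℤ.+ s) N∣2h))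
    where
    lemma : ∀ p q r s x y z e →
      + 2 ℤ.* (+ 2 ℤ.* e) ℤ.* (p ℤ.* x ℤ.+ q ℤ.* y ℤ.+ r ℤ.* z ℤ.+ s)
      ≡ ((0ℤ ℤ.+ (p ℤ.* + 2) ℤ.* (+ 2 ℤ.* e)) ℤ.* x ℤ.+ (0ℤ ℤ.+ (q ℤ.* + 2) ℤ.* (+ 2 ℤ.* e)) ℤ.* y
        ℤ.+ (0ℤ ℤ.+ (r ℤ.* + 2) ℤ.* (+ 2 ℤ.* e)) ℤ.* z ℤ.+ 0ℤ ℤ.+ (s ℤ.* + 4) ℤ.* e) ℤ.- 0ℤ
    lemma = solve-∀

  Valid : Expr → Expr → Set
  Valid E E′ = True (vanishes? (normalise (E :+ (:- E′))))

  solve : ∀ E E′ {_ : Valid E E′} x y z → ⟦ E ⟧ x y z ≡ ⟦ E′ ⟧ x y z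
  solve E E′ {v} x y z =
    trans (⟦⟧-red E x y z) (trans (red-cong congruent) (sym (⟦⟧-red E′ x y z)))
    where
    u = ⟦ E ⟧ℤ (ι x) (ι y) (ι z)
    u′ = ⟦ E′ ⟧ℤ (ι x) (ι y) (ι z)
    lemma : ∀ u u′ → u ℤ.+ -1ℤ ℤ.* u′ ℤ.- 0ℤ ≡ u ℤ.- u′
    lemma = solve-∀
    congruent : u ≋ u′
    congruent = mod (subst (+ N ∣ℤ_) (lemma u u′) (_≋_.difference
      (≋-trans (normalise-sound (E :+ (:- E′)) (ι x) (ι y) (ι z))
        (vanishes-sound (normalise (E :+ (:- E′))) (ι x) (ι y) (ι z) (toWitness v)))))

  infixr 7 _•_
  _•_ : ℕ → Z → Z
  zero  • u = 𝟘
  suc k • u = u ⊕ k • u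

  •-red : ∀ k a → k • red a ≡ red (+ k ℤ.* a)
  •-red zero    a = 𝟘-red
  •-red (suc k) a = begin
    red a ⊕ k • red a       ≡⟨ cong (red a ⊕_) (•-red k a) ⟩
    red a ⊕ red (+ k ℤ.* a) ≡⟨ ⊕-red a (+ k ℤ.* a) ⟩
    red (a ℤ.+ + k ℤ.* a)   ≡⟨ cong red (sym (ℤ.suc-* (+ k) a)) ⟩
    red (+ suc k ℤ.* a)       ∎
    where open ≡-Reasoning

  •-ι : ∀ k u → k • u ≡ red (+ k ℤ.* ι u)
  •-ι k u = trans (cong (k •_) (sym (red-ι u))) (•-red k (ι u))

  N•≡𝟘 : ∀ u → N • u ≡ 𝟘
  N•≡𝟘 u = trans (•-ι N u) (trans
    (red-cong (mod (divides (ι u) (trans (ℤ.+-identityʳ _) (ℤ.*-comm (+ N) (ι u))))))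
    (sym 𝟘-red))

  multiple-of-𝟙 : ∀ u → toℕ u • 𝟙 ≡ u
  multiple-of-𝟙 u = begin
    toℕ u • 𝟙        ≡⟨ cong (toℕ u •_) 𝟙-red ⟩
    toℕ u • red 1ℤ   ≡⟨ •-red (toℕ u) 1ℤ ⟩
    red (ι u ℤ.* 1ℤ) ≡⟨ cong red (ℤ.*-identityʳ (ι u)) ⟩
    red (ι u)        ≡⟨ red-ι u ⟩
    u                   ∎
    where open ≡-Reasoning

  half quarter : ℕ
  half    = 2 ^ (2 ℕ.+ j)
  quarter = 2 ^ (1 ℕ.+ j)

  +quarter : + quarter ≡ + 2 ℤ.* N/8
  +quarter = ℤ.pos-* 2 (2 ^ j)

  +half : + half ≡ + 4 ℤ.* N/8
  +half = trans (cong +_ (ℕ.^-distribˡ-+-* 2 2 j)) (ℤ.pos-* 4 (2 ^ j))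

  -- Since 2 h vanishes, h and -h coincide, so the sign `ϵ` is lost and h is N/2 in both cases.
  half≋h : + half ≋ h₀
  half≋h = [ (λ { refl → ≋-reflexive (trans +half (pos N/8)) })
           , (λ { refl → mod (by-N/8 1ℤ (trans (cong (ℤ._- h₀) +half) (neg N/8))) }) ]′ ϵ-unit
    where
    pos : ∀ m → + 4 ℤ.* m ≡ + 2 ℤ.* (1ℤ ℤ.* (+ 2 ℤ.* m))
    pos = solve-∀
    neg : ∀ m → + 4 ℤ.* m ℤ.- + 2 ℤ.* (-1ℤ ℤ.* (+ 2 ℤ.* m)) ≡ 1ℤ ℤ.* (+ 8 ℤ.* m)
    neg = solve-∀

  half• : ∀ u → half • u ≡ h· u
  half• u = begin
    half • u             ≡⟨ •-ι half u ⟩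
    red (+ half ℤ.* ι u) ≡⟨ cong red (ℤ.*-comm (+ half) (ι u)) ⟩
    red (ι u ℤ.* + half) ≡⟨ red-cong (≋-*ˡ (ι u) half≋h) ⟩
    red (ι u ℤ.* h₀)     ≡⟨ cong red (ℤ.*-comm (ι u) h₀) ⟩
    red (h₀ ℤ.* ι u)     ≡⟨ sym (h·-red (ι u)) ⟩
    h· red (ι u)         ≡⟨ cong h·_ (red-ι u) ⟩
    h· u                     ∎
    where open ≡-Reasoning

  quarter•𝟙 : quarter • 𝟙 ≡ red (+ 2 ℤ.* N/8)
  quarter•𝟙 = trans (cong (quarter •_) 𝟙-red)
    (trans (•-red quarter 1ℤ) (cong red (trans (ℤ.*-identityʳ _) +quarter)))

  quarter•𝟙≡𝕖 : ϵ ≡ 1ℤ → quarter • 𝟙 ≡ 𝕖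
  quarter•𝟙≡𝕖 ϵ≡1 = trans quarter•𝟙 (trans (cong red (sym
    (trans (cong (ℤ._* (+ 2 ℤ.* N/8)) ϵ≡1) (ℤ.*-identityˡ _)))) (sym 𝕖-red))

  quarter•𝟙≡⊝𝕖 : ϵ ≡ -1ℤ → quarter • 𝟙 ≡ ⊝ 𝕖
  quarter•𝟙≡⊝𝕖 ϵ≡-1 = trans quarter•𝟙 (trans (cong red (lemma ϵ (+ 2 ℤ.* N/8) ϵ≡-1))
    (sym (trans (cong ⊝_ 𝕖-red) (⊝-red e₀))))
    where
    lemma : ∀ s m → s ≡ -1ℤ → m ≡ -1ℤ ℤ.* (s ℤ.* m)
    lemma _ m refl = lemma′ m
      where
      lemma′ : ∀ m → m ≡ -1ℤ ℤ.* (-1ℤ ℤ.* m)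
      lemma′ = solve-∀

  h𝟙≢𝟘 : h· 𝟙 ≢ 𝟘
  h𝟙≢𝟘 eq = contradiction half<N (ℕ.≤⇒≯ (ℕ.∣⇒≤ N∣half))
    where
    half<N : half ℕ.< N
    half<N = ℕ.^-monoʳ-< 2 (ℕ.s≤s (ℕ.s≤s ℕ.z≤n)) (ℕ.n<1+n (2 ℕ.+ j))
    instance
      half-nonZero : ℕ.NonZero half
      half-nonZero = ℕ.m^n≢0 2 (2 ℕ.+ j)
    half•1 : red (+ half) ≡ red 0ℤ
    half•1 = begin
      red (+ half)        ≡⟨ cong red (sym (ℤ.*-identityʳ (+ half))) ⟩
      red (+ half ℤ.* 1ℤ) ≡⟨ sym (•-red half 1ℤ) ⟩
      half • red 1ℤ       ≡⟨ cong (half •_) (sym 𝟙-red) ⟩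
      half • 𝟙            ≡⟨ half• 𝟙 ⟩
      h· 𝟙                ≡⟨ eq ⟩
      𝟘                   ≡⟨ 𝟘-red ⟩
      red 0ℤ                  ∎
      where open ≡-Reasoning
    N∣half : N ℕ.∣ half
    N∣half = subst (N ℕ.∣_) (cong ℤ.∣_∣ (ℤ.+-identityʳ (+ half)))
      (ℤ∣.∣⇒∣ᵤ (_≋_.difference (red-injective half•1)))

  -- (e - 1)(1 + e + e²) = e³ - 1 and e³ = 0.
  multiple-of-𝕖⊖𝟙 : ∀ u → ∃[ k ] k • (𝕖 ⊖ 𝟙) ≡ u
  multiple-of-𝕖⊖𝟙 u = toℕ (red c) , (begin
    toℕ (red c) • (𝕖 ⊖ 𝟙)            ≡⟨ cong (toℕ (red c) •_) 𝕖⊖𝟙≡ ⟩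
    toℕ (red c) • red (e₀ ℤ.+ -1ℤ)   ≡⟨ •-red (toℕ (red c)) (e₀ ℤ.+ -1ℤ) ⟩
    red (ι (red c) ℤ.* (e₀ ℤ.+ -1ℤ)) ≡⟨ red-cong (≋-trans commuted (≋-*ˡ (e₀ ℤ.+ -1ℤ) (ι-red c))) ⟩
    red ((e₀ ℤ.+ -1ℤ) ℤ.* c)
      ≡⟨ red-cong (mod (subst (+ N ∣ℤ_) (lemma e₀ (ι u)) (∣m⇒∣m*n (ℤ.- ι u) N∣eee))) ⟩
    red (ι u)                        ≡⟨ red-ι u ⟩
    u                                  ∎)
    where
    open ≡-Reasoning
    c = ℤ.- ((1ℤ ℤ.+ e₀ ℤ.+ e₀ ℤ.* e₀) ℤ.* ι u)
    𝕖⊖𝟙≡ : 𝕖 ⊖ 𝟙 ≡ red (e₀ ℤ.+ -1ℤ)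
    𝕖⊖𝟙≡ = trans (cong₂ (λ p q → p ⊕ ⊝ q) 𝕖-red 𝟙-red)
      (trans (cong (red e₀ ⊕_) (⊝-red 1ℤ)) (⊕-red e₀ (-1ℤ ℤ.* 1ℤ)))
    commuted : ι (red c) ℤ.* (e₀ ℤ.+ -1ℤ) ≋ (e₀ ℤ.+ -1ℤ) ℤ.* ι (red c)
    commuted = ≋-reflexive (ℤ.*-comm (ι (red c)) (e₀ ℤ.+ -1ℤ))
    lemma : ∀ e u → e ℤ.* e ℤ.* e ℤ.* (ℤ.- u)
      ≡ (e ℤ.+ -1ℤ) ℤ.* (ℤ.- ((1ℤ ℤ.+ e ℤ.+ e ℤ.* e) ℤ.* u)) ℤ.- u
    lemma = solve-∀

  -- If 2 ^ a is the exact power of two in t, then a ≤ K and c = 2 ^ (K - a) makes c t an odd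
  -- multiple of 2 ^ K. The recursion strips one factor of two from t and lowers K at the same time.
  odd-multiple : ∀ K t → ¬ 2 ^ suc K ℕ.∣ t → ∃₂ λ c r → c ℕ.* t ≡ 2 ^ K ℕ.+ r ℕ.* 2 ^ suc K
  odd-multiple K t ∤ with 2 ℕ.∣? t
  odd-multiple zero t ∤ | yes 2∣t = contradiction 2∣t ∤
  odd-multiple (suc K) t ∤ | yes (ℕ.divides t′ refl) with odd-multiple K t′
    (λ d → ∤ (subst (ℕ._∣ t′ ℕ.* 2) (ℕ.*-comm (2 ^ suc K) 2) (ℕ.*-monoˡ-∣ 2 d)))
  ... | c , r , eq = c , r , (begin
    c ℕ.* (t′ ℕ.* 2)                      ≡⟨ sym (ℕ.*-assoc c t′ 2) ⟩
    c ℕ.* t′ ℕ.* 2                        ≡⟨ cong (ℕ._* 2) eq ⟩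
    (2 ^ K ℕ.+ r ℕ.* 2 ^ suc K) ℕ.* 2     ≡⟨ ℕ.*-distribʳ-+ 2 (2 ^ K) _ ⟩
    2 ^ K ℕ.* 2 ℕ.+ r ℕ.* 2 ^ suc K ℕ.* 2 ≡⟨ cong₂ ℕ._+_ (ℕ.*-comm (2 ^ K) 2)
                                                 (trans (ℕ.*-assoc r (2 ^ suc K) 2)
                                                   (cong (r ℕ.*_) (ℕ.*-comm (2 ^ suc K) 2))) ⟩
    2 ^ suc K ℕ.+ r ℕ.* 2 ^ suc (suc K)       ∎)
    where open ≡-Reasoning
  odd-multiple K t ∤ | no 2∤t = 2 ^ K , t ℕ./ 2 , (begin
    2 ^ K ℕ.* t                           ≡⟨ cong (2 ^ K ℕ.*_) (ℕ.m≡m%n+[m/n]*n t 2) ⟩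
    2 ^ K ℕ.* (t ℕ.% 2 ℕ.+ t ℕ./ 2 ℕ.* 2) ≡⟨ cong (λ r → 2 ^ K ℕ.* (r ℕ.+ t ℕ./ 2 ℕ.* 2)) odd ⟩
    2 ^ K ℕ.* (1 ℕ.+ t ℕ./ 2 ℕ.* 2)       ≡⟨ lemma (2 ^ K) (t ℕ./ 2) ⟩
    2 ^ K ℕ.+ t ℕ./ 2 ℕ.* 2 ^ suc K           ∎)
    where
    open ≡-Reasoning
    odd : t ℕ.% 2 ≡ 1
    odd with t ℕ.% 2 in eq | ℕ.m%n<n t 2
    ... | 0 | _ = contradiction (ℕ.m%n≡0⇒n∣m t 2 eq) 2∤t
    ... | 1 | _ = refl
    ... | suc (suc _) | ℕ.s≤s (ℕ.s≤s ())
    lemma : ∀ p q → p ℕ.* (1 ℕ.+ q ℕ.* 2) ≡ p ℕ.+ q ℕ.* (2 ℕ.* p)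
    lemma = ℕ-solve-∀

  -- N/2 lies in every nontrivial subgroup of ℤ/N. Hence any collapse of positions, however coarse
  -- or fine, makes the translation by h trivial.
  half-multiple : ∀ {u} → u ≢ 𝟘 → ∃[ c ] c • u ≡ h· 𝟙
  half-multiple {u} u≢0 = c , (begin
    c • u                      ≡⟨ •-ι c u ⟩
    red (+ c ℤ.* ι u)          ≡⟨ cong red (sym (ℤ.pos-* c (toℕ u))) ⟩
    red (+ (c ℕ.* toℕ u))      ≡⟨ cong (λ k → red (+ k)) eq ⟩
    red (+ (half ℕ.+ r ℕ.* N)) ≡⟨ red-cong (mod (divides (+ r) shifted)) ⟩
    red (+ half)               ≡⟨ cong red (sym (ℤ.*-identityʳ (+ half))) ⟩
    red (+ half ℤ.* 1ℤ)        ≡⟨ sym (•-red half 1ℤ) ⟩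
    half • red 1ℤ              ≡⟨ cong (half •_) (sym 𝟙-red) ⟩
    half • 𝟙                   ≡⟨ half• 𝟙 ⟩
    h· 𝟙                               ∎)
    where
    open ≡-Reasoning
    u∤ : ¬ N ℕ.∣ toℕ u
    u∤ N∣u = u≢0 (trans (sym (red-ι u)) (trans
      (red-cong (mod (ℤ∣.∣ᵤ⇒∣ (subst (N ℕ.∣_) (sym (cong ℤ.∣_∣ (ℤ.+-identityʳ (ι u)))) N∣u))))
      (sym 𝟘-red)))
    odd : ∃₂ λ c r → c ℕ.* toℕ u ≡ half ℕ.+ r ℕ.* N
    odd = odd-multiple (2 ℕ.+ j) (toℕ u) u∤
    c = proj₁ odd
    r = proj₁ (proj₂ odd)
    eq = proj₂ (proj₂ odd)
    lemma : ∀ a b → a ℤ.+ b ℤ.- a ≡ b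
    lemma = solve-∀
    shifted : + (half ℕ.+ r ℕ.* N) ℤ.- + half ≡ + r ℤ.* + N
    shifted = trans (cong (ℤ._- + half) (ℤ.pos-+ half (r ℕ.* N)))
      (trans (lemma (+ half) (+ (r ℕ.* N))) (ℤ.pos-* r N))

-- Coordinates of faces and data of a rotation

nxt prv neg₄ : Fin 4 → Fin 4
nxt 0F = 1F
nxt 1F = 2F
nxt 2F = 3F
nxt 3F = 0F
prv 0F = 3F
prv 1F = 0F
prv 2F = 1F
prv 3F = 2F
neg₄ 0F = 0F
neg₄ 1F = 3F
neg₄ 2F = 2F
neg₄ 3F = 1F

-- A 2-face of kind κ lies between facets of the consecutive classes κ and κ + 1, exactly one of
-- which is even.
evenClass oddClass : Fin 4 → Fin 4
evenClass 0F = 0F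
evenClass 1F = 2F
evenClass 2F = 2F
evenClass 3F = 0F
oddClass 0F = 1F
oddClass 1F = 1F
oddClass 2F = 3F
oddClass 3F = 3F

nxt-prv : ∀ i → nxt (prv i) ≡ i
nxt-prv 0F = refl
nxt-prv 1F = refl
nxt-prv 2F = refl
nxt-prv 3F = refl

prv-nxt : ∀ i → prv (nxt i) ≡ i
prv-nxt 0F = refl
prv-nxt 1F = refl
prv-nxt 2F = refl
prv-nxt 3F = refl

prv≢ : ∀ i → prv i ≢ i
prv≢ 0F ()
prv≢ 1F ()
prv≢ 2F ()
prv≢ 3F ()

data Face (A : Set) : Set where
  bot top : Face A
  vtx     : Fin 4 → Face A
  edg     : Fin 4 → A → Face A
  fac     : Fin 4 → A → A → Face A
  cel     : Fin 4 → A → Face A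

mapFace : ∀ {A B : Set} → (A → B) → Face A → Face B
mapFace f bot         = bot
mapFace f top         = top
mapFace f (vtx i)     = vtx i
mapFace f (edg i t)   = edg i (f t)
mapFace f (fac κ b c) = fac κ (f b) (f c)
mapFace f (cel ρ s)   = cel ρ (f s)

rankOf : ∀ {A} → Face A → Fin 6
rankOf bot         = 0F
rankOf (vtx _)     = 1F
rankOf (edg _ _)   = 2F
rankOf (fac _ _ _) = 3F
rankOf (cel _ _)   = 4F
rankOf top         = 5F

-- The generators of the automorphism group, their inverses, and the translations
-- χ² c and υ⁴ c interpolating the powers of χ² and υ⁴.
data Step (A : Set) : Set where
  α α⁻ χ χ⁻ υ υ⁻ : Step A
  χ² υ⁴          : A → Step A

-- The image of a 2-face is computed from the images of its two walls. A rotation that changes the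
-- parity of the facet classes sends the even wall to the odd one, which `swaps` records.
record Action (A : Set) : Set where
  field
    vertex   : Fin 4 → Fin 4
    edge     : Fin 4 → Fin 4
    edgeVal  : Fin 4 → A → A
    kind     : Fin 4 → Fin 4
    swaps    : Bool
    class    : Fin 4 → Fin 4
    cellVal  : Fin 4 → A → A

  image : Face A → Face A
  image bot         = bot
  image top         = top
  image (vtx i)     = vtx (vertex i)
  image (edg i t)   = edg (edge i) (edgeVal i t)
  image (fac κ b c) = if swaps
    then fac (kind κ) (cellVal (oddClass κ) c) (cellVal (evenClass κ) b)
    else fac (kind κ) (cellVal (evenClass κ) b) (cellVal (oddClass κ) c)
  image (cel ρ s)   = cel (class ρ) (cellVal ρ s)

-- Negation of vertices induces i ↦ 1 - i on edge classes, because edge class i joins i - 1 and i.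
-- Negation of facet classes induces κ ↦ -1 - κ on kinds, because kind κ joins κ and κ + 1.
mirror₁ : Fin 4 → Fin 4
mirror₁ i = nxt (neg₄ i)

mirror₃ : Fin 4 → Fin 4
mirror₃ i = prv (neg₄ i)

-- Faces, incidence and rotations

module Geometry (j : ℕ) (ϵ : ℤ) (ϵ-unit : ϵ ≡ 1ℤ ⊎ ϵ ≡ -1ℤ) where
  open Residues j ϵ ϵ-unit public

  module Formulas {A : Set} (O : Ops A) where
    open Ops O

    -- Multiplication by 1 + h, an involution because 2 h = h² = 0.
    tw : A → A
    tw x = x + h* x

    2e : A
    2e = e + e

    -- With kind 0 normalised to the plain difference, `υ` carries the sides from kind to kind and
    -- forces the later constants: shift₂ = -1 - h shift₁ and shift₃ = shift₁ - (1 + h)(shift₂ + 1),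
    -- up to 4 e = 0.
    shift₁ shift₂ shift₃ : Fin 4 → A
    shift₁ 0F = 0#
    shift₁ 1F = neg 1# - e
    shift₁ 2F = 2e
    shift₁ 3F = neg 1# + e
    shift₂ 0F = neg 1#
    shift₂ 1F = neg 1# + 2e
    shift₂ 2F = neg 1#
    shift₂ 3F = neg 1# + 2e
    shift₃ 0F = 0#
    shift₃ 1F = neg 1# + e
    shift₃ 2F = 2e
    shift₃ 3F = neg 1# - e

    -- The edge joining vertices i - 1 and i of the 2-face (κ, b, c).
    side : Fin 4 → Fin 4 → A → A → A
    side 0F i b c = c - b
    side 1F i b c = tw (c - b) + shift₁ i
    side 2F i b c = (c - b) + shift₂ i
    side 3F i b c = tw (c - b) + shift₃ i

    -- The difference c - b for which side κ i b c = t.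
    gap : Fin 4 → Fin 4 → A → A
    gap 0F i t = t
    gap 1F i t = tw (t - shift₁ i)
    gap 2F i t = t - shift₂ i
    gap 3F i t = tw (t - shift₃ i)

    sideOf : Fin 4 → Face A → Face A
    sideOf i (fac κ b c) = edg i (side κ i b c)
    sideOf i _           = bot

    evenWall oddWall : Face A → Face A
    evenWall (fac κ b c) = cel (evenClass κ) b
    evenWall _           = bot
    oddWall (fac κ b c) = cel (oddClass κ) c
    oddWall _           = bot

    -- `α`, `χ`, `υ` are designed as `σ₁`, `σ₂`, `σ₃`. In `υ` only the passage from class 2 to class
    -- 3 adds 1, so `υ⁴` translates every facet by 1 in one full turn. The square of `χ` translates
    -- every edge by e - 1.
    action : Step A → Action A
    action α = record
      { vertex = nxt ; edge = nxt ; edgeVal = λ _ t → h* t - t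
      ; kind = λ κ → κ ; swaps = false ; class = λ ρ → ρ ; cellVal = val }
      where
      val : Fin 4 → A → A
      val 0F s = h* s - s
      val 1F s = h* s - s
      val 2F s = (h* s - s) + (e - 1#)
      val 3F s = (h* s - s) + (e + 1#)
    action α⁻ = record
      { vertex = prv ; edge = prv ; edgeVal = λ _ t → h* t - t
      ; kind = λ κ → κ ; swaps = false ; class = λ ρ → ρ ; cellVal = val }
      where
      val : Fin 4 → A → A
      val 0F s = h* s - s
      val 1F s = h* s - s
      val 2F s = h* (s - (e - 1#)) - (s - (e - 1#))
      val 3F s = h* (s - (e + 1#)) - (s - (e + 1#))
    action χ = record
      { vertex = neg₄ ; edge = mirror₁ ; edgeVal = eval
      ; kind = mirror₃ ; swaps = false ; class = neg₄ ; cellVal = val }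
      where
      eval : Fin 4 → A → A
      eval 0F t = t - 1# + e
      eval 1F t = t
      eval 2F t = t - 1# - e
      eval 3F t = t + 2e
      val : Fin 4 → A → A
      val 0F s = tw s
      val 1F s = tw s
      val 2F s = tw s + e
      val 3F s = tw s - 1# + e
    action χ⁻ = record
      { vertex = neg₄ ; edge = mirror₁ ; edgeVal = eval
      ; kind = mirror₃ ; swaps = false ; class = neg₄ ; cellVal = val }
      where
      eval : Fin 4 → A → A
      eval 0F t = t
      eval 1F t = t + 1# - e
      eval 2F t = t - 2e
      eval 3F t = t + 1# + e
      val : Fin 4 → A → A
      val 0F s = tw s
      val 1F s = tw (s + 1# - e)
      val 2F s = tw (s - e)
      val 3F s = tw s
    action υ = record
      { vertex = λ i → i ; edge = λ i → i ; edgeVal = λ i t → shift₁ i - tw t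
      ; kind = nxt ; swaps = true ; class = nxt ; cellVal = val }
      where
      val : Fin 4 → A → A
      val 0F s = s
      val 1F s = s
      val 2F s = s + 1#
      val 3F s = s
    action υ⁻ = record
      { vertex = λ i → i ; edge = λ i → i ; edgeVal = λ i t → tw (shift₁ i - t)
      ; kind = prv ; swaps = true ; class = prv ; cellVal = val }
      where
      val : Fin 4 → A → A
      val 0F s = s
      val 1F s = s
      val 2F s = s
      val 3F s = s - 1#
    action (χ² c) = record
      { vertex = λ i → i ; edge = λ i → i ; edgeVal = λ _ t → t + c
      ; kind = λ κ → κ ; swaps = false ; class = λ ρ → ρ ; cellVal = val }
      where
      val : Fin 4 → A → A
      val 0F s = s
      val 1F s = s + c
      val 2F s = s + h* c
      val 3F s = s + tw c
    action (υ⁴ c) = record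
      { vertex = λ i → i ; edge = λ i → i ; edgeVal = λ _ t → t
      ; kind = λ κ → κ ; swaps = false ; class = λ ρ → ρ ; cellVal = λ _ s → s + c }

    move : Step A → Face A → Face A
    move g = Action.image (action g)

    run : List (Step A) → Face A → Face A
    run []       F = F
    run (g ∷ gs) F = run gs (move g F)

  open Formulas ops public
  private module E = Formulas exprOps
  open Action

  evalFace : Z → Z → Z → Face Expr → Face Z
  evalFace x y z = mapFace (λ E → ⟦ E ⟧ x y z)

  evalStep : Z → Z → Z → Step Expr → Step Z
  evalStep x y z α  = α
  evalStep x y z α⁻ = α⁻
  evalStep x y z χ  = χ
  evalStep x y z χ⁻ = χ⁻
  evalStep x y z υ  = υ
  evalStep x y z υ⁻ = υ⁻
  evalStep x y z (χ² c) = χ² (⟦ c ⟧ x y z)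
  evalStep x y z (υ⁴ c) = υ⁴ (⟦ c ⟧ x y z)

  module _ (x y z : Z) where
    private
      val : Expr → Z
      val E = ⟦ E ⟧ x y z

      ev : Step Expr → Step Z
      ev = evalStep x y z

    edgeVal-eval : ∀ g i t → val (edgeVal (E.action g) i t) ≡ edgeVal (action (ev g)) i (val t)
    edgeVal-eval α  i t = refl
    edgeVal-eval α⁻ i t = refl
    edgeVal-eval χ  0F t = refl
    edgeVal-eval χ  1F t = refl
    edgeVal-eval χ  2F t = refl
    edgeVal-eval χ  3F t = refl
    edgeVal-eval χ⁻ 0F t = refl
    edgeVal-eval χ⁻ 1F t = refl
    edgeVal-eval χ⁻ 2F t = refl
    edgeVal-eval χ⁻ 3F t = refl
    edgeVal-eval υ  0F t = refl
    edgeVal-eval υ  1F t = refl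
    edgeVal-eval υ  2F t = refl
    edgeVal-eval υ  3F t = refl
    edgeVal-eval υ⁻ 0F t = refl
    edgeVal-eval υ⁻ 1F t = refl
    edgeVal-eval υ⁻ 2F t = refl
    edgeVal-eval υ⁻ 3F t = refl
    edgeVal-eval (χ² c) i t = refl
    edgeVal-eval (υ⁴ c) i t = refl

    cellVal-eval : ∀ g ρ s → val (cellVal (E.action g) ρ s) ≡ cellVal (action (ev g)) ρ (val s)
    cellVal-eval α  0F s = refl
    cellVal-eval α  1F s = refl
    cellVal-eval α  2F s = refl
    cellVal-eval α  3F s = refl
    cellVal-eval α⁻ 0F s = refl
    cellVal-eval α⁻ 1F s = refl
    cellVal-eval α⁻ 2F s = refl
    cellVal-eval α⁻ 3F s = refl
    cellVal-eval χ  0F s = refl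
    cellVal-eval χ  1F s = refl
    cellVal-eval χ  2F s = refl
    cellVal-eval χ  3F s = refl
    cellVal-eval χ⁻ 0F s = refl
    cellVal-eval χ⁻ 1F s = refl
    cellVal-eval χ⁻ 2F s = refl
    cellVal-eval χ⁻ 3F s = refl
    cellVal-eval υ  0F s = refl
    cellVal-eval υ  1F s = refl
    cellVal-eval υ  2F s = refl
    cellVal-eval υ  3F s = refl
    cellVal-eval υ⁻ 0F s = refl
    cellVal-eval υ⁻ 1F s = refl
    cellVal-eval υ⁻ 2F s = refl
    cellVal-eval υ⁻ 3F s = refl
    cellVal-eval (χ² c) 0F s = refl
    cellVal-eval (χ² c) 1F s = refl
    cellVal-eval (χ² c) 2F s = refl
    cellVal-eval (χ² c) 3F s = refl
    cellVal-eval (υ⁴ c) ρ s = refl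

    side-eval : ∀ κ i b c → val (E.side κ i b c) ≡ side κ i (val b) (val c)
    side-eval 0F i  b c = refl
    side-eval 1F 0F b c = refl
    side-eval 1F 1F b c = refl
    side-eval 1F 2F b c = refl
    side-eval 1F 3F b c = refl
    side-eval 2F 0F b c = refl
    side-eval 2F 1F b c = refl
    side-eval 2F 2F b c = refl
    side-eval 2F 3F b c = refl
    side-eval 3F 0F b c = refl
    side-eval 3F 1F b c = refl
    side-eval 3F 2F b c = refl
    side-eval 3F 3F b c = refl

    fac-eval : ∀ g κ b c →
      evalFace x y z (E.move g (fac κ b c)) ≡ move (ev g) (fac κ (val b) (val c))
    fac-eval α  κ b c = cong₂ (fac _) (cellVal-eval α (evenClass κ) b) (cellVal-eval α (oddClass κ) c)
    fac-eval α⁻ κ b c = cong₂ (fac _) (cellVal-eval α⁻ (evenClass κ) b) (cellVal-eval α⁻ (oddClass κ) c)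
    fac-eval χ  κ b c = cong₂ (fac _) (cellVal-eval χ (evenClass κ) b) (cellVal-eval χ (oddClass κ) c)
    fac-eval χ⁻ κ b c = cong₂ (fac _) (cellVal-eval χ⁻ (evenClass κ) b) (cellVal-eval χ⁻ (oddClass κ) c)
    fac-eval υ  κ b c = cong₂ (fac _) (cellVal-eval υ (oddClass κ) c) (cellVal-eval υ (evenClass κ) b)
    fac-eval υ⁻ κ b c = cong₂ (fac _) (cellVal-eval υ⁻ (oddClass κ) c) (cellVal-eval υ⁻ (evenClass κ) b)
    fac-eval g@(χ² _) κ b c = cong₂ (fac _) (cellVal-eval g (evenClass κ) b) (cellVal-eval g (oddClass κ) c)
    fac-eval g@(υ⁴ _) κ b c = cong₂ (fac _) (cellVal-eval g (evenClass κ) b) (cellVal-eval g (oddClass κ) c)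

    gap-eval : ∀ κ i t → val (E.gap κ i t) ≡ gap κ i (val t)
    gap-eval 0F i  t = refl
    gap-eval 1F 0F t = refl
    gap-eval 1F 1F t = refl
    gap-eval 1F 2F t = refl
    gap-eval 1F 3F t = refl
    gap-eval 2F 0F t = refl
    gap-eval 2F 1F t = refl
    gap-eval 2F 2F t = refl
    gap-eval 2F 3F t = refl
    gap-eval 3F 0F t = refl
    gap-eval 3F 1F t = refl
    gap-eval 3F 2F t = refl
    gap-eval 3F 3F t = refl

    sideOf-eval : ∀ i F → evalFace x y z (E.sideOf i F) ≡ sideOf i (evalFace x y z F)
    sideOf-eval i bot         = refl
    sideOf-eval i top         = refl
    sideOf-eval i (vtx _)     = refl
    sideOf-eval i (edg _ _)   = refl
    sideOf-eval i (cel _ _)   = refl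
    sideOf-eval i (fac κ b c) = cong (edg i) (side-eval κ i b c)

    vertex-eval : ∀ g i → vertex (E.action g) i ≡ vertex (action (ev g)) i
    vertex-eval α  i = refl
    vertex-eval α⁻ i = refl
    vertex-eval χ  i = refl
    vertex-eval χ⁻ i = refl
    vertex-eval υ  i = refl
    vertex-eval υ⁻ i = refl
    vertex-eval (χ² _) i = refl
    vertex-eval (υ⁴ _) i = refl

    edge-eval : ∀ g i → edge (E.action g) i ≡ edge (action (ev g)) i
    edge-eval α  i = refl
    edge-eval α⁻ i = refl
    edge-eval χ  i = refl
    edge-eval χ⁻ i = refl
    edge-eval υ  i = refl
    edge-eval υ⁻ i = refl
    edge-eval (χ² _) i = refl
    edge-eval (υ⁴ _) i = refl

    class-eval : ∀ g ρ → class (E.action g) ρ ≡ class (action (ev g)) ρ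
    class-eval α  i = refl
    class-eval α⁻ i = refl
    class-eval χ  i = refl
    class-eval χ⁻ i = refl
    class-eval υ  i = refl
    class-eval υ⁻ i = refl
    class-eval (χ² _) i = refl
    class-eval (υ⁴ _) i = refl

    move-eval : ∀ g F → evalFace x y z (E.move g F) ≡ move (ev g) (evalFace x y z F)
    move-eval g bot         = refl
    move-eval g top         = refl
    move-eval g (vtx i)     = cong vtx (vertex-eval g i)
    move-eval g (edg i t)   = cong₂ edg (edge-eval g i) (edgeVal-eval g i t)
    move-eval g (fac κ b c) = fac-eval g κ b c
    move-eval g (cel ρ s)   = cong₂ cel (class-eval g ρ) (cellVal-eval g ρ s)

    run-eval : ∀ gs F → evalFace x y z (E.run gs F) ≡ run (map ev gs) (evalFace x y z F)
    run-eval []       F = refl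
    run-eval (g ∷ gs) F = trans (run-eval gs (E.move g F)) (cong (run (map ev gs)) (move-eval g F))

  -- Checks return `Maybe` so that families of them can be combined over all classes and kinds. A
  -- result extracted with `from-just` is verified during type checking.
  solve? : ∀ E E′ → Maybe (∀ x y z → ⟦ E ⟧ x y z ≡ ⟦ E′ ⟧ x y z)
  solve? E E′ with T? _
  ... | yes v = just (solve E E′ {v})
  ... | no  _ = nothing

  sameFace? : ∀ F F′ → Maybe (∀ x y z → evalFace x y z F ≡ evalFace x y z F′)
  sameFace? bot bot = just λ _ _ _ → refl
  sameFace? top top = just λ _ _ _ → refl
  sameFace? (vtx i) (vtx i′) with i Fin.≟ i′
  ... | yes refl = just λ _ _ _ → refl
  ... | no  _    = nothing
  sameFace? (edg i t) (edg i′ t′) with i Fin.≟ i′ | solve? t t′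
  ... | yes refl | just p = just λ x y z → cong (edg i) (p x y z)
  ... | _        | _      = nothing
  sameFace? (fac κ b c) (fac κ′ b′ c′) with κ Fin.≟ κ′ | solve? b b′ | solve? c c′
  ... | yes refl | just p | just q = just λ x y z → cong₂ (fac κ) (p x y z) (q x y z)
  ... | _        | _      | _      = nothing
  sameFace? (cel ρ s) (cel ρ′ s′) with ρ Fin.≟ ρ′ | solve? s s′
  ... | yes refl | just p = just λ x y z → cong (cel ρ) (p x y z)
  ... | _        | _      = nothing
  sameFace? _ _ = nothing

  infixr 4 _&_
  _&_ : ∀ {A B : Set} → Maybe A → Maybe B → Maybe (A × B)
  just a & just b = just (a , b)
  _      & _      = nothing

  infixr 3 _or_
  _or_ : ∀ {A B : Set} → Maybe A → Maybe B → Maybe (A ⊎ B)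
  just a  or _      = just (inj₁ a)
  nothing or just b = just (inj₂ b)
  nothing or nothing = nothing

  infix 5 _=?_
  _=?_ : (i i′ : Fin 4) → Maybe (i ≡ i′)
  i =? i′ with i Fin.≟ i′
  ... | yes p = just p
  ... | no  _ = nothing

  forAll : ∀ {P : Fin 4 → Set} → (∀ i → Maybe (P i)) → Maybe (∀ i → P i)
  forAll p with p 0F & p 1F & p 2F & p 3F
  ... | just (a , b , c , d) = just λ { 0F → a ; 1F → b ; 2F → c ; 3F → d }
  ... | nothing              = nothing

  -- Two words in the steps agree on all faces if they agree on generic faces; the
  -- third variable is reserved for the parameter of a translation.
  agree? : ∀ gs gs′ →
    Maybe (∀ (us us′ : Z → List (Step Z)) →
      (∀ x y z → map (evalStep x y z) gs ≡ us z) → (∀ x y z → map (evalStep x y z) gs′ ≡ us′ z) →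
      ∀ z F → run (us z) F ≡ run (us′ z) F)
  agree? gs gs′
    with s? bot & s? top & forAll (λ i → s? (vtx i)) & forAll (λ i → s? (edg i var₁))
       & forAll (λ κ → s? (fac κ var₁ var₂)) & forAll (λ ρ → s? (cel ρ var₁))
    where
    s? : ∀ F → Maybe (∀ x y z → evalFace x y z (E.run gs F) ≡ evalFace x y z (E.run gs′ F))
    s? F = sameFace? (E.run gs F) (E.run gs′ F)
  ... | nothing = nothing
  ... | just (pb , pt , pv , pe , pf , pc) = just λ us us′ eq eq′ → λ where
      z bot         → on us us′ eq eq′ bot pb z z z
      z top         → on us us′ eq eq′ top pt z z z
      z (vtx i)     → on us us′ eq eq′ (vtx i) (pv i) z z z
      z (edg i t)   → on us us′ eq eq′ (edg i var₁) (pe i) t t z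
      z (fac κ b c) → on us us′ eq eq′ (fac κ var₁ var₂) (pf κ) b c z
      z (cel ρ s)   → on us us′ eq eq′ (cel ρ var₁) (pc ρ) s s z
    where
    on : ∀ us us′ → (∀ x y z → map (evalStep x y z) gs ≡ us z) →
      (∀ x y z → map (evalStep x y z) gs′ ≡ us′ z) →
      ∀ F → (∀ x y z → evalFace x y z (E.run gs F) ≡ evalFace x y z (E.run gs′ F)) →
      ∀ x y z → run (us z) (evalFace x y z F) ≡ run (us′ z) (evalFace x y z F)
    on us us′ eq eq′ F p x y z = begin
      run (us z) (evalFace x y z F)                     ≡⟨ cong (λ u → run u _) (sym (eq x y z)) ⟩
      run (map (evalStep x y z) gs) (evalFace x y z F)  ≡⟨ sym (run-eval x y z gs F) ⟩
      evalFace x y z (E.run gs F)                       ≡⟨ p x y z ⟩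
      evalFace x y z (E.run gs′ F)                      ≡⟨ run-eval x y z gs′ F ⟩
      run (map (evalStep x y z) gs′) (evalFace x y z F) ≡⟨ cong (λ u → run u _) (eq′ x y z) ⟩
      run (us′ z) (evalFace x y z F)                     ∎
      where open ≡-Reasoning

  runsTo? : ∀ gs F F′ → Maybe (∀ x y z →
    run (map (evalStep x y z) gs) (evalFace x y z F) ≡ evalFace x y z F′)
  runsTo? gs F F′ with sameFace? (E.run gs F) F′
  ... | nothing = nothing
  ... | just p  = just λ x y z → trans (sym (run-eval x y z gs F)) (p x y z)

  αα⁻ : ∀ F → move α⁻ (move α F) ≡ F
  αα⁻ = from-just (agree? (α ∷ α⁻ ∷ []) []) _ _ (λ _ _ _ → refl) (λ _ _ _ → refl) 𝟘

  α⁻α : ∀ F → move α (move α⁻ F) ≡ F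
  α⁻α = from-just (agree? (α⁻ ∷ α ∷ []) []) _ _ (λ _ _ _ → refl) (λ _ _ _ → refl) 𝟘

  χχ⁻ : ∀ F → move χ⁻ (move χ F) ≡ F
  χχ⁻ = from-just (agree? (χ ∷ χ⁻ ∷ []) []) _ _ (λ _ _ _ → refl) (λ _ _ _ → refl) 𝟘

  χ⁻χ : ∀ F → move χ (move χ⁻ F) ≡ F
  χ⁻χ = from-just (agree? (χ⁻ ∷ χ ∷ []) []) _ _ (λ _ _ _ → refl) (λ _ _ _ → refl) 𝟘

  υυ⁻ : ∀ F → move υ⁻ (move υ F) ≡ F
  υυ⁻ = from-just (agree? (υ ∷ υ⁻ ∷ []) []) _ _ (λ _ _ _ → refl) (λ _ _ _ → refl) 𝟘

  υ⁻υ : ∀ F → move υ (move υ⁻ F) ≡ F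
  υ⁻υ = from-just (agree? (υ⁻ ∷ υ ∷ []) []) _ _ (λ _ _ _ → refl) (λ _ _ _ → refl) 𝟘

  -- Any map that preserves ranks respects incidences across two or more ranks, so these three laws
  -- about consecutive ranks are all that remains. The alternatives allow for an exchange of the two
  -- ends of an edge or of the two walls.
  record Preserves (g : Step Z) : Set where
    private module g = Action (action g)
    field
      ends-law : ∀ i →
        (g.vertex i ≡ g.edge i × g.vertex (prv i) ≡ prv (g.edge i)) ⊎
        (g.vertex i ≡ prv (g.edge i) × g.vertex (prv i) ≡ g.edge i)
      side-law : ∀ i κ b c →
        sideOf (g.edge i) (move g (fac κ b c)) ≡ move g (sideOf i (fac κ b c))
      wall-law : ∀ κ b c → let F = fac κ b c in
        (evenWall (move g F) ≡ move g (evenWall F) × oddWall (move g F) ≡ move g (oddWall F)) ⊎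
        (evenWall (move g F) ≡ move g (oddWall F) × oddWall (move g F) ≡ move g (evenWall F))

  ends? : (v e : Fin 4 → Fin 4) → Maybe (∀ i →
    (v i ≡ e i × v (prv i) ≡ prv (e i)) ⊎ (v i ≡ prv (e i) × v (prv i) ≡ e i))
  ends? v e = forAll λ i →
    (v i =? e i & v (prv i) =? prv (e i)) or (v i =? prv (e i) & v (prv i) =? e i)

  sides? : ∀ g → Maybe ((u : Z → Step Z) → (∀ x y z → evalStep x y z g ≡ u z) →
    ∀ z i κ b c → sideOf (edge (action (u z)) i) (move (u z) (fac κ b c))
      ≡ move (u z) (sideOf i (fac κ b c)))
  sides? g with forAll (λ i → forAll λ κ → sameFace?
    (E.sideOf (edge (E.action g) i) (E.move g (fac κ var₁ var₂)))
    (E.move g (E.sideOf i (fac κ var₁ var₂))))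
  ... | nothing = nothing
  ... | just p  = just λ u eq z i κ b c →
    let open ≡-Reasoning
        F = fac κ var₁ var₂
        at : Face Expr → Face Z
        at = evalFace b c z
    in begin
    sideOf (edge (action (u z)) i) (move (u z) (at F))
      ≡⟨ cong (λ v → sideOf (edge (action v) i) (move v (at F))) (sym (eq b c z)) ⟩
    sideOf (edge (action (evalStep b c z g)) i) (move (evalStep b c z g) (at F))
      ≡⟨ cong₂ sideOf (sym (edge-eval b c z g i)) (sym (move-eval b c z g F)) ⟩
    sideOf (edge (E.action g) i) (at (E.move g F))
      ≡⟨ sym (sideOf-eval b c z (edge (E.action g) i) (E.move g F)) ⟩
    at (E.sideOf (edge (E.action g) i) (E.move g F))
      ≡⟨ p i κ b c z ⟩
    at (E.move g (E.sideOf i F))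
      ≡⟨ move-eval b c z g (E.sideOf i F) ⟩
    move (evalStep b c z g) (at (E.sideOf i F))
      ≡⟨ cong₂ move (eq b c z) (sideOf-eval b c z i F) ⟩
    move (u z) (sideOf i (at F)) ∎

  preserves : ∀ g → Preserves g
  preserves α = record
    { ends-law = from-just (ends? nxt nxt)
    ; side-law = from-just (sides? α) _ (λ _ _ _ → refl) 𝟘
    ; wall-law = λ κ b c → inj₁ (refl , refl) }
  preserves α⁻ = record
    { ends-law = from-just (ends? prv prv)
    ; side-law = from-just (sides? α⁻) _ (λ _ _ _ → refl) 𝟘
    ; wall-law = λ κ b c → inj₁ (refl , refl) }
  preserves χ = record
    { ends-law = from-just (ends? neg₄ mirror₁)
    ; side-law = from-just (sides? χ) _ (λ _ _ _ → refl) 𝟘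
    ; wall-law = λ { 0F b c → inj₁ (refl , refl) ; 1F b c → inj₁ (refl , refl)
                   ; 2F b c → inj₁ (refl , refl) ; 3F b c → inj₁ (refl , refl) } }
  preserves χ⁻ = record
    { ends-law = from-just (ends? neg₄ mirror₁)
    ; side-law = from-just (sides? χ⁻) _ (λ _ _ _ → refl) 𝟘
    ; wall-law = λ { 0F b c → inj₁ (refl , refl) ; 1F b c → inj₁ (refl , refl)
                   ; 2F b c → inj₁ (refl , refl) ; 3F b c → inj₁ (refl , refl) } }
  preserves υ = record
    { ends-law = from-just (ends? (λ i → i) (λ i → i))
    ; side-law = from-just (sides? υ) _ (λ _ _ _ → refl) 𝟘
    ; wall-law = λ { 0F b c → inj₂ (refl , refl) ; 1F b c → inj₂ (refl , refl)
                   ; 2F b c → inj₂ (refl , refl) ; 3F b c → inj₂ (refl , refl) } }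
  preserves υ⁻ = record
    { ends-law = from-just (ends? (λ i → i) (λ i → i))
    ; side-law = from-just (sides? υ⁻) _ (λ _ _ _ → refl) 𝟘
    ; wall-law = λ { 0F b c → inj₂ (refl , refl) ; 1F b c → inj₂ (refl , refl)
                   ; 2F b c → inj₂ (refl , refl) ; 3F b c → inj₂ (refl , refl) } }
  preserves (χ² c) = record
    { ends-law = from-just (ends? (λ i → i) (λ i → i))
    ; side-law = from-just (sides? (χ² var₃)) χ² (λ _ _ _ → refl) c
    ; wall-law = λ κ b c → inj₁ (refl , refl) }
  preserves (υ⁴ c) = record
    { ends-law = from-just (ends? (λ i → i) (λ i → i))
    ; side-law = from-just (sides? (υ⁴ var₃)) υ⁴ (λ _ _ _ → refl) c
    ; wall-law = λ κ b c → inj₁ (refl , refl) }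

  infix 4 _⋖_ _≼_

  _⋖_ : Face Z → Face Z → Set
  bot ⋖ bot = ⊥
  bot ⋖ top = ⊤
  bot ⋖ vtx _ = ⊤
  bot ⋖ edg _ _ = ⊤
  bot ⋖ fac _ _ _ = ⊤
  bot ⋖ cel _ _ = ⊤
  vtx i ⋖ edg j _ = i ≡ j ⊎ i ≡ prv j
  vtx _ ⋖ fac _ _ _ = ⊤
  vtx _ ⋖ cel _ _ = ⊤
  vtx _ ⋖ top = ⊤
  edg i t ⋖ fac κ b c = edg i t ≡ sideOf i (fac κ b c)
  edg _ _ ⋖ cel _ _ = ⊤
  edg _ _ ⋖ top = ⊤
  fac κ b c ⋖ cel ρ s = cel ρ s ≡ evenWall (fac κ b c) ⊎ cel ρ s ≡ oddWall (fac κ b c)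
  fac _ _ _ ⋖ top = ⊤
  cel _ _ ⋖ top = ⊤
  _ ⋖ _ = ⊥

  _≼_ : Face Z → Face Z → Set
  F ≼ G = F ≡ G ⊎ F ⋖ G

  _≟F_ : (F G : Face Z) → Dec (F ≡ G)
  F ≟F G = map′ decode-injective (cong code)
      (Product.≡-dec _≟ₙ_ (Product.≡-dec _≟ₙ_ (Product.≡-dec _≟ₙ_ _≟ₙ_)) (code F) (code G))
    where
    _≟ₙ_ = ℕ._≟_
    code : Face Z → ℕ × ℕ × ℕ × ℕ
    code bot         = 0 , 0 , 0 , 0
    code (vtx i)     = 1 , toℕ i , 0 , 0
    code (edg i t)   = 2 , toℕ i , toℕ t , 0
    code (fac κ b c) = 3 , toℕ κ , toℕ b , toℕ c
    code (cel ρ s)   = 4 , toℕ ρ , toℕ s , 0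
    code top         = 5 , 0 , 0 , 0
    inj = Fin.toℕ-injective
    decode-injective : ∀ {F G} → code F ≡ code G → F ≡ G
    decode-injective {bot} {bot} eq = refl
    decode-injective {vtx _} {vtx _} eq = cong vtx (inj (cong (proj₁ ∘ proj₂) eq))
    decode-injective {edg _ _} {edg _ _} eq =
      cong₂ edg (inj (cong (proj₁ ∘ proj₂) eq)) (inj (cong (proj₁ ∘ proj₂ ∘ proj₂) eq))
    decode-injective {fac κ b c} {fac κ′ b′ c′} eq
      with inj {i = κ} {κ′} (cong (proj₁ ∘ proj₂) eq) | inj {i = b} {b′} (cong (proj₁ ∘ proj₂ ∘ proj₂) eq)
         | inj {i = c} {c′} (cong (proj₂ ∘ proj₂ ∘ proj₂) eq)
    ... | refl | refl | refl = refl
    decode-injective {cel _ _} {cel _ _} eq =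
      cong₂ cel (inj (cong (proj₁ ∘ proj₂) eq)) (inj (cong (proj₁ ∘ proj₂ ∘ proj₂) eq))
    decode-injective {top} {top} eq = refl

  _⋖?_ : ∀ F G → Dec (F ⋖ G)
  bot ⋖? bot = no λ ()
  bot ⋖? top = yes tt
  bot ⋖? vtx _ = yes tt
  bot ⋖? edg _ _ = yes tt
  bot ⋖? fac _ _ _ = yes tt
  bot ⋖? cel _ _ = yes tt
  vtx i ⋖? edg j _ = i Fin.≟ j ⊎-dec i Fin.≟ prv j
  vtx _ ⋖? fac _ _ _ = yes tt
  vtx _ ⋖? cel _ _ = yes tt
  vtx _ ⋖? top = yes tt
  vtx _ ⋖? bot = no λ ()
  vtx _ ⋖? vtx _ = no λ ()
  edg i t ⋖? fac κ b c = edg i t ≟F sideOf i (fac κ b c)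
  edg _ _ ⋖? cel _ _ = yes tt
  edg _ _ ⋖? top = yes tt
  edg _ _ ⋖? bot = no λ ()
  edg _ _ ⋖? vtx _ = no λ ()
  edg _ _ ⋖? edg _ _ = no λ ()
  fac κ b c ⋖? cel ρ s = cel ρ s ≟F evenWall (fac κ b c) ⊎-dec cel ρ s ≟F oddWall (fac κ b c)
  fac _ _ _ ⋖? top = yes tt
  fac _ _ _ ⋖? bot = no λ ()
  fac _ _ _ ⋖? vtx _ = no λ ()
  fac _ _ _ ⋖? edg _ _ = no λ ()
  fac _ _ _ ⋖? fac _ _ _ = no λ ()
  cel _ _ ⋖? top = yes tt
  cel _ _ ⋖? bot = no λ ()
  cel _ _ ⋖? vtx _ = no λ ()
  cel _ _ ⋖? edg _ _ = no λ ()
  cel _ _ ⋖? fac _ _ _ = no λ ()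
  cel _ _ ⋖? cel _ _ = no λ ()
  top ⋖? _ = no λ ()

  ⋖-rank : ∀ F G → F ⋖ G → rankOf F Fin.< rankOf G
  ⋖-rank bot top _ = s≤s z≤n
  ⋖-rank bot (vtx _) _ = s≤s z≤n
  ⋖-rank bot (edg _ _) _ = s≤s z≤n
  ⋖-rank bot (fac _ _ _) _ = s≤s z≤n
  ⋖-rank bot (cel _ _) _ = s≤s z≤n
  ⋖-rank (vtx _) (edg _ _) _ = s≤s (s≤s z≤n)
  ⋖-rank (vtx _) (fac _ _ _) _ = s≤s (s≤s z≤n)
  ⋖-rank (vtx _) (cel _ _) _ = s≤s (s≤s z≤n)
  ⋖-rank (vtx _) top _ = s≤s (s≤s z≤n)
  ⋖-rank (edg _ _) (fac _ _ _) _ = s≤s (s≤s (s≤s z≤n))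
  ⋖-rank (edg _ _) (cel _ _) _ = s≤s (s≤s (s≤s z≤n))
  ⋖-rank (edg _ _) top _ = s≤s (s≤s (s≤s z≤n))
  ⋖-rank (fac _ _ _) (cel _ _) _ = s≤s (s≤s (s≤s (s≤s z≤n)))
  ⋖-rank (fac _ _ _) top _ = s≤s (s≤s (s≤s (s≤s z≤n)))
  ⋖-rank (cel _ _) top _ = s≤s (s≤s (s≤s (s≤s (s≤s z≤n))))

  far⇒⋖ : ∀ F G → 2 ℕ.+ toℕ (rankOf F) ℕ.≤ toℕ (rankOf G) → F ⋖ G
  far⇒⋖ bot bot ()
  far⇒⋖ bot top _ = tt
  far⇒⋖ bot (vtx _) _ = tt
  far⇒⋖ bot (edg _ _) _ = tt
  far⇒⋖ bot (fac _ _ _) _ = tt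
  far⇒⋖ bot (cel _ _) _ = tt
  far⇒⋖ (vtx _) top _ = tt
  far⇒⋖ (vtx _) (edg _ _) (s≤s (s≤s ()))
  far⇒⋖ (vtx _) (vtx _) (s≤s ())
  far⇒⋖ (vtx _) (fac _ _ _) _ = tt
  far⇒⋖ (vtx _) (cel _ _) _ = tt
  far⇒⋖ (edg _ _) (vtx _) (s≤s ())
  far⇒⋖ (edg _ _) (edg _ _) (s≤s (s≤s ()))
  far⇒⋖ (edg _ _) (fac _ _ _) (s≤s (s≤s (s≤s ())))
  far⇒⋖ (edg _ _) (cel _ _) _ = tt
  far⇒⋖ (edg _ _) top _ = tt
  far⇒⋖ (fac _ _ _) (vtx _) (s≤s ())
  far⇒⋖ (fac _ _ _) (edg _ _) (s≤s (s≤s ()))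
  far⇒⋖ (fac _ _ _) (fac _ _ _) (s≤s (s≤s (s≤s ())))
  far⇒⋖ (fac _ _ _) (cel _ _) (s≤s (s≤s (s≤s (s≤s ()))))
  far⇒⋖ (fac _ _ _) top _ = tt
  far⇒⋖ (cel _ _) (vtx _) (s≤s ())
  far⇒⋖ (cel _ _) (edg _ _) (s≤s (s≤s ()))
  far⇒⋖ (cel _ _) (fac _ _ _) (s≤s (s≤s (s≤s ())))
  far⇒⋖ (cel _ _) (cel _ _) (s≤s (s≤s (s≤s (s≤s ()))))
  far⇒⋖ (cel _ _) top (s≤s (s≤s (s≤s (s≤s (s≤s ())))))
  far⇒⋖ top (vtx _) (s≤s ())
  far⇒⋖ top (edg _ _) (s≤s (s≤s ()))
  far⇒⋖ top (fac _ _ _) (s≤s (s≤s (s≤s ())))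
  far⇒⋖ top (cel _ _) (s≤s (s≤s (s≤s (s≤s ()))))
  far⇒⋖ top top (s≤s (s≤s (s≤s (s≤s (s≤s ())))))

  ⋖-irrefl : ∀ {F} → ¬ F ⋖ F
  ⋖-irrefl {F} p = ℕ.<-irrefl refl (⋖-rank F F p)

  -- Two strict steps raise the rank by at least two, and such faces are always incident.
  ⋖-trans : ∀ {F G H} → F ⋖ G → G ⋖ H → F ⋖ H
  ⋖-trans {F} {G} {H} p q = far⇒⋖ F H (ℕ.≤-trans (s≤s (⋖-rank F G p)) (⋖-rank G H q))

  ≼-trans : ∀ {F G H} → F ≼ G → G ≼ H → F ≼ H
  ≼-trans (inj₁ refl) q           = q
  ≼-trans (inj₂ p)    (inj₁ refl) = inj₂ p
  ≼-trans {F} {G} {H} (inj₂ p) (inj₂ q) = inj₂ (⋖-trans {F} {G} {H} p q)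

  ≼-antisym : ∀ {F G} → F ≼ G → G ≼ F → F ≡ G
  ≼-antisym (inj₁ p) _        = p
  ≼-antisym (inj₂ _) (inj₁ q) = sym q
  ≼-antisym {F} {G} (inj₂ p) (inj₂ q) = contradiction (⋖-trans {F} {G} {F} p q) (⋖-irrefl {F})

  poset : RankedPoset 4
  poset = record
    { Face              = Face Z
    ; _≤_               = _≼_
    ; isDecPartialOrder = record
      { isPartialOrder = record
        { isPreorder = record
          { isEquivalence = isEquivalence
          ; reflexive     = inj₁
          ; trans         = ≼-trans
          }
        ; antisym = ≼-antisym
        }
      ; _≟_  = _≟F_
      ; _≤?_ = λ F G → F ≟F G ⊎-dec F ⋖? G
      }
    ; rank            = rankOf
    ; rank-strictMono = λ { (inj₁ F≡G , F≢G) → contradiction F≡G F≢G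
                          ; {F} {G} (inj₂ p , _) → ⋖-rank F G p }
    }

  move-rank : ∀ g F → rankOf (move g F) ≡ rankOf F
  move-rank g bot         = refl
  move-rank g top         = refl
  move-rank g (vtx _)     = refl
  move-rank g (edg _ _)   = refl
  move-rank g (cel _ _)   = refl
  move-rank g (fac _ _ _) with swaps (action g)
  ... | true  = refl
  ... | false = refl

  move-far : ∀ g F G → 2 ℕ.+ toℕ (rankOf F) ℕ.≤ toℕ (rankOf G) → move g F ⋖ move g G
  move-far g F G p = far⇒⋖ (move g F) (move g G)
    (subst₂ (λ r r′ → 2 ℕ.+ toℕ r ℕ.≤ toℕ r′) (sym (move-rank g F)) (sym (move-rank g G)) p)

  move-⋖ : ∀ g F G → F ⋖ G → move g F ⋖ move g G
  move-⋖ g (vtx i) (edg j t) (inj₁ refl) with Preserves.ends-law (preserves g) j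
  ... | inj₁ (p , _) = inj₁ p
  ... | inj₂ (p , _) = inj₂ p
  move-⋖ g (vtx i) (edg j t) (inj₂ refl) with Preserves.ends-law (preserves g) j
  ... | inj₁ (_ , p) = inj₂ p
  ... | inj₂ (_ , p) = inj₁ p
  move-⋖ g (edg i t) (fac κ b c) p
    with move g (fac κ b c) | move-rank g (fac κ b c) | Preserves.side-law (preserves g) i κ b c
  ... | fac κ′ b′ c′ | _ | q = trans (cong (move g) p) (sym q)
  move-⋖ g (fac κ b c) (cel ρ s) p
    with move g (fac κ b c) | move-rank g (fac κ b c) | Preserves.wall-law (preserves g) κ b c | p
  ... | fac κ′ b′ c′ | _ | inj₁ (q , _) | inj₁ r = inj₁ (trans (cong (move g) r) (sym q))
  ... | fac κ′ b′ c′ | _ | inj₁ (_ , q) | inj₂ r = inj₂ (trans (cong (move g) r) (sym q))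
  ... | fac κ′ b′ c′ | _ | inj₂ (_ , q) | inj₁ r = inj₂ (trans (cong (move g) r) (sym q))
  ... | fac κ′ b′ c′ | _ | inj₂ (q , _) | inj₂ r = inj₁ (trans (cong (move g) r) (sym q))
  move-⋖ g F@bot G@top         _ = move-far g F G (s≤s (s≤s z≤n))
  move-⋖ g F@bot G@(vtx _)     _ = tt
  move-⋖ g F@bot G@(edg _ _)   _ = move-far g F G (s≤s (s≤s z≤n))
  move-⋖ g F@bot G@(fac _ _ _) _ = move-far g F G (s≤s (s≤s z≤n))
  move-⋖ g F@bot G@(cel _ _)   _ = move-far g F G (s≤s (s≤s z≤n))
  move-⋖ g F@(vtx _) G@(fac _ _ _) _ = move-far g F G (s≤s (s≤s (s≤s z≤n)))
  move-⋖ g F@(vtx _) G@(cel _ _)   _ = move-far g F G (s≤s (s≤s (s≤s z≤n)))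
  move-⋖ g F@(vtx _) G@top         _ = move-far g F G (s≤s (s≤s (s≤s z≤n)))
  move-⋖ g F@(edg _ _) G@(cel _ _) _ = move-far g F G (s≤s (s≤s (s≤s (s≤s z≤n))))
  move-⋖ g F@(edg _ _) G@top       _ = move-far g F G (s≤s (s≤s (s≤s (s≤s z≤n))))
  move-⋖ g F@(fac _ _ _) G@top     _ = move-far g F G (s≤s (s≤s (s≤s (s≤s (s≤s z≤n)))))
  move-⋖ g (cel _ _) top _ = tt

  move-≼ : ∀ g {F G} → F ≼ G → move g F ≼ move g G
  move-≼ g (inj₁ F≡G)    = inj₁ (cong (move g) F≡G)
  move-≼ g {F} {G} (inj₂ p) = inj₂ (move-⋖ g F G p)

  inverseStep : Step Z → Step Z
  inverseStep α      = α⁻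
  inverseStep α⁻     = α
  inverseStep χ      = χ⁻
  inverseStep χ⁻     = χ
  inverseStep υ      = υ⁻
  inverseStep υ⁻     = υ
  inverseStep (χ² c) = χ² (⊝ c)
  inverseStep (υ⁴ c) = υ⁴ (⊝ c)

  move-inverseˡ : ∀ g F → move (inverseStep g) (move g F) ≡ F
  move-inverseˡ α      = αα⁻
  move-inverseˡ α⁻     = α⁻α
  move-inverseˡ χ      = χχ⁻
  move-inverseˡ χ⁻     = χ⁻χ
  move-inverseˡ υ      = υυ⁻
  move-inverseˡ υ⁻     = υ⁻υ
  move-inverseˡ (χ² c) = from-just (agree? (χ² var₃ ∷ χ² (:- var₃) ∷ []) []) (λ c → χ² c ∷ χ² (⊝ c) ∷ [])
      _ (λ _ _ _ → refl) (λ _ _ _ → refl) c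
  move-inverseˡ (υ⁴ c) = from-just (agree? (υ⁴ var₃ ∷ υ⁴ (:- var₃) ∷ []) []) (λ c → υ⁴ c ∷ υ⁴ (⊝ c) ∷ [])
      _ (λ _ _ _ → refl) (λ _ _ _ → refl) c

  move-inverseʳ : ∀ g F → move g (move (inverseStep g) F) ≡ F
  move-inverseʳ α      = α⁻α
  move-inverseʳ α⁻     = αα⁻
  move-inverseʳ χ      = χ⁻χ
  move-inverseʳ χ⁻     = χχ⁻
  move-inverseʳ υ      = υ⁻υ
  move-inverseʳ υ⁻     = υυ⁻
  move-inverseʳ (χ² c) = from-just (agree? (χ² (:- var₃) ∷ χ² var₃ ∷ []) []) (λ c → χ² (⊝ c) ∷ χ² c ∷ [])
      _ (λ _ _ _ → refl) (λ _ _ _ → refl) c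
  move-inverseʳ (υ⁴ c) = from-just (agree? (υ⁴ (:- var₃) ∷ υ⁴ var₃ ∷ []) []) (λ c → υ⁴ (⊝ c) ∷ υ⁴ c ∷ [])
      _ (λ _ _ _ → refl) (λ _ _ _ → refl) c

  run-fixes-bot : ∀ gs → run gs bot ≡ bot
  run-fixes-bot []       = refl
  run-fixes-bot (g ∷ gs) = run-fixes-bot gs

  run-fixes-top : ∀ gs → run gs top ≡ top
  run-fixes-top []       = refl
  run-fixes-top (g ∷ gs) = run-fixes-top gs

  run-++ : ∀ gs gs′ F → run (gs ++ gs′) F ≡ run gs′ (run gs F)
  run-++ []       gs′ F = refl
  run-++ (g ∷ gs) gs′ F = run-++ gs gs′ (move g F)

  inverse : List (Step Z) → List (Step Z)
  inverse []       = []
  inverse (g ∷ gs) = inverse gs ++ inverseStep g ∷ []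

  run-inverseˡ : ∀ gs F → run (inverse gs) (run gs F) ≡ F
  run-inverseˡ []       F = refl
  run-inverseˡ (g ∷ gs) F = begin
    run (inverse gs ++ inverseStep g ∷ []) (run gs (move g F))  ≡⟨ run-++ (inverse gs) _ _ ⟩
    move (inverseStep g) (run (inverse gs) (run gs (move g F)))
      ≡⟨ cong (move (inverseStep g)) (run-inverseˡ gs (move g F)) ⟩
    move (inverseStep g) (move g F)                             ≡⟨ move-inverseˡ g F ⟩
    F                                                           ∎
    where open ≡-Reasoning

  run-inverseʳ : ∀ gs F → run gs (run (inverse gs) F) ≡ F
  run-inverseʳ []       F = refl
  run-inverseʳ (g ∷ gs) F = begin
    run gs (move g (run (inverse gs ++ inverseStep g ∷ []) F))
      ≡⟨ cong (run gs ∘ move g) (run-++ (inverse gs) _ F) ⟩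
    run gs (move g (move (inverseStep g) (run (inverse gs) F))) ≡⟨ cong (run gs) (move-inverseʳ g _) ⟩
    run gs (run (inverse gs) F)                                 ≡⟨ run-inverseʳ gs F ⟩
    F                                                           ∎
    where open ≡-Reasoning

  run-injective : ∀ gs {F G} → run gs F ≡ run gs G → F ≡ G
  run-injective gs {F} {G} eq =
    trans (sym (run-inverseˡ gs F)) (trans (cong (run (inverse gs)) eq) (run-inverseˡ gs G))

  run-≼ : ∀ gs {F G} → F ≼ G → run gs F ≼ run gs G
  run-≼ []       p = p
  run-≼ (g ∷ gs) p = run-≼ gs (move-≼ g p)

  run-rank : ∀ gs F → rankOf (run gs F) ≡ rankOf F
  run-rank []       F = refl
  run-rank (g ∷ gs) F = trans (run-rank gs (move g F)) (move-rank g F)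

  υ⁴-power : ∀ k F → run (replicate (k ℕ.* 4) υ) F ≡ move (υ⁴ (k • 𝟙)) F
  υ⁴-power zero    F = from-just (agree? [] (υ⁴ zer ∷ [])) _ _ (λ _ _ _ → refl) (λ _ _ _ → refl) 𝟘 F
  υ⁴-power (suc k) F = trans (υ⁴-power k _) (add F)
    where
    add : ∀ F → move (υ⁴ (k • 𝟙)) (move υ (move υ (move υ (move υ F)))) ≡ move (υ⁴ (𝟙 ⊕ k • 𝟙)) F
    add = from-just (agree? (υ ∷ υ ∷ υ ∷ υ ∷ υ⁴ var₃ ∷ []) (υ⁴ (one :+ var₃) ∷ []))
      (λ z → υ ∷ υ ∷ υ ∷ υ ∷ υ⁴ z ∷ []) (λ z → υ⁴ (𝟙 ⊕ z) ∷ []) (λ _ _ _ → refl) (λ _ _ _ → refl) (k • 𝟙)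

  χ²-power : ∀ k F → run (replicate (k ℕ.* 2) χ) F ≡ move (χ² (k • (𝕖 ⊖ 𝟙))) F
  χ²-power zero    F = from-just (agree? [] (χ² zer ∷ [])) _ _ (λ _ _ _ → refl) (λ _ _ _ → refl) 𝟘 F
  χ²-power (suc k) F = trans (χ²-power k _) (add F)
    where
    add : ∀ F → move (χ² (k • (𝕖 ⊖ 𝟙))) (move χ (move χ F)) ≡ move (χ² ((𝕖 ⊖ 𝟙) ⊕ k • (𝕖 ⊖ 𝟙))) F
    add = from-just (agree? (χ ∷ χ ∷ χ² var₃ ∷ []) (χ² ((ee :+ (:- one)) :+ var₃) ∷ []))
      (λ z → χ ∷ χ ∷ χ² z ∷ []) (λ z → χ² ((𝕖 ⊖ 𝟙) ⊕ z) ∷ []) (λ _ _ _ → refl) (λ _ _ _ → refl) (k • (𝕖 ⊖ 𝟙))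

  gap-side? : Maybe (∀ κ k x y z →
    ⟦ var₁ :+ E.gap κ k (E.side κ k var₁ var₂) ⟧ x y z ≡ ⟦ var₂ ⟧ x y z)
  gap-side? = forAll λ κ → forAll λ k → solve? (var₁ :+ E.gap κ k (E.side κ k var₁ var₂)) var₂

  side-odd? : Maybe (∀ κ k x y z →
    ⟦ E.side κ k var₁ (var₁ :+ E.gap κ k var₂) ⟧ x y z ≡ ⟦ var₂ ⟧ x y z)
  side-odd? = forAll λ κ → forAll λ k → solve? (E.side κ k var₁ (var₁ :+ E.gap κ k var₂)) var₂

  side-even? : Maybe (∀ κ k x y z →
    ⟦ E.side κ k (var₁ :+ (:- E.gap κ k var₂)) var₁ ⟧ x y z ≡ ⟦ var₂ ⟧ x y z)
  side-even? = forAll λ κ → forAll λ k → solve? (E.side κ k (var₁ :+ (:- E.gap κ k var₂)) var₁) var₂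

  gap-side : ∀ κ k b c → b ⊕ gap κ k (side κ k b c) ≡ c
  gap-side κ k b c = trans
    (cong (b ⊕_) (sym (trans (gap-eval b c c κ k (E.side κ k var₁ var₂))
        (cong (gap κ k) (side-eval b c c κ k var₁ var₂)))))
    (from-just gap-side? κ k b c c)

  side-odd : ∀ κ k b t → side κ k b (b ⊕ gap κ k t) ≡ t
  side-odd κ k b t = trans
    (sym (trans (side-eval b t t κ k var₁ (var₁ :+ E.gap κ k var₂))
        (cong (λ g → side κ k b (b ⊕ g)) (gap-eval b t t κ k var₂))))
    (from-just side-odd? κ k b t t)

  side-even : ∀ κ k c t → side κ k (c ⊖ gap κ k t) c ≡ t
  side-even κ k c t = trans
    (sym (trans (side-eval c t t κ k (var₁ :+ (:- E.gap κ k var₂)) var₁)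
        (cong (λ g → side κ k (c ⊖ g) c) (gap-eval c t t κ k var₂))))
    (from-just side-even? κ k c t t)

  ⊕-cancel : ∀ b g c → b ⊕ g ≡ c → b ≡ c ⊖ g
  ⊕-cancel b g _ refl = solve var₁ ((var₁ :+ var₂) :+ (:- var₂)) b g g

-- Diamonds, flags and maximal chains

module Construction (j : ℕ) (ϵ : ℤ) (ϵ-unit : ϵ ≡ 1ℤ ⊎ ϵ ≡ -1ℤ) where
  open Geometry j ϵ ϵ-unit public
  private module P = RankedPoset poset

  <⇒⋖ : ∀ {F G} → F P.< G → F ⋖ G
  <⇒⋖ (inj₁ F≡G , F≢G) = contradiction F≡G F≢G
  <⇒⋖ (inj₂ p , _)     = p

  ⋖⇒< : ∀ {F G} → F ⋖ G → F P.< G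
  ⋖⇒< {F} {G} p = inj₂ p , λ { refl → ⋖-irrefl {F} p }

  -- The facets of class ρ lie on the 2-faces of kinds ρ and prv ρ, as even or odd
  -- wall according to the parity of ρ.
  wallKind : Fin 4 → Fin 2 → Fin 4
  wallKind ρ 0F = ρ
  wallKind ρ 1F = prv ρ

  through : Fin 4 → Fin 4 → Z → Fin 4 → Z → Face Z
  through 0F κ s k t = fac κ s (s ⊕ gap κ k t)
  through 1F κ s k t = fac κ (s ⊖ gap κ k t) s
  through 2F κ s k t = fac κ s (s ⊕ gap κ k t)
  through 3F κ s k t = fac κ (s ⊖ gap κ k t) s

  edg-through : ∀ ρ n s k t → edg k t ⋖ through ρ (wallKind ρ n) s k t
  edg-through 0F n s k t = cong (edg k) (sym (side-odd (wallKind 0F n) k s t))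
  edg-through 1F n s k t = cong (edg k) (sym (side-even (wallKind 1F n) k s t))
  edg-through 2F n s k t = cong (edg k) (sym (side-odd (wallKind 2F n) k s t))
  edg-through 3F n s k t = cong (edg k) (sym (side-even (wallKind 3F n) k s t))

  through-wall : ∀ ρ n s k t → through ρ (wallKind ρ n) s k t ⋖ cel ρ s
  through-wall 0F 0F s k t = inj₁ refl
  through-wall 0F 1F s k t = inj₁ refl
  through-wall 1F 0F s k t = inj₂ refl
  through-wall 1F 1F s k t = inj₂ refl
  through-wall 2F 0F s k t = inj₁ refl
  through-wall 2F 1F s k t = inj₁ refl
  through-wall 3F 0F s k t = inj₂ refl
  through-wall 3F 1F s k t = inj₂ refl

  through-distinct : ∀ ρ s k t →
    through ρ (wallKind ρ 0F) s k t ≢ through ρ (wallKind ρ 1F) s k t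
  through-distinct 0F s k t ()
  through-distinct 1F s k t ()
  through-distinct 2F s k t ()
  through-distinct 3F s k t ()

  through-unique : ∀ {ρ s k t} κ b c → edg k t ⋖ fac κ b c → fac κ b c ⋖ cel ρ s →
    ∃[ n ] fac κ b c ≡ through ρ (wallKind ρ n) s k t
  through-unique {k = k} 0F b c refl (inj₁ refl) = 0F , cong (fac 0F b) (sym (gap-side 0F k b c))
  through-unique {k = k} 0F b c refl (inj₂ refl) = 1F , cong (λ b → fac 0F b c)
      (⊕-cancel b _ c (gap-side 0F k b c))
  through-unique {k = k} 1F b c refl (inj₁ refl) = 1F , cong (fac 1F b) (sym (gap-side 1F k b c))
  through-unique {k = k} 1F b c refl (inj₂ refl) = 0F , cong (λ b → fac 1F b c)
      (⊕-cancel b _ c (gap-side 1F k b c))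
  through-unique {k = k} 2F b c refl (inj₁ refl) = 0F , cong (fac 2F b) (sym (gap-side 2F k b c))
  through-unique {k = k} 2F b c refl (inj₂ refl) = 1F , cong (λ b → fac 2F b c)
      (⊕-cancel b _ c (gap-side 2F k b c))
  through-unique {k = k} 3F b c refl (inj₁ refl) = 1F , cong (fac 3F b) (sym (gap-side 3F k b c))
  through-unique {k = k} 3F b c refl (inj₂ refl) = 0F , cong (λ b → fac 3F b c)
      (⊕-cancel b _ c (gap-side 3F k b c))

  nxt≢ : ∀ i → i ≢ nxt i
  nxt≢ 0F ()
  nxt≢ 1F ()
  nxt≢ 2F ()
  nxt≢ 3F ()

  evenClass≢oddClass : ∀ κ → evenClass κ ≢ oddClass κ
  evenClass≢oddClass 0F ()
  evenClass≢oddClass 1F ()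
  evenClass≢oddClass 2F ()
  evenClass≢oddClass 3F ()

  through-fac : ∀ ρ n s k t → ∃[ κ ] ∃[ b ] ∃[ c ] through ρ (wallKind ρ n) s k t ≡ fac κ b c
  through-fac 0F n s k t = _ , _ , _ , refl
  through-fac 1F n s k t = _ , _ , _ , refl
  through-fac 2F n s k t = _ , _ , _ , refl
  through-fac 3F n s k t = _ , _ , _ , refl

  diamond⋖ : ∀ F G → F ⋖ G → toℕ (rankOf G) ≡ 2 ℕ.+ toℕ (rankOf F) →
    ∃₂ λ H₁ H₂ → H₁ ≢ H₂ × (F ⋖ H₁ × H₁ ⋖ G) × (F ⋖ H₂ × H₂ ⋖ G) ×
      (∀ H → F ⋖ H → H ⋖ G → H ≡ H₁ ⊎ H ≡ H₂)
  diamond⋖ bot (edg k t) _ _ = vtx k , vtx (prv k) , (λ { eq → prv≢ k (sym (vtx-injective eq)) }) ,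
    (tt , inj₁ refl) , (tt , inj₂ refl) ,
    λ { (vtx i) _ (inj₁ refl) → inj₁ refl ; (vtx i) _ (inj₂ refl) → inj₂ refl }
    where
    vtx-injective : ∀ {i k} → vtx {Z} i ≡ vtx k → i ≡ k
    vtx-injective refl = refl
  diamond⋖ (vtx i) F@(fac κ b c) _ _ = sideOf i F , sideOf (nxt i) F ,
    (λ eq → nxt≢ i (edg-injective eq)) ,
    (inj₁ refl , refl) , (inj₂ (sym (prv-nxt i)) , refl) ,
    λ { (edg k t) (inj₁ refl) p → inj₁ p
      ; (edg k t) (inj₂ refl) p → inj₂ (trans p (cong (λ k → sideOf k F) (sym (nxt-prv k)))) }
    where
    edg-injective : ∀ {i k} {t u : Z} → edg i t ≡ edg k u → i ≡ k
    edg-injective refl = refl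
  diamond⋖ (edg k t) (cel ρ s) _ _ =
    through ρ (wallKind ρ 0F) s k t , through ρ (wallKind ρ 1F) s k t , through-distinct ρ s k t ,
    (edg-through ρ 0F s k t , through-wall ρ 0F s k t) ,
    (edg-through ρ 1F s k t , through-wall ρ 1F s k t) , unique
    where
    unique : ∀ H → edg k t ⋖ H → H ⋖ cel ρ s → _
    unique (fac κ b c) p q with through-unique {ρ} {s} {k} {t} κ b c p q
    ... | 0F , eq = inj₁ eq
    ... | 1F , eq = inj₂ eq
  diamond⋖ F@(fac κ b c) top _ _ = evenWall F , oddWall F , (λ eq → evenClass≢oddClass κ (cel-injective eq)) ,
    (inj₁ refl , tt) , (inj₂ refl , tt) , λ { (cel ρ s) p _ → p }
    where
    cel-injective : ∀ {i k} {t u : Z} → cel i t ≡ cel k u → i ≡ k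
    cel-injective refl = refl

  diamond : P.DiamondCondition
  diamond {F} {G} F<G r =
    let H₁ , H₂ , ne , (p₁ , q₁) , (p₂ , q₂) , unique = diamond⋖ F G (<⇒⋖ F<G) r in
    H₁ , H₂ , ne , (⋖⇒< p₁ , ⋖⇒< q₁) , (⋖⇒< p₂ , ⋖⇒< q₂) ,
    λ H p q → unique H (<⇒⋖ p) (<⇒⋖ q)

  -- Three incidences determine a flag: the improper faces are below and above everything, and all
  -- pairs of ranks further apart are incident anyway.
  record Chain : Set where
    constructor chain
    field
      {V E F C} : Face Z
      rank-V : rankOf V ≡ 1F
      rank-E : rankOf E ≡ 2F
      rank-F : rankOf F ≡ 3F
      rank-C : rankOf C ≡ 4F
      V⋖E : V ⋖ E
      E⋖F : E ⋖ F
      F⋖C : F ⋖ C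

    at : Fin 6 → Face Z
    at 0F = bot
    at 1F = V
    at 2F = E
    at 3F = F
    at 4F = C
    at 5F = top

    rank-at : ∀ i → rankOf (at i) ≡ i
    rank-at 0F = refl
    rank-at 1F = rank-V
    rank-at 2F = rank-E
    rank-at 3F = rank-F
    rank-at 4F = rank-C
    rank-at 5F = refl

    consecutive : ∀ (i : Fin 5) → at (inject₁ i) ⋖ at (suc i)
    consecutive 0F with V | rank-V
    ... | vtx _ | _ = tt
    consecutive 1F = V⋖E
    consecutive 2F = E⋖F
    consecutive 3F = F⋖C
    consecutive 4F with C | rank-C
    ... | cel _ _ | _ = tt

    mono : ∀ {i k} → i Fin.≤ k → at i ≼ at k
    mono {i} {k} i≤k with ℕ.m≤n⇒m<n∨m≡n i≤k
    ... | inj₂ i≡k = inj₁ (cong at (Fin.toℕ-injective i≡k))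
    ... | inj₁ i<k with ℕ.m≤n⇒m<n∨m≡n i<k
    ...   | inj₁ far = inj₂ (far⇒⋖ (at i) (at k)
              (subst₂ (λ r r′ → 2 ℕ.+ toℕ r ℕ.≤ toℕ r′) (sym (rank-at i)) (sym (rank-at k)) far))
    mono {i} {suc k} i≤k | inj₁ i<k | inj₂ eq = inj₂ (subst (λ i → at i ⋖ at (suc k))
      (Fin.toℕ-injective (trans (Fin.toℕ-inject₁ k) (sym (ℕ.suc-injective eq)))) (consecutive k))

    flag : P.Flag
    flag = record { face = at ; rank-face = rank-at ; face-mono = mono }

  open Chain using (flag) public

  flag-⋖ : ∀ Φ {i k} → i Fin.< k → P.face Φ i ⋖ P.face Φ k
  flag-⋖ Φ {i} {k} i<k with P.face-mono Φ {i} {k} (ℕ.<⇒≤ i<k)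
  ... | inj₂ p = p
  ... | inj₁ eq = contradiction
    (trans (sym (P.rank-face Φ i)) (trans (cong rankOf eq) (P.rank-face Φ k)))
    (λ i≡k → ℕ.<-irrefl (cong toℕ i≡k) i<k)

  chainOf : P.Flag → Chain
  chainOf Φ = chain (P.rank-face Φ 1F) (P.rank-face Φ 2F) (P.rank-face Φ 3F) (P.rank-face Φ 4F)
    (flag-⋖ Φ (s≤s (s≤s z≤n))) (flag-⋖ Φ (s≤s (s≤s (s≤s z≤n)))) (flag-⋖ Φ (s≤s (s≤s (s≤s (s≤s z≤n)))))

  rank-0 : ∀ (F : Face Z) → rankOf F ≡ 0F → F ≡ bot
  rank-0 bot _ = refl

  rank-5 : ∀ (F : Face Z) → rankOf F ≡ 5F → F ≡ top
  rank-5 top _ = refl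

  bot-≼ : ∀ F → bot ≼ F
  bot-≼ bot         = inj₁ refl
  bot-≼ top         = inj₂ tt
  bot-≼ (vtx _)     = inj₂ tt
  bot-≼ (edg _ _)   = inj₂ tt
  bot-≼ (fac _ _ _) = inj₂ tt
  bot-≼ (cel _ _)   = inj₂ tt

  ≼-top : ∀ F → F ≼ top
  ≼-top bot         = inj₂ tt
  ≼-top top         = inj₁ refl
  ≼-top (vtx _)     = inj₂ tt
  ≼-top (edg _ _)   = inj₂ tt
  ≼-top (fac _ _ _) = inj₂ tt
  ≼-top (cel _ _)   = inj₂ tt

  module MaximalChain (C : Pred (Face Z) 0ℓ) (C? : Decidable C) (max : P.IsMaximalChain C) where

    same-rank : ∀ {F G} → F ∈ C → G ∈ C → rankOf F ≡ rankOf G → F ≡ G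
    same-rank {F} {G} F∈C G∈C eq with proj₁ max F∈C G∈C
    ... | inj₁ (inj₁ F≡G) = F≡G
    ... | inj₁ (inj₂ p)   = contradiction (⋖-rank F G p) (ℕ.<-irrefl (cong toℕ eq))
    ... | inj₂ (inj₁ G≡F) = sym G≡F
    ... | inj₂ (inj₂ p)   = contradiction (⋖-rank G F p) (ℕ.<-irrefl (cong toℕ (sym eq)))

    ordered : ∀ {F G} → F ∈ C → G ∈ C → rankOf F Fin.< rankOf G → F ⋖ G
    ordered {F} {G} F∈C G∈C F<G with proj₁ max F∈C G∈C
    ... | inj₁ (inj₁ refl) = contradiction F<G (ℕ.<-irrefl refl)
    ... | inj₁ (inj₂ p)    = p
    ... | inj₂ (inj₁ refl) = contradiction F<G (ℕ.<-irrefl refl)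
    ... | inj₂ (inj₂ p)    = contradiction (⋖-rank G F p) (ℕ.<-asym F<G)

    In : Fin 6 → Set
    In r = ∃[ F ] (rankOf F ≡ r × F ∈ C)

    -- A face of an unoccupied rank that is incident with the members of the two neighbouring ranks
    -- is comparable with the whole chain, so maximality puts it into the chain.
    join : ∀ H → ¬ In (rankOf H) →
      (∀ {F} → F ∈ C → suc (toℕ (rankOf F)) ≡ toℕ (rankOf H) → F ⋖ H) →
      (∀ {F} → F ∈ C → suc (toℕ (rankOf H)) ≡ toℕ (rankOf F) → H ⋖ F) → In (rankOf H)
    join H new below above = H , refl , proj₂ max H comparable
      where
      comparable : ∀ {F} → F ∈ C → F ≼ H ⊎ H ≼ F
      comparable {F} F∈C with ℕ.<-cmp (toℕ (rankOf F)) (toℕ (rankOf H))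
      ... | tri≈ _ eq _ = contradiction (F , Fin.toℕ-injective eq , F∈C) new
      ... | tri< lt _ _ with ℕ.m≤n⇒m<n∨m≡n lt
      ...   | inj₁ far = inj₁ (inj₂ (far⇒⋖ F H far))
      ...   | inj₂ eq  = inj₁ (inj₂ (below F∈C eq))
      comparable {F} F∈C | tri> _ _ gt with ℕ.m≤n⇒m<n∨m≡n gt
      ...   | inj₁ far = inj₂ (inj₂ (far⇒⋖ H F far))
      ...   | inj₂ eq  = inj₂ (inj₂ (above F∈C eq))

    vertex? : Dec (In 1F)
    vertex? = map′ (λ (i , p) → vtx i , refl , p) (λ { (vtx i , _ , p) → i , p })
      (Fin.any? λ i → C? (vtx i))

    edge? : Dec (In 2F)
    edge? = map′ (λ (i , t , p) → edg i t , refl , p) (λ { (edg i t , _ , p) → i , t , p })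
      (Fin.any? λ i → Fin.any? λ t → C? (edg i t))

    fac? : Dec (In 3F)
    fac? = map′ (λ (κ , b , c , p) → fac κ b c , refl , p) (λ { (fac κ b c , _ , p) → κ , b , c , p })
      (Fin.any? λ κ → Fin.any? λ b → Fin.any? λ c → C? (fac κ b c))

    cel? : Dec (In 4F)
    cel? = map′ (λ (ρ , s , p) → cel ρ s , refl , p) (λ { (cel ρ s , _ , p) → ρ , s , p })
      (Fin.any? λ ρ → Fin.any? λ s → C? (cel ρ s))

    -- If the chain has no member of rank r, the second condition is vacuous and any face of that
    -- rank may stand in as a dummy neighbour.
    Only : Fin 6 → Face Z → Set
    Only r F = rankOf F ≡ r × (∀ {G} → G ∈ C → rankOf G ≡ r → G ≡ F)

    only : ∀ {r} → Dec (In r) → (D : Face Z) → rankOf D ≡ r → ∃[ F ] Only r F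
    only (yes (F , refl , F∈C)) D _ = F , refl , λ G∈C eq → same-rank G∈C F∈C eq
    only (no none) D r = D , r , λ {G} G∈C eq → contradiction (G , eq , G∈C) none

    -- The edge has to come before its neighbours. Every vertex and every 2-face share an edge, so
    -- unknown neighbours may be dummies; afterwards a vertex is chosen on the actual edge, a 2-face
    -- between the edge and a possibly dummy facet, and a facet on the actual 2-face.
    anEdge : In 2F
    anEdge with edge? | only vertex? (vtx 0F) refl | only fac? (fac 0F 𝟘 𝟘) refl
    ... | yes E | _ | _ = E
    ... | no ¬E | vtx i , _ , only-V | fac κ b c , _ , only-F = join (sideOf i (fac κ b c)) ¬E
      (λ {F} F∈C eq → subst (_⋖ edg i _) (sym (only-V F∈C (Fin.toℕ-injective (ℕ.suc-injective eq)))) (inj₁ refl))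
      (λ {F} F∈C eq → subst (edg i _ ⋖_) (sym (only-F F∈C (Fin.toℕ-injective (sym eq)))) refl)

    aVertex : In 1F
    aVertex with vertex? | anEdge
    ... | yes V | _ = V
    ... | no ¬V | edg k t , _ , E∈C = join (vtx k) ¬V
      (λ {F} _ eq → subst (_⋖ vtx k) (sym (rank-0 F (Fin.toℕ-injective (ℕ.suc-injective eq)))) tt)
      (λ {F} F∈C eq → subst (vtx k ⋖_) (same-rank E∈C F∈C (Fin.toℕ-injective eq)) (inj₁ refl))

    aFace : In 3F
    aFace with fac? | anEdge | only cel? (cel 0F 𝟘) refl
    ... | yes F | _ | _ = F
    ... | no ¬F | edg k t , _ , E∈C | cel ρ s , _ , only-C
      with through ρ (wallKind ρ 0F) s k t | through-fac ρ 0F s k t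
         | edg-through ρ 0F s k t | through-wall ρ 0F s k t
    ...   | H@(fac _ _ _) | _ | p | q = join H ¬F
      (λ {F} F∈C eq → subst (_⋖ H) (same-rank E∈C F∈C (Fin.toℕ-injective (ℕ.suc-injective (sym eq)))) p)
      (λ {F} F∈C eq → subst (H ⋖_) (sym (only-C F∈C (Fin.toℕ-injective (sym eq)))) q)

    aFacet : In 4F
    aFacet with cel? | aFace
    ... | yes C | _ = C
    ... | no ¬C | F@(fac κ b c) , _ , F∈C = join (evenWall F) ¬C
      (λ {G} G∈C eq → subst (_⋖ evenWall F)
          (same-rank F∈C G∈C (Fin.toℕ-injective (ℕ.suc-injective (sym eq)))) (inj₁ refl))
      (λ {G} _ eq → subst (evenWall F ⋖_) (sym (rank-5 G (Fin.toℕ-injective (sym eq)))) tt)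

    theChain : Chain
    theChain = chain (rank aVertex) (rank anEdge) (rank aFace) (rank aFacet)
      (below aVertex anEdge (s≤s (s≤s z≤n))) (below anEdge aFace (s≤s (s≤s (s≤s z≤n))))
      (below aFace aFacet (s≤s (s≤s (s≤s (s≤s z≤n)))))
      where
      rank : ∀ {r} (i : In r) → rankOf (proj₁ i) ≡ r
      rank i = proj₁ (proj₂ i)
      below : ∀ {r r′} (i : In r) (i′ : In r′) → r Fin.< r′ → proj₁ i ⋖ proj₁ i′
      below (_ , refl , p) (_ , refl , q) lt = ordered p q lt

    bot∈C : bot ∈ C
    bot∈C = proj₂ max bot (λ {F} _ → inj₂ (bot-≼ F))

    top∈C : top ∈ C
    top∈C = proj₂ max top (λ {F} _ → inj₁ (≼-top F))

    at∈C : ∀ i → Chain.at theChain i ∈ C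
    at∈C 0F = bot∈C
    at∈C 1F = proj₂ (proj₂ aVertex)
    at∈C 2F = proj₂ (proj₂ anEdge)
    at∈C 3F = proj₂ (proj₂ aFace)
    at∈C 4F = proj₂ (proj₂ aFacet)
    at∈C 5F = top∈C

  maximalChainsAreFlags : P.MaximalChainsAreFlags
  maximalChainsAreFlags C C? max = flag theChain , λ F → mk⇔
    (λ F∈C → rankOf F , same-rank (at∈C (rankOf F)) F∈C (Chain.rank-at theChain (rankOf F)))
    (λ (i , eq) → subst C eq (at∈C i))
    where open MaximalChain C C? max

-- Strong flag-connectivity

module Connectivity (j : ℕ) (ϵ : ℤ) (ϵ-unit : ϵ ≡ 1ℤ ⊎ ϵ ≡ -1ℤ) where
  open Construction j ϵ ϵ-unit public
  private module P = RankedPoset poset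

  ≈-sym : ∀ {Φ Ψ} → Φ P.≈ Ψ → Ψ P.≈ Φ
  ≈-sym e i = sym (e i)

  infixl 7 _▸_
  _▸_ : P.Flag → List (Step Z) → P.Flag
  Φ ▸ gs = record
    { face      = run gs ∘ P.face Φ
    ; rank-face = λ i → trans (run-rank gs _) (P.rank-face Φ i)
    ; face-mono = run-≼ gs ∘ P.face-mono Φ
    }

  base : Chain
  base = chain {vtx 0F} {edg 0F 𝟘} {fac 0F 𝟘 𝟘} {cel 0F 𝟘} refl refl refl refl
    (inj₁ refl) (cong (edg 0F) (solve zer (zer :+ (:- zer)) 𝟘 𝟘 𝟘)) (inj₁ refl)

  base₁ : Chain
  base₁ = chain {vtx 0F} {edg 1F 𝟘} {fac 0F 𝟘 𝟘} {cel 0F 𝟘} refl refl refl refl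
    (inj₂ refl) (cong (edg 1F) (solve zer (zer :+ (:- zer)) 𝟘 𝟘 𝟘)) (inj₁ refl)

  Φ₀ Φ₁ : P.Flag
  Φ₀ = flag base
  Φ₁ = flag base₁

  -- For strong connectivity `J` consists of the ranks at which the two given flags differ. A path
  -- that flips only these ranks never loses a common face.
  data Reach (J : Fin 6 → Set) : P.Flag → P.Flag → Set where
    done : ∀ {Φ Ψ} → Φ P.≈ Ψ → Reach J Φ Ψ
    step : ∀ {Φ Χ Ψ i} → J i → P.Adjacent i Φ Χ → Reach J Χ Ψ → Reach J Φ Ψ

  module _ {J : Fin 6 → Set} where

    respˡ : ∀ {Φ Φ′ Ψ} → Φ P.≈ Φ′ → Reach J Φ′ Ψ → Reach J Φ Ψ
    respˡ e (done e′) = done λ i → trans (e i) (e′ i)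
    respˡ e (step {i = i} q (ne , eq) r) =
      step q ((λ p → ne (trans (sym (e i)) p)) , λ k k≢i → trans (e k) (eq k k≢i)) r

    infixr 5 _⨟_
    _⨟_ : ∀ {Φ Χ Ψ} → Reach J Φ Χ → Reach J Χ Ψ → Reach J Φ Ψ
    done e     ⨟ r = respˡ e r
    step q a p ⨟ r = step q a (p ⨟ r)

    flip : ∀ i {Φ Ψ} → (P.face Φ i ≢ P.face Ψ i → J i) →
      (∀ k → k ≢ i → P.face Φ k ≡ P.face Ψ k) → Reach J Φ Ψ
    flip i {Φ} {Ψ} allowed eq with P.face Φ i ≟F P.face Ψ i
    ... | no ne = step (allowed ne) (ne , eq) (done {Φ = Ψ} λ _ → refl)
    ... | yes e = done same
      where
      same : Φ P.≈ Ψ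
      same k with k Fin.≟ i
      ... | yes refl = e
      ... | no k≢i   = eq k k≢i

    transport : ∀ gs {Φ Ψ} → Reach J Φ Ψ → Reach J (Φ ▸ gs) (Ψ ▸ gs)
    transport gs (done e) = done λ i → cong (run gs) (e i)
    transport gs (step q (ne , eq) r) =
      step q ((λ p → ne (run-injective gs p)) , λ k k≢i → cong (run gs) (eq k k≢i)) (transport gs r)

    iterate : ∀ g {Φ} → Reach J Φ (Φ ▸ (g ∷ [])) → ∀ k → Reach J Φ (Φ ▸ replicate k g)
    iterate g {Φ} r zero    = done λ _ → refl
    iterate g {Φ} r (suc k) = iterate g r k ⨟ transport (replicate k g) r ⨟
      done {Φ = (Φ ▸ (g ∷ [])) ▸ replicate k g} {Ψ = Φ ▸ replicate (suc k) g} (λ _ → refl)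

  Agree : (i₁ i₂ i₃ : Fin 6) → P.Flag → P.Flag → Set
  Agree i₁ i₂ i₃ Φ Ψ =
    P.face Φ i₁ ≡ P.face Ψ i₁ × P.face Φ i₂ ≡ P.face Ψ i₂ × P.face Φ i₃ ≡ P.face Ψ i₃

  face-0 : ∀ Φ → P.face Φ 0F ≡ bot
  face-0 Φ = rank-0 _ (P.rank-face Φ 0F)

  face-5 : ∀ Φ → P.face Φ 5F ≡ top
  face-5 Φ = rank-5 _ (P.rank-face Φ 5F)

  module _ {Φ Ψ : P.Flag} where
    off : ∀ i → (1F ≢ i → P.face Φ 1F ≡ P.face Ψ 1F) → (2F ≢ i → P.face Φ 2F ≡ P.face Ψ 2F) →
      (3F ≢ i → P.face Φ 3F ≡ P.face Ψ 3F) → (4F ≢ i → P.face Φ 4F ≡ P.face Ψ 4F) →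
      ∀ k → k ≢ i → P.face Φ k ≡ P.face Ψ k
    off i p q r s 0F _ = trans (face-0 Φ) (sym (face-0 Ψ))
    off i p q r s 1F   = p
    off i p q r s 2F   = q
    off i p q r s 3F   = r
    off i p q r s 4F   = s
    off i p q r s 5F _ = trans (face-5 Φ) (sym (face-5 Ψ))

    off₁ : Agree 2F 3F 4F Φ Ψ → ∀ k → k ≢ 1F → P.face Φ k ≡ P.face Ψ k
    off₁ (p , q , r) = off 1F (contradiction refl) (λ _ → p) (λ _ → q) (λ _ → r)

    off₂ : Agree 1F 3F 4F Φ Ψ → ∀ k → k ≢ 2F → P.face Φ k ≡ P.face Ψ k
    off₂ (p , q , r) = off 2F (λ _ → p) (contradiction refl) (λ _ → q) (λ _ → r)

    off₃ : Agree 1F 2F 4F Φ Ψ → ∀ k → k ≢ 3F → P.face Φ k ≡ P.face Ψ k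
    off₃ (p , q , r) = off 3F (λ _ → p) (λ _ → q) (contradiction refl) (λ _ → r)

    off₄ : Agree 1F 2F 3F Φ Ψ → ∀ k → k ≢ 4F → P.face Φ k ≡ P.face Ψ k
    off₄ (p , q , r) = off 4F (λ _ → p) (λ _ → q) (λ _ → r) (contradiction refl)

  flip₁ : ∀ {J Φ Ψ} → J 1F → Agree 2F 3F 4F Φ Ψ → Reach J Φ Ψ
  flip₁ {J} {Φ} {Ψ} q a = flip 1F (λ _ → q) (off₁ {Φ} {Ψ} a)

  flip₂ : ∀ {J Φ Ψ} → J 2F → Agree 1F 3F 4F Φ Ψ → Reach J Φ Ψ
  flip₂ {J} {Φ} {Ψ} q a = flip 2F (λ _ → q) (off₂ {Φ} {Ψ} a)

  flip₃ : ∀ {J Φ Ψ} → J 3F → Agree 1F 2F 4F Φ Ψ → Reach J Φ Ψ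
  flip₃ {J} {Φ} {Ψ} q a = flip 3F (λ _ → q) (off₃ {Φ} {Ψ} a)

  flip₄ : ∀ {J Φ Ψ} → J 4F → Agree 1F 2F 3F Φ Ψ → Reach J Φ Ψ
  flip₄ {J} {Φ} {Ψ} q a = flip 4F (λ _ → q) (off₄ {Φ} {Ψ} a)

  -- The flags Φ₀³, Φ₀² adjacent to the base flag, through which υ, χ are reached.
  base₂ base₃ : Chain
  base₂ = chain {vtx 0F} {edg 0F 𝟘} {fac 3F 𝟘 𝟘} {cel 0F 𝟘} refl refl refl refl
    (inj₁ refl) (cong (edg 0F) (E⋖F₂)) (inj₁ refl)
    where
    E⋖F₂ : 𝟘 ≡ side 3F 0F 𝟘 𝟘
    E⋖F₂ = from-just (solve? zer (((zer :+ (:- zer)) :+ (:h (zer :+ (:- zer)))) :+ zer)) 𝟘 𝟘 𝟘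
  base₃ = chain {vtx 0F} {edg 0F 𝟘} {fac 0F 𝟘 𝟘} {cel 1F 𝟘} refl refl refl refl
    (inj₁ refl) (Chain.E⋖F base) (inj₂ refl)

  walk-υ : ∀ {J} → J 3F → J 4F → Reach J Φ₀ (Φ₀ ▸ (υ ∷ []))
  walk-υ q₃ q₄ = flip₄ {Ψ = flag base₃} q₄ (refl , refl , refl) ⨟ flip₃ q₃
    ( refl
    , sym (from-just (runsTo? (υ ∷ []) (edg 0F zer) (edg 0F zer)) 𝟘 𝟘 𝟘)
    , refl )

  walk-χ : ∀ {J} → J 2F → J 3F → Reach J Φ₀ (Φ₀ ▸ (χ ∷ []))
  walk-χ q₂ q₃ = flip₃ {Ψ = flag base₂} q₃ (refl , refl , refl) ⨟ flip₂ q₂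
    ( refl
    , sym (from-just (runsTo? (χ ∷ []) (fac 0F zer zer) (fac 3F zer zer)) 𝟘 𝟘 𝟘)
    , sym (from-just (runsTo? (χ ∷ []) (cel 0F zer) (cel 0F zer)) 𝟘 𝟘 𝟘) )

  walk-α : ∀ {J} → J 1F → J 2F → Reach J Φ₀ (Φ₀ ▸ (α ∷ []))
  walk-α q₁ q₂ = flip₂ {Ψ = Φ₁} q₂ (refl , refl , refl) ⨟ flip₁ q₁
    ( sym (from-just (runsTo? (α ∷ []) (edg 0F zer) (edg 1F zer)) 𝟘 𝟘 𝟘)
    , sym (from-just (runsTo? (α ∷ []) (fac 0F zer zer) (fac 0F zer zer)) 𝟘 𝟘 𝟘)
    , sym (from-just (runsTo? (α ∷ []) (cel 0F zer) (cel 0F zer)) 𝟘 𝟘 𝟘) )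

  run-replicate : ∀ m n g F → run (replicate (m ℕ.+ n) g) F ≡ run (replicate n g) (run (replicate m g) F)
  run-replicate zero    n g F = refl
  run-replicate (suc m) n g F = run-replicate m n g (move g F)

  υ-facet : ∀ ρ s → ∃[ k ] run (replicate k υ) (cel 0F 𝟘) ≡ cel ρ s
  υ-facet 0F s = toℕ s ℕ.* 4 , trans (υ⁴-power (toℕ s) _) (cong (cel 0F)
    (trans (cong (𝟘 ⊕_) (multiple-of-𝟙 s)) (solve (zer :+ var₁) var₁ s s s)))
  υ-facet 1F s = let k , eq = υ-facet 0F s in
    k ℕ.+ 1 , trans (run-replicate k 1 υ _) (cong (move υ) eq)
  υ-facet 2F s = let k , eq = υ-facet 0F s in
    k ℕ.+ 2 , trans (run-replicate k 2 υ _) (cong (run (υ ∷ υ ∷ [])) eq)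
  -- The passage from class 2 to class 3 adds 1, hence the start at s - 1.
  υ-facet 3F s = let k , eq = υ-facet 0F (s ⊖ 𝟙) in
    k ℕ.+ 3 , trans (run-replicate k 3 υ _) (trans (cong (run (υ ∷ υ ∷ υ ∷ [])) eq)
      (cong (cel 3F) (solve ((var₁ :+ (:- one)) :+ one) var₁ s s s)))

  -- The square of `χ` is the translation by the unit e - 1, whose multiples exhaust ℤ/N.
  χ-even : ∀ u → ∃[ k ] (∀ F → run (replicate k χ) F ≡ move (χ² u) F)
  χ-even u = let k , eq = multiple-of-𝕖⊖𝟙 u in
    k ℕ.* 2 , λ F → trans (χ²-power k F) (cong (λ u → move (χ² u) F) eq)

  χ-odd : ∀ u → ∃[ k ] (∀ F → run (replicate k χ) F ≡ move χ (move (χ² u) F))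
  χ-odd u = let k , eq = χ-even u in
    k ℕ.+ 1 , λ F → trans (run-replicate k 1 χ F) (cong (move χ) (eq F))

  χ-edge : ∀ E → rankOf E ≡ 2F → vtx 0F ⋖ E → ∃[ k ] run (replicate k χ) (edg 0F 𝟘) ≡ E
  χ-edge (edg 0F t) _ _ = let k , eq = χ-even t in
    k , trans (eq _) (cong (edg 0F) (solve (zer :+ var₁) var₁ t t t))
  -- `χ` moves an edge from class 0 to class 1 and adds e - 1, which the translation compensates in
  -- advance.
  χ-edge (edg 1F t) _ _ = let k , eq = χ-odd (t ⊕ (𝟙 ⊖ 𝕖)) in
    k , trans (eq _) (cong (edg 1F)
      (solve (((zer :+ (var₁ :+ (one :+ (:- ee)))) :+ (:- one)) :+ ee) var₁ t t t))
  χ-edge (edg 2F t) _ (inj₁ ())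
  χ-edge (edg 2F t) _ (inj₂ ())
  χ-edge (edg 3F t) _ (inj₁ ())
  χ-edge (edg 3F t) _ (inj₂ ())

  χ-face : ∀ F → rankOf F ≡ 3F → F ⋖ cel 0F 𝟘 → ∃[ k ] run (replicate k χ) (fac 0F 𝟘 𝟘) ≡ F
  χ-face (fac 0F b c) _ (inj₁ refl) = let k , eq = χ-even c in
    k , trans (eq _) (cong (fac 0F 𝟘) (solve (zer :+ var₁) var₁ c c c))
  -- On the odd wall `χ` multiplies the position by 1 + h, which is its own inverse.
  χ-face (fac 3F b c) _ (inj₁ refl) = let k , eq = χ-odd (c ⊕ h· c) in
    k , trans (eq _) (cong₂ (fac 3F) (solve (zer :+ (:h zer)) zer c c c)
      (solve ((zer :+ (var₁ :+ (:h var₁))) :+ (:h (zer :+ (var₁ :+ (:h var₁))))) var₁ c c c))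
  χ-face (fac 0F b c) _ (inj₂ ())
  χ-face (fac 1F b c) _ (inj₂ ())
  χ-face (fac 2F b c) _ (inj₂ ())
  χ-face (fac 3F b c) _ (inj₂ ())

  χ-fixes : ∀ k → run (replicate k χ) (vtx 0F) ≡ vtx 0F × run (replicate k χ) (cel 0F 𝟘) ≡ cel 0F 𝟘
  χ-fixes zero    = refl , refl
  χ-fixes (suc k) = proj₁ (χ-fixes k) , trans
    (cong (run (replicate k χ)) (from-just (runsTo? (χ ∷ []) (cel 0F zer) (cel 0F zer)) 𝟘 𝟘 𝟘)) (proj₂ (χ-fixes k))

  υ-fixes : ∀ k → run (replicate k υ) (vtx 0F) ≡ vtx 0F × run (replicate k υ) (edg 0F 𝟘) ≡ edg 0F 𝟘
  υ-fixes zero    = refl , refl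
  υ-fixes (suc k) = proj₁ (υ-fixes k) , trans
    (cong (run (replicate k υ)) (from-just (runsTo? (υ ∷ []) (edg 0F zer) (edg 0F zer)) 𝟘 𝟘 𝟘)) (proj₂ (υ-fixes k))

  α-fixes : ∀ k → run (replicate k α) (fac 0F 𝟘 𝟘) ≡ fac 0F 𝟘 𝟘 × run (replicate k α) (cel 0F 𝟘) ≡ cel 0F 𝟘
  α-fixes zero    = refl , refl
  α-fixes (suc k) =
    trans (cong (run (replicate k α))
        (from-just (runsTo? (α ∷ []) (fac 0F zer zer) (fac 0F zer zer)) 𝟘 𝟘 𝟘)) (proj₁ (α-fixes k)) ,
    trans (cong (run (replicate k α)) (from-just (runsTo? (α ∷ []) (cel 0F zer) (cel 0F zer)) 𝟘 𝟘 𝟘))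
        (proj₂ (α-fixes k))

  α-vertex : ∀ i → ∃[ k ] run (replicate k α) (vtx 0F) ≡ vtx i
  α-vertex 0F = 0 , refl
  α-vertex 1F = 1 , refl
  α-vertex 2F = 2 , refl
  α-vertex 3F = 3 , refl

  rank-vtx : ∀ (F : Face Z) → rankOf F ≡ 1F → ∃[ i ] F ≡ vtx i
  rank-vtx (vtx i) _ = i , refl

  rank-cel : ∀ (F : Face Z) → rankOf F ≡ 4F → ∃[ ρ ] ∃[ s ] F ≡ cel ρ s
  rank-cel (cel ρ s) _ = ρ , s , refl

  pullback : ∀ gs {F G} → run gs F ≡ G → F ≡ run (inverse gs) G
  pullback gs {F} eq = trans (sym (run-inverseˡ gs F)) (cong (run (inverse gs)) eq)

  ▸-inverse : ∀ gs Φ → (Φ ▸ inverse gs) ▸ gs P.≈ Φ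
  ▸-inverse gs Φ i = run-inverseʳ gs (P.face Φ i)

  -- After pulling back by `gs` the flags share the base vertex and base edge. Each `υ` is a pair of
  -- flips at ranks 3 and 4; enough of them match the facets, and then at most the 2-face differs.
  -- The other two polygons work in the same way.
  polygon-υ : ∀ {J} gs {Ψ} → J 3F → J 4F → let Φ = Φ₀ ▸ gs in
    P.face Φ 1F ≡ P.face Ψ 1F → P.face Φ 2F ≡ P.face Ψ 2F → Reach J Φ Ψ
  polygon-υ gs {Ψ} q₃ q₄ eq₁ eq₂ = transport gs
      (iterate υ (walk-υ q₃ q₄) k ⨟ flip₃ {Φ = Φ₀ ▸ replicate k υ} {Ψ ▸ inverse gs} q₃
        ( trans (proj₁ (υ-fixes k)) (pullback gs eq₁)
        , trans (proj₂ (υ-fixes k)) (pullback gs eq₂)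
        , trans (proj₂ reached) (sym eq) ))
    ⨟ done {Φ = (Ψ ▸ inverse gs) ▸ gs} {Ψ} (▸-inverse gs Ψ)
    where
    facet = rank-cel _ (P.rank-face (Ψ ▸ inverse gs) 4F)
    eq = proj₂ (proj₂ facet)
    reached = υ-facet (proj₁ facet) (proj₁ (proj₂ facet))
    k = proj₁ reached

  polygon-χ : ∀ {J} gs {Ψ} → J 2F → J 3F → let Φ = Φ₀ ▸ gs in
    P.face Φ 1F ≡ P.face Ψ 1F → P.face Φ 4F ≡ P.face Ψ 4F → Reach J Φ Ψ
  polygon-χ gs {Ψ} q₂ q₃ eq₁ eq₄ = transport gs
      (iterate χ (walk-χ q₂ q₃) k ⨟ flip₃ {Φ = Φ₀ ▸ replicate k χ} {Ψ ▸ inverse gs} q₃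
        ( trans (proj₁ (χ-fixes k)) (pullback gs eq₁)
        , proj₂ reached
        , trans (proj₂ (χ-fixes k)) (pullback gs eq₄) ))
    ⨟ done {Φ = (Ψ ▸ inverse gs) ▸ gs} {Ψ} (▸-inverse gs Ψ)
    where
    Ψ′ = Ψ ▸ inverse gs
    reached = χ-edge (P.face Ψ′ 2F) (P.rank-face Ψ′ 2F)
      (subst (_⋖ P.face Ψ′ 2F) (sym (pullback gs eq₁)) (flag-⋖ Ψ′ {1F} {2F} (s≤s (s≤s z≤n))))
    k = proj₁ reached

  polygon-α : ∀ {J} gs {Ψ} → J 1F → J 2F → let Φ = Φ₀ ▸ gs in
    P.face Φ 3F ≡ P.face Ψ 3F → P.face Φ 4F ≡ P.face Ψ 4F → Reach J Φ Ψ
  polygon-α gs {Ψ} q₁ q₂ eq₃ eq₄ = transport gs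
      (iterate α (walk-α q₁ q₂) k ⨟ flip₂ {Φ = Φ₀ ▸ replicate k α} {Ψ ▸ inverse gs} q₂
        ( trans (proj₂ reached) (sym (proj₂ vertex))
        , trans (proj₁ (α-fixes k)) (pullback gs eq₃)
        , trans (proj₂ (α-fixes k)) (pullback gs eq₄) ))
    ⨟ done {Φ = (Ψ ▸ inverse gs) ▸ gs} {Ψ} (▸-inverse gs Ψ)
    where
    vertex = rank-vtx _ (P.rank-face (Ψ ▸ inverse gs) 1F)
    reached = α-vertex (proj₁ vertex)
    k = proj₁ reached

  -- The shape is kept because it must later be read as a word in the generators of `Λ₃`; an
  -- arbitrary list may contain the auxiliary translations.
  data Rotation : List (Step Z) → Set where
    rotation : ∀ i k l → Rotation (replicate i α ++ replicate k χ ++ replicate l υ)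

  -- Going back from `Ψ`, a power of `υ` normalises the facet, a power of `χ` the 2-face and a power
  -- of `α` the vertex, each fixing what is already normalised. Two edges remain, which accounts for
  -- the two base flags.
  transitive : ∀ Ψ → ∃[ gs ] (Rotation gs × (Φ₀ ▸ gs P.≈ Ψ ⊎ Φ₁ ▸ gs P.≈ Ψ))
  transitive Ψ = decide (edge (P.face Ψ₃ 2F) (P.rank-face Ψ₃ 2F)
      (subst (_⋖ P.face Ψ₃ 2F) (sym V₃) (flag-⋖ Ψ₃ {1F} {2F} (s≤s (s≤s z≤n))))
      (subst (P.face Ψ₃ 2F ⋖_) (sym F₃) (flag-⋖ Ψ₃ {2F} {3F} (s≤s (s≤s (s≤s z≤n))))))
    where
    facet = rank-cel _ (P.rank-face Ψ 4F)
    υl = υ-facet (proj₁ facet) (proj₁ (proj₂ facet))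
    ls = replicate (proj₁ υl) υ
    Ψ₁ = Ψ ▸ inverse ls
    C₁ : cel 0F 𝟘 ≡ P.face Ψ₁ 4F
    C₁ = pullback ls (trans (proj₂ υl) (sym (proj₂ (proj₂ facet))))
    χk = χ-face (P.face Ψ₁ 3F) (P.rank-face Ψ₁ 3F)
        (subst (P.face Ψ₁ 3F ⋖_) (sym C₁) (flag-⋖ Ψ₁ {3F} {4F} (s≤s (s≤s (s≤s (s≤s z≤n))))))
    ks = replicate (proj₁ χk) χ
    Ψ₂ = Ψ₁ ▸ inverse ks
    C₂ : cel 0F 𝟘 ≡ P.face Ψ₂ 4F
    C₂ = pullback ks (trans (proj₂ (χ-fixes (proj₁ χk))) C₁)
    F₂ : fac 0F 𝟘 𝟘 ≡ P.face Ψ₂ 3F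
    F₂ = pullback ks (proj₂ χk)
    vi = rank-vtx _ (P.rank-face Ψ₂ 1F)
    αi = α-vertex (proj₁ vi)
    is = replicate (proj₁ αi) α
    Ψ₃ = Ψ₂ ▸ inverse is
    C₃ : cel 0F 𝟘 ≡ P.face Ψ₃ 4F
    C₃ = pullback is (trans (proj₂ (α-fixes (proj₁ αi))) C₂)
    F₃ : fac 0F 𝟘 𝟘 ≡ P.face Ψ₃ 3F
    F₃ = pullback is (trans (proj₁ (α-fixes (proj₁ αi))) F₂)
    V₃ : vtx 0F ≡ P.face Ψ₃ 1F
    V₃ = pullback is (trans (proj₂ αi) (sym (proj₂ vi)))
    gs = is ++ ks ++ ls
    lift : ∀ Φ → Φ P.≈ Ψ₃ → Φ ▸ gs P.≈ Ψ
    lift Φ e i = begin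
      run gs (P.face Φ i)                   ≡⟨ cong (run gs) (e i) ⟩
      run gs (P.face Ψ₃ i)                  ≡⟨ run-++ is (ks ++ ls) _ ⟩
      run (ks ++ ls) (run is (P.face Ψ₃ i)) ≡⟨ cong (run (ks ++ ls)) (▸-inverse is Ψ₂ i) ⟩
      run (ks ++ ls) (P.face Ψ₂ i)          ≡⟨ run-++ ks ls _ ⟩
      run ls (run ks (P.face Ψ₂ i))         ≡⟨ cong (run ls) (▸-inverse ks Ψ₁ i) ⟩
      run ls (P.face Ψ₁ i)                  ≡⟨ ▸-inverse ls Ψ i ⟩
      P.face Ψ i                             ∎
      where open ≡-Reasoning
    agrees : ∀ (B : Chain) → Chain.at B 1F ≡ vtx 0F → Chain.at B 3F ≡ fac 0F 𝟘 𝟘 → Chain.at B 4F ≡ cel 0F 𝟘 →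
      Chain.at B 2F ≡ P.face Ψ₃ 2F → flag B P.≈ Ψ₃
    agrees B v f c e 2F = e
    agrees B v f c e 0F = off₂ {flag B} {Ψ₃} (trans v V₃ , trans f F₃ , trans c C₃) 0F (λ ())
    agrees B v f c e 1F = trans v V₃
    agrees B v f c e 3F = trans f F₃
    agrees B v f c e 4F = trans c C₃
    agrees B v f c e 5F = off₂ {flag B} {Ψ₃} (trans v V₃ , trans f F₃ , trans c C₃) 5F (λ ())
    edge : ∀ E → rankOf E ≡ 2F → vtx 0F ⋖ E → E ⋖ fac 0F 𝟘 𝟘 → edg 0F 𝟘 ≡ E ⊎ edg 1F 𝟘 ≡ E
    edge (edg 0F t) _ _ p = inj₁ (trans (Chain.E⋖F base) (sym p))
    edge (edg 1F t) _ _ p = inj₂ (trans (Chain.E⋖F base₁) (sym p))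
    edge (edg 2F t) _ (inj₁ ()) _
    edge (edg 2F t) _ (inj₂ ()) _
    edge (edg 3F t) _ (inj₁ ()) _
    edge (edg 3F t) _ (inj₂ ()) _
    turn : Rotation gs
    turn = rotation (proj₁ αi) (proj₁ χk) (proj₁ υl)
    decide : edg 0F 𝟘 ≡ P.face Ψ₃ 2F ⊎ edg 1F 𝟘 ≡ P.face Ψ₃ 2F →
      ∃[ gs ] (Rotation gs × (Φ₀ ▸ gs P.≈ Ψ ⊎ Φ₁ ▸ gs P.≈ Ψ))
    decide (inj₁ e) = gs , turn , inj₁ (lift Φ₀ (agrees base refl refl refl e))
    decide (inj₂ e) = gs , turn , inj₂ (lift Φ₁ (agrees base₁ refl refl refl e))

  -- Around an edge, the orbit of `Φ₁` has to be left without touching vertex or edge, so the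
  -- obvious flip to `Φ₀` is forbidden. A flip of the facet serves instead.
  Φ₁-flips : Agree 1F 2F 3F Φ₁ (Φ₀ ▸ (υ⁻ ∷ χ⁻ ∷ []))
  Φ₁-flips = refl
    , sym (from-just (runsTo? (υ⁻ ∷ χ⁻ ∷ []) (edg 0F zer) (edg 1F zer)) 𝟘 𝟘 𝟘)
    , sym (from-just (runsTo? (υ⁻ ∷ χ⁻ ∷ []) (fac 0F zer zer) (fac 0F zer zer)) 𝟘 𝟘 𝟘)

  module _ {J : Fin 6 → Set} {Φ Ψ : P.Flag} where

    around-edge : J 3F → J 4F → P.face Φ 1F ≡ P.face Ψ 1F → P.face Φ 2F ≡ P.face Ψ 2F → Reach J Φ Ψ
    around-edge q₃ q₄ eq₁ eq₂ = decide (transitive Φ)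
      where
      decide : ∃[ gs ] (Rotation gs × (Φ₀ ▸ gs P.≈ Φ ⊎ Φ₁ ▸ gs P.≈ Φ)) → Reach J Φ Ψ
      decide (gs , _ , inj₁ e) = respˡ (≈-sym {Φ₀ ▸ gs} {Φ} e)
        (polygon-υ gs q₃ q₄ (trans (e 1F) eq₁) (trans (e 2F) eq₂))
      decide (gs , _ , inj₂ e) = respˡ (≈-sym {Φ₁ ▸ gs} {Φ} e)
        (transport gs (flip₄ {Φ = Φ₁} {Φ₀ ▸ (υ⁻ ∷ χ⁻ ∷ [])} q₄ Φ₁-flips)
         ⨟ respˡ {Φ′ = Φ₀ ▸ (υ⁻ ∷ χ⁻ ∷ gs)} (λ _ → refl)
           (polygon-υ (υ⁻ ∷ χ⁻ ∷ gs) q₃ q₄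
             (trans (sym (cong (run gs) (proj₁ Φ₁-flips))) (trans (e 1F) eq₁))
             (trans (sym (cong (run gs) (proj₁ (proj₂ Φ₁-flips)))) (trans (e 2F) eq₂))))

    around-middle : J 2F → J 3F → P.face Φ 1F ≡ P.face Ψ 1F → P.face Φ 4F ≡ P.face Ψ 4F → Reach J Φ Ψ
    around-middle q₂ q₃ eq₁ eq₄ = decide (transitive Φ)
      where
      decide : ∃[ gs ] (Rotation gs × (Φ₀ ▸ gs P.≈ Φ ⊎ Φ₁ ▸ gs P.≈ Φ)) → Reach J Φ Ψ
      decide (gs , _ , inj₁ e) = respˡ (≈-sym {Φ₀ ▸ gs} {Φ} e)
        (polygon-χ gs q₂ q₃ (trans (e 1F) eq₁) (trans (e 4F) eq₄))
      decide (gs , _ , inj₂ e) = respˡ (≈-sym {Φ₁ ▸ gs} {Φ} e)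
        (transport gs (flip₂ {Φ = Φ₁} {Φ₀} q₂ (refl , refl , refl))
         ⨟ polygon-χ gs q₂ q₃ (trans (e 1F) eq₁) (trans (e 4F) eq₄))

    around-face : J 1F → J 2F → P.face Φ 3F ≡ P.face Ψ 3F → P.face Φ 4F ≡ P.face Ψ 4F → Reach J Φ Ψ
    around-face q₁ q₂ eq₃ eq₄ = decide (transitive Φ)
      where
      decide : ∃[ gs ] (Rotation gs × (Φ₀ ▸ gs P.≈ Φ ⊎ Φ₁ ▸ gs P.≈ Φ)) → Reach J Φ Ψ
      decide (gs , _ , inj₁ e) = respˡ (≈-sym {Φ₀ ▸ gs} {Φ} e)
        (polygon-α gs q₁ q₂ (trans (e 3F) eq₃) (trans (e 4F) eq₄))
      decide (gs , _ , inj₂ e) = respˡ (≈-sym {Φ₁ ▸ gs} {Φ} e)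
        (transport gs (flip₂ {Φ = Φ₁} {Φ₀} q₂ (refl , refl , refl))
         ⨟ polygon-α gs q₁ q₂ (trans (e 3F) eq₃) (trans (e 4F) eq₄))

  faceBetween : ∀ E C → rankOf E ≡ 2F → rankOf C ≡ 4F → ∃[ F ] (rankOf F ≡ 3F × E ⋖ F × F ⋖ C)
  faceBetween (edg k t) (cel ρ s) _ _ = through ρ (wallKind ρ 0F) s k t , rank ρ ,
    edg-through ρ 0F s k t , through-wall ρ 0F s k t
    where
    rank : ∀ ρ → rankOf (through ρ (wallKind ρ 0F) s k t) ≡ 3F
    rank 0F = refl
    rank 1F = refl
    rank 2F = refl
    rank 3F = refl

  edgeBetween : ∀ V F → rankOf V ≡ 1F → rankOf F ≡ 3F → ∃[ E ] (rankOf E ≡ 2F × V ⋖ E × E ⋖ F)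
  edgeBetween (vtx i) F@(fac _ _ _) _ _ = sideOf i F , refl , inj₁ refl , refl

  module _ (Φ Ψ : P.Flag) where
    private
      Differ : Fin 6 → Set
      Differ i = P.face Φ i ≢ P.face Ψ i

      module L = Chain (chainOf Φ)
      module R = Chain (chainOf Ψ)

    -- If the edges or the 2-faces agree, the ranks on the two sides of the common face are adjusted
    -- separately. Otherwise facet and vertex are matched first, through a 2-face between the old
    -- edge and the new facet and an edge between the new vertex and the current 2-face; both exist
    -- by flatness. One polygon of ranks 2 and 3 finishes.
    connected : Reach Differ Φ Ψ
    connected with P.face Φ 2F ≟F P.face Ψ 2F | P.face Φ 3F ≟F P.face Ψ 3F
    ... | yes e₂ | d₃ = flip 1F {Φ} {X} (λ d → d) (off₁ {Φ} {X} (refl , refl , refl)) ⨟ second d₃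
      where
      X = flag (chain R.rank-V L.rank-E L.rank-F L.rank-C (subst (R.V ⋖_) (sym e₂) R.V⋖E) L.E⋖F L.F⋖C)
      second : Dec (P.face Φ 3F ≡ P.face Ψ 3F) → Reach Differ X Ψ
      second (yes e₃) = flip 4F {X} {Ψ} (λ d → d) (off₄ {X} {Ψ} (refl , e₂ , e₃))
      second (no d₃) with P.face Φ 4F ≟F P.face Ψ 4F
      ... | yes e₄ = flip 3F {X} {Ψ} (λ d → d) (off₃ {X} {Ψ} (refl , e₂ , e₄))
      ... | no  d₄ = around-edge {Φ = X} {Ψ} d₃ d₄ refl e₂
    ... | no d₂ | yes e₃ = flip 4F {Φ} {X} (λ d → d) (off₄ {Φ} {X} (refl , refl , refl)) ⨟ second
      where
      X = flag (chain L.rank-V L.rank-E L.rank-F R.rank-C L.V⋖E L.E⋖F (subst (_⋖ R.C) (sym e₃) R.F⋖C))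
      second : Reach Differ X Ψ
      second with P.face Φ 1F ≟F P.face Ψ 1F
      ... | yes e₁ = flip 2F {X} {Ψ} (λ d → d) (off₂ {X} {Ψ} (e₁ , e₃ , refl))
      ... | no  d₁ = around-face {Φ = X} {Ψ} d₁ d₂ e₃ refl
    ... | no d₂ | no d₃ = matchC (P.face Φ 4F ≟F P.face Ψ 4F)
      where
      matchV : ∀ {X} → P.face X 1F ≡ P.face Φ 1F → P.face X 4F ≡ P.face Ψ 4F → Reach Differ X Ψ
      matchV {X} v c with P.face Φ 1F ≟F P.face Ψ 1F
      ... | yes e₁ = around-middle {Φ = X} {Ψ} d₂ d₃ (trans v e₁) c
      ... | no  d₁ =
        let module X = Chain (chainOf X)
            E , rank-E , V⋖E , E⋖F = edgeBetween R.V X.F R.rank-V X.rank-F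
            Y = flag (chain R.rank-V rank-E X.rank-F X.rank-C V⋖E E⋖F X.F⋖C)
        in around-face {Φ = X} {Y} d₁ d₂ refl refl ⨟ around-middle {Φ = Y} {Ψ} d₂ d₃ refl c
      matchC : Dec (P.face Φ 4F ≡ P.face Ψ 4F) → Reach Differ Φ Ψ
      matchC (yes e₄) = matchV {Φ} refl e₄
      matchC (no d₄) =
        let F , rank-F , E⋖F , F⋖C = faceBetween L.E R.C L.rank-E R.rank-C
            Y = flag (chain L.rank-V L.rank-E rank-F R.rank-C L.V⋖E E⋖F F⋖C)
        in around-edge {Φ = Φ} {Y} d₃ d₄ refl refl ⨟ matchV {Y} refl refl

    toStar : ∀ {Χ} → (∀ i → P.face Φ i ≡ P.face Ψ i → P.face Χ i ≡ P.face Φ i) → Reach Differ Χ Ψ →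
      ∃[ Ω ] (Star (P.AdjacentAbove Φ Ψ) Χ Ω × Ω P.≈ Ψ)
    toStar {Χ} fixed (done e) = Χ , ε , e
    toStar {Χ} fixed (step {Χ = Χ′} {i = i} d (ne , eq) r) =
      let Ω , path , e = toStar {Χ′} fixed′ r in Ω , ((i , ne , eq) , fixed′) ◅ path , e
      where
      fixed′ : ∀ k → P.face Φ k ≡ P.face Ψ k → P.face Χ′ k ≡ P.face Φ k
      fixed′ k s with k Fin.≟ i
      ... | yes refl = contradiction s d
      ... | no k≢i   = trans (sym (eq k k≢i)) (fixed k s)

  polytope : Polytope 4
  polytope = record
    { rankedPoset           = poset
    ; least                 = bot
    ; least-minimum         = bot-≼
    ; greatest              = top
    ; greatest-maximum      = ≼-top
    ; maximalChainsAreFlags = maximalChainsAreFlags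
    ; diamond               = diamond
    ; stronglyFlagConnected = λ Φ Ψ → toStar Φ Ψ (λ _ _ → refl) (connected Φ Ψ)
    }

-- Polytopes and their flags in general

module PolytopeLemmas (Q : Polytope 4) where
  open Polytope Q
  private
    _⊙_ = _·_ Q
    infixl 7 _⊙_

  flag-< : ∀ Φ {i k} → i Fin.< k → face Φ i < face Φ k
  flag-< Φ i<k = face-mono Φ (ℕ.<⇒≤ i<k) , λ eq → ℕ.<-irrefl
    (cong toℕ (trans (sym (rank-face Φ _)) (trans (cong rank eq) (rank-face Φ _)))) i<k

  lowest : ∀ Φ Ψ → face Φ 0F ≡ face Ψ 0F
  lowest Φ Ψ = trans (sym (is-least Φ)) (is-least Ψ)
    where
    is-least : ∀ Φ → least ≡ face Φ 0F
    is-least Φ with least ≟ face Φ 0F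
      where open import Relation.Binary.Structures using (IsDecPartialOrder)
            open IsDecPartialOrder isDecPartialOrder using (_≟_)
    ... | yes eq = eq
    ... | no  ne = contradiction
      (subst (rank least Fin.<_) (rank-face Φ 0F) (rank-strictMono (least-minimum (face Φ 0F) , ne))) λ ()

  highest : ∀ Φ Ψ → face Φ 5F ≡ face Ψ 5F
  highest Φ Ψ = trans (is-greatest Φ) (sym (is-greatest Ψ))
    where
    is-greatest : ∀ Φ → face Φ 5F ≡ greatest
    is-greatest Φ with face Φ 5F ≟ greatest
      where open import Relation.Binary.Structures using (IsDecPartialOrder)
            open IsDecPartialOrder isDecPartialOrder using (_≟_)
    ... | yes eq = eq
    ... | no  ne = contradiction
      (subst (Fin._< rank greatest) (rank-face Φ 5F) (rank-strictMono (greatest-maximum (face Φ 5F) , ne)))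
      (ℕ.≤⇒≯ (ℕ.s≤s⁻¹ (Fin.toℕ<n (rank greatest))))

  third : ∀ {F G} → F < G → toℕ (rank G) ≡ 2 ℕ.+ toℕ (rank F) → ∀ {A B C} →
    (F < A × A < G) → (F < B × B < G) → (F < C × C < G) → A ≢ B → A ≢ C → B ≡ C
  third F<G r a b c A≢B A≢C with diamond F<G r
  ... | H₁ , H₂ , _ , _ , _ , only
    with only _ (proj₁ a) (proj₂ a) | only _ (proj₁ b) (proj₂ b) | only _ (proj₁ c) (proj₂ c)
  ... | inj₁ p | inj₁ q | _      = contradiction (trans p (sym q)) A≢B
  ... | inj₁ p | inj₂ q | inj₁ s = contradiction (trans p (sym s)) A≢C
  ... | inj₁ p | inj₂ q | inj₂ s = trans q (sym s)
  ... | inj₂ p | inj₂ q | _      = contradiction (trans p (sym q)) A≢B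
  ... | inj₂ p | inj₁ q | inj₂ s = contradiction (trans p (sym s)) A≢C
  ... | inj₂ p | inj₁ q | inj₁ s = trans q (sym s)

  adjacent-unique : ∀ i {Φ Ψ Ψ′} → Adjacent i Φ Ψ → Adjacent i Φ Ψ′ → Ψ ≈ Ψ′
  adjacent-unique i {Φ} {Ψ} {Ψ′} (ne , eq) (ne′ , eq′) k with k Fin.≟ i
  ... | no k≢i = trans (sym (eq k k≢i)) (eq′ k k≢i)
  ... | yes refl = at i eq eq′ ne ne′
    where
    between : ∀ (lo i hi : Fin 6) → lo Fin.< i → i Fin.< hi → toℕ hi ≡ 2 ℕ.+ toℕ lo →
      (∀ k → k ≢ i → face Φ k ≡ face Ψ k) → (∀ k → k ≢ i → face Φ k ≡ face Ψ′ k) →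
      face Φ i ≢ face Ψ i → face Φ i ≢ face Ψ′ i → face Ψ i ≡ face Ψ′ i
    between lo i hi lo<i i<hi two eq eq′ = third (flag-< Φ (ℕ.<-trans lo<i i<hi))
        (trans (cong toℕ (rank-face Φ hi)) (trans two (cong ((2 ℕ.+_) ∘ toℕ) (sym (rank-face Φ lo)))))
        (flag-< Φ lo<i , flag-< Φ i<hi) (around Ψ eq) (around Ψ′ eq′)
      where
      around : ∀ Ψ → (∀ k → k ≢ i → face Φ k ≡ face Ψ k) → face Φ lo < face Ψ i × face Ψ i < face Φ hi
      around Ψ eq = subst (_< face Ψ i) (sym (eq lo (Fin.<⇒≢ lo<i))) (flag-< Ψ lo<i)
        , subst (face Ψ i <_) (sym (eq hi (Fin.<⇒≢ i<hi ∘ sym))) (flag-< Ψ i<hi)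
    at : ∀ i → (∀ k → k ≢ i → face Φ k ≡ face Ψ k) → (∀ k → k ≢ i → face Φ k ≡ face Ψ′ k) →
      face Φ i ≢ face Ψ i → face Φ i ≢ face Ψ′ i → face Ψ i ≡ face Ψ′ i
    at 0F _ _ ne _ = contradiction (lowest Φ Ψ) ne
    at 1F = between 0F 1F 2F (s≤s z≤n) (s≤s (s≤s z≤n)) refl
    at 2F = between 1F 2F 3F (s≤s (s≤s z≤n)) (s≤s (s≤s (s≤s z≤n))) refl
    at 3F = between 2F 3F 4F (s≤s (s≤s (s≤s z≤n))) (s≤s (s≤s (s≤s (s≤s z≤n)))) refl
    at 4F = between 3F 4F 5F (s≤s (s≤s (s≤s (s≤s z≤n)))) (s≤s (s≤s (s≤s (s≤s (s≤s z≤n))))) refl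
    at 5F _ _ ne _ = contradiction (highest Φ Ψ) ne

  adjacent-sym : ∀ {i Φ Ψ} → Adjacent i Φ Ψ → Adjacent i Ψ Φ
  adjacent-sym (ne , eq) = ne ∘ sym , λ k k≢i → sym (eq k k≢i)

  adjacent-resp : ∀ {i Φ Φ′ Ψ Ψ′} → Φ ≈ Φ′ → Ψ ≈ Ψ′ → Adjacent i Φ Ψ → Adjacent i Φ′ Ψ′
  adjacent-resp {i} e e′ (ne , eq) =
    (λ p → ne (trans (e i) (trans p (sym (e′ i))))) ,
    λ k k≢i → trans (sym (e k)) (trans (eq k k≢i) (e′ k))

  open Isomorphism

  auto-adjacent : ∀ (g : Isomorphism Q Q) {i Φ Ψ} → Adjacent i Φ Ψ → Adjacent i (Φ ⊙ g) (Ψ ⊙ g)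
  auto-adjacent g (ne , eq) = (λ p → ne (IsOrderIsomorphism.injective (isOrderIsomorphism g) p)) ,
    λ k k≢i → cong (to g) (eq k k≢i)

  private module Aut = Group (Aut Q)

  undo : ∀ (g : Isomorphism Q Q) Φ → (Φ ⊙ g) ⊙ (g Aut.⁻¹) ≈ Φ
  undo g Φ i = Aut.inverseʳ g (face Φ i)

  redo : ∀ (g : Isomorphism Q Q) Φ → (Φ ⊙ (g Aut.⁻¹)) ⊙ g ≈ Φ
  redo g Φ i = Aut.inverseˡ g (face Φ i)

  orbit-sym : ∀ {Φ Ψ} → SameOrbit Q Φ Ψ → SameOrbit Q Ψ Φ
  orbit-sym {Φ} {Ψ} (g , e) = g Aut.⁻¹ , λ i → trans (cong (to (g Aut.⁻¹)) (sym (e i))) (undo g Φ i)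

  orbit-trans : ∀ {Φ Χ Ψ} → SameOrbit Q Φ Χ → SameOrbit Q Χ Ψ → SameOrbit Q Φ Ψ
  orbit-trans (g , e) (g′ , e′) = g Aut.∙ g′ , λ i → trans (cong (to g′) (e i)) (e′ i)

  -- Every flip changes the orbit and there are only two orbits, so a second flip returns to the
  -- first one.
  two-flips : IsChiral Q → ∀ {i k Φ Χ Ψ} → Adjacent i Φ Χ → Adjacent k Χ Ψ → SameOrbit Q Φ Ψ
  two-flips ((Φ₁ , Φ₂ , _ , cover) , distinct) {i} {k} {Φ} {Χ} {Ψ} a b =
    decide (cover Φ) (cover Χ) (cover Ψ)
    where
    Orbit : Flag → Set
    Orbit Ω = SameOrbit Q Φ₁ Ω ⊎ SameOrbit Q Φ₂ Ω
    same : ∀ {Θ Ω Ω′} → SameOrbit Q Θ Ω → SameOrbit Q Θ Ω′ → SameOrbit Q Ω Ω′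
    same {Θ} {Ω} {Ω′} p q = orbit-trans {Ω} {Θ} {Ω′} (orbit-sym {Θ} {Ω} p) q
    decide : Orbit Φ → Orbit Χ → Orbit Ψ → SameOrbit Q Φ Ψ
    decide (inj₁ p) (inj₁ q) _        = contradiction (same {Φ₁} {Φ} {Χ} p q) (distinct i {Φ} {Χ} a)
    decide (inj₁ p) (inj₂ q) (inj₁ r) = same {Φ₁} {Φ} {Ψ} p r
    decide (inj₁ p) (inj₂ q) (inj₂ r) = contradiction (same {Φ₂} {Χ} {Ψ} q r) (distinct k {Χ} {Ψ} b)
    decide (inj₂ p) (inj₂ q) _        = contradiction (same {Φ₂} {Φ} {Χ} p q) (distinct i {Φ} {Χ} a)
    decide (inj₂ p) (inj₁ q) (inj₂ r) = same {Φ₂} {Φ} {Ψ} p r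
    decide (inj₂ p) (inj₁ q) (inj₁ r) = contradiction (same {Φ₁} {Χ} {Ψ} q r) (distinct k {Χ} {Ψ} b)

-- A flag map preserving adjacency is determined by the image of one flag.
module Rigidity (P Q : Polytope 4) where
  private
    module P = Polytope P
    module Q = Polytope Q

  record FlagMap : Set where
    field
      on       : P.Flag → Q.Flag
      resp     : ∀ {Φ Ψ} → Φ P.≈ Ψ → on Φ Q.≈ on Ψ
      adjacent : ∀ {i Φ Ψ} → P.Adjacent i Φ Ψ → Q.Adjacent i (on Φ) (on Ψ)

  open FlagMap

  rigid : ∀ (f g : FlagMap) {Φ} → on f Φ Q.≈ on g Φ → ∀ Ψ → on f Ψ Q.≈ on g Ψ
  rigid f g {Φ} e Ψ = let Χ , path , Χ≈Ψ = P.stronglyFlagConnected Φ Ψ in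
    λ i → trans (sym (resp f {Χ} {Ψ} Χ≈Ψ i)) (trans (along path e i) (resp g {Χ} {Ψ} Χ≈Ψ i))
    where
    along : ∀ {Ω Χ} → Star (P.AdjacentAbove Φ Ψ) Ω Χ → on f Ω Q.≈ on g Ω → on f Χ Q.≈ on g Χ
    along ε e = e
    along (_◅_ {Ω} {Ω′} ((i , a) , _) path) e = along path
      (PolytopeLemmas.adjacent-unique Q i {on f Ω} {on f Ω′} {on g Ω′} (adjacent f {i} {Ω} {Ω′} a)
        (PolytopeLemmas.adjacent-resp Q {i} {on g Ω} {on f Ω} {on g Ω′} {on g Ω′} (λ k → sym (e k)) (λ _ → refl)
          (adjacent g {i} {Ω} {Ω′} a)))

-- Automorphisms and chirality

module Symmetry (j : ℕ) (ϵ : ℤ) (ϵ-unit : ϵ ≡ 1ℤ ⊎ ϵ ≡ -1ℤ) where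
  open Connectivity j ϵ ϵ-unit public
  private
    module P = Polytope polytope

  open PolytopeLemmas polytope
  open Isomorphism

  auto : List (Step Z) → Isomorphism polytope polytope
  auto gs = record
    { to = run gs
    ; isOrderIsomorphism = record
      { isOrderMonomorphism = record
        { isOrderHomomorphism = record { cong = cong (run gs) ; mono = run-≼ gs }
        ; injective = run-injective gs
        ; cancel = λ {F} {G} le → subst₂ _≼_ (run-inverseˡ gs F) (run-inverseˡ gs G) (run-≼ (inverse gs) le)
        }
      ; surjective = λ F → run (inverse gs) F , λ { refl → run-inverseʳ gs F }
      }
    ; rank-preserving = run-rank gs
    }

  -- Rigidity compares maps on flags; this transfers its conclusions to single faces.
  flagThrough : ∀ F → ∃₂ λ Φ i → P.face Φ i ≡ F
  flagThrough bot = Φ₀ , 0F , refl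
  flagThrough top = Φ₀ , 5F , refl
  flagThrough (vtx i) =
    flag (chain {vtx i} {sideOf i (fac 0F 𝟘 𝟘)} {fac 0F 𝟘 𝟘} {cel 0F 𝟘} refl refl refl refl (inj₁ refl)
        refl (inj₁ refl)) , 1F , refl
  flagThrough (edg k t) =
    flag (chain {vtx k} {edg k t} {through 0F 0F 𝟘 k t} {cel 0F 𝟘} refl refl refl refl (inj₁ refl)
        (edg-through 0F 0F 𝟘 k t) (inj₁ refl)) , 2F , refl
  flagThrough (fac κ b c) =
    flag (chain {vtx 0F} {sideOf 0F (fac κ b c)} {fac κ b c} {evenWall (fac κ b c)} refl refl refl refl
        (inj₁ refl) refl (inj₁ refl)) , 3F , refl
  flagThrough (cel ρ s) =
    let F , rank-F , p , q = faceBetween (edg 0F 𝟘) (cel ρ s) refl refl in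
    flag (chain {vtx 0F} {edg 0F 𝟘} {F} {cel ρ s} refl refl rank-F refl (inj₁ refl) p q) , 4F , refl

  flagMap : Isomorphism polytope polytope → Rigidity.FlagMap polytope polytope
  flagMap g = record
    { on       = λ Φ → _·_ polytope Φ g
    ; resp     = λ e i → cong (to g) (e i)
    ; adjacent = λ {i} {Φ} {Ψ} → auto-adjacent g {i} {Φ} {Ψ}
    }

  equal-on-flag : ∀ (g g′ : Isomorphism polytope polytope) Φ →
    (∀ i → to g (P.face Φ i) ≡ to g′ (P.face Φ i)) → ∀ F → to g F ≡ to g′ F
  equal-on-flag g g′ Φ e F = let Ψ , i , eq = flagThrough F in
    trans (cong (to g) (sym eq))
        (trans (Rigidity.rigid polytope polytope (flagMap g) (flagMap g′) {Φ} e Ψ i) (cong (to g′) eq))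

  base⁰ : Chain
  base⁰ = chain {vtx 3F} {edg 0F 𝟘} {fac 0F 𝟘 𝟘} {cel 0F 𝟘} refl refl refl refl
    (inj₂ refl) (Chain.E⋖F base) (inj₁ refl)

  Φ⁰ : P.Flag
  Φ⁰ = flag base⁰

  fac-by-walls : ∀ {F} κ b c → rankOf F ≡ 3F → F ⋖ cel (evenClass κ) b → F ⋖ cel (oddClass κ) c → F ≡ fac κ b c
  fac-by-walls {fac κ′ b′ c′} κ b c _ p q = go p q
    where
    class-of : ∀ {ρ ρ′} {s s′ : Z} → cel ρ s ≡ cel ρ′ s′ → ρ ≡ ρ′
    class-of refl = refl
    val-of : ∀ {ρ ρ′} {s s′ : Z} → cel ρ s ≡ cel ρ′ s′ → s ≡ s′
    val-of refl = refl
    even≢odd : ∀ κ κ′ → evenClass κ ≢ oddClass κ′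
    even≢odd = toWitness {a? = Fin.all? λ κ → Fin.all? λ κ′ → ¬? (evenClass κ Fin.≟ oddClass κ′)} _
    classes : ∀ κ κ′ → evenClass κ ≢ evenClass κ′ ⊎ oddClass κ ≢ oddClass κ′ ⊎ κ ≡ κ′
    classes = toWitness {a? = Fin.all? λ κ → Fin.all? λ κ′ → ¬? (evenClass κ Fin.≟ evenClass κ′) ⊎-dec
      (¬? (oddClass κ Fin.≟ oddClass κ′) ⊎-dec κ Fin.≟ κ′)} _
    kinds : evenClass κ ≡ evenClass κ′ → oddClass κ ≡ oddClass κ′ → κ ≡ κ′
    kinds e o with classes κ κ′
    ... | inj₁ ne        = contradiction e ne
    ... | inj₂ (inj₁ ne) = contradiction o ne
    ... | inj₂ (inj₂ eq) = eq
    go : fac κ′ b′ c′ ⋖ cel (evenClass κ) b → fac κ′ b′ c′ ⋖ cel (oddClass κ) c → fac κ′ b′ c′ ≡ fac κ b c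
    go (inj₂ p) _        = contradiction (class-of p) (even≢odd κ κ′)
    go (inj₁ _) (inj₁ q) = contradiction (sym (class-of q)) (even≢odd κ′ κ)
    go (inj₁ p) (inj₂ q) with kinds (class-of p) (class-of q)
    ... | refl = cong₂ (fac κ) (sym (val-of p)) (sym (val-of q))

  -- An automorphism taking Φ₀ to Φ⁰ fixes all facets around the base edge, that is,
  -- all facets, and hence all 2-faces.
  module Reflection (g : Isomorphism polytope polytope)
    (e : ∀ i → to g (P.face Φ₀ i) ≡ P.face Φ⁰ i) where

    mirrored : ∀ Χ → P.face Χ 2F ≡ edg 0F 𝟘 → P.Flag
    mirrored Χ eq = flag (chain {vtx 3F} {edg 0F 𝟘} refl refl (Chain.rank-F (chainOf Χ)) (Chain.rank-C (chainOf Χ))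
      (inj₂ refl) (subst (_⋖ P.face Χ 3F) eq (Chain.E⋖F (chainOf Χ))) (Chain.F⋖C (chainOf Χ)))

    Mirrors : P.Flag → Set
    Mirrors Χ = P.face Χ 1F ≡ vtx 0F × Σ (P.face Χ 2F ≡ edg 0F 𝟘) λ eq →
      ∀ i → to g (P.face Χ i) ≡ P.face (mirrored Χ eq) i

    -- Both `g` and the replacement of vertex 0 by vertex 3 commute with a flip that keeps vertex 0
    -- and the base edge, and adjacent flags are unique.
    spread : ∀ i {Χ Χ′} → P.Adjacent i Χ Χ′ → P.face Χ′ 1F ≡ vtx 0F → P.face Χ′ 2F ≡ edg 0F 𝟘 →
      Mirrors Χ → Mirrors Χ′
    spread i {Χ} {Χ′} a@(ne , same) v′ e′ (v , e , m) = v′ , e′ ,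
      adjacent-unique i {_·_ polytope Χ g} {_·_ polytope Χ′ g} {mirrored Χ′ e′} (auto-adjacent g {i} {Χ} {Χ′} a)
        (adjacent-resp {i} {mirrored Χ e} {_·_ polytope Χ g} {mirrored Χ′ e′} {mirrored Χ′ e′}
          (λ k → sym (m k)) (λ _ → refl) (moved i ne , others))
      where
      moved : ∀ i → P.face Χ i ≢ P.face Χ′ i → P.face (mirrored Χ e) i ≢ P.face (mirrored Χ′ e′) i
      moved 0F ne _ = ne (lowest Χ Χ′)
      moved 1F ne _ = ne (trans v (sym v′))
      moved 2F ne _ = ne (trans e (sym e′))
      moved 3F ne   = ne
      moved 4F ne   = ne
      moved 5F ne _ = ne (highest Χ Χ′)
      others : ∀ k → k ≢ i → P.face (mirrored Χ e) k ≡ P.face (mirrored Χ′ e′) k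
      others 0F _ = refl
      others 1F _ = refl
      others 2F _ = refl
      others 3F   = same 3F
      others 4F   = same 4F
      others 5F _ = refl

    everywhere : ∀ Ψ → P.face Ψ 1F ≡ vtx 0F → P.face Ψ 2F ≡ edg 0F 𝟘 → to g (P.face Ψ 4F) ≡ P.face Ψ 4F
    everywhere Ψ v e′ = let Χ , path , Χ≈Ψ = P.stronglyFlagConnected Φ₀ Ψ in
      subst (λ C → to g C ≡ C) (Χ≈Ψ 4F) (proj₂ (proj₂ (along path start)) 4F)
      where
      start : Mirrors Φ₀
      start = refl , refl , λ { 0F → e 0F ; 1F → e 1F ; 2F → e 2F ; 3F → e 3F ; 4F → e 4F ; 5F → e 5F }
      along : ∀ {Ω Χ} → Star (P.AdjacentAbove Φ₀ Ψ) Ω Χ → Mirrors Ω → Mirrors Χ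
      along ε m = m
      along (_◅_ {Ω} {Ω′} ((i , a) , fixed) path) m =
        along path (spread i {Ω} {Ω′} a (fixed 1F (sym v)) (fixed 2F (sym e′)) m)

    fixes-facet : ∀ ρ s → to g (cel ρ s) ≡ cel ρ s
    fixes-facet ρ s = let F , rank-F , p , q = faceBetween (edg 0F 𝟘) (cel ρ s) refl refl in
      everywhere (flag (chain {vtx 0F} {edg 0F 𝟘} {F} {cel ρ s} refl refl rank-F refl (inj₁ refl) p q)) refl refl

    to-⋖ : ∀ {F G} → F ⋖ G → to g F ⋖ to g G
    to-⋖ {F} {G} p = strict (mono g {F} {G} (inj₂ p))
      where
      strict : to g F ≼ to g G → to g F ⋖ to g G
      strict (inj₂ q)  = q
      strict (inj₁ eq) = contradiction
        (trans (sym (rank-preserving g F)) (trans (cong rankOf eq) (rank-preserving g G)))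
        (λ r → ℕ.<-irrefl (cong toℕ r) (⋖-rank F G p))

    fixes-fac : ∀ κ b c → to g (fac κ b c) ≡ fac κ b c
    fixes-fac κ b c = fac-by-walls κ b c (rank-preserving g (fac κ b c))
      (subst (to g (fac κ b c) ⋖_) (fixes-facet (evenClass κ) b)
          (to-⋖ {fac κ b c} {cel (evenClass κ) b} (inj₁ refl)))
      (subst (to g (fac κ b c) ⋖_) (fixes-facet (oddClass κ) c)
          (to-⋖ {fac κ b c} {cel (oddClass κ) c} (inj₂ refl)))

    impossible : ⊥
    impossible = on-edge (to g (edg 1F 𝟘)) (rank-preserving g (edg 1F 𝟘)) refl
      (subst (_⋖ to g (edg 1F 𝟘)) (e 1F) (to-⋖ {vtx 0F} {edg 1F 𝟘} (inj₂ refl)))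
      (subst (to g (edg 1F 𝟘) ⋖_) (fixes-fac 0F 𝟘 𝟘) (to-⋖ {edg 1F 𝟘} {fac 0F 𝟘 𝟘} (Chain.E⋖F base₁)))
      -- The 2-face of kind 1 at (e - 1, 0) also has `edg 1F 𝟘` as a side. Both 2-faces are fixed,
      -- so they would share the image edge as well; in class 3, however, their sides are at 0 and
      -- at h.
      (subst (to g (edg 1F 𝟘) ⋖_) (fixes-fac 1F (𝕖 ⊖ 𝟙) 𝟘) (to-⋖ {edg 1F 𝟘} {fac 1F (𝕖 ⊖ 𝟙) 𝟘}
        (cong (edg 1F) (solve zer (Formulas.side exprOps 1F 1F (ee :+ (:- one)) zer) 𝟘 𝟘 𝟘))))
      where
      on-edge : ∀ E → rankOf E ≡ 2F → to g (edg 1F 𝟘) ≡ E → vtx 3F ⋖ E → E ⋖ fac 0F 𝟘 𝟘 → E ⋖ fac 1F (𝕖 ⊖ 𝟙) 𝟘 → ⊥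
      on-edge (edg 0F t) _ eq _ p _ = contradiction (IsOrderIsomorphism.injective (isOrderIsomorphism g)
        (trans eq (trans p (trans (sym (Chain.E⋖F base)) (sym (e 2F)))))) λ ()
      on-edge (edg 1F t) _ _ (inj₁ ())
      on-edge (edg 1F t) _ _ (inj₂ ())
      on-edge (edg 2F t) _ _ (inj₁ ())
      on-edge (edg 2F t) _ _ (inj₂ ())
      on-edge (edg 3F t) _ _ _ p q = h𝟙≢𝟘 (trans
        (solve (:h one) (Formulas.side exprOps 1F 3F (ee :+ (:- one)) zer) 𝟘 𝟘 𝟘)
        (trans (val-of (trans (sym q) p)) (solve (zer :+ (:- zer)) zer 𝟘 𝟘 𝟘)))
        where
        val-of : ∀ {k} {t u : Z} → edg k t ≡ edg k u → t ≡ u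
        val-of refl = refl

  ¬Φ₀~Φ⁰ : ¬ SameOrbit polytope Φ₀ Φ⁰
  ¬Φ₀~Φ⁰ (g , e) = Reflection.impossible g e

  Φ₁▸α⁻≈Φ⁰ : Φ₁ ▸ (α⁻ ∷ []) P.≈ Φ⁰
  Φ₁▸α⁻≈Φ⁰ 0F = refl
  Φ₁▸α⁻≈Φ⁰ 1F = refl
  Φ₁▸α⁻≈Φ⁰ 2F = from-just (runsTo? (α⁻ ∷ []) (edg 1F zer) (edg 0F zer)) 𝟘 𝟘 𝟘
  Φ₁▸α⁻≈Φ⁰ 3F = from-just (runsTo? (α⁻ ∷ []) (fac 0F zer zer) (fac 0F zer zer)) 𝟘 𝟘 𝟘
  Φ₁▸α⁻≈Φ⁰ 4F = from-just (runsTo? (α⁻ ∷ []) (cel 0F zer) (cel 0F zer)) 𝟘 𝟘 𝟘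
  Φ₁▸α⁻≈Φ⁰ 5F = refl

  ¬Φ₀~Φ₁ : ¬ SameOrbit polytope Φ₀ Φ₁
  ¬Φ₀~Φ₁ p = ¬Φ₀~Φ⁰ (orbit-trans {Φ₀} {Φ₁} {Φ⁰} p (auto (α⁻ ∷ []) , Φ₁▸α⁻≈Φ⁰))

  -- Adjacent flags are unique, so one such word for each proper rank shows that every flip of `Φ₀`
  -- ends in the orbit of `Φ₁`; the inverse words show the converse.
  Crosses : Fin 6 → Set
  Crosses i = ∃[ gs ] P.Adjacent i Φ₀ (Φ₁ ▸ gs)

  crosses : ∀ i {Φ Ψ} → P.Adjacent i Φ Ψ → Crosses i
  crosses 0F {Φ} {Ψ} (ne , _) = contradiction (lowest Φ Ψ) ne
  crosses 5F {Φ} {Ψ} (ne , _) = contradiction (highest Φ Ψ) ne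
  crosses 1F _ = α⁻ ∷ [] , (λ ()) , off₁ {Φ₀} {Φ₁ ▸ (α⁻ ∷ [])}
    (sym (Φ₁▸α⁻≈Φ⁰ 2F) , sym (Φ₁▸α⁻≈Φ⁰ 3F) , sym (Φ₁▸α⁻≈Φ⁰ 4F))
  crosses 2F _ = [] , (λ ()) , off₂ {Φ₀} {Φ₁ ▸ []} (refl , refl , refl)
  crosses 3F _ = χ ∷ [] ,
    (λ eq → kinds (trans eq (from-just (runsTo? (χ ∷ []) (fac 0F zer zer) (fac 3F zer zer)) 𝟘 𝟘 𝟘))) ,
    off₃ {Φ₀} {Φ₁ ▸ (χ ∷ [])}
      ( refl
      , sym (from-just (runsTo? (χ ∷ []) (edg 1F zer) (edg 0F zer)) 𝟘 𝟘 𝟘)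
      , sym (from-just (runsTo? (χ ∷ []) (cel 0F zer) (cel 0F zer)) 𝟘 𝟘 𝟘) )
    where
    kinds : fac 0F 𝟘 𝟘 ≢ fac 3F 𝟘 𝟘
    kinds ()
  crosses 4F _ = χ ∷ υ ∷ [] , (λ ()) , off₄ {Φ₀} {Φ₁ ▸ (χ ∷ υ ∷ [])}
    ( refl
    , sym (from-just (runsTo? (χ ∷ υ ∷ []) (edg 1F zer) (edg 0F zer)) 𝟘 𝟘 𝟘)
    , sym (from-just (runsTo? (χ ∷ υ ∷ []) (fac 0F zer zer) (fac 0F zer zer)) 𝟘 𝟘 𝟘) )

  neighbour₀ : ∀ i {Ψ} → P.Adjacent i Φ₀ Ψ → SameOrbit polytope Φ₁ Ψ
  neighbour₀ i {Ψ} a = let gs , a′ = crosses i {Φ₀} {Ψ} a in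
    auto gs , adjacent-unique i {Φ₀} {Φ₁ ▸ gs} {Ψ} a′ a

  neighbour₁ : ∀ i {Ψ} → P.Adjacent i Φ₁ Ψ → SameOrbit polytope Φ₀ Ψ
  neighbour₁ i {Ψ} a = let gs , a′ = crosses i {Φ₁} {Ψ} a in
    auto (inverse gs) , adjacent-unique i {Φ₁} {Φ₀ ▸ inverse gs} {Ψ}
      (adjacent-sym {i} {Φ₀ ▸ inverse gs} {Φ₁}
          (adjacent-resp {i} {Φ₀ ▸ inverse gs} {Φ₀ ▸ inverse gs} {(Φ₁ ▸ gs) ▸ inverse gs} {Φ₁}
        (λ _ → refl) (λ k → run-inverseˡ gs (P.face Φ₁ k))
        (auto-adjacent (auto (inverse gs)) {i} {Φ₀} {Φ₁ ▸ gs} a′))) a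

  cover : ∀ Ψ → SameOrbit polytope Φ₀ Ψ ⊎ SameOrbit polytope Φ₁ Ψ
  cover Ψ = decide (transitive Ψ)
    where
    decide : ∃[ gs ] (Rotation gs × (Φ₀ ▸ gs P.≈ Ψ ⊎ Φ₁ ▸ gs P.≈ Ψ)) →
      SameOrbit polytope Φ₀ Ψ ⊎ SameOrbit polytope Φ₁ Ψ
    decide (gs , _ , inj₁ e) = inj₁ (auto gs , e)
    decide (gs , _ , inj₂ e) = inj₂ (auto gs , e)

  chiral : IsChiral polytope
  chiral = (Φ₀ , Φ₁ , ¬Φ₀~Φ₁ , cover) , λ i {Φ} {Ψ} → distinct i {Φ} {Ψ}
    where
    across : ∀ {Θ Θ′} i → (∀ {Ψ} → P.Adjacent i Θ Ψ → SameOrbit polytope Θ′ Ψ) →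
      ∀ {Φ Ψ} → P.Adjacent i Φ Ψ → SameOrbit polytope Θ Φ → SameOrbit polytope Θ′ Ψ
    across {Θ} {Θ′} i near {Φ} {Ψ} a (g , e) = orbit-trans {Θ′} {_·_ polytope Ψ g⁻¹} {Ψ}
      (near {_·_ polytope Ψ g⁻¹}
          (adjacent-resp {i} {_·_ polytope Φ g⁻¹} {Θ} {_·_ polytope Ψ g⁻¹} {_·_ polytope Ψ g⁻¹}
        (λ k → trans (cong (to g⁻¹) (sym (e k))) (undo g Θ k)) (λ _ → refl) (auto-adjacent g⁻¹ {i} {Φ} {Ψ} a)))
      (g , redo g Ψ)
      where g⁻¹ = Group._⁻¹ (Aut polytope) g
    absurd : ∀ {Ψ} → SameOrbit polytope Φ₀ Ψ → SameOrbit polytope Φ₁ Ψ → ⊥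
    absurd {Ψ} q r = ¬Φ₀~Φ₁ (orbit-trans {Φ₀} {Ψ} {Φ₁} q (orbit-sym {Φ₁} {Ψ} r))
    distinct : ∀ i {Φ Ψ} → P.Adjacent i Φ Ψ → ¬ SameOrbit polytope Φ Ψ
    distinct i {Φ} {Ψ} a p = decide (cover Φ)
      where
      decide : SameOrbit polytope Φ₀ Φ ⊎ SameOrbit polytope Φ₁ Φ → ⊥
      decide (inj₁ q) = absurd {Ψ} (orbit-trans {Φ₀} {Φ} {Ψ} q p)
        (across {Φ₀} {Φ₁} i (λ {Ω} → neighbour₀ i {Ω}) {Φ} {Ψ} a q)
      decide (inj₂ q) = absurd {Ψ} (across {Φ₁} {Φ₀} i (λ {Ω} → neighbour₁ i {Ω}) {Φ} {Ψ} a q)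
        (orbit-trans {Φ₁} {Φ} {Ψ} q p)

-- Coverings onto chiral polytopes

module Quotients (j : ℕ) (ϵ : ℤ) (ϵ-unit : ϵ ≡ 1ℤ ⊎ ϵ ≡ -1ℤ) where
  open Symmetry j ϵ ϵ-unit public
  private
    module P = Polytope polytope

  Between : P.Flag → P.Flag → Fin 6 → Fin 6 → Set
  Between Φ Ψ i k = ∃[ Χ ] (P.Adjacent i Φ Χ × P.Adjacent k Χ Ψ)

  flips-α : Between Φ₀ (Φ₀ ▸ (α ∷ [])) 2F 1F
  flips-α = Φ₁ , ((λ ()) , off₂ {Φ₀} {Φ₁} (refl , refl , refl)) , (λ ()) , off₁ {Φ₁} {Φ₀ ▸ (α ∷ [])}
    ( sym (from-just (runsTo? (α ∷ []) (edg 0F zer) (edg 1F zer)) 𝟘 𝟘 𝟘)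
    , sym (from-just (runsTo? (α ∷ []) (fac 0F zer zer) (fac 0F zer zer)) 𝟘 𝟘 𝟘)
    , sym (from-just (runsTo? (α ∷ []) (cel 0F zer) (cel 0F zer)) 𝟘 𝟘 𝟘) )

  flips-χ : Between Φ₀ (Φ₀ ▸ (χ ∷ [])) 3F 2F
  flips-χ = flag base₂ , ((λ ()) , off₃ {Φ₀} {flag base₂} (refl , refl , refl)) , (λ ()) , off₂
      {flag base₂} {Φ₀ ▸ (χ ∷ [])}
    ( refl
    , sym (from-just (runsTo? (χ ∷ []) (fac 0F zer zer) (fac 3F zer zer)) 𝟘 𝟘 𝟘)
    , sym (from-just (runsTo? (χ ∷ []) (cel 0F zer) (cel 0F zer)) 𝟘 𝟘 𝟘) )

  flips-υ : Between Φ₀ (Φ₀ ▸ (υ ∷ [])) 4F 3F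
  flips-υ = flag base₃ , ((λ ()) , off₄ {Φ₀} {flag base₃} (refl , refl , refl)) , (λ ()) , off₃
      {flag base₃} {Φ₀ ▸ (υ ∷ [])}
    ( refl
    , sym (from-just (runsTo? (υ ∷ []) (edg 0F zer) (edg 0F zer)) 𝟘 𝟘 𝟘)
    , refl )

  -- Two parameters occur here, while `agree?` reserves a single variable for parameters; hence the
  -- direct case analysis.
  χ²-⊕ : ∀ a b F → move (χ² b) (move (χ² a) F) ≡ move (χ² (a ⊕ b)) F
  χ²-⊕ a b bot = refl
  χ²-⊕ a b top = refl
  χ²-⊕ a b (vtx i) = refl
  χ²-⊕ a b (edg i t) = cong (edg i) (solve ((var₁ :+ var₂) :+ var₃) (var₁ :+ (var₂ :+ var₃)) t a b)
  χ²-⊕ a b (fac κ s t) = cong₂ (fac κ) (on (evenClass κ) s) (on (oddClass κ) t)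
    where
    on : ∀ ρ s → Action.cellVal (action (χ² b)) ρ (Action.cellVal (action (χ² a)) ρ s) ≡ Action.cellVal
        (action (χ² (a ⊕ b))) ρ s
    on 0F s = refl
    on 1F s = solve ((var₁ :+ var₂) :+ var₃) (var₁ :+ (var₂ :+ var₃)) s a b
    on 2F s = solve ((var₁ :+ (:h var₂)) :+ (:h var₃)) (var₁ :+ (:h (var₂ :+ var₃))) s a b
    on 3F s = solve ((var₁ :+ (var₂ :+ (:h var₂))) :+ (var₃ :+ (:h var₃)))
      (var₁ :+ ((var₂ :+ var₃) :+ (:h (var₂ :+ var₃)))) s a b
  χ²-⊕ a b (cel 0F s) = refl
  χ²-⊕ a b (cel 1F s) = cong (cel 1F) (solve ((var₁ :+ var₂) :+ var₃) (var₁ :+ (var₂ :+ var₃)) s a b)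
  χ²-⊕ a b (cel 2F s) = cong (cel 2F)
      (solve ((var₁ :+ (:h var₂)) :+ (:h var₃)) (var₁ :+ (:h (var₂ :+ var₃))) s a b)
  χ²-⊕ a b (cel 3F s) = cong (cel 3F) (solve ((var₁ :+ (var₂ :+ (:h var₂))) :+ (var₃ :+ (:h var₃)))
      (var₁ :+ ((var₂ :+ var₃) :+ (:h (var₂ :+ var₃)))) s a b)

  υ⁴-⊕ : ∀ a b F → move (υ⁴ b) (move (υ⁴ a) F) ≡ move (υ⁴ (a ⊕ b)) F
  υ⁴-⊕ a b bot = refl
  υ⁴-⊕ a b top = refl
  υ⁴-⊕ a b (vtx i) = refl
  υ⁴-⊕ a b (edg i t) = refl
  υ⁴-⊕ a b (fac κ s t) = cong₂ (fac κ) (⊕-assoc s a b) (⊕-assoc t a b)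
    where
    ⊕-assoc : ∀ s a b → (s ⊕ a) ⊕ b ≡ s ⊕ (a ⊕ b)
    ⊕-assoc s a b = solve ((var₁ :+ var₂) :+ var₃) (var₁ :+ (var₂ :+ var₃)) s a b
  υ⁴-⊕ a b (cel ρ s) = cong (cel ρ) (solve ((var₁ :+ var₂) :+ var₃) (var₁ :+ (var₂ :+ var₃)) s a b)

  •-h : ∀ k u → k • (h· u) ≡ h· (k • u)
  •-h zero    u = solve zer (:h zer) u u u
  •-h (suc k) u = trans (cong (h· u ⊕_) (•-h k u)) (solve ((:h var₁) :+ (:h var₂)) (:h (var₁ :+ var₂)) u (k • u) u)

  -- The square of `α` translates the facets of classes 2 and 3 by h, and its conjugate by the
  -- square of `υ` those of classes 0 and 1. On vertices and edges the two factors cancel.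
  z∈⟨α²⟩ : ∀ F → run (α ∷ α ∷ υ⁻ ∷ υ⁻ ∷ α ∷ α ∷ υ ∷ υ ∷ []) F ≡ move (υ⁴ (h· 𝟙)) F
  z∈⟨α²⟩ = from-just (agree? (α ∷ α ∷ υ⁻ ∷ υ⁻ ∷ α ∷ α ∷ υ ∷ υ ∷ []) (υ⁴ (:h one) ∷ []))
    _ _ (λ _ _ _ → refl) (λ _ _ _ → refl) 𝟘

  -- Conjugation by `χ` turns the translated classes 2 and 3 into 2 and 1. In the product class 2 is
  -- translated by 2 h = 0, and the odd classes remain.
  χ²h∈⟨α²⟩ : ∀ F → run (α ∷ α ∷ χ⁻ ∷ α ∷ α ∷ χ ∷ []) F ≡ move (χ² (h· 𝟙)) F
  χ²h∈⟨α²⟩ = from-just (agree? (α ∷ α ∷ χ⁻ ∷ α ∷ α ∷ χ ∷ []) (χ² (:h one) ∷ []))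
    _ _ (λ _ _ _ → refl) (λ _ _ _ → refl) 𝟘

  -- `χ² (h· 𝟙)` translates the odd classes by h and its conjugate by `υ` the even ones, while the
  -- edges are translated twice, by 2 h = 0.
  z∈⟨χ²h⟩ : ∀ F → run (χ² (h· 𝟙) ∷ υ⁻ ∷ χ² (h· 𝟙) ∷ υ ∷ []) F ≡ move (υ⁴ (h· 𝟙)) F
  z∈⟨χ²h⟩ = from-just (agree? (χ² (:h one) ∷ υ⁻ ∷ χ² (:h one) ∷ υ ∷ []) (υ⁴ (:h one) ∷ []))
    _ _ (λ _ _ _ → refl) (λ _ _ _ → refl) 𝟘

  module Defect {A : Set} (O : Ops A) where
    open Ops O

    -- The shift by which the reflection below corrects the odd wall of a 2-face.
    defect : Fin 4 → A → A → A
    defect 0F b d = d - b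
    defect 1F b d = d - b
    defect 2F b d = (d - b) + 1#
    defect 3F b d = d - b

  open Defect ops public
  private
    module Dᴱ = Defect exprOps
    module Fᴱ = Formulas exprOps

  -- A reflection of the quotient by the central element υ⁴ (h· 𝟙); it fixes the
  -- facets, and in the polytope itself it respects the incidence of 2-faces and
  -- facets only up to that element.
  reflect : Face Z → Face Z
  reflect bot         = bot
  reflect top         = top
  reflect (vtx i)     = vtx (mirror₃ i)
  reflect (edg i t)   = edg (neg₄ i) (tw t)
  reflect (fac κ b d) = move (χ² (h· defect κ b d)) (fac κ b d)
  reflect (cel ρ s)   = cel ρ s

  reflect-rank : ∀ F → rankOf (reflect F) ≡ rankOf F
  reflect-rank bot         = refl
  reflect-rank top         = refl
  reflect-rank (vtx _)     = refl
  reflect-rank (edg _ _)   = refl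
  reflect-rank (fac _ _ _) = refl
  reflect-rank (cel _ _)   = refl

  reflect-fac : ∀ κ b d → reflect (fac κ b d) ≡ fac κ b (d ⊕ h· defect κ b d)
  reflect-fac 0F b d = refl
  reflect-fac 1F b d = cong (λ b′ → fac 1F b′ (d ⊕ h· (d ⊖ b)))
      (solve (var₁ :+ (:h (:h (var₂ :+ (:- var₁))))) var₁ b d d)
  reflect-fac 2F b d = cong₂ (fac 2F) (solve (var₁ :+ (:h (:h ((var₂ :+ (:- var₁)) :+ one)))) var₁ b d d)
    (solve (var₂ :+ ((:h ((var₂ :+ (:- var₁)) :+ one)) :+ (:h (:h ((var₂ :+ (:- var₁)) :+ one)))))
      (var₂ :+ (:h ((var₂ :+ (:- var₁)) :+ one))) b d d)
  reflect-fac 3F b d = cong (fac 3F b)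
    (solve (var₂ :+ ((:h (var₂ :+ (:- var₁))) :+ (:h (:h (var₂ :+ (:- var₁))))))
      (var₂ :+ (:h (var₂ :+ (:- var₁)))) b d d)

  reflect-involutive : ∀ F → reflect (reflect F) ≡ F
  reflect-involutive bot        = refl
  reflect-involutive top        = refl
  reflect-involutive (vtx 0F)   = refl
  reflect-involutive (vtx 1F)   = refl
  reflect-involutive (vtx 2F)   = refl
  reflect-involutive (vtx 3F)   = refl
  reflect-involutive (edg 0F t) = cong (edg 0F)
      (solve ((var₁ :+ (:h var₁)) :+ (:h (var₁ :+ (:h var₁)))) var₁ t t t)
  reflect-involutive (edg 1F t) = cong (edg 1F)
      (solve ((var₁ :+ (:h var₁)) :+ (:h (var₁ :+ (:h var₁)))) var₁ t t t)
  reflect-involutive (edg 2F t) = cong (edg 2F)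
      (solve ((var₁ :+ (:h var₁)) :+ (:h (var₁ :+ (:h var₁)))) var₁ t t t)
  reflect-involutive (edg 3F t) = cong (edg 3F)
      (solve ((var₁ :+ (:h var₁)) :+ (:h (var₁ :+ (:h var₁)))) var₁ t t t)
  reflect-involutive (fac κ b d) = trans (cong reflect (reflect-fac κ b d))
    (trans (reflect-fac κ b (d ⊕ h· defect κ b d)) (cong (fac κ b) (twice κ)))
    where
    twice : ∀ κ → (d ⊕ h· defect κ b d) ⊕ h· defect κ b (d ⊕ h· defect κ b d) ≡ d
    twice 0F = solve ((var₂ :+ (:h (var₂ :+ (:- var₁)))) :+
        (:h ((var₂ :+ (:h (var₂ :+ (:- var₁)))) :+ (:- var₁)))) var₂ b d d
    twice 1F = solve ((var₂ :+ (:h (var₂ :+ (:- var₁)))) :+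
        (:h ((var₂ :+ (:h (var₂ :+ (:- var₁)))) :+ (:- var₁)))) var₂ b d d
    twice 2F = solve ((var₂ :+ (:h ((var₂ :+ (:- var₁)) :+ one)))
      :+ (:h (((var₂ :+ (:h ((var₂ :+ (:- var₁)) :+ one))) :+ (:- var₁)) :+ one))) var₂ b d d
    twice 3F = solve ((var₂ :+ (:h (var₂ :+ (:- var₁)))) :+
        (:h ((var₂ :+ (:h (var₂ :+ (:- var₁)))) :+ (:- var₁)))) var₂ b d d
  reflect-involutive (cel ρ s)  = refl

  -- This equation dictates the defect. For kind 0 the difference d - b must become (1 + h)(d - b);
  -- for kinds 1 and 3 the exchange of edge classes 1 and 3 supplies the twisted constants; for kind
  -- 2 the summand 1 makes up for the constant -1 in `shift₂`.
  reflect-side : ∀ k κ b d → side κ (neg₄ k) b (d ⊕ h· defect κ b d) ≡ tw (side κ k b d)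
  reflect-side k κ b d = trans
      (sym (trans (side-eval b d d κ (neg₄ k) var₁ (var₂ :+ (:h Dᴱ.defect κ var₁ var₂)))
          (cong (λ w → side κ (neg₄ k) b (d ⊕ h· w)) (defect-eval κ))))
      (trans (from-just symbolic κ k b d d) (cong tw (side-eval b d d κ k var₁ var₂)))
    where
    defect-eval : ∀ κ → ⟦ Dᴱ.defect κ var₁ var₂ ⟧ b d d ≡ defect κ b d
    defect-eval 0F = refl
    defect-eval 1F = refl
    defect-eval 2F = refl
    defect-eval 3F = refl
    symbolic : Maybe (∀ κ k x y z → ⟦ Fᴱ.side κ (neg₄ k) var₁ (var₂ :+ (:h Dᴱ.defect κ var₁ var₂)) ⟧ x y z
      ≡ ⟦ Fᴱ.tw (Fᴱ.side κ k var₁ var₂) ⟧ x y z)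
    symbolic = forAll λ κ → forAll λ k →
      solve? (Fᴱ.side κ (neg₄ k) var₁ (var₂ :+ (:h Dᴱ.defect κ var₁ var₂))) (Fᴱ.tw (Fᴱ.side κ k var₁ var₂))

  offset₁ offset₂ : Fin 4 → Expr
  offset₁ 0F = zer
  offset₁ 1F = (:- one) :+ (:- ee)
  offset₁ 2F = :h one
  offset₁ 3F = (:- one) :+ ee
  offset₂ 0F = zer
  offset₂ 1F = :h one
  offset₂ 2F = zer
  offset₂ 3F = :h one

  side-offset₁ : ∀ κ b d → side κ 1F b d ⊖ side κ 0F b d ≡ ⟦ offset₁ κ ⟧ 𝟘 𝟘 𝟘
  side-offset₁ 0F b d = solve (Fᴱ.side 0F 1F var₁ var₂ :+ (:- Fᴱ.side 0F 0F var₁ var₂)) (offset₁ 0F) b d d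
  side-offset₁ 1F b d = solve (Fᴱ.side 1F 1F var₁ var₂ :+ (:- Fᴱ.side 1F 0F var₁ var₂)) (offset₁ 1F) b d d
  side-offset₁ 2F b d = solve (Fᴱ.side 2F 1F var₁ var₂ :+ (:- Fᴱ.side 2F 0F var₁ var₂)) (offset₁ 2F) b d d
  side-offset₁ 3F b d = solve (Fᴱ.side 3F 1F var₁ var₂ :+ (:- Fᴱ.side 3F 0F var₁ var₂)) (offset₁ 3F) b d d

  side-offset₂ : ∀ κ b d → side κ 2F b d ⊖ side κ 0F b d ≡ ⟦ offset₂ κ ⟧ 𝟘 𝟘 𝟘
  side-offset₂ 0F b d = solve (Fᴱ.side 0F 2F var₁ var₂ :+ (:- Fᴱ.side 0F 0F var₁ var₂)) (offset₂ 0F) b d d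
  side-offset₂ 1F b d = solve (Fᴱ.side 1F 2F var₁ var₂ :+ (:- Fᴱ.side 1F 0F var₁ var₂)) (offset₂ 1F) b d d
  side-offset₂ 2F b d = solve (Fᴱ.side 2F 2F var₁ var₂ :+ (:- Fᴱ.side 2F 0F var₁ var₂)) (offset₂ 2F) b d d
  side-offset₂ 3F b d = solve (Fᴱ.side 3F 2F var₁ var₂ :+ (:- Fᴱ.side 3F 0F var₁ var₂)) (offset₂ 3F) b d d

  -- `offset₂` is 0 or h according to the parity of the kind, and within one parity the values of
  -- `offset₁` differ by h = 2 e. So h ≠ 0 separates all four kinds.
  offsets-determine-kind : ∀ κ κ′ → ⟦ offset₁ κ ⟧ 𝟘 𝟘 𝟘 ≡ ⟦ offset₁ κ′ ⟧ 𝟘 𝟘 𝟘 →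
    ⟦ offset₂ κ ⟧ 𝟘 𝟘 𝟘 ≡ ⟦ offset₂ κ′ ⟧ 𝟘 𝟘 𝟘 → κ ≡ κ′
  offsets-determine-kind 0F 0F _ _ = refl
  offsets-determine-kind 1F 1F _ _ = refl
  offsets-determine-kind 2F 2F _ _ = refl
  offsets-determine-kind 3F 3F _ _ = refl
  offsets-determine-kind 0F 1F _ q = contradiction (sym q) h𝟙≢𝟘
  offsets-determine-kind 0F 3F _ q = contradiction (sym q) h𝟙≢𝟘
  offsets-determine-kind 2F 1F _ q = contradiction (sym q) h𝟙≢𝟘
  offsets-determine-kind 2F 3F _ q = contradiction (sym q) h𝟙≢𝟘
  offsets-determine-kind 1F 0F _ q = contradiction q h𝟙≢𝟘
  offsets-determine-kind 1F 2F _ q = contradiction q h𝟙≢𝟘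
  offsets-determine-kind 3F 0F _ q = contradiction q h𝟙≢𝟘
  offsets-determine-kind 3F 2F _ q = contradiction q h𝟙≢𝟘
  offsets-determine-kind 0F 2F p _ = contradiction (sym p) h𝟙≢𝟘
  offsets-determine-kind 2F 0F p _ = contradiction p h𝟙≢𝟘
  offsets-determine-kind 1F 3F p _ = contradiction
      (trans (solve (:h one) ((offset₁ 3F) :+ (:- (offset₁ 1F))) 𝟘 𝟘 𝟘)
    (trans (cong (⟦ offset₁ 3F ⟧ 𝟘 𝟘 𝟘 ⊖_) p) (solve (var₁ :+ (:- var₁)) zer (⟦ offset₁ 3F ⟧ 𝟘 𝟘 𝟘) 𝟘 𝟘))) h𝟙≢𝟘
  offsets-determine-kind 3F 1F p _ = sym (offsets-determine-kind 1F 3F (sym p) refl)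

  -- The reflection depends on a 2-face only through its kind and d - b. This makes it well defined
  -- on a quotient that identifies 2-faces without identifying edges.
  sides-determine : ∀ κ b d κ′ b′ d′ → (∀ k → side κ k b d ≡ side κ′ k b′ d′) →
    Σ (κ ≡ κ′) λ _ → d ⊖ b ≡ d′ ⊖ b′
  sides-determine κ b d κ′ b′ d′ eq = κ≡κ′ , trans (difference κ b d)
      (trans (cong₂ (λ κ t → gap κ 0F t) κ≡κ′ (eq 0F)) (sym (difference κ′ b′ d′)))
    where
    κ≡κ′ : κ ≡ κ′
    κ≡κ′ = offsets-determine-kind κ κ′
      (trans (sym (side-offset₁ κ b d)) (trans (cong₂ _⊖_ (eq 1F) (eq 0F)) (side-offset₁ κ′ b′ d′)))
      (trans (sym (side-offset₂ κ b d)) (trans (cong₂ _⊖_ (eq 2F) (eq 0F)) (side-offset₂ κ′ b′ d′)))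
    difference : ∀ κ b d → d ⊖ b ≡ gap κ 0F (side κ 0F b d)
    difference κ b d = let g = gap κ 0F (side κ 0F b d) in
      trans (cong (_⊖ b) (sym (gap-side κ 0F b d))) (solve ((var₁ :+ var₂) :+ (:- var₁)) var₂ b g g)

  defect-cong : ∀ κ {b d b′ d′} → d ⊖ b ≡ d′ ⊖ b′ → defect κ b d ≡ defect κ b′ d′
  defect-cong 0F eq = eq
  defect-cong 1F eq = eq
  defect-cong 2F eq = cong (_⊕ 𝟙) eq
  defect-cong 3F eq = eq

  -- The kernel of a covering onto a chiral polytope

  module Kernel (Q : Polytope 4) (chiralQ : IsChiral Q) (cov : Covering polytope Q) where
    private
      module Q = Polytope Q
      module L = PolytopeLemmas Q
      module Au = Group (Aut Q)
    open Covering cov using (rank-preserving; adjacency-preserving) renaming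
            (to to c; mono to c-mono; surjective to c-surjective)
    open Isomorphism using (to)

    cᶠ : P.Flag → Q.Flag
    cᶠ = mapFlag polytope Q c c-mono rank-preserving

    _~_ : Face Z → Face Z → Set
    F ~ G = c F ≡ c G

    infix 4 _~_

    record Lift (gs : List (Step Z)) : Set where
      field
        lifted   : Isomorphism Q Q
        commutes : ∀ F → to lifted (c F) ≡ c (run gs F)

    open Lift


    down : Isomorphism Q Q → Rigidity.FlagMap polytope Q
    down g = record
      { on       = λ Ψ → _·_ Q (cᶠ Ψ) g
      ; resp     = λ e i → cong (λ F → to g (c F)) (e i)
      ; adjacent = λ {i} {Φ} {Ψ} a → L.auto-adjacent g {i} {cᶠ Φ} {cᶠ Ψ} (adjacency-preserving i {Φ} {Ψ} a)
      }

    after : List (Step Z) → Rigidity.FlagMap polytope Q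
    after gs = record
      { on       = λ Ψ → cᶠ (Ψ ▸ gs)
      ; resp     = λ e i → cong (λ F → c (run gs F)) (e i)
      ; adjacent = λ {i} {Φ} {Ψ} a → adjacency-preserving i {Φ ▸ gs} {Ψ ▸ gs}
          (PolytopeLemmas.auto-adjacent polytope (auto gs) {i} {Φ} {Ψ} a)
      }

    commute : ∀ g gs → (∀ i → to g (c (P.face Φ₀ i)) ≡ c (run gs (P.face Φ₀ i))) →
      ∀ F → to g (c F) ≡ c (run gs F)
    commute g gs e F = let Ψ , i , eq = flagThrough F in
      subst (λ F → to g (c F) ≡ c (run gs F)) eq (Rigidity.rigid polytope Q (down g) (after gs) {Φ₀} e Ψ i)

    -- The image of the base flag moves by two flips, hence stays in its orbit because `Q` is
    -- chiral. The automorphism of `Q` obtained on this one flag commutes with the covering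
    -- everywhere, by rigidity.
    lift-flips : ∀ gs {i k} → Between Φ₀ (Φ₀ ▸ gs) i k → Lift gs
    lift-flips gs {i} {k} (Χ , a , b) =
      let g , e = L.two-flips chiralQ {i} {k} {cᶠ Φ₀} {cᶠ Χ} {cᶠ (Φ₀ ▸ gs)}
                    (adjacency-preserving i {Φ₀} {Χ} a) (adjacency-preserving k {Χ} {Φ₀ ▸ gs} b)
      in record { lifted = g ; commutes = commute g gs e }

    lift-++ : ∀ {gs hs} → Lift gs → Lift hs → Lift (gs ++ hs)
    lift-++ {gs} {hs} l m = record
      { lifted   = lifted l Au.∙ lifted m
      ; commutes = λ F → trans (cong (to (lifted m)) (commutes l F))
          (trans (commutes m (run gs F)) (cong c (sym (run-++ gs hs F))))
      }

    lift-cong : ∀ {gs hs} → (∀ F → run gs F ≡ run hs F) → Lift gs → Lift hs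
    lift-cong e l = record { lifted = lifted l ; commutes = λ F → trans (commutes l F) (cong c (e F)) }

    lift-[] : Lift []
    lift-[] = record { lifted = Au.ε ; commutes = λ _ → refl }

    lift-inverse : ∀ {gs} → Lift gs → Lift (inverse gs)
    lift-inverse {gs} l = record
      { lifted   = lifted l Au.⁻¹
      ; commutes = λ F → trans
          (cong (to (lifted l Au.⁻¹))
              (trans (cong c (sym (run-inverseʳ gs F))) (sym (commutes l (run (inverse gs) F)))))
          (Au.inverseʳ (lifted l) (c (run (inverse gs) F)))
      }

    lift-replicate : ∀ k {g} → Lift (g ∷ []) → Lift (replicate k g)
    lift-replicate zero    l = lift-[]
    lift-replicate (suc k) l = lift-++ l (lift-replicate k l)

    lift-step : ∀ g → Lift (g ∷ [])
    lift-step α  = lift-flips (α ∷ []) flips-α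
    lift-step χ  = lift-flips (χ ∷ []) flips-χ
    lift-step υ  = lift-flips (υ ∷ []) flips-υ
    lift-step α⁻ = lift-inverse (lift-step α)
    lift-step χ⁻ = lift-inverse (lift-step χ)
    lift-step υ⁻ = lift-inverse (lift-step υ)
    lift-step (χ² u) = lift-cong (proj₂ (χ-even u)) (lift-replicate (proj₁ (χ-even u)) (lift-step χ))
    lift-step (υ⁴ u) = lift-cong {replicate (toℕ u ℕ.* 4) υ} {υ⁴ u ∷ []}
      (λ F → trans (υ⁴-power (toℕ u) F) (cong (λ u → move (υ⁴ u) F) (multiple-of-𝟙 u)))
      (lift-replicate (toℕ u ℕ.* 4) (lift-step υ))

    lift : ∀ gs → Lift gs
    lift []       = lift-[]
    lift (g ∷ gs) = lift-++ (lift-step g) (lift gs)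

    ~-run : ∀ gs {F G} → F ~ G → run gs F ~ run gs G
    ~-run gs {F} {G} e = trans (sym (commutes (lift gs) F))
      (trans (cong (to (lifted (lift gs))) e) (commutes (lift gs) G))

    Trivial : List (Step Z) → Set
    Trivial gs = ∀ F → run gs F ~ F

    _≟Q_ : (F G : Q.Face) → Dec (F ≡ G)
    _≟Q_ = IsDecPartialOrder._≟_ Q.isDecPartialOrder

    -- Chirality of Q excludes that gs acts on the base flag of Q as a single flip.
    trivial : ∀ gs i → (∀ k → k ≢ i → run gs (P.face Φ₀ k) ~ P.face Φ₀ k) → Trivial gs
    trivial gs i same F = trans (sym (commutes (lift gs) F)) (commute (lifted (lift gs)) [] fixed F)
      where
      fixed : ∀ k → to (lifted (lift gs)) (c (P.face Φ₀ k)) ≡ c (P.face Φ₀ k)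
      fixed k = trans (commutes (lift gs) (P.face Φ₀ k))
          (settle k (k Fin.≟ i) (c (run gs (P.face Φ₀ i)) ≟Q c (P.face Φ₀ i)))
        where
        settle : ∀ k → Dec (k ≡ i) → Dec (run gs (P.face Φ₀ i) ~ P.face Φ₀ i) → run gs (P.face Φ₀ k) ~ P.face Φ₀ k
        settle k (no k≢i)   _       = same k k≢i
        settle k (yes refl) (yes e) = e
        settle k (yes refl) (no ne) = contradiction
          (lifted (lift gs) , λ k → commutes (lift gs) (P.face Φ₀ k))
          (proj₂ chiralQ i {cᶠ Φ₀} {cᶠ (Φ₀ ▸ gs)} ((λ e → ne (sym e)) , λ k k≢i → sym (same k k≢i)))

    trivial-++ : ∀ gs hs → Trivial gs → Trivial hs → Trivial (gs ++ hs)
    trivial-++ gs hs s t F = trans (cong c (run-++ gs hs F)) (trans (t (run gs F)) (s F))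

    trivial-conj : ∀ gs hs → Trivial gs → Trivial (inverse hs ++ gs ++ hs)
    trivial-conj gs hs s F = begin
      c (run (inverse hs ++ gs ++ hs) F)       ≡⟨ cong c (run-++ (inverse hs) (gs ++ hs) F) ⟩
      c (run (gs ++ hs) (run (inverse hs) F))  ≡⟨ cong c (run-++ gs hs _) ⟩
      c (run hs (run gs (run (inverse hs) F))) ≡⟨ ~-run hs (s (run (inverse hs) F)) ⟩
      c (run hs (run (inverse hs) F))          ≡⟨ cong c (run-inverseʳ hs F) ⟩
      c F                                        ∎
      where open ≡-Reasoning

    trivial-χ²• : ∀ k u → Trivial (χ² u ∷ []) → Trivial (χ² (k • u) ∷ [])
    trivial-χ²• zero    u s F = cong c (sym (χ²-power zero F))
    trivial-χ²• (suc k) u s F = trans (cong c (sym (χ²-⊕ u (k • u) F)))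
      (trans (trivial-χ²• k u s (move (χ² u) F)) (s F))

    trivial-υ⁴• : ∀ k u → Trivial (υ⁴ u ∷ []) → Trivial (υ⁴ (k • u) ∷ [])
    trivial-υ⁴• zero    u s F = cong c (sym (υ⁴-power zero F))
    trivial-υ⁴• (suc k) u s F = trans (cong c (sym (υ⁴-⊕ u (k • u) F)))
      (trans (trivial-υ⁴• k u s (move (υ⁴ u) F)) (s F))

    α²-trivial⇒z : Trivial (α ∷ α ∷ []) → Trivial (υ⁴ (h· 𝟙) ∷ [])
    α²-trivial⇒z s F = trans (cong c (sym (z∈⟨α²⟩ F)))
      (trivial-++ (α ∷ α ∷ []) (υ⁻ ∷ υ⁻ ∷ α ∷ α ∷ υ ∷ υ ∷ []) s (trivial-conj (α ∷ α ∷ []) (υ ∷ υ ∷ []) s) F)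

    α²-trivial⇒χ²h : Trivial (α ∷ α ∷ []) → Trivial (χ² (h· 𝟙) ∷ [])
    α²-trivial⇒χ²h s F = trans (cong c (sym (χ²h∈⟨α²⟩ F)))
      (trivial-++ (α ∷ α ∷ []) (χ⁻ ∷ α ∷ α ∷ χ ∷ []) s (trivial-conj (α ∷ α ∷ []) (χ ∷ []) s) F)

    χ²h-trivial⇒z : Trivial (χ² (h· 𝟙) ∷ []) → Trivial (υ⁴ (h· 𝟙) ∷ [])
    χ²h-trivial⇒z s F = trans (cong c (sym (z∈⟨χ²h⟩ F)))
      (trivial-++ (χ² (h· 𝟙) ∷ []) (υ⁻ ∷ χ² (h· 𝟙) ∷ υ ∷ []) s (trivial-conj (χ² (h· 𝟙) ∷ []) (υ ∷ []) s) F)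

    trivial-χ²-h : Trivial (χ² (h· 𝟙) ∷ []) → ∀ w → Trivial (χ² (h· w) ∷ [])
    trivial-χ²-h s w = subst (λ u → Trivial (χ² u ∷ [])) (trans (•-h (toℕ w) 𝟙) (cong h·_ (multiple-of-𝟙 w)))
      (trivial-χ²• (toℕ w) (h· 𝟙) s)

    trivial-υ⁴-h : Trivial (υ⁴ (h· 𝟙) ∷ []) → ∀ w → Trivial (υ⁴ (h· w) ∷ [])
    trivial-υ⁴-h s w = subst (λ u → Trivial (υ⁴ u ∷ [])) (trans (•-h (toℕ w) 𝟙) (cong h·_ (multiple-of-𝟙 w)))
      (trivial-υ⁴• (toℕ w) (h· 𝟙) s)

    distinct-at : ∀ {Φ Ψ} i → P.Adjacent i Φ Ψ → ¬ P.face Φ i ~ P.face Ψ i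
    distinct-at {Φ} {Ψ} i a = proj₁ (adjacency-preserving i {Φ} {Ψ} a)

    cel-on : ∀ k t → ∃₂ λ F C → rankOf F ≡ 3F × rankOf C ≡ 4F × edg k t ⋖ F × F ⋖ C
    cel-on k t = through 0F 0F 𝟘 k t , cel 0F 𝟘 , refl , refl , edg-through 0F 0F 𝟘 k t , inj₁ refl

    ends-distinct : ∀ k → ¬ vtx k ~ vtx (prv k)
    ends-distinct k =
      let F , C , rank-F , rank-C , p , q = cel-on k 𝟘
          Φ = flag (chain {vtx k} {edg k 𝟘} {F} {C} refl refl rank-F rank-C (inj₁ refl) p q)
          Ψ = flag (chain {vtx (prv k)} {edg k 𝟘} {F} {C} refl refl rank-F rank-C (inj₂ refl) p q)
      in distinct-at {Φ} {Ψ} 1F ((λ e → prv≢ k (vtx-injective (sym e))) , off₁ {Φ} {Ψ} (refl , refl , refl))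
      where
      vtx-injective : ∀ {i k} → vtx {Z} i ≡ vtx k → i ≡ k
      vtx-injective refl = refl

    sides-distinct : ∀ k κ b d → ¬ sideOf k (fac κ b d) ~ sideOf (nxt k) (fac κ b d)
    sides-distinct k κ b d =
      let F = fac κ b d
          Φ = flag (chain {vtx k} {sideOf k F} {F} {evenWall F} refl refl refl refl (inj₁ refl) refl (inj₁ refl))
          Ψ = flag (chain {vtx k} {sideOf (nxt k) F} {F} {evenWall F} refl refl refl refl
              (inj₂ (sym (prv-nxt k))) refl (inj₁ refl))
      in distinct-at {Φ} {Ψ} 2F ((λ e → nxt≢ k (edg-injective e)) , off₂ {Φ} {Ψ} (refl , refl , refl))
      where
      edg-injective : ∀ {i k} {t u : Z} → edg i t ≡ edg k u → i ≡ k
      edg-injective refl = refl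

    walls-distinct : ∀ κ b d → ¬ evenWall (fac κ b d) ~ oddWall (fac κ b d)
    walls-distinct κ b d =
      let F = fac κ b d
          Φ = flag (chain {vtx 0F} {sideOf 0F F} {F} {evenWall F} refl refl refl refl (inj₁ refl) refl (inj₁ refl))
          Ψ = flag (chain {vtx 0F} {sideOf 0F F} {F} {oddWall F} refl refl refl refl (inj₁ refl) refl (inj₂ refl))
      in distinct-at {Φ} {Ψ} 4F
              ((λ e → evenClass≢oddClass κ (cel-injective e)) , off₄ {Φ} {Ψ} (refl , refl , refl))
      where
      cel-injective : ∀ {i k} {t u : Z} → cel i t ≡ cel k u → i ≡ k
      cel-injective refl = refl

    c-rank : ∀ {F G r} → F ~ G → rankOf F ≡ r → rankOf G ≡ r
    c-rank {F} {G} e p = trans (sym (rank-preserving G))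
        (trans (cong Q.rank (sym e)) (trans (rank-preserving F) p))

    c-< : ∀ {F G} → F ⋖ G → c F Q.< c G
    c-< {F} {G} p = c-mono (inj₂ p) , λ e → ℕ.<-irrefl
      (cong toℕ (c-rank {G} {F} (sym e) refl)) (⋖-rank F G p)

    -- Coverings preserve adjacency, so the two faces of a diamond stay distinct in `Q`; the diamond
    -- condition of `Q` then leaves no third face. This is how incidences in `Q` are traced back.
    one-of : ∀ {A B C} → A Q.< B → toℕ (Q.rank B) ≡ 2 ℕ.+ toℕ (Q.rank A) →
      ∀ {H H′} → H ≢ H′ → A Q.< H → H Q.< B → A Q.< H′ → H′ Q.< B → A Q.< C → C Q.< B → C ≡ H ⊎ C ≡ H′
    one-of {A} {B} {C} A<B r {H} {H′} ne p q p′ q′ s t = decide (C ≟Q H)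
      where
      decide : Dec (C ≡ H) → C ≡ H ⊎ C ≡ H′
      decide (yes e)  = inj₁ e
      decide (no ne′) = inj₂ (L.third {A} {B} A<B r {H} {C} {H′} (p , q) (s , t) (p′ , q′) (λ e → ne′ (sym e)) ne)

    rank-gap : ∀ F G → toℕ (rankOf G) ≡ 2 ℕ.+ toℕ (rankOf F) → toℕ (Q.rank (c G)) ≡ 2 ℕ.+ toℕ (Q.rank (c F))
    rank-gap F G e = trans (cong toℕ (rank-preserving G))
        (trans e (cong (λ r → 2 ℕ.+ toℕ r) (sym (rank-preserving F))))

    lift-end : ∀ i k t → c (vtx i) Q.< c (edg k t) → vtx i ~ vtx k ⊎ vtx i ~ vtx (prv k)
    lift-end i k t p = one-of (c-< {bot} {edg k t} tt) (rank-gap bot (edg k t) refl) (ends-distinct k)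
      (c-< {bot} {vtx k} tt) (c-< {vtx k} {edg k t} (inj₁ refl))
      (c-< {bot} {vtx (prv k)} tt) (c-< {vtx (prv k)} {edg k t} (inj₂ refl))
      (c-< {bot} {vtx i} tt) p

    lift-side : ∀ k t κ b d → c (edg k t) Q.< c (fac κ b d) →
      edg k t ~ sideOf k (fac κ b d) ⊎ edg k t ~ sideOf (nxt k) (fac κ b d)
    lift-side k t κ b d p = let F = fac κ b d in
      one-of (c-< {vtx k} {F} tt) (rank-gap (vtx k) F refl) (sides-distinct k κ b d)
        (c-< {vtx k} {sideOf k F} (inj₁ refl)) (c-< {sideOf k F} {F} refl)
        (c-< {vtx k} {sideOf (nxt k) F} (inj₂ (sym (prv-nxt k)))) (c-< {sideOf (nxt k) F} {F} refl)
        (c-< {vtx k} {edg k t} (inj₁ refl)) p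

    lift-wall : ∀ κ b d ρ s → c (fac κ b d) Q.< c (cel ρ s) →
      cel ρ s ~ evenWall (fac κ b d) ⊎ cel ρ s ~ oddWall (fac κ b d)
    lift-wall κ b d ρ s p = let F = fac κ b d in
      one-of (c-< {F} {top} tt) (rank-gap F top refl) (walls-distinct κ b d)
        (c-< {F} {evenWall F} (inj₁ refl)) (c-< {evenWall F} {top} tt)
        (c-< {F} {oddWall F} (inj₂ refl)) (c-< {oddWall F} {top} tt)
        p (c-< {cel ρ s} {top} tt)

    Lifted : Face Z → Face Z → Set
    Lifted F G = ∃₂ λ F′ G′ → F ~ F′ × G ~ G′ × F′ ≼ G′

    lift-consecutive : ∀ F G → suc (toℕ (rankOf F)) ≡ toℕ (rankOf G) → c F Q.< c G → Lifted F G
    lift-consecutive bot (vtx i) _ _ = bot , vtx i , refl , refl , inj₂ tt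
    lift-consecutive (cel ρ s) top _ _ = cel ρ s , top , refl , refl , inj₂ tt
    lift-consecutive (vtx i) (edg k t) _ p =
      [ (λ e → vtx k , edg k t , e , refl , inj₂ (inj₁ refl))
      , (λ e → vtx (prv k) , edg k t , e , refl , inj₂ (inj₂ refl)) ]′ (lift-end i k t p)
    lift-consecutive (edg k t) (fac κ b d) _ p =
      [ (λ e → sideOf k (fac κ b d) , fac κ b d , e , refl , inj₂ refl)
      , (λ e → sideOf (nxt k) (fac κ b d) , fac κ b d , e , refl , inj₂ refl) ]′ (lift-side k t κ b d p)
    lift-consecutive (fac κ b d) (cel ρ s) _ p =
      [ (λ e → fac κ b d , evenWall (fac κ b d) , refl , e , inj₂ (inj₁ refl))
      , (λ e → fac κ b d , oddWall (fac κ b d) , refl , e , inj₂ (inj₂ refl)) ]′ (lift-wall κ b d ρ s p)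

    lift-≤ : ∀ F G → c F Q.≤ c G → Lifted F G
    lift-≤ F G le = decide (c F ≟Q c G)
      where
      near : c F Q.< c G → suc (toℕ (rankOf F)) ℕ.< toℕ (rankOf G) ⊎ suc (toℕ (rankOf F)) ≡ toℕ
          (rankOf G) → Lifted F G
      near p (inj₁ far) = F , G , refl , refl , inj₂ (far⇒⋖ F G far)
      near p (inj₂ eq)  = lift-consecutive F G eq p
      decide : Dec (c F ≡ c G) → Lifted F G
      decide (yes e) = F , F , refl , sym e , inj₁ refl
      decide (no ne) = near (le , ne) (ℕ.m≤n⇒m<n∨m≡n
        (subst₂ Fin._<_ (rank-preserving F) (rank-preserving G) (Q.rank-strictMono (le , ne))))

    -- Consecutive vertices are the ends of an edge and stay distinct, so only opposite ones can
    -- merge; the rotation `α⁻` carries one opposite pair to the other.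
    opposite : ∀ i i′ → vtx i ~ vtx i′ → i ≢ i′ → vtx 0F ~ vtx 2F × i′ ≡ nxt (nxt i)
    opposite 0F 0F e ne = contradiction refl ne
    opposite 1F 1F e ne = contradiction refl ne
    opposite 2F 2F e ne = contradiction refl ne
    opposite 3F 3F e ne = contradiction refl ne
    opposite 0F 1F e ne = contradiction (sym e) (ends-distinct 1F)
    opposite 1F 2F e ne = contradiction (sym e) (ends-distinct 2F)
    opposite 2F 3F e ne = contradiction (sym e) (ends-distinct 3F)
    opposite 3F 0F e ne = contradiction (sym e) (ends-distinct 0F)
    opposite 1F 0F e ne = contradiction e (ends-distinct 1F)
    opposite 2F 1F e ne = contradiction e (ends-distinct 2F)
    opposite 3F 2F e ne = contradiction e (ends-distinct 3F)
    opposite 0F 3F e ne = contradiction e (ends-distinct 0F)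
    opposite 0F 2F e ne = e , refl
    opposite 2F 0F e ne = sym e , refl
    opposite 1F 3F e ne = ~-run (α⁻ ∷ []) e , refl
    opposite 3F 1F e ne = sym (~-run (α⁻ ∷ []) e) , refl

    vtx-injective : ¬ vtx 0F ~ vtx 2F → ∀ {i i′} → vtx i ~ vtx i′ → i ≡ i′
    vtx-injective ne {i} {i′} e = decide (i Fin.≟ i′)
      where
      decide : Dec (i ≡ i′) → i ≡ i′
      decide (yes i≡i′) = i≡i′
      decide (no i≢i′)  = contradiction (proj₁ (opposite i i′ e i≢i′)) ne

    -- The square of `α` fixes the base 2-face and base facet, and modulo the covering also the base
    -- vertex. Only the edge could move, and chirality of `Q` forbids that.
    α²-trivial : vtx 0F ~ vtx 2F → Trivial (α ∷ α ∷ [])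
    α²-trivial e = trivial (α ∷ α ∷ []) 2F λ where
      0F _  → refl
      1F _  → sym e
      2F ne → contradiction refl ne
      3F _  → cong c (from-just (runsTo? (α ∷ α ∷ []) (fac 0F zer zer) (fac 0F zer zer)) 𝟘 𝟘 𝟘)
      4F _  → cong c (from-just (runsTo? (α ∷ α ∷ []) (cel 0F zer) (cel 0F zer)) 𝟘 𝟘 𝟘)
      5F _  → refl

    -- All four vertices stay distinct under this hypothesis, and the two ends of an edge determine
    -- its class.
    edge-class : ¬ vtx 0F ~ vtx 2F → ∀ k t k′ t′ → edg k t ~ edg k′ t′ → k ≡ k′
    edge-class ne k t k′ t′ e = decide
      (lift-end k′ k t (end {vtx k′} (inj₁ refl))) (lift-end (prv k′) k t (end {vtx (prv k′)} (inj₂ refl)))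
      where
      end : ∀ {V} → V ⋖ edg k′ t′ → c V Q.< c (edg k t)
      end {V} p = subst (c V Q.<_) (sym e) (c-< {V} {edg k′ t′} p)
      prv² : ∀ k → prv (prv k) ≢ k × prv (prv k) ≢ prv k
      prv² 0F = (λ ()) , λ ()
      prv² 1F = (λ ()) , λ ()
      prv² 2F = (λ ()) , λ ()
      prv² 3F = (λ ()) , λ ()
      decide : vtx k′ ~ vtx k ⊎ vtx k′ ~ vtx (prv k) → vtx (prv k′) ~ vtx k ⊎ vtx (prv k′) ~ vtx (prv k) → k ≡ k′
      decide (inj₁ p) _ = sym (vtx-injective ne p)
      decide (inj₂ p) (inj₁ q) = contradiction
          (trans (cong prv (sym (vtx-injective ne p))) (vtx-injective ne q)) (proj₁ (prv² k))
      decide (inj₂ p) (inj₂ q) = contradiction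
          (trans (cong prv (sym (vtx-injective ne p))) (vtx-injective ne q)) (proj₂ (prv² k))

    -- Modulo the covering, `χ² u` fixes the base flag except perhaps its 2-face, so it is trivial.
    -- Some multiple of `u` is h.
    base-edge-collapse : ∀ u → edg 0F 𝟘 ~ edg 0F u → u ≢ 𝟘 → Trivial (χ² (h· 𝟙) ∷ [])
    base-edge-collapse u e ne = let k , eq = half-multiple ne in
      subst (λ u → Trivial (χ² u ∷ [])) eq (trivial-χ²• k u (trivial (χ² u ∷ []) 3F λ where
        0F _  → refl
        1F _  → refl
        2F _  → trans (cong (λ t → c (edg 0F t)) (solve (zer :+ var₁) var₁ u u u)) (sym e)
        3F ne → contradiction refl ne
        4F _  → refl
        5F _  → refl))

    edge-collapse : ∀ k t t′ → edg k t ~ edg k t′ → t ≢ t′ → Trivial (χ² (h· 𝟙) ∷ [])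
    edge-collapse k t t′ e ne = base-edge-collapse (proj₁ (rotated k t t′)) (subst₂ _~_
        (proj₁ (proj₂ (rotated k t t′))) (proj₂ (proj₂ (rotated k t t′))) (~-run (to-base k t) e))
      (λ u≡𝟘 → ne (edg-val (run-injective (to-base k t) (trans (proj₁ (proj₂ (rotated k t t′)))
        (sym (trans (proj₂ (proj₂ (rotated k t t′))) (cong (edg 0F) u≡𝟘)))))))
      where
      edg-val : ∀ {k} {t u : Z} → edg k t ≡ edg k u → t ≡ u
      edg-val refl = refl
      to-base : Fin 4 → Z → List (Step Z)
      to-base 0F t = χ² (⊝ t) ∷ []
      to-base 1F t = χ² (⊝ t) ∷ α⁻ ∷ []
      to-base 2F t = χ² (⊝ t) ∷ α⁻ ∷ α⁻ ∷ []
      to-base 3F t = χ² (⊝ t) ∷ α ∷ []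
      rotated : ∀ k t t′ → ∃[ u ]
          (run (to-base k t) (edg k t) ≡ edg 0F 𝟘 × run (to-base k t) (edg k t′) ≡ edg 0F u)
      rotated 0F t t′ = t′ ⊖ t , from-just (runsTo? (χ² (:- var₁) ∷ []) (edg 0F var₁) (edg 0F zer)) t t t , refl
      rotated 1F t t′ = h· (t′ ⊖ t) ⊖ (t′ ⊖ t) , from-just
          (runsTo? (χ² (:- var₁) ∷ α⁻ ∷ []) (edg 1F var₁) (edg 0F zer)) t t t , refl
      rotated 2F t t′ = t′ ⊖ t , from-just
          (runsTo? (χ² (:- var₁) ∷ α⁻ ∷ α⁻ ∷ []) (edg 2F var₁) (edg 0F zer)) t t t ,
        from-just (runsTo? (χ² (:- var₁) ∷ α⁻ ∷ α⁻ ∷ []) (edg 2F var₂) (edg 0F (var₂ :+ (:- var₁)))) t t′ t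
      rotated 3F t t′ = h· (t′ ⊖ t) ⊖ (t′ ⊖ t) , from-just
          (runsTo? (χ² (:- var₁) ∷ α ∷ []) (edg 3F var₁) (edg 0F zer)) t t t , refl

    facet-word : Fin 4 → Z → List (Step Z)
    facet-word 0F s = υ⁴ s ∷ []
    facet-word 1F s = υ⁴ s ∷ υ ∷ []
    facet-word 2F s = υ⁴ s ∷ υ ∷ υ ∷ []
    facet-word 3F s = υ⁴ (s ⊖ 𝟙) ∷ υ ∷ υ ∷ υ ∷ []

    facet-word-cel : ∀ ρ s → run (facet-word ρ s) (cel 0F 𝟘) ≡ cel ρ s
    facet-word-cel 0F s = from-just (runsTo? (υ⁴ var₁ ∷ []) (cel 0F zer) (cel 0F var₁)) s s s
    facet-word-cel 1F s = from-just (runsTo? (υ⁴ var₁ ∷ υ ∷ []) (cel 0F zer) (cel 1F var₁)) s s s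
    facet-word-cel 2F s = from-just (runsTo? (υ⁴ var₁ ∷ υ ∷ υ ∷ []) (cel 0F zer) (cel 2F var₁)) s s s
    facet-word-cel 3F s = from-just
        (runsTo? (υ⁴ (var₁ :+ (:- one)) ∷ υ ∷ υ ∷ υ ∷ []) (cel 0F zer) (cel 3F var₁)) s s s

    facet-word-edg : ∀ ρ s → run (facet-word ρ s) (edg 0F 𝟘) ≡ edg 0F 𝟘
    facet-word-edg 0F s = refl
    facet-word-edg 1F s = from-just (runsTo? (υ⁴ var₁ ∷ υ ∷ []) (edg 0F zer) (edg 0F zer)) s s s
    facet-word-edg 2F s = from-just (runsTo? (υ⁴ var₁ ∷ υ ∷ υ ∷ []) (edg 0F zer) (edg 0F zer)) s s s
    facet-word-edg 3F s = from-just
        (runsTo? (υ⁴ (var₁ :+ (:- one)) ∷ υ ∷ υ ∷ υ ∷ []) (edg 0F zer) (edg 0F zer)) s s s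

    facet-word-vtx : ∀ ρ s → run (facet-word ρ s) (vtx 0F) ≡ vtx 0F
    facet-word-vtx 0F s = refl
    facet-word-vtx 1F s = refl
    facet-word-vtx 2F s = refl
    facet-word-vtx 3F s = refl

    -- The hypothesis h u = h says that `u` is odd, and N/2 times an odd residue is h.
    υ⁴-odd : ∀ u → h· u ≡ h· 𝟙 → Trivial (υ⁴ u ∷ []) → Trivial (υ⁴ (h· 𝟙) ∷ [])
    υ⁴-odd u eq s = subst (λ u → Trivial (υ⁴ u ∷ [])) (trans (half• u) eq) (trivial-υ⁴• half u s)

    base-facet-collapse : ∀ ρ s → cel 0F 𝟘 ~ cel ρ s → cel 0F 𝟘 ≢ cel ρ s → Trivial (υ⁴ (h· 𝟙) ∷ [])
    base-facet-collapse ρ s e ne = by-class ρ s ne (trivial (facet-word ρ s) 3F λ where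
        0F _  → cong c (run-fixes-bot (facet-word ρ s))
        1F _  → cong c (facet-word-vtx ρ s)
        2F _  → cong c (facet-word-edg ρ s)
        3F ne → contradiction refl ne
        4F _  → trans (cong c (facet-word-cel ρ s)) (sym e)
        5F _  → cong c (run-fixes-top (facet-word ρ s)))
      where
      twice : ∀ gs → Trivial gs → Trivial (gs ++ gs)
      twice gs t = trivial-++ gs gs t t
      via : ∀ gs u → (∀ F → run gs F ≡ move (υ⁴ u) F) → Trivial gs → Trivial (υ⁴ u ∷ [])
      via gs u eq t F = trans (cong c (sym (eq F))) (t F)
      by-class : ∀ ρ s → cel 0F 𝟘 ≢ cel ρ s → Trivial (facet-word ρ s) → Trivial (υ⁴ (h· 𝟙) ∷ [])
      by-class 0F s ne t = let k , eq = half-multiple (λ s≡𝟘 → ne (cong (cel 0F) (sym s≡𝟘))) in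
        subst (λ u → Trivial (υ⁴ u ∷ [])) eq (trivial-υ⁴• k s t)
      -- The word equals υ ^ (4 s + 1); its fourth power preserves every class and translates by the
      -- odd number 4 s + 1. In class 2 a square suffices and gives 2 s + 1.
      by-class 1F s _ t = υ⁴-odd ((s ⊕ s) ⊕ (s ⊕ s) ⊕ 𝟙)
          (solve (:h (((var₁ :+ var₁) :+ (var₁ :+ var₁)) :+ one)) (:h one) s s s)
        (via (gs ++ gs ++ gs ++ gs) ((s ⊕ s) ⊕ (s ⊕ s) ⊕ 𝟙)
          (from-just (agree? (υ⁴ var₃ ∷ υ ∷ υ⁴ var₃ ∷ υ ∷ υ⁴ var₃ ∷ υ ∷ υ⁴ var₃ ∷ υ ∷ [])
              (υ⁴ (((var₃ :+ var₃) :+ (var₃ :+ var₃)) :+ one) ∷ []))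
            (λ s → let gs = facet-word 1F s in gs ++ gs ++ gs ++ gs) (λ s → υ⁴ ((s ⊕ s) ⊕ (s ⊕ s) ⊕ 𝟙) ∷ [])
            (λ _ _ _ → refl) (λ _ _ _ → refl) s)
          (twice (gs ++ gs) (twice gs t)))
        where gs = facet-word 1F s
      by-class 2F s _ t = υ⁴-odd ((s ⊕ s) ⊕ 𝟙) (solve (:h ((var₁ :+ var₁) :+ one)) (:h one) s s s)
        (via (gs ++ gs) ((s ⊕ s) ⊕ 𝟙)
          (from-just (agree? (υ⁴ var₃ ∷ υ ∷ υ ∷ υ⁴ var₃ ∷ υ ∷ υ ∷ []) (υ⁴ ((var₃ :+ var₃) :+ one) ∷ []))
            (λ s → let gs = facet-word 2F s in gs ++ gs) (λ s → υ⁴ ((s ⊕ s) ⊕ 𝟙) ∷ [])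
            (λ _ _ _ → refl) (λ _ _ _ → refl) s)
          (twice gs t))
        where gs = facet-word 2F s
      -- Here the word is υ ^ (4 (s - 1) + 3), whence the odd translation 4 s - 1.
      by-class 3F s _ t = υ⁴-odd ((s ⊕ s) ⊕ (s ⊕ s) ⊖ 𝟙)
          (solve (:h (((var₁ :+ var₁) :+ (var₁ :+ var₁)) :+ (:- one))) (:h one) s s s)
        (via (gs ++ gs ++ gs ++ gs) ((s ⊕ s) ⊕ (s ⊕ s) ⊖ 𝟙)
          (from-just (agree? (υ⁴ (var₃ :+ (:- one)) ∷ υ ∷ υ ∷ υ ∷ υ⁴ (var₃ :+ (:- one)) ∷ υ ∷ υ ∷ υ ∷
              υ⁴ (var₃ :+ (:- one)) ∷ υ ∷ υ ∷ υ ∷ υ⁴ (var₃ :+ (:- one)) ∷ υ ∷ υ ∷ υ ∷ [])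
              (υ⁴ (((var₃ :+ var₃) :+ (var₃ :+ var₃)) :+ (:- one)) ∷ []))
            (λ s → let gs = facet-word 3F s in gs ++ gs ++ gs ++ gs) (λ s → υ⁴ ((s ⊕ s) ⊕ (s ⊕ s) ⊖ 𝟙) ∷ [])
            (λ _ _ _ → refl) (λ _ _ _ → refl) s)
          (twice (gs ++ gs) (twice gs t)))
        where gs = facet-word 3F s

    facet-collapse : ∀ ρ s ρ′ s′ → cel ρ s ~ cel ρ′ s′ → cel ρ s ≢ cel ρ′ s′ → Trivial (υ⁴ (h· 𝟙) ∷ [])
    facet-collapse ρ s ρ′ s′ e ne = from-image (rank-cel (run gs (cel ρ′ s′)) (run-rank gs (cel ρ′ s′)))
      where
      gs = inverse (facet-word ρ s)
      at-base : run gs (cel ρ s) ≡ cel 0F 𝟘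
      at-base = trans (cong (run gs) (sym (facet-word-cel ρ s))) (run-inverseˡ (facet-word ρ s) (cel 0F 𝟘))
      from-image : (∃[ σ ] ∃[ u ] run gs (cel ρ′ s′) ≡ cel σ u) → Trivial (υ⁴ (h· 𝟙) ∷ [])
      from-image (σ , u , eq) = base-facet-collapse σ u
        (subst₂ _~_ at-base eq (~-run gs e))
        (λ eq′ → ne (run-injective gs (trans at-base (trans eq′ (sym eq)))))

    facet-injective : ¬ Trivial (υ⁴ (h· 𝟙) ∷ []) → ∀ {ρ s ρ′ s′} → cel ρ s ~ cel ρ′ s′ → cel ρ s ≡ cel ρ′ s′
    facet-injective nt {ρ} {s} {ρ′} {s′} e = decide (cel ρ s ≟F cel ρ′ s′)
      where
      decide : Dec (cel ρ s ≡ cel ρ′ s′) → cel ρ s ≡ cel ρ′ s′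
      decide (yes eq) = eq
      decide (no ne)  = contradiction (facet-collapse ρ s ρ′ s′ e ne) nt

    injective : ¬ Trivial (υ⁴ (h· 𝟙) ∷ []) → ∀ F G → F ~ G → F ≡ G
    injective nt F G e = same-rank F G e (c-rank e refl)
      where
      same-rank : ∀ F G → F ~ G → rankOf G ≡ rankOf F → F ≡ G
      same-rank bot bot _ _ = refl
      same-rank top top _ _ = refl
      same-rank (vtx i) (vtx i′) e _ =
        cong vtx (vtx-injective (λ e → nt (α²-trivial⇒z (α²-trivial e))) e)
      same-rank (edg k t) (edg k′ t′) e _ = edges
          (edge-class (λ e → nt (α²-trivial⇒z (α²-trivial e))) k t k′ t′ e) e (t Fin.≟ t′)
        where
        edges : k ≡ k′ → edg k t ~ edg k′ t′ → Dec (t ≡ t′) → edg k t ≡ edg k′ t′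
        edges refl e (yes refl) = refl
        edges refl e (no ne)    = contradiction (χ²h-trivial⇒z (edge-collapse k t t′ e ne)) nt
      -- Both 2-faces lie, up to the covering, on the same two facets. Facets are not identified,
      -- and a 2-face is determined by its walls.
      same-rank (fac κ b d) (fac κ′ b′ d′) e _ = sym (fac-by-walls κ b d refl
        (wall (evenClass κ) b
            (subst (Q._< c (cel (evenClass κ) b)) e (c-< {fac κ b d} {cel (evenClass κ) b} (inj₁ refl))))
        (wall (oddClass κ) d (subst (Q._< c (cel (oddClass κ) d)) e
            (c-< {fac κ b d} {cel (oddClass κ) d} (inj₂ refl)))))
        where
        wall : ∀ ρ s → c (fac κ′ b′ d′) Q.< c (cel ρ s) → fac κ′ b′ d′ ⋖ cel ρ s
        wall ρ s p = [ (λ e → inj₁ (facet-injective nt e)) , (λ e → inj₂ (facet-injective nt e)) ]′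
            (lift-wall κ′ b′ d′ ρ s p)
      same-rank (cel ρ s) (cel ρ′ s′) e _ = facet-injective nt e

    isomorphism : ¬ Trivial (υ⁴ (h· 𝟙) ∷ []) → Isomorphism polytope Q
    isomorphism nt = record
      { to = c
      ; isOrderIsomorphism = record
        { isOrderMonomorphism = record
          { isOrderHomomorphism = record { cong = cong c ; mono = c-mono }
          ; injective = λ {F} {G} → injective nt F G
          ; cancel = λ {F} {G} le → let F′ , G′ , p , q , le′ = lift-≤ F G le in
              subst₂ _≼_ (sym (injective nt F F′ p)) (sym (injective nt G G′ q)) le′
          }
        ; surjective = λ G → proj₁ (c-surjective G) , λ { refl → proj₂ (c-surjective G) }
        }
      ; rank-preserving = rank-preserving
      }

    -- The reflection induced on a quotient

    module Reflected (z-trivial : Trivial (υ⁴ (h· 𝟙) ∷ [])) where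

      reflect-mono : ∀ {F G} → F ≼ G → c (reflect F) Q.≤ c (reflect G)
      reflect-mono {F} {G} (inj₁ refl) = c-mono (inj₁ refl)
      reflect-mono {F} {G} (inj₂ p)    = consecutive F G p (ℕ.m≤n⇒m<n∨m≡n (⋖-rank F G p))
        where
        near : ∀ F G → F ⋖ G → suc (toℕ (rankOf F)) ≡ toℕ (rankOf G) → c (reflect F) Q.≤ c (reflect G)
        near bot (vtx _) _ _ = c-mono (inj₂ tt)
        near (cel _ _) top _ _ = c-mono (inj₂ tt)
        near (vtx i) (edg k t) p _ = c-mono (inj₂ (ends i k p))
          where
          prv-neg : ∀ k → mirror₃ (prv k) ≡ neg₄ k
          prv-neg 0F = refl
          prv-neg 1F = refl
          prv-neg 2F = refl
          prv-neg 3F = refl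
          ends : ∀ i k → i ≡ k ⊎ i ≡ prv k → mirror₃ i ≡ neg₄ k ⊎ mirror₃ i ≡ prv (neg₄ k)
          ends i k (inj₁ refl) = inj₂ refl
          ends i k (inj₂ refl) = inj₁ (prv-neg k)
        near (edg k t) (fac κ b d) p _ = subst (λ F → c (reflect (edg k t)) Q.≤ c F) (sym (reflect-fac κ b d))
          (c-mono (inj₂ (trans (cong reflect p) (cong (edg (neg₄ k)) (sym (reflect-side k κ b d))))))
        near (fac κ b d) (cel ρ s) p _ = subst₂ Q._≤_ (cong c (sym (reflect-fac κ b d))) (wall p)
            (c-mono (facet p))
          where
          d′ = d ⊕ h· defect κ b d
          facet : (p : fac κ b d ⋖ cel ρ s) → fac κ b d′ ≼ [ (λ _ → cel ρ s) , (λ _ → cel ρ d′) ]′ p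
          facet (inj₁ refl) = inj₂ (inj₁ refl)
          facet (inj₂ refl) = inj₂ (inj₂ refl)
          wall : (p : fac κ b d ⋖ cel ρ s) → c ([ (λ _ → cel ρ s) , (λ _ → cel ρ d′) ]′ p) ≡ c (cel ρ s)
          wall (inj₁ _)    = refl
          -- The odd wall of the reflected 2-face has been displaced by a multiple of h, which the
          -- quotient cannot see.
          wall (inj₂ refl) = trivial-υ⁴-h z-trivial (defect κ b d) (cel (oddClass κ) d)
        consecutive : ∀ F G → F ⋖ G → suc (toℕ (rankOf F)) ℕ.< toℕ (rankOf G) ⊎ suc (toℕ (rankOf F)) ≡
            toℕ (rankOf G) →
          c (reflect F) Q.≤ c (reflect G)
        consecutive F G p (inj₂ eq)  = near F G p eq
        consecutive F G p (inj₁ far) = c-mono (inj₂ (far⇒⋖ (reflect F) (reflect G)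
          (subst₂ (λ r r′ → 2 ℕ.+ toℕ r ℕ.≤ toℕ r′) (sym (reflect-rank F)) (sym (reflect-rank G)) far)))

      χ²h-trivial⇒fac : Trivial (χ² (h· 𝟙) ∷ []) → ∀ κ b d → reflect (fac κ b d) ~ fac κ b d
      χ²h-trivial⇒fac t κ b d = trivial-χ²-h t (defect κ b d) (fac κ b d)

      χ²h-trivial⇒edg : Trivial (χ² (h· 𝟙) ∷ []) → ∀ k t → reflect (edg k t) ~ edg (neg₄ k) t
      χ²h-trivial⇒edg triv k t = trivial-χ²-h triv t (edg (neg₄ k) t)

      α²-edg : ∀ k t → run (α ∷ α ∷ []) (edg k t) ≡ edg (nxt (nxt k)) t
      α²-edg k t = cong (edg _) (solve ((:h ((:h var₁) :+ (:- var₁))) :+ (:- ((:h var₁) :+ (:- var₁)))) var₁ t t t)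

      even-or-odd : ∀ k → neg₄ k ≡ k ⊎ neg₄ k ≡ nxt (nxt k)
      even-or-odd 0F = inj₁ refl
      even-or-odd 1F = inj₂ refl
      even-or-odd 2F = inj₁ refl
      even-or-odd 3F = inj₂ refl

      α²-trivial⇒edg : vtx 0F ~ vtx 2F → ∀ k t → reflect (edg k t) ~ edg k t
      α²-trivial⇒edg e k t = trans (χ²h-trivial⇒edg (α²-trivial⇒χ²h (α²-trivial e)) k t)
        ([ (λ eq → cong (λ k → c (edg k t)) eq)
         , (λ eq → trans (cong (λ k → c (edg k t)) eq)
                 (trans (cong c (sym (α²-edg k t))) (α²-trivial e (edg k t)))) ]′ (even-or-odd k))

      same-class : ∀ k t t′ → edg k t ~ edg k t′ → edg (neg₄ k) t ~ edg (neg₄ k) t′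
      same-class k t t′ e = [ (λ eq → subst (λ k → edg k t ~ edg k t′) (sym eq) e)
        , (λ eq → subst (λ k → edg k t ~ edg k t′) (sym eq)
            (subst₂ _~_ (α²-edg k t) (α²-edg k t′) (~-run (α ∷ α ∷ []) e))) ]′ (even-or-odd k)

      -- If opposite vertices merge, both the twist by 1 + h and the exchange of opposite edge
      -- classes become invisible. Otherwise the classes agree, and different positions force
      -- `χ² (h· 𝟙)` to be trivial, so that again the twist is invisible.
      reflect-edg : ∀ k t k′ t′ → edg k t ~ edg k′ t′ → reflect (edg k t) ~ reflect (edg k′ t′)
      reflect-edg k t k′ t′ e = decide (c (vtx 0F) ≟Q c (vtx 2F))
        where
        within : k ≡ k′ → Dec (t ≡ t′) → reflect (edg k t) ~ reflect (edg k′ t′)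
        within refl (yes refl) = refl
        within refl (no ne)    = let triv = edge-collapse k t t′ e ne in
          trans (χ²h-trivial⇒edg triv k t) (trans (same-class k t t′ e) (sym (χ²h-trivial⇒edg triv k t′)))
        decide : Dec (vtx 0F ~ vtx 2F) → reflect (edg k t) ~ reflect (edg k′ t′)
        decide (yes v) = trans (α²-trivial⇒edg v k t) (trans e (sym (α²-trivial⇒edg v k′ t′)))
        decide (no nv) = within (edge-class nv k t k′ t′ e) (t Fin.≟ t′)

      edge-injective : ¬ edg 0F 𝟘 ~ edg 0F (h· 𝟙) → ∀ {k t k′ t′} → edg k t ~ edg k′ t′ → edg k t ≡ edg k′ t′
      edge-injective ne {k} {t} {k′} {t′} e = same (edge-class nv k t k′ t′ e) (t Fin.≟ t′)
        where
        no-χ²h : ¬ Trivial (χ² (h· 𝟙) ∷ [])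
        no-χ²h triv = ne (sym
            (trans (cong (λ t → c (edg 0F t)) (solve (:h one) (zer :+ (:h one)) 𝟘 𝟘 𝟘)) (triv (edg 0F 𝟘))))
        nv : ¬ vtx 0F ~ vtx 2F
        nv e = no-χ²h (α²-trivial⇒χ²h (α²-trivial e))
        same : k ≡ k′ → Dec (t ≡ t′) → edg k t ≡ edg k′ t′
        same refl (yes refl) = refl
        same refl (no t≢t′)  = contradiction (edge-collapse k t t′ e t≢t′) no-χ²h

      same-sides : ¬ edg 0F 𝟘 ~ edg 0F (h· 𝟙) → ∀ κ b d κ′ b′ d′ → fac κ b d ~ fac κ′ b′ d′ →
        ∀ k → side κ k b d ≡ side κ′ k b′ d′
      same-sides ne κ b d κ′ b′ d′ e k = [ (λ e → edg-val (edge-injective ne e))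
          , (λ e → contradiction (edg-class (edge-injective ne e)) (nxt≢ k)) ]′
        (lift-side k (side κ k b d) κ′ b′ d′
            (subst (c (sideOf k (fac κ b d)) Q.<_) e (c-< {sideOf k (fac κ b d)} {fac κ b d} refl)))
        where
        edg-val : ∀ {k} {t u : Z} → edg k t ≡ edg k u → t ≡ u
        edg-val refl = refl
        edg-class : ∀ {k k′} {t u : Z} → edg k t ≡ edg k′ u → k ≡ k′
        edg-class refl = refl

      reflect-~ : ∀ F G → F ~ G → reflect F ~ reflect G
      reflect-~ F G e = by-rank F G e (c-rank e refl)
        where
        by-rank : ∀ F G → F ~ G → rankOf G ≡ rankOf F → reflect F ~ reflect G
        by-rank bot bot _ _ = refl
        by-rank top top _ _ = refl
        by-rank (vtx i) (vtx i′) e _ = decide (i Fin.≟ i′)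
          where
          mirror₃-opposite : ∀ i → mirror₃ (nxt (nxt i)) ≡ nxt (nxt (mirror₃ i))
          mirror₃-opposite 0F = refl
          mirror₃-opposite 1F = refl
          mirror₃-opposite 2F = refl
          mirror₃-opposite 3F = refl
          decide : Dec (i ≡ i′) → vtx (mirror₃ i) ~ vtx (mirror₃ i′)
          decide (yes eq) = cong (λ i → c (vtx (mirror₃ i))) eq
          decide (no ne)  = let v , eq = opposite i i′ e ne in
            sym (trans (cong (λ i → c (vtx i)) (trans (cong mirror₃ eq) (mirror₃-opposite i)))
              (α²-trivial v (vtx (mirror₃ i))))
        by-rank (edg k t) (edg k′ t′) e _ = reflect-edg k t k′ t′ e
        by-rank (cel ρ s) (cel ρ′ s′) e _ = e
        -- Either translations of edges by h are trivial and the reflection changes no 2-face, or no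
        -- edges are identified; then the sides give both 2-faces the same defect, and the same
        -- translation acts on both.
        by-rank (fac κ b d) (fac κ′ b′ d′) e _ = decide (c (edg 0F 𝟘) ≟Q c (edg 0F (h· 𝟙)))
          where
          decide : Dec (edg 0F 𝟘 ~ edg 0F (h· 𝟙)) → reflect (fac κ b d) ~ reflect (fac κ′ b′ d′)
          decide (yes p) = let triv = base-edge-collapse (h· 𝟙) p h𝟙≢𝟘 in
            trans (χ²h-trivial⇒fac triv κ b d) (trans e (sym (χ²h-trivial⇒fac triv κ′ b′ d′)))
          decide (no np) = let κ≡κ′ , eq = sides-determine κ b d κ′ b′ d′ (same-sides np κ b d κ′ b′ d′ e) in
            trans (~-run (χ² (h· defect κ b d) ∷ []) e)
              (cong (λ w → c (move (χ² (h· w)) (fac κ′ b′ d′)))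
                  (trans (cong (λ κ → defect κ b d) κ≡κ′) (defect-cong κ′ eq)))

      section : Q.Face → Face Z
      section G = proj₁ (c-surjective G)

      R : Q.Face → Q.Face
      R G = c (reflect (section G))

      R-c : ∀ F → R (c F) ≡ c (reflect F)
      R-c F = reflect-~ (section (c F)) F (proj₂ (c-surjective (c F)))

      R-involutive : ∀ G → R (R G) ≡ G
      R-involutive G = trans (R-c (reflect (section G)))
        (trans (cong c (reflect-involutive (section G))) (proj₂ (c-surjective G)))

      R-mono : ∀ {G H} → G Q.≤ H → R G Q.≤ R H
      R-mono {G} {H} le =
        let F′ , F″ , p , q , le′ = lift-≤ (section G) (section H)
              (subst₂ Q._≤_ (sym (proj₂ (c-surjective G))) (sym (proj₂ (c-surjective H))) le)
        in subst₂ Q._≤_ (sym (reflect-~ (section G) F′ p)) (sym (reflect-~ (section H) F″ q)) (reflect-mono le′)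

      reflection : Isomorphism Q Q
      reflection = record
        { to = R
        ; isOrderIsomorphism = record
          { isOrderMonomorphism = record
            { isOrderHomomorphism = record { cong = cong R ; mono = R-mono }
            ; injective = λ {G} {H} e → trans (sym (R-involutive G)) (trans (cong R e) (R-involutive H))
            ; cancel = λ {G} {H} le → subst₂ Q._≤_ (R-involutive G) (R-involutive H) (R-mono le)
            }
          ; surjective = λ G → R G , λ { refl → R-involutive G }
          }
        ; rank-preserving = λ G → trans (rank-preserving (reflect (section G))) (trans (reflect-rank (section G))
            (trans (sym (rank-preserving (section G))) (cong Q.rank (proj₂ (c-surjective G)))))
        }

      not-chiral : ⊥
      not-chiral = proj₂ chiralQ 1F {cᶠ Φ₀} {cᶠ Φ⁰}
        (adjacency-preserving 1F {Φ₀} {Φ⁰} ((λ ()) , off₁ {Φ₀} {Φ⁰} (refl , refl , refl)))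
        (reflection , λ i → trans (R-c (P.face Φ₀ i)) (cong c (reflects i)))
        where
        reflects : ∀ i → reflect (P.face Φ₀ i) ≡ P.face Φ⁰ i
        reflects 0F = refl
        reflects 1F = refl
        reflects 2F = cong (edg 0F) (solve (zer :+ (:h zer)) zer 𝟘 𝟘 𝟘)
        reflects 3F = cong (fac 0F 𝟘) (solve (zer :+ (:h (zer :+ (:- zer)))) zer 𝟘 𝟘 𝟘)
        reflects 4F = refl
        reflects 5F = refl

  -- No decision on the central element is required: its triviality contradicts chirality, and this
  -- refutation is exactly what injectivity asks for.
  no-proper-chiral-quotient : ∀ Q → IsChiral Q → ¬ ProperlyCovers polytope Q
  no-proper-chiral-quotient Q chiralQ (cov , ¬iso) = ¬iso (isomorphism λ triv → Reflected.not-chiral triv)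
    where open Kernel Q chiralQ cov

-- Sizes of setoids

module _ (S : Setoid 0ℓ 0ℓ) where
  private module S = Setoid S

  record Coding (A : Set) : Set where
    field
      code        : S.Carrier → A
      decode      : A → S.Carrier
      code-cong   : ∀ {x y} → x S.≈ y → code x ≡ code y
      code-decode : ∀ a → code (decode a) ≡ a
      decode-code : ∀ x → decode (code x) S.≈ x

  hasSize : ∀ {A n} → Coding A → Fin n ↔ A → HasSize S n
  hasSize K L = record
    { to        = λ i → K.decode (L.to i)
    ; from      = λ x → L.from (K.code x)
    ; to-cong   = λ { refl → S.refl }
    ; from-cong = λ e → cong L.from (K.code-cong e)
    ; inverse   = (λ { {x} refl → S.trans (S.reflexive (cong K.decode (L.strictlyInverseˡ (K.code x))))
            (K.decode-code x) })
                , (λ {i} e → trans (cong L.from (trans (K.code-cong e) (K.code-decode (L.to i))))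
                        (L.strictlyInverseʳ i))
    }
    where
    module K = Coding K
    module L = Inverse L

infixr 5 _×↔_
_×↔_ : ∀ {m n} {A B : Set} → Fin m ↔ A → Fin n ↔ B → Fin (m ℕ.* n) ↔ (A × B)
f ×↔ g = (f ×-↔ g) ↔-∘ Fin.*↔×

Fin↔ : ∀ {m n} → m ≡ n → ∀ {A : Set} → Fin m ↔ A → Fin n ↔ A
Fin↔ refl A = A

id↔ : ∀ {n} → Fin n ↔ Fin n
id↔ = mk↔ₛ′ (λ i → i) (λ i → i) (λ _ → refl) (λ _ → refl)

-- Type and number of flags

module Counting (j : ℕ) (ϵ : ℤ) (ϵ-unit : ϵ ≡ 1ℤ ⊎ ϵ ≡ -1ℤ) where
  open Quotients j ϵ ϵ-unit public
  private
    module P = Polytope polytope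

  vertices-of-face : ∀ κ b d → Coding (sectionVertices polytope bot (fac κ b d)) (Fin 4)
  vertices-of-face κ b d = record
    { code        = λ (H , _) → index H
    ; decode      = λ i → vtx i , ⋖⇒< tt , ⋖⇒< tt , refl
    ; code-cong   = cong index
    ; code-decode = λ _ → refl
    ; decode-code = λ (H , _ , _ , r) → vertex H r
    }
    where
    index : Face Z → Fin 4
    index (vtx i) = i
    index _       = 0F
    vertex : ∀ H → toℕ (rankOf H) ≡ 1 → vtx (index H) ≡ H
    vertex (vtx i) _ = refl

  edges-at-vertex : ∀ i ρ s → Coding (sectionVertices polytope (vtx i) (cel ρ s)) (Fin 2 × Z)
  edges-at-vertex i ρ s = record
    { code        = λ (H , _) → index H
    ; decode      = λ (n , t) → edg (pick n) t , ⋖⇒< (incident n) , ⋖⇒< tt , refl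
    ; code-cong   = cong index
    ; code-decode = λ { (0F , t) → cong (_, t) (first i (i Fin.≟ i) refl)
                      ; (1F , t) → cong (_, t) (second (nxt i) (nxt i Fin.≟ i) (λ e → nxt≢ i (sym e))) }
    ; decode-code = λ (H , p , _ , r) → edge H (<⇒⋖ p) r
    }
    where
    end : ∀ k → Dec (k ≡ i) → Fin 2
    end k (yes _) = 0F
    end k (no _)  = 1F
    index : Face Z → Fin 2 × Z
    index (edg k t) = end k (k Fin.≟ i) , t
    index _         = 0F , 𝟘
    first : ∀ k (d : Dec (k ≡ i)) → k ≡ i → end k d ≡ 0F
    first k (yes _) _ = refl
    first k (no ne) e = contradiction e ne
    second : ∀ k (d : Dec (k ≡ i)) → k ≢ i → end k d ≡ 1F
    second k (yes e) ne = contradiction e ne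
    second k (no _)  _  = refl
    pick : Fin 2 → Fin 4
    pick 0F = i
    pick 1F = nxt i
    incident : ∀ n → i ≡ pick n ⊎ i ≡ prv (pick n)
    incident 0F = inj₁ refl
    incident 1F = inj₂ (sym (prv-nxt i))
    pick-end : ∀ k (d : Dec (k ≡ i)) → i ≡ k ⊎ i ≡ prv k → pick (end k d) ≡ k
    pick-end k (yes e) _           = sym e
    pick-end k (no ne) (inj₁ i≡k)  = contradiction (sym i≡k) ne
    pick-end k (no ne) (inj₂ i≡k-) = trans (cong nxt i≡k-) (nxt-prv k)
    decoded : Fin 2 × Z → Face Z
    decoded (n , t) = edg (pick n) t
    edge : ∀ H → vtx i ⋖ H → toℕ (rankOf H) ≡ 2 → decoded (index H) ≡ H
    edge (edg k t) p _ = cong (λ k → edg k t) (pick-end k (k Fin.≟ i) p)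

  faces-at-edge : ∀ k t → Coding (sectionVertices polytope (edg k t) top) (Fin 4 × Z)
  faces-at-edge k t = record
    { code        = λ (H , _) → index H
    ; decode      = λ (κ , b) → fac κ b (b ⊕ gap κ k t) , ⋖⇒< (cong (edg k) (sym (side-odd κ k b t))) ,
            ⋖⇒< tt , refl
    ; code-cong   = cong index
    ; code-decode = λ _ → refl
    ; decode-code = λ (H , p , _ , r) → face H (<⇒⋖ p) r
    }
    where
    index : Face Z → Fin 4 × Z
    index (fac κ b d) = κ , b
    index _           = 0F , 𝟘
    decoded : Fin 4 × Z → Face Z
    decoded (κ , b) = fac κ b (b ⊕ gap κ k t)
    face : ∀ H → edg k t ⋖ H → toℕ (rankOf H) ≡ 3 → decoded (index H) ≡ H
    face (fac κ b d) refl _ = cong (fac κ b) (gap-side κ k b d)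

  4*N : 4 ℕ.* N ≡ 2 ℕ.* (2 ℕ.* N)
  4*N = ℕ.*-assoc 2 2 N

  hasType : HasType polytope 4 (2 ℕ.* N) (2 ℕ.* (2 ℕ.* N))
  hasType 0F F G p r r′ = at F G p r r′
    where
    at : ∀ F G → F P.< G → toℕ (rankOf F) ≡ 0 → toℕ (rankOf G) ≡ 3 → HasSize (sectionVertices polytope F G) 4
    at bot (fac κ b d) _ _ _ = hasSize _ (vertices-of-face κ b d) id↔
  hasType 1F F G p r r′ = at F G p r r′
    where
    at : ∀ F G → F P.< G → toℕ (rankOf F) ≡ 1 → toℕ (rankOf G) ≡ 4 → HasSize
        (sectionVertices polytope F G) (2 ℕ.* N)
    at (vtx i) (cel ρ s) _ _ _ = hasSize _ (edges-at-vertex i ρ s) (id↔ ×↔ id↔)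
  hasType 2F F G p r r′ = at F G p r r′
    where
    at : ∀ F G → F P.< G → toℕ (rankOf F) ≡ 2 → toℕ (rankOf G) ≡ 5 → HasSize
        (sectionVertices polytope F G) (2 ℕ.* (2 ℕ.* N))
    at (edg k t) top _ _ _ = hasSize _ (faces-at-edge k t) (Fin↔ 4*N (id↔ ×↔ id↔))

  -- Once the edge is known, the kind and even wall of a 2-face determine its odd wall through
  -- `gap`, so one coordinate of the 2-face is omitted. The two outer bits choose an end of the edge
  -- and a wall.
  flagCoding : Coding P.flagSetoid (Fin 2 × Fin 4 × Z × Fin 4 × Z × Fin 2)
  flagCoding = record
    { code        = λ Φ → index (P.face Φ 1F) (P.face Φ 2F) (P.face Φ 3F) (P.face Φ 4F)
    ; decode      = λ a → flag (chainFor a)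
    ; code-cong   = λ e → index-cong (e 1F) (e 2F) (e 3F) (e 4F)
    ; code-decode = λ a → index-chain a
    ; decode-code = λ Φ → chain-index Φ
    }
    where
    choose : ∀ {A B : Face Z} → Dec (A ≡ B) → Fin 2
    choose (yes _) = 0F
    choose (no _)  = 1F
    choose-yes : ∀ {A B : Face Z} (d : Dec (A ≡ B)) → A ≡ B → choose d ≡ 0F
    choose-yes (yes _) _ = refl
    choose-yes (no ne) e = contradiction e ne
    choose-no : ∀ {A B : Face Z} (d : Dec (A ≡ B)) → A ≢ B → choose d ≡ 1F
    choose-no (yes e) ne = contradiction e ne
    choose-no (no _)  _  = refl
    edgeIndex faceIndex : Face Z → Fin 4 × Z
    edgeIndex (edg k t)   = k , t
    edgeIndex _           = 0F , 𝟘
    faceIndex (fac κ b _) = κ , b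
    faceIndex _           = 0F , 𝟘
    index : Face Z → Face Z → Face Z → Face Z → Fin 2 × Fin 4 × Z × Fin 4 × Z × Fin 2
    index V E F C = choose (V ≟F vtx (proj₁ (edgeIndex E))) , proj₁ (edgeIndex E) , proj₂ (edgeIndex E) ,
      proj₁ (faceIndex F) , proj₂ (faceIndex F) , choose (C ≟F evenWall F)
    index-cong : ∀ {V V′ E E′ F F′ C C′} → V ≡ V′ → E ≡ E′ → F ≡ F′ → C ≡ C′ → index V E F C ≡ index V′ E′ F′ C′
    index-cong refl refl refl refl = refl
    end : Fin 2 → Fin 4 → Face Z
    end 0F k = vtx k
    end 1F k = vtx (prv k)
    wall : Fin 2 → Fin 4 → Z → Z → Face Z
    wall 0F κ b d = cel (evenClass κ) b
    wall 1F κ b d = cel (oddClass κ) d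
    end-rank : ∀ u k → rankOf (end u k) ≡ 1F
    end-rank 0F k = refl
    end-rank 1F k = refl
    wall-rank : ∀ w κ b d → rankOf (wall w κ b d) ≡ 4F
    wall-rank 0F κ b d = refl
    wall-rank 1F κ b d = refl
    end-⋖ : ∀ u k t → end u k ⋖ edg k t
    end-⋖ 0F k t = inj₁ refl
    end-⋖ 1F k t = inj₂ refl
    wall-⋖ : ∀ w κ b d → fac κ b d ⋖ wall w κ b d
    wall-⋖ 0F κ b d = inj₁ refl
    wall-⋖ 1F κ b d = inj₂ refl
    chainFor : Fin 2 × Fin 4 × Z × Fin 4 × Z × Fin 2 → Chain
    chainFor (u , k , t , κ , b , w) = let d = b ⊕ gap κ k t in
      chain {end u k} {edg k t} {fac κ b d} {wall w κ b d} (end-rank u k) refl refl (wall-rank w κ b d)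
        (end-⋖ u k t) (cong (edg k) (sym (side-odd κ k b t))) (wall-⋖ w κ b d)
    index-chain : ∀ a → let Φ = flag (chainFor a) in index (P.face Φ 1F) (P.face Φ 2F) (P.face Φ 3F)
            (P.face Φ 4F) ≡ a
    index-chain (u , k , t , κ , b , w) = cong₂ (λ u w → u , k , t , κ , b , w) (ends u) (walls w)
      where
      ends : ∀ u → choose (end u k ≟F vtx k) ≡ u
      ends 0F = choose-yes (vtx k ≟F vtx k) refl
      ends 1F = choose-no (vtx (prv k) ≟F vtx k) (λ e → prv≢ k (vtx-inj e))
        where
        vtx-inj : ∀ {i k} → vtx {Z} i ≡ vtx k → i ≡ k
        vtx-inj refl = refl
      walls : ∀ w → choose (wall w κ b (b ⊕ gap κ k t) ≟F cel (evenClass κ) b) ≡ w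
      walls 0F = choose-yes (cel (evenClass κ) b ≟F cel (evenClass κ) b) refl
      walls 1F = choose-no (cel (oddClass κ) (b ⊕ gap κ k t) ≟F cel (evenClass κ) b)
          (λ e → evenClass≢oddClass κ (sym (class-inj e)))
        where
        class-inj : ∀ {i k} {t u : Z} → cel i t ≡ cel k u → i ≡ k
        class-inj refl = refl
    recover : ∀ V E F C → rankOf V ≡ 1F → rankOf E ≡ 2F → rankOf F ≡ 3F → rankOf C ≡ 4F → V ⋖ E → E ⋖ F → F ⋖ C →
      let X = chainFor (index V E F C) in Chain.at X 1F ≡ V × Chain.at X 2F ≡ E × Chain.at X 3F ≡ F ×
              Chain.at X 4F ≡ C
    recover (vtx i) (edg k t) (fac κ b d) (cel ρ s) _ _ _ _ p refl q =
      vertex (vtx i ≟F vtx k) p , refl , cong (fac κ b) (gap-side κ k b d) , facet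
          (cel ρ s ≟F cel (evenClass κ) b) q
      where
      vertex : (d : Dec (vtx i ≡ vtx k)) → i ≡ k ⊎ i ≡ prv k → end (choose d) k ≡ vtx i
      vertex (yes e) _           = sym e
      vertex (no ne) (inj₁ refl) = contradiction refl ne
      vertex (no ne) (inj₂ refl) = refl
      facet : ∀ (e : Dec (cel ρ s ≡ cel (evenClass κ) b)) → fac κ b d ⋖ cel ρ s →
        wall (choose e) κ b (b ⊕ gap κ k (side κ k b d)) ≡ cel ρ s
      facet (yes e) _        = sym e
      facet (no ne) (inj₁ e) = contradiction e ne
      facet (no ne) (inj₂ e) = trans (cong (cel (oddClass κ)) (gap-side κ k b d)) (sym e)
    chain-index : ∀ Φ → flag (chainFor (index (P.face Φ 1F) (P.face Φ 2F) (P.face Φ 3F) (P.face Φ 4F))) P.≈ Φ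
    chain-index Φ = λ where
        0F → sym (face-0 Φ)
        1F → proj₁ same
        2F → proj₁ (proj₂ same)
        3F → proj₁ (proj₂ (proj₂ same))
        4F → proj₂ (proj₂ (proj₂ same))
        5F → sym (face-5 Φ)
      where
      module X = Chain (chainOf Φ)
      same = recover _ _ _ _ X.rank-V X.rank-E X.rank-F X.rank-C X.V⋖E X.E⋖F X.F⋖C

  tight : IsTight polytope
  tight = 4 , 2 ℕ.* N , 2 ℕ.* (2 ℕ.* N) , hasType ,
    hasSize _ flagCoding (Fin↔ (count N) (id↔ ×↔ id↔ ×↔ id↔ ×↔ id↔ ×↔ id↔ ×↔ id↔))
    where
    count : ∀ n → 2 ℕ.* (4 ℕ.* (n ℕ.* (4 ℕ.* (n ℕ.* 2)))) ≡ 2 ℕ.* (4 ℕ.* (2 ℕ.* n) ℕ.* (2 ℕ.* (2 ℕ.* n)))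
    count = ℕ-solve-∀

ℤ-induction : (P : ℤ → Set) → P 0ℤ → (∀ i → P i → P (1ℤ ℤ.+ i)) → (∀ i → P i → P (-1ℤ ℤ.+ i)) → ∀ i → P i
ℤ-induction P z s p (+ zero)       = z
ℤ-induction P z s p (+ suc m)      = s (+ m) (ℤ-induction P z s p (+ m))
ℤ-induction P z s p -[1+ zero ]    = p 0ℤ z
ℤ-induction P z s p -[1+ suc m ]   = p -[1+ m ] (ℤ-induction P z s p -[1+ m ])

-- Words modulo relations

module WordPowers {n} (R : List (Word n × Word n)) where
  open import Data.Integer using (_+_; _*_; _-_; -_)
  infix 4 _≈_
  _≈_ : Word n → Word n → Set
  _≈_ = Derivable R

  open SetoidReasoning (Group.setoid (Presented n R))

  ∙-congˡ : ∀ {u v w} → v ≈ w → u ∙ v ≈ u ∙ w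
  ∙-congˡ = ∙-cong ≐-refl

  ∙-congʳ : ∀ {u v w} → v ≈ w → v ∙ u ≈ w ∙ u
  ∙-congʳ p = ∙-cong p ≐-refl

  cancelˡ : ∀ u v → u ⁻¹ ∙ (u ∙ v) ≈ v
  cancelˡ u v = ≐-trans (≐-sym (assoc (u ⁻¹) u v)) (≐-trans (∙-congʳ (inverseˡ u)) (identityˡ v))

  cancelʳ : ∀ u v → u ∙ (u ⁻¹ ∙ v) ≈ v
  cancelʳ u v = ≐-trans (≐-sym (assoc u (u ⁻¹) v)) (≐-trans (∙-congʳ (inverseʳ u)) (identityˡ v))

  pow-comm : ∀ w m → w ∙ pow w m ≈ pow w m ∙ w
  pow-comm w zero    = ≐-trans (identityʳ w) (≐-sym (identityˡ w))
  pow-comm w (suc m) = ≐-trans (∙-congˡ (pow-comm w m)) (≐-sym (assoc w (pow w m) w))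

  ⁻¹-anti : ∀ u v → (u ∙ v) ⁻¹ ≈ v ⁻¹ ∙ u ⁻¹
  ⁻¹-anti u v = begin
    (u ∙ v) ⁻¹                             ≈⟨ ≐-sym (identityʳ _) ⟩
    (u ∙ v) ⁻¹ ∙ ε                         ≈⟨ ∙-congˡ (≐-sym (inverseʳ u)) ⟩
    (u ∙ v) ⁻¹ ∙ (u ∙ u ⁻¹)                ≈⟨ ∙-congˡ (∙-congˡ (≐-sym (cancelʳ v (u ⁻¹)))) ⟩
    (u ∙ v) ⁻¹ ∙ (u ∙ (v ∙ (v ⁻¹ ∙ u ⁻¹))) ≈⟨ ∙-congˡ (≐-sym (assoc u v _)) ⟩
    (u ∙ v) ⁻¹ ∙ ((u ∙ v) ∙ (v ⁻¹ ∙ u ⁻¹)) ≈⟨ cancelˡ (u ∙ v) _ ⟩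
    v ⁻¹ ∙ u ⁻¹                                 ∎

  ^ᶻ-suc : ∀ w k → w ^ᶻ (1ℤ + k) ≈ w ∙ w ^ᶻ k
  ^ᶻ-suc w (+ m) = ≐-refl
  ^ᶻ-suc w -[1+ zero ] = ≐-sym (≐-trans (∙-congˡ (⁻¹-cong (identityʳ w))) (inverseʳ w))
  ^ᶻ-suc w -[1+ suc m ] = ≐-sym (begin
    w ∙ (w ∙ pow w (suc m)) ⁻¹    ≈⟨ ∙-congˡ (⁻¹-cong (pow-comm w (suc m))) ⟩
    w ∙ (pow w (suc m) ∙ w) ⁻¹    ≈⟨ ∙-congˡ (⁻¹-anti (pow w (suc m)) w) ⟩
    w ∙ (w ⁻¹ ∙ pow w (suc m) ⁻¹) ≈⟨ cancelʳ w _ ⟩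
    pow w (suc m) ⁻¹                   ∎)

  ^ᶻ-pred : ∀ w k → w ^ᶻ (-1ℤ + k) ≈ w ⁻¹ ∙ w ^ᶻ k
  ^ᶻ-pred w k = begin
    w ^ᶻ (-1ℤ + k)               ≈⟨ ≐-sym (cancelˡ w _) ⟩
    w ⁻¹ ∙ (w ∙ w ^ᶻ (-1ℤ + k))  ≈⟨ ∙-congˡ (≐-sym (^ᶻ-suc w (-1ℤ + k))) ⟩
    w ⁻¹ ∙ w ^ᶻ (1ℤ + (-1ℤ + k)) ≡⟨ cong (λ k → w ⁻¹ ∙ w ^ᶻ k) (lemma k) ⟩
    w ⁻¹ ∙ w ^ᶻ k                           ∎
    where
    lemma : ∀ k → 1ℤ + (-1ℤ + k) ≡ k
    lemma = solve-∀

  ^ᶻ-+ : ∀ w i k → w ^ᶻ (i + k) ≈ w ^ᶻ i ∙ w ^ᶻ k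
  ^ᶻ-+ w i k = ℤ-induction (λ i → w ^ᶻ (i + k) ≈ w ^ᶻ i ∙ w ^ᶻ k)
    (subst (λ m → w ^ᶻ m ≈ ε ∙ w ^ᶻ k) (sym (ℤ.+-identityˡ k)) (≐-sym (identityˡ _)))
    (λ i p → begin
      w ^ᶻ (1ℤ + i + k)     ≡⟨ cong (w ^ᶻ_) (ℤ.+-assoc 1ℤ i k) ⟩
      w ^ᶻ (1ℤ + (i + k))   ≈⟨ ^ᶻ-suc w (i + k) ⟩
      w ∙ w ^ᶻ (i + k)      ≈⟨ ∙-congˡ p ⟩
      w ∙ (w ^ᶻ i ∙ w ^ᶻ k) ≈⟨ ≐-sym (assoc w _ _) ⟩
      w ∙ w ^ᶻ i ∙ w ^ᶻ k   ≈⟨ ∙-congʳ (≐-sym (^ᶻ-suc w i)) ⟩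
      w ^ᶻ (1ℤ + i) ∙ w ^ᶻ k    ∎)
    (λ i p → begin
      w ^ᶻ (-1ℤ + i + k)       ≡⟨ cong (w ^ᶻ_) (ℤ.+-assoc -1ℤ i k) ⟩
      w ^ᶻ (-1ℤ + (i + k))     ≈⟨ ^ᶻ-pred w (i + k) ⟩
      w ⁻¹ ∙ w ^ᶻ (i + k)      ≈⟨ ∙-congˡ p ⟩
      w ⁻¹ ∙ (w ^ᶻ i ∙ w ^ᶻ k) ≈⟨ ≐-sym (assoc (w ⁻¹) _ _) ⟩
      w ⁻¹ ∙ w ^ᶻ i ∙ w ^ᶻ k   ≈⟨ ∙-congʳ (≐-sym (^ᶻ-pred w i)) ⟩
      w ^ᶻ (-1ℤ + i) ∙ w ^ᶻ k   ∎) i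

  ^ᶻ-neg : ∀ w k → w ^ᶻ (- k) ≈ (w ^ᶻ k) ⁻¹
  ^ᶻ-neg w k = begin
    w ^ᶻ (- k)                          ≈⟨ ≐-sym (cancelˡ (w ^ᶻ k) _) ⟩
    (w ^ᶻ k) ⁻¹ ∙ (w ^ᶻ k ∙ w ^ᶻ (- k)) ≈⟨ ∙-congˡ (≐-sym (^ᶻ-+ w k (- k))) ⟩
    (w ^ᶻ k) ⁻¹ ∙ w ^ᶻ (k + - k)        ≡⟨ cong (λ m → (w ^ᶻ k) ⁻¹ ∙ w ^ᶻ m) (ℤ.+-inverseʳ k) ⟩
    (w ^ᶻ k) ⁻¹ ∙ ε                     ≈⟨ identityʳ _ ⟩
    (w ^ᶻ k) ⁻¹                           ∎

  -- The hypothesis says that conjugation by `g` takes one power of `w` to another, and conjugation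
  -- is compatible with powers.
  ^ᶻ-shift : ∀ w g p q → w ^ᶻ p ∙ g ≈ g ∙ w ^ᶻ q → ∀ s → w ^ᶻ (s * p) ∙ g ≈ g ∙ w ^ᶻ (s * q)
  ^ᶻ-shift w g p q eq = ℤ-induction (λ s → w ^ᶻ (s * p) ∙ g ≈ g ∙ w ^ᶻ (s * q))
    (≐-trans (identityˡ g) (≐-sym (identityʳ g)))
    (λ s ih → begin
      w ^ᶻ ((1ℤ + s) * p) ∙ g ≡⟨ cong (λ m → w ^ᶻ m ∙ g) (suc* s p) ⟩
      w ^ᶻ (p + s * p) ∙ g    ≈⟨ slide p q s eq ih ⟩
      g ∙ w ^ᶻ (q + s * q)    ≡⟨ cong (λ m → g ∙ w ^ᶻ m) (sym (suc* s q)) ⟩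
      g ∙ w ^ᶻ ((1ℤ + s) * q)          ∎)
    (λ s ih → begin
      w ^ᶻ ((-1ℤ + s) * p) ∙ g ≡⟨ cong (λ m → w ^ᶻ m ∙ g) (pred* s p) ⟩
      w ^ᶻ (- p + s * p) ∙ g   ≈⟨ slide (- p) (- q) s eq⁻ ih ⟩
      g ∙ w ^ᶻ (- q + s * q)   ≡⟨ cong (λ m → g ∙ w ^ᶻ m) (sym (pred* s q)) ⟩
      g ∙ w ^ᶻ ((-1ℤ + s) * q)         ∎)
    where
    suc* : ∀ s p → (1ℤ + s) * p ≡ p + s * p
    suc* = solve-∀
    pred* : ∀ s p → (-1ℤ + s) * p ≡ - p + s * p
    pred* = solve-∀
    slide : ∀ p q s → w ^ᶻ p ∙ g ≈ g ∙ w ^ᶻ q → ∀ {p′ q′} → w ^ᶻ p′ ∙ g ≈ g ∙ w ^ᶻ q′ →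
      w ^ᶻ (p + p′) ∙ g ≈ g ∙ w ^ᶻ (q + q′)
    slide p q s eq {p′} {q′} ih = begin
      w ^ᶻ (p + p′) ∙ g      ≈⟨ ∙-congʳ (^ᶻ-+ w p p′) ⟩
      w ^ᶻ p ∙ w ^ᶻ p′ ∙ g   ≈⟨ assoc _ _ _ ⟩
      w ^ᶻ p ∙ (w ^ᶻ p′ ∙ g) ≈⟨ ∙-congˡ ih ⟩
      w ^ᶻ p ∙ (g ∙ w ^ᶻ q′) ≈⟨ ≐-sym (assoc _ _ _) ⟩
      w ^ᶻ p ∙ g ∙ w ^ᶻ q′   ≈⟨ ∙-congʳ eq ⟩
      g ∙ w ^ᶻ q ∙ w ^ᶻ q′   ≈⟨ assoc _ _ _ ⟩
      g ∙ (w ^ᶻ q ∙ w ^ᶻ q′) ≈⟨ ∙-congˡ (≐-sym (^ᶻ-+ w q q′)) ⟩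
      g ∙ w ^ᶻ (q + q′)        ∎
    eq⁻ : w ^ᶻ (- p) ∙ g ≈ g ∙ w ^ᶻ (- q)
    eq⁻ = begin
      w ^ᶻ (- p) ∙ g                             ≈⟨ ∙-congʳ (^ᶻ-neg w p) ⟩
      (w ^ᶻ p) ⁻¹ ∙ g                            ≈⟨ ∙-congˡ (≐-sym (identityʳ g)) ⟩
      (w ^ᶻ p) ⁻¹ ∙ (g ∙ ε)                      ≈⟨ ∙-congˡ (∙-congˡ (≐-sym (inverseʳ (w ^ᶻ q)))) ⟩
      (w ^ᶻ p) ⁻¹ ∙ (g ∙ (w ^ᶻ q ∙ (w ^ᶻ q) ⁻¹)) ≈⟨ ∙-congˡ (≐-sym (assoc _ _ _)) ⟩
      (w ^ᶻ p) ⁻¹ ∙ (g ∙ w ^ᶻ q ∙ (w ^ᶻ q) ⁻¹)   ≈⟨ ∙-congˡ (∙-congʳ (≐-sym eq)) ⟩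
      (w ^ᶻ p) ⁻¹ ∙ (w ^ᶻ p ∙ g ∙ (w ^ᶻ q) ⁻¹)   ≈⟨ ∙-congˡ (assoc _ _ _) ⟩
      (w ^ᶻ p) ⁻¹ ∙ (w ^ᶻ p ∙ (g ∙ (w ^ᶻ q) ⁻¹)) ≈⟨ cancelˡ (w ^ᶻ p) _ ⟩
      g ∙ (w ^ᶻ q) ⁻¹                            ≈⟨ ∙-congˡ (≐-sym (^ᶻ-neg w q)) ⟩
      g ∙ w ^ᶻ (- q)                                   ∎

  ^ᶻ-multiple : ∀ w p → w ^ᶻ p ≈ ε → ∀ s → w ^ᶻ (s * p) ≈ ε
  ^ᶻ-multiple w p eq s = begin
    w ^ᶻ (s * p)      ≈⟨ ≐-sym (identityʳ _) ⟩
    w ^ᶻ (s * p) ∙ ε  ≈⟨ ^ᶻ-shift w ε p 0ℤ (≐-trans (identityʳ _) (≐-trans eq (≐-sym (identityʳ ε)))) s ⟩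
    ε ∙ w ^ᶻ (s * 0ℤ) ≡⟨ cong (λ m → ε ∙ w ^ᶻ m) (ℤ.*-zeroʳ s) ⟩
    ε ∙ ε             ≈⟨ identityʳ ε ⟩
    ε                       ∎

  ^ᶻ-mod : ∀ w p → w ^ᶻ p ≈ ε → ∀ i s → w ^ᶻ (i + s * p) ≈ w ^ᶻ i
  ^ᶻ-mod w p eq i s = ≐-trans (^ᶻ-+ w i (s * p))
    (≐-trans (∙-congˡ (^ᶻ-multiple w p eq s)) (identityʳ _))

-- Normal forms in Λ₃

module NormalForm (j : ℕ) (ϵ : ℤ) (ϵ-unit : ϵ ≡ 1ℤ ⊎ ϵ ≡ -1ℤ) where
  open import Data.Integer using (_+_; _*_; _-_; -_)

  N H : ℕ
  N = 2 ^ (3 ℕ.+ j)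
  H = 2 ^ (2 ℕ.+ j)

  -- Exponents, not positions: `e` is now ϵ N, the exponent in the relations for `σ₃`, and differs
  -- from the residue ϵ N / 4 of the same name. Likewise `h` is N/2 as an integer, without a sign.
  n h m e : ℤ
  n = + N
  h = + H
  m = + (2 ^ j)
  e = ϵ * n

  R : List (Word 3 × Word 3)
  R = rotationRelations 4 (2 ℕ.* N) (2 ℕ.* (2 ℕ.* N)) ++
    ( (σ₂ ⁻¹ ∙ σ₁ ≐ σ₁ ⁻¹ ∙ σ₂ ^ᶻ (1ℤ + n))
    ∷ (σ₃ ⁻¹ ∙ σ₂ ≐ σ₂ ^ᶻ (-1ℤ + n) ∙ σ₃ ^ᶻ (- (+ 3) + e))
    ∷ (σ₃ ∙ σ₂ ⁻¹ ≐ σ₂ ^ᶻ (1ℤ + n) ∙ σ₃ ^ᶻ (+ 3 + e))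
    ∷ [])

  open WordPowers R public

  -- Lists of powers keep products flat, so that a relation can be applied in any context by
  -- `within` without steps of reassociation. The record `_≃_` lets the two lists be inferred.
  data Syllable : Set where
    A X Y : ℤ → Syllable

  ⟪_⟫ : Syllable → Word 3
  ⟪ A i ⟫ = σ₁ ^ᶻ i
  ⟪ X i ⟫ = σ₂ ^ᶻ i
  ⟪ Y i ⟫ = σ₃ ^ᶻ i

  val : List Syllable → Word 3
  val []       = ε
  val (s ∷ ss) = ⟪ s ⟫ ∙ val ss

  val-++ : ∀ ss ts → val (ss ++ ts) ≈ val ss ∙ val ts
  val-++ []       ts = ≐-sym (identityˡ _)
  val-++ (s ∷ ss) ts = ≐-trans (∙-congˡ (val-++ ss ts)) (≐-sym (assoc _ _ _))

  infix 4 _≃_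
  record _≃_ (ss ts : List Syllable) : Set where
    constructor equal
    field equality : val ss ≈ val ts

  open _≃_

  ≃-setoid : Setoid 0ℓ 0ℓ
  ≃-setoid = record
    { Carrier = List Syllable
    ; _≈_ = _≃_
    ; isEquivalence = record
      { refl = equal ≐-refl
      ; sym = λ p → equal (≐-sym (equality p))
      ; trans = λ p q → equal (≐-trans (equality p) (equality q))
      }
    }

  ≃-refl : ∀ {ss} → ss ≃ ss
  ≃-refl = equal ≐-refl

  ≃-sym : ∀ {ss ts} → ss ≃ ts → ts ≃ ss
  ≃-sym p = equal (≐-sym (equality p))

  ≃-trans : ∀ {ss ts us} → ss ≃ ts → ts ≃ us → ss ≃ us
  ≃-trans p q = equal (≐-trans (equality p) (equality q))

  ++-cong : ∀ {ss ss′ ts ts′} → ss ≃ ss′ → ts ≃ ts′ → ss ++ ts ≃ ss′ ++ ts′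
  ++-cong {ss} {ss′} {ts} {ts′} p q = equal (≐-trans (val-++ ss ts)
    (≐-trans (∙-cong (equality p) (equality q)) (≐-sym (val-++ ss′ ts′))))

  within : ∀ ps qs {ss ts} → ss ≃ ts → ps ++ ss ++ qs ≃ ps ++ ts ++ qs
  within ps qs p = ++-cong (≃-refl {ps}) (++-cong p (≃-refl {qs}))

  val-∙ : ∀ ss ts {u v} → val ss ≈ u → val ts ≈ v → val (ss ++ ts) ≈ u ∙ v
  val-∙ ss ts p q = ≐-trans (val-++ ss ts) (∙-cong p q)

  single : ∀ s → val (s ∷ []) ≈ ⟪ s ⟫
  single s = identityʳ _

  one : ∀ s {w} → ⟪ s ⟫ ≡ w ∙ ε → val (s ∷ []) ≈ w
  one s {w} eq = ≐-trans (single s) (subst (_≈ w) (sym eq) (identityʳ w))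

  minus-one : ∀ s {w} → ⟪ s ⟫ ≡ (w ∙ ε) ⁻¹ → val (s ∷ []) ≈ w ⁻¹
  minus-one s {w} eq = ≐-trans (single s) (subst (_≈ w ⁻¹) (sym eq) (⁻¹-cong (identityʳ w)))

  a¹ : val (A 1ℤ ∷ []) ≈ σ₁
  a¹ = one (A 1ℤ) refl
  x¹ : val (X 1ℤ ∷ []) ≈ σ₂
  x¹ = one (X 1ℤ) refl
  y¹ : val (Y 1ℤ ∷ []) ≈ σ₃
  y¹ = one (Y 1ℤ) refl
  a⁻¹ : val (A -1ℤ ∷ []) ≈ σ₁ ⁻¹
  a⁻¹ = minus-one (A -1ℤ) refl
  x⁻¹ : val (X -1ℤ ∷ []) ≈ σ₂ ⁻¹
  x⁻¹ = minus-one (X -1ℤ) refl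
  y⁻¹ : val (Y -1ℤ ∷ []) ≈ σ₃ ⁻¹
  y⁻¹ = minus-one (Y -1ℤ) refl

  from-relation : ∀ ss ts {u v} → (u , v) ∈ₗ R → val ss ≈ u → val ts ≈ v → ss ≃ ts
  from-relation ss ts r p q = equal (≐-trans p (≐-trans (relation r) (≐-sym q)))

  square : ∀ ss {w} → (w ^ᶻ (+ 2) , ε) ∈ₗ R → val ss ≈ w → ss ++ ss ++ [] ≃ []
  square ss r p = from-relation (ss ++ ss ++ []) [] r (val-∙ ss (ss ++ []) p (val-∙ ss [] p ≐-refl)) ≐-refl

  a⁴ : σ₁ ^ᶻ (+ 4) ≈ ε
  a⁴ = relation (here refl)
  x²ᴺ : σ₂ ^ᶻ (+ (2 ℕ.* N)) ≈ ε
  x²ᴺ = relation (there (here refl))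
  y⁴ᴺ : σ₃ ^ᶻ (+ (2 ℕ.* (2 ℕ.* N))) ≈ ε
  y⁴ᴺ = relation (there (there (here refl)))

  axax : A 1ℤ ∷ X 1ℤ ∷ A 1ℤ ∷ X 1ℤ ∷ [] ≃ []
  axax = square (A 1ℤ ∷ X 1ℤ ∷ []) (there (there (there (here refl)))) (val-∙ (A 1ℤ ∷ []) (X 1ℤ ∷ []) a¹ x¹)

  xyxy : X 1ℤ ∷ Y 1ℤ ∷ X 1ℤ ∷ Y 1ℤ ∷ [] ≃ []
  xyxy = square (X 1ℤ ∷ Y 1ℤ ∷ []) (there (there (there (there (here refl)))))
      (val-∙ (X 1ℤ ∷ []) (Y 1ℤ ∷ []) x¹ y¹)

  axyaxy : A 1ℤ ∷ X 1ℤ ∷ Y 1ℤ ∷ A 1ℤ ∷ X 1ℤ ∷ Y 1ℤ ∷ [] ≃ []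
  axyaxy = square (A 1ℤ ∷ X 1ℤ ∷ Y 1ℤ ∷ []) (there (there (there (there (there (here refl))))))
    (val-∙ (A 1ℤ ∷ X 1ℤ ∷ []) (Y 1ℤ ∷ []) (val-∙ (A 1ℤ ∷ []) (X 1ℤ ∷ []) a¹ x¹) y¹)

  x⁻a : X -1ℤ ∷ A 1ℤ ∷ [] ≃ A -1ℤ ∷ X (1ℤ + n) ∷ []
  x⁻a = from-relation (X -1ℤ ∷ A 1ℤ ∷ []) (A -1ℤ ∷ X (1ℤ + n) ∷ [])
      (there (there (there (there (there (there (here refl)))))))
    (val-∙ (X -1ℤ ∷ []) (A 1ℤ ∷ []) x⁻¹ a¹) (val-∙ (A -1ℤ ∷ []) (X (1ℤ + n) ∷ []) a⁻¹ (single (X (1ℤ + n))))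

  y⁻x : Y -1ℤ ∷ X 1ℤ ∷ [] ≃ X (-1ℤ + n) ∷ Y (- (+ 3) + e) ∷ []
  y⁻x = from-relation (Y -1ℤ ∷ X 1ℤ ∷ []) (X (-1ℤ + n) ∷ Y (- (+ 3) + e) ∷ [])
      (there (there (there (there (there (there (there (here refl))))))))
    (val-∙ (Y -1ℤ ∷ []) (X 1ℤ ∷ []) y⁻¹ x¹)
        (val-∙ (X (-1ℤ + n) ∷ []) (Y (- (+ 3) + e) ∷ []) (single (X (-1ℤ + n))) (single (Y (- (+ 3) + e))))

  yx⁻ : Y 1ℤ ∷ X -1ℤ ∷ [] ≃ X (1ℤ + n) ∷ Y (+ 3 + e) ∷ []
  yx⁻ = from-relation (Y 1ℤ ∷ X -1ℤ ∷ []) (X (1ℤ + n) ∷ Y (+ 3 + e) ∷ [])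
      (there (there (there (there (there (there (there (there (here refl)))))))))
    (val-∙ (Y 1ℤ ∷ []) (X -1ℤ ∷ []) y¹ x⁻¹)
        (val-∙ (X (1ℤ + n) ∷ []) (Y (+ 3 + e) ∷ []) (single (X (1ℤ + n))) (single (Y (+ 3 + e))))

  A+ : ∀ i k {l} → i + k ≡ l → A i ∷ A k ∷ [] ≃ A l ∷ []
  A+ i k refl = equal (≐-trans (∙-congˡ (identityʳ _)) (≐-trans (≐-sym (^ᶻ-+ σ₁ i k)) (≐-sym (identityʳ _))))
  X+ : ∀ i k {l} → i + k ≡ l → X i ∷ X k ∷ [] ≃ X l ∷ []
  X+ i k refl = equal (≐-trans (∙-congˡ (identityʳ _)) (≐-trans (≐-sym (^ᶻ-+ σ₂ i k)) (≐-sym (identityʳ _))))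
  Y+ : ∀ i k {l} → i + k ≡ l → Y i ∷ Y k ∷ [] ≃ Y l ∷ []
  Y+ i k refl = equal (≐-trans (∙-congˡ (identityʳ _)) (≐-trans (≐-sym (^ᶻ-+ σ₃ i k)) (≐-sym (identityʳ _))))

  A0 : A 0ℤ ∷ [] ≃ []
  A0 = equal (identityʳ ε)
  X0 : X 0ℤ ∷ [] ≃ []
  X0 = equal (identityʳ ε)
  Y0 : Y 0ℤ ∷ [] ≃ []
  Y0 = equal (identityʳ ε)

  A± : ∀ i k → i + k ≡ 0ℤ → A i ∷ A k ∷ [] ≃ []
  A± i k eq = ≃-trans (A+ i k eq) A0
  X± : ∀ i k → i + k ≡ 0ℤ → X i ∷ X k ∷ [] ≃ []
  X± i k eq = ≃-trans (X+ i k eq) X0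
  Y± : ∀ i k → i + k ≡ 0ℤ → Y i ∷ Y k ∷ [] ≃ []
  Y± i k eq = ≃-trans (Y+ i k eq) Y0

  X-mod : ∀ i s → X (i + s * + (2 ℕ.* N)) ∷ [] ≃ X i ∷ []
  X-mod i s = equal (∙-congʳ (^ᶻ-mod σ₂ _ x²ᴺ i s))

  Y-mod : ∀ i s → Y (i + s * + (2 ℕ.* (2 ℕ.* N))) ∷ [] ≃ Y i ∷ []
  Y-mod i s = equal (∙-congʳ (^ᶻ-mod σ₃ _ y⁴ᴺ i s))

  module ≃R = SetoidReasoning ≃-setoid

  xy : X 1ℤ ∷ Y 1ℤ ∷ [] ≃ Y -1ℤ ∷ X -1ℤ ∷ []
  xy = ≃R.begin
    X 1ℤ ∷ Y 1ℤ ∷ []                               ≃R.≈⟨ within (X 1ℤ ∷ Y 1ℤ ∷ []) [] (≃-sym (X± 1ℤ -1ℤ refl)) ⟩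
    X 1ℤ ∷ Y 1ℤ ∷ X 1ℤ ∷ X -1ℤ ∷ []
      ≃R.≈⟨ within (X 1ℤ ∷ Y 1ℤ ∷ X 1ℤ ∷ []) (X -1ℤ ∷ []) (≃-sym (Y± 1ℤ -1ℤ refl)) ⟩
    X 1ℤ ∷ Y 1ℤ ∷ X 1ℤ ∷ Y 1ℤ ∷ Y -1ℤ ∷ X -1ℤ ∷ [] ≃R.≈⟨ within [] (Y -1ℤ ∷ X -1ℤ ∷ []) xyxy ⟩
    Y -1ℤ ∷ X -1ℤ ∷ []                                          ≃R.∎

  yx : Y 1ℤ ∷ X 1ℤ ∷ [] ≃ X -1ℤ ∷ Y -1ℤ ∷ []
  yx = ≃R.begin
    Y 1ℤ ∷ X 1ℤ ∷ []                               ≃R.≈⟨ within (Y 1ℤ ∷ X 1ℤ ∷ []) [] (≃-sym (Y± 1ℤ -1ℤ refl)) ⟩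
    Y 1ℤ ∷ X 1ℤ ∷ Y 1ℤ ∷ Y -1ℤ ∷ []
      ≃R.≈⟨ within [] (Y 1ℤ ∷ X 1ℤ ∷ Y 1ℤ ∷ Y -1ℤ ∷ []) (≃-sym (X± -1ℤ 1ℤ refl)) ⟩
    X -1ℤ ∷ X 1ℤ ∷ Y 1ℤ ∷ X 1ℤ ∷ Y 1ℤ ∷ Y -1ℤ ∷ [] ≃R.≈⟨ within (X -1ℤ ∷ []) (Y -1ℤ ∷ []) xyxy ⟩
    X -1ℤ ∷ Y -1ℤ ∷ []                               ≃R.∎

  xyx : X 1ℤ ∷ Y 1ℤ ∷ X 1ℤ ∷ [] ≃ Y -1ℤ ∷ []
  xyx = ≃-trans (within (X 1ℤ ∷ []) [] yx) (within [] (Y -1ℤ ∷ []) (X± 1ℤ -1ℤ refl))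

  ax : A 1ℤ ∷ X 1ℤ ∷ [] ≃ X -1ℤ ∷ A -1ℤ ∷ []
  ax = ≃R.begin
    A 1ℤ ∷ X 1ℤ ∷ []                               ≃R.≈⟨ within (A 1ℤ ∷ X 1ℤ ∷ []) [] (≃-sym (A± 1ℤ -1ℤ refl)) ⟩
    A 1ℤ ∷ X 1ℤ ∷ A 1ℤ ∷ A -1ℤ ∷ []
      ≃R.≈⟨ within (A 1ℤ ∷ X 1ℤ ∷ A 1ℤ ∷ []) (A -1ℤ ∷ []) (≃-sym (X± 1ℤ -1ℤ refl)) ⟩
    A 1ℤ ∷ X 1ℤ ∷ A 1ℤ ∷ X 1ℤ ∷ X -1ℤ ∷ A -1ℤ ∷ [] ≃R.≈⟨ within [] (X -1ℤ ∷ A -1ℤ ∷ []) axax ⟩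
    X -1ℤ ∷ A -1ℤ ∷ []                               ≃R.∎

  xa : X 1ℤ ∷ A 1ℤ ∷ [] ≃ A -1ℤ ∷ X -1ℤ ∷ []
  xa = ≃R.begin
    X 1ℤ ∷ A 1ℤ ∷ []                               ≃R.≈⟨ within (X 1ℤ ∷ A 1ℤ ∷ []) [] (≃-sym (X± 1ℤ -1ℤ refl)) ⟩
    X 1ℤ ∷ A 1ℤ ∷ X 1ℤ ∷ X -1ℤ ∷ []
      ≃R.≈⟨ within [] (X 1ℤ ∷ A 1ℤ ∷ X 1ℤ ∷ X -1ℤ ∷ []) (≃-sym (A± -1ℤ 1ℤ refl)) ⟩
    A -1ℤ ∷ A 1ℤ ∷ X 1ℤ ∷ A 1ℤ ∷ X 1ℤ ∷ X -1ℤ ∷ [] ≃R.≈⟨ within (A -1ℤ ∷ []) (X -1ℤ ∷ []) axax ⟩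
    A -1ℤ ∷ X -1ℤ ∷ []                               ≃R.∎

  xax : X 1ℤ ∷ A 1ℤ ∷ X 1ℤ ∷ [] ≃ A -1ℤ ∷ []
  xax = ≃-trans (within [] (X 1ℤ ∷ []) xa) (within (A -1ℤ ∷ []) [] (X± -1ℤ 1ℤ refl))

  yx² : Y 1ℤ ∷ X (+ 2) ∷ [] ≃ X (- (+ 2) + n) ∷ Y (- (+ 3) + e) ∷ []
  yx² = ≃R.begin
    Y 1ℤ ∷ X (+ 2) ∷ []
      ≃R.≈⟨ within (Y 1ℤ ∷ []) [] (≃-sym (X+ 1ℤ 1ℤ refl)) ⟩
    Y 1ℤ ∷ X 1ℤ ∷ X 1ℤ ∷ []
      ≃R.≈⟨ within [] (Y 1ℤ ∷ X 1ℤ ∷ X 1ℤ ∷ []) (≃-sym (X± -1ℤ 1ℤ refl)) ⟩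
    X -1ℤ ∷ X 1ℤ ∷ Y 1ℤ ∷ X 1ℤ ∷ X 1ℤ ∷ []
      ≃R.≈⟨ within (X -1ℤ ∷ []) (X 1ℤ ∷ []) xyx ⟩
    X -1ℤ ∷ Y -1ℤ ∷ X 1ℤ ∷ []
      ≃R.≈⟨ within (X -1ℤ ∷ []) [] y⁻x ⟩
    X -1ℤ ∷ X (-1ℤ + n) ∷ Y (- (+ 3) + e) ∷ []
      ≃R.≈⟨ within [] (Y (- (+ 3) + e) ∷ []) (X+ -1ℤ (-1ℤ + n) (sum n)) ⟩
    X (- (+ 2) + n) ∷ Y (- (+ 3) + e) ∷ []
      ≃R.∎
    where
    sum : ∀ n → -1ℤ + (-1ℤ + n) ≡ - (+ 2) + n
    sum = solve-∀

  y⁻x⁻² : Y -1ℤ ∷ X (- (+ 2)) ∷ [] ≃ X (+ 2 + n) ∷ Y (+ 3 + e) ∷ []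
  y⁻x⁻² = ≃R.begin
    Y -1ℤ ∷ X (- (+ 2)) ∷ []
      ≃R.≈⟨ within [] (X (- (+ 2)) ∷ []) (≃-sym xyx) ⟩
    X 1ℤ ∷ Y 1ℤ ∷ X 1ℤ ∷ X (- (+ 2)) ∷ []
      ≃R.≈⟨ within (X 1ℤ ∷ Y 1ℤ ∷ []) [] (X+ 1ℤ (- (+ 2)) refl) ⟩
    X 1ℤ ∷ Y 1ℤ ∷ X -1ℤ ∷ []
      ≃R.≈⟨ within (X 1ℤ ∷ []) [] yx⁻ ⟩
    X 1ℤ ∷ X (1ℤ + n) ∷ Y (+ 3 + e) ∷ []
      ≃R.≈⟨ within [] (Y (+ 3 + e) ∷ []) (X+ 1ℤ (1ℤ + n) (sum n)) ⟩
    X (+ 2 + n) ∷ Y (+ 3 + e) ∷ []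
      ≃R.∎
    where
    sum : ∀ n → 1ℤ + (1ℤ + n) ≡ + 2 + n
    sum = solve-∀

  -- The inverse of both sides of `y⁻x⁻²`. Together with `yx²` it evaluates one element in two ways,
  -- which yields a commutation rule that neither relation gives alone.
  x²y : X (+ 2) ∷ Y 1ℤ ∷ [] ≃ Y (- (+ 3 + e)) ∷ X (- (+ 2 + n)) ∷ []
  x²y = ≃R.begin
    X (+ 2) ∷ Y 1ℤ ∷ []
      ≃R.≈⟨ within [] (X (+ 2) ∷ Y 1ℤ ∷ []) (≃-sym (Y± (- (+ 3 + e)) (+ 3 + e) (ℤ.+-inverseˡ (+ 3 + e)))) ⟩
    Y (- (+ 3 + e)) ∷ Y (+ 3 + e) ∷ X (+ 2) ∷ Y 1ℤ ∷ []
      ≃R.≈⟨ within (Y (- (+ 3 + e)) ∷ []) (Y (+ 3 + e) ∷ X (+ 2) ∷ Y 1ℤ ∷ [])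
             (≃-sym (X± (- (+ 2 + n)) (+ 2 + n) (ℤ.+-inverseˡ (+ 2 + n)))) ⟩
    Y (- (+ 3 + e)) ∷ X (- (+ 2 + n)) ∷ X (+ 2 + n) ∷ Y (+ 3 + e) ∷ X (+ 2) ∷ Y 1ℤ ∷ []
      ≃R.≈⟨ within (Y (- (+ 3 + e)) ∷ X (- (+ 2 + n)) ∷ []) (X (+ 2) ∷ Y 1ℤ ∷ []) (≃-sym y⁻x⁻²) ⟩
    Y (- (+ 3 + e)) ∷ X (- (+ 2 + n)) ∷ Y -1ℤ ∷ X (- (+ 2)) ∷ X (+ 2) ∷ Y 1ℤ ∷ []
      ≃R.≈⟨ within (Y (- (+ 3 + e)) ∷ X (- (+ 2 + n)) ∷ Y -1ℤ ∷ []) (Y 1ℤ ∷ []) (X± (- (+ 2)) (+ 2) refl) ⟩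
    Y (- (+ 3 + e)) ∷ X (- (+ 2 + n)) ∷ Y -1ℤ ∷ Y 1ℤ ∷ []
      ≃R.≈⟨ within (Y (- (+ 3 + e)) ∷ X (- (+ 2 + n)) ∷ []) [] (Y± -1ℤ 1ℤ refl) ⟩
    Y (- (+ 3 + e)) ∷ X (- (+ 2 + n)) ∷ []
      ≃R.∎

  n≡2h : n ≡ + 2 * h
  n≡2h = ℤ.pos-* 2 H

  h≡4m : h ≡ + 4 * m
  h≡4m = trans (cong +_ (ℕ.^-distribˡ-+-* 2 2 j)) (ℤ.pos-* 4 (2 ^ j))

  2N≡ : + (2 ℕ.* N) ≡ + 2 * n
  2N≡ = ℤ.pos-* 2 N

  4N≡ : + (2 ℕ.* (2 ℕ.* N)) ≡ + 2 * (+ 2 * n)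
  4N≡ = trans (ℤ.pos-* 2 (2 ℕ.* N)) (cong (+ 2 *_) 2N≡)

  ϵ²≡1 : ϵ * ϵ ≡ 1ℤ
  ϵ²≡1 = [ (λ { refl → refl }) , (λ { refl → refl }) ]′ ϵ-unit

  -- Both sides equal y⁻¹ x^(n - 2) y⁻¹, by yx² and x²y.
  y²⁺ᵉx² : Y (+ 2 + e) ∷ X (+ 2) ∷ [] ≃ X (+ 2) ∷ Y (+ 2 - e) ∷ []
  y²⁺ᵉx² = ≃R.begin
    Y (+ 2 + e) ∷ X (+ 2) ∷ []
      ≃R.≈⟨ within (Y (+ 2 + e) ∷ X (+ 2) ∷ []) [] (≃-sym (Y± 1ℤ -1ℤ refl)) ⟩
    Y (+ 2 + e) ∷ X (+ 2) ∷ Y 1ℤ ∷ Y -1ℤ ∷ []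
      ≃R.≈⟨ within (Y (+ 2 + e) ∷ []) (Y -1ℤ ∷ []) x²y ⟩
    Y (+ 2 + e) ∷ Y (- (+ 3 + e)) ∷ X (- (+ 2 + n)) ∷ Y -1ℤ ∷ []
      ≃R.≈⟨ within [] (X (- (+ 2 + n)) ∷ Y -1ℤ ∷ []) (Y+ (+ 2 + e) (- (+ 3 + e)) (sum₁ e)) ⟩
    Y -1ℤ ∷ X (- (+ 2 + n)) ∷ Y -1ℤ ∷ []
      ≃R.≈⟨ within (Y -1ℤ ∷ []) (Y -1ℤ ∷ []) (≃-sym (X-mod (- (+ 2 + n)) 1ℤ)) ⟩
    Y -1ℤ ∷ X (- (+ 2 + n) + 1ℤ * + (2 ℕ.* N)) ∷ Y -1ℤ ∷ []
      ≃R.≡⟨ cong (λ k → Y -1ℤ ∷ X k ∷ Y -1ℤ ∷ []) (trans (cong (λ k → - (+ 2 + n) + 1ℤ * k) 2N≡) (sum₂ n)) ⟩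
    Y -1ℤ ∷ X (- (+ 2) + n) ∷ Y -1ℤ ∷ []
      ≃R.≈⟨ within (Y -1ℤ ∷ X (- (+ 2) + n) ∷ []) [] (≃-sym (Y+ (- (+ 3) + e) (+ 2 - e) (sum₃ e))) ⟩
    Y -1ℤ ∷ X (- (+ 2) + n) ∷ Y (- (+ 3) + e) ∷ Y (+ 2 - e) ∷ []
      ≃R.≈⟨ within (Y -1ℤ ∷ []) (Y (+ 2 - e) ∷ []) (≃-sym yx²) ⟩
    Y -1ℤ ∷ Y 1ℤ ∷ X (+ 2) ∷ Y (+ 2 - e) ∷ []
      ≃R.≈⟨ within [] (X (+ 2) ∷ Y (+ 2 - e) ∷ []) (Y± -1ℤ 1ℤ refl) ⟩
    X (+ 2) ∷ Y (+ 2 - e) ∷ []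
      ≃R.∎
    where
    sum₁ : ∀ e → + 2 + e + - (+ 3 + e) ≡ -1ℤ
    sum₁ = solve-∀
    sum₂ : ∀ n → - (+ 2 + n) + 1ℤ * (+ 2 * n) ≡ - (+ 2) + n
    sum₂ = solve-∀
    sum₃ : ∀ e → - (+ 3) + e + (+ 2 - e) ≡ -1ℤ
    sum₃ = solve-∀

  X-shift : ∀ s p q → X p ∷ s ∷ [] ≃ s ∷ X q ∷ [] → ∀ k → X (k * p) ∷ s ∷ [] ≃ s ∷ X (k * q) ∷ []
  X-shift s p q eq k = equal (≐-trans (val-∙ (X (k * p) ∷ []) (s ∷ []) (single (X (k * p))) (single s))
    (≐-trans (^ᶻ-shift σ₂ ⟪ s ⟫ p q (≐-trans (≐-sym (val-∙ (X p ∷ []) (s ∷ []) (single (X p)) (single s)))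
      (≐-trans (equality eq) (val-∙ (s ∷ []) (X q ∷ []) (single s) (single (X q))))) k)
    (≐-sym (val-∙ (s ∷ []) (X (k * q) ∷ []) (single s) (single (X (k * q)))))))

  Y-shift : ∀ s p q → Y p ∷ s ∷ [] ≃ s ∷ Y q ∷ [] → ∀ k → Y (k * p) ∷ s ∷ [] ≃ s ∷ Y (k * q) ∷ []
  Y-shift s p q eq k = equal (≐-trans (val-∙ (Y (k * p) ∷ []) (s ∷ []) (single (Y (k * p))) (single s))
    (≐-trans (^ᶻ-shift σ₃ ⟪ s ⟫ p q (≐-trans (≐-sym (val-∙ (Y p ∷ []) (s ∷ []) (single (Y p)) (single s)))
      (≐-trans (equality eq) (val-∙ (s ∷ []) (Y q ∷ []) (single s) (single (Y q))))) k)
    (≐-sym (val-∙ (s ∷ []) (Y (k * q) ∷ []) (single s) (single (Y (k * q)))))))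

  -- 1 - ϵ h inverts 1 + e / 2 modulo 2 n.
  unit : ℤ
  unit = 1ℤ - ϵ * h

  -- The preceding rule, taken to the power `unit`, has on the left the exponent (1 - ϵ h)(2 + 2 ϵ
  -- h) = 2 - 2 h². Since 2 h² = 4 m n is a multiple of the exponent 4 n that kills `σ₃`, this is 2.
  y²x² : Y (+ 2) ∷ X (+ 2) ∷ [] ≃ X (+ 2) ∷ Y (unit * unit * + 2) ∷ []
  y²x² = ≃R.begin
    Y (+ 2) ∷ X (+ 2) ∷ []
      ≃R.≈⟨ within [] (X (+ 2) ∷ []) (≃-sym (Y-mod (+ 2) (- m))) ⟩
    Y (+ 2 + (- m) * + (2 ℕ.* (2 ℕ.* N))) ∷ X (+ 2) ∷ []
      ≃R.≡⟨ cong (λ k → Y k ∷ X (+ 2) ∷ []) (sym exponent) ⟩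
    Y (unit * (+ 2 + e)) ∷ X (+ 2) ∷ []
      ≃R.≈⟨ Y-shift (X (+ 2)) (+ 2 + e) (+ 2 - e) y²⁺ᵉx² unit ⟩
    X (+ 2) ∷ Y (unit * (+ 2 - e)) ∷ []
      ≃R.≡⟨ cong (λ k → X (+ 2) ∷ Y k ∷ []) (trans (cong (λ n → unit * (+ 2 - ϵ * n)) n≡2h) (expand′ ϵ h)) ⟩
    X (+ 2) ∷ Y (unit * unit * + 2) ∷ []
      ≃R.∎
    where
    expand : ∀ ϵ h → (1ℤ - ϵ * h) * (+ 2 + ϵ * (+ 2 * h)) ≡ + 2 - + 2 * (ϵ * ϵ) * (h * h)
    expand = solve-∀
    expand′ : ∀ ϵ h → (1ℤ - ϵ * h) * (+ 2 - ϵ * (+ 2 * h)) ≡ (1ℤ - ϵ * h) * (1ℤ - ϵ * h) * + 2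
    expand′ = solve-∀
    collect : ∀ h m → + 2 - + 2 * 1ℤ * (h * (+ 4 * m)) ≡ + 2 + (- m) * (+ 2 * (+ 2 * (+ 2 * h)))
    collect = solve-∀
    exponent : unit * (+ 2 + e) ≡ + 2 + (- m) * + (2 ℕ.* (2 ℕ.* N))
    exponent = begin
      unit * (+ 2 + ϵ * n)                    ≡⟨ cong (λ n → unit * (+ 2 + ϵ * n)) n≡2h ⟩
      unit * (+ 2 + ϵ * (+ 2 * h))            ≡⟨ expand ϵ h ⟩
      + 2 - + 2 * (ϵ * ϵ) * (h * h)           ≡⟨ cong₂ (λ u k → + 2 - + 2 * u * (h * k)) ϵ²≡1 h≡4m ⟩
      + 2 - + 2 * 1ℤ * (h * (+ 4 * m))        ≡⟨ collect h m ⟩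
      + 2 + (- m) * (+ 2 * (+ 2 * (+ 2 * h))) ≡⟨ cong (λ n → + 2 + (- m) * (+ 2 * (+ 2 * n))) (sym n≡2h) ⟩
      + 2 + (- m) * (+ 2 * (+ 2 * n))         ≡⟨ cong (λ k → + 2 + (- m) * k) (sym 4N≡) ⟩
      + 2 + (- m) * + (2 ℕ.* (2 ℕ.* N))                        ∎
      where open ≡-Reasoning

  parity : ∀ k → ∃[ s ] (k ≡ s * + 2 ⊎ k ≡ 1ℤ + s * + 2)
  parity k = k ℤ./ℕ 2 , residue (k ℤ.%ℕ 2) (n%ℕd<d k 2) (a≡a%ℕn+[a/ℕn]*n k 2)
    where
    residue : ∀ r → r ℕ.< 2 → ∀ {s} → k ≡ + r + s → k ≡ s ⊎ k ≡ 1ℤ + s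
    residue 0 _ eq = inj₁ (trans eq (ℤ.+-identityˡ _))
    residue 1 _ eq = inj₂ eq
    residue (suc (suc r)) (s≤s (s≤s ())) _

  InXY InX²Y : List Syllable → Set
  InXY ss  = ∃₂ λ i k → ss ≃ X i ∷ Y k ∷ []
  InX²Y ss = ∃₂ λ i k → ss ≃ X (i * + 2) ∷ Y k ∷ []

  -- Even powers of `σ₃` pass `σ₂ ^ 2` as even powers. An odd power therefore costs only a single
  -- use of `yx²`, which again leaves an even power of `σ₂`.
  y-even-x² : ∀ s → ∃[ t ] (Y (s * + 2) ∷ X (+ 2) ∷ [] ≃ X (+ 2) ∷ Y (t * + 2) ∷ [])
  y-even-x² s = s * (unit * unit) , ≃-trans (Y-shift (X (+ 2)) (+ 2) (unit * unit * + 2) y²x² s)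
    (≃R.begin
      X (+ 2) ∷ Y (s * (unit * unit * + 2)) ∷ []
        ≃R.≡⟨ cong (λ k → X (+ 2) ∷ Y k ∷ []) (sym (ℤ.*-assoc s (unit * unit) (+ 2))) ⟩
      X (+ 2) ∷ Y (s * (unit * unit) * + 2) ∷ []  ≃R.∎)

  even-suc : ∀ u → + 2 + + u * + 2 ≡ + suc u * + 2
  even-suc u = sym (ℤ.suc-* (+ u) (+ 2))

  y-even-x-even : ∀ u s → ∃[ t ] (Y (s * + 2) ∷ X (+ u * + 2) ∷ [] ≃ X (+ u * + 2) ∷ Y (t * + 2) ∷ [])
  y-even-x-even zero s = s , ≃-trans (within (Y (s * + 2) ∷ []) [] X0) (≃-sym (within [] (Y (s * + 2) ∷ []) X0))
  y-even-x-even (suc u) s = let t , p = y-even-x² s ; t′ , q = y-even-x-even u t in t′ , (≃R.begin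
    Y (s * + 2) ∷ X (+ suc u * + 2) ∷ []
      ≃R.≈⟨ within (Y (s * + 2) ∷ []) [] (≃-sym (X+ (+ 2) (+ u * + 2) (even-suc u))) ⟩
    Y (s * + 2) ∷ X (+ 2) ∷ X (+ u * + 2) ∷ []
      ≃R.≈⟨ within [] (X (+ u * + 2) ∷ []) p ⟩
    X (+ 2) ∷ Y (t * + 2) ∷ X (+ u * + 2) ∷ []
      ≃R.≈⟨ within (X (+ 2) ∷ []) [] q ⟩
    X (+ 2) ∷ X (+ u * + 2) ∷ Y (t′ * + 2) ∷ []
      ≃R.≈⟨ within [] (Y (t′ * + 2) ∷ []) (X+ (+ 2) (+ u * + 2) (even-suc u)) ⟩
    X (+ suc u * + 2) ∷ Y (t′ * + 2) ∷ []
      ≃R.∎)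

  n-2-even : ∃[ u ] - (+ 2) + n ≡ + u * + 2
  n-2-even = predecessor H (ℕ.m^n>0 2 (2 ℕ.+ j)) n≡2h
    where
    lemma : ∀ u → - (+ 2) + + 2 * (1ℤ + u) ≡ u * + 2
    lemma = solve-∀
    predecessor : ∀ h → 0 ℕ.< h → n ≡ + 2 * + h → ∃[ u ] - (+ 2) + n ≡ + u * + 2
    predecessor (suc u) _ eq = u , trans (cong (λ k → - (+ 2) + k) eq) (lemma (+ u))

  y-x² : ∀ k → InX²Y (Y k ∷ X (+ 2) ∷ [])
  y-x² k = by-parity (proj₁ (parity k)) (proj₂ (parity k))
    where
    by-parity : ∀ {k} s → k ≡ s * + 2 ⊎ k ≡ 1ℤ + s * + 2 → InX²Y (Y k ∷ X (+ 2) ∷ [])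
    by-parity s (inj₁ refl) = let t , p = y-even-x² s in 1ℤ , t * + 2 , p
    by-parity s (inj₂ refl) = let u , even = n-2-even ; t , p = y-even-x-even u s in
      + u , t * + 2 + (- (+ 3) + e) , (≃R.begin
      Y (1ℤ + s * + 2) ∷ X (+ 2) ∷ []
        ≃R.≈⟨ within [] (X (+ 2) ∷ []) (≃-sym (Y+ (s * + 2) 1ℤ (ℤ.+-comm (s * + 2) 1ℤ))) ⟩
      Y (s * + 2) ∷ Y 1ℤ ∷ X (+ 2) ∷ []
        ≃R.≈⟨ within (Y (s * + 2) ∷ []) [] yx² ⟩
      Y (s * + 2) ∷ X (- (+ 2) + n) ∷ Y (- (+ 3) + e) ∷ []
        ≃R.≡⟨ cong (λ k → Y (s * + 2) ∷ X k ∷ Y (- (+ 3) + e) ∷ []) even ⟩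
      Y (s * + 2) ∷ X (+ u * + 2) ∷ Y (- (+ 3) + e) ∷ []
        ≃R.≈⟨ within [] (Y (- (+ 3) + e) ∷ []) p ⟩
      X (+ u * + 2) ∷ Y (t * + 2) ∷ Y (- (+ 3) + e) ∷ []
        ≃R.≈⟨ within (X (+ u * + 2) ∷ []) [] (Y+ (t * + 2) (- (+ 3) + e) refl) ⟩
      X (+ u * + 2) ∷ Y (t * + 2 + (- (+ 3) + e)) ∷ []
        ≃R.∎)

  y-x-even : ∀ u k → InX²Y (Y k ∷ X (+ u * + 2) ∷ [])
  y-x-even zero k = 0ℤ , k , ≃-trans (within (Y k ∷ []) [] X0) (≃-sym (within [] (Y k ∷ []) X0))
  y-x-even (suc u) k = extend (y-x² k)
    where
    extend : InX²Y (Y k ∷ X (+ 2) ∷ []) → InX²Y (Y k ∷ X (+ suc u * + 2) ∷ [])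
    extend (i , k₁ , p) = finish (y-x-even u k₁)
      where
      finish : InX²Y (Y k₁ ∷ X (+ u * + 2) ∷ []) → InX²Y (Y k ∷ X (+ suc u * + 2) ∷ [])
      finish (i′ , k₂ , q) = i + i′ , k₂ , (≃R.begin
        Y k ∷ X (+ suc u * + 2) ∷ []
          ≃R.≈⟨ within (Y k ∷ []) [] (≃-sym (X+ (+ 2) (+ u * + 2) (even-suc u))) ⟩
        Y k ∷ X (+ 2) ∷ X (+ u * + 2) ∷ []
          ≃R.≈⟨ within [] (X (+ u * + 2) ∷ []) p ⟩
        X (i * + 2) ∷ Y k₁ ∷ X (+ u * + 2) ∷ []
          ≃R.≈⟨ within (X (i * + 2) ∷ []) [] q ⟩
        X (i * + 2) ∷ X (i′ * + 2) ∷ Y k₂ ∷ []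
          ≃R.≈⟨ within [] (Y k₂ ∷ []) (X+ (i * + 2) (i′ * + 2) (sym (ℤ.*-distribʳ-+ (+ 2) i i′))) ⟩
        X ((i + i′) * + 2) ∷ Y k₂ ∷ []
          ≃R.∎)

  n-even : n ≡ + H * + 2
  n-even = trans n≡2h (ℤ.*-comm (+ 2) h)

  -- Induction in steps of two, from y² x = y x⁻¹ y⁻¹ = x ^ (1 + n) y ^ (2 + e). The remaining power
  -- of y passes x by induction and then x ^ n, whose exponent is even.
  ypow-x : ∀ k → InXY (Y (+ k) ∷ X 1ℤ ∷ [])
  ypow-x 0 = 1ℤ , 0ℤ , ≃-trans (within [] (X 1ℤ ∷ []) Y0) (≃-sym (within (X 1ℤ ∷ []) [] Y0))
  ypow-x 1 = -1ℤ , -1ℤ , yx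
  ypow-x (suc (suc k)) = extend (ypow-x k)
    where
    extend : InXY (Y (+ k) ∷ X 1ℤ ∷ []) → InXY (Y (+ suc (suc k)) ∷ X 1ℤ ∷ [])
    extend (i , k₁ , p) = finish (y-x-even H k₁)
      where
      finish : InX²Y (Y k₁ ∷ X (+ H * + 2) ∷ []) → InXY (Y (+ suc (suc k)) ∷ X 1ℤ ∷ [])
      finish (i′ , k₂ , q) = i + i′ * + 2 , k₂ + (+ 2 + e) , (≃R.begin
        Y (+ suc (suc k)) ∷ X 1ℤ ∷ []
          ≃R.≈⟨ within [] (X 1ℤ ∷ []) (≃-sym (Y+ (+ k) (+ 2) (ℤ.+-comm (+ k) (+ 2)))) ⟩
        Y (+ k) ∷ Y (+ 2) ∷ X 1ℤ ∷ []
          ≃R.≈⟨ within (Y (+ k) ∷ []) (X 1ℤ ∷ []) (≃-sym (Y+ 1ℤ 1ℤ refl)) ⟩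
        Y (+ k) ∷ Y 1ℤ ∷ Y 1ℤ ∷ X 1ℤ ∷ []
          ≃R.≈⟨ within (Y (+ k) ∷ Y 1ℤ ∷ []) [] yx ⟩
        Y (+ k) ∷ Y 1ℤ ∷ X -1ℤ ∷ Y -1ℤ ∷ []
          ≃R.≈⟨ within (Y (+ k) ∷ []) (Y -1ℤ ∷ []) yx⁻ ⟩
        Y (+ k) ∷ X (1ℤ + n) ∷ Y (+ 3 + e) ∷ Y -1ℤ ∷ []
          ≃R.≈⟨ within (Y (+ k) ∷ X (1ℤ + n) ∷ []) [] (Y+ (+ 3 + e) -1ℤ (sum e)) ⟩
        Y (+ k) ∷ X (1ℤ + n) ∷ Y (+ 2 + e) ∷ []
          ≃R.≈⟨ within (Y (+ k) ∷ []) (Y (+ 2 + e) ∷ []) (≃-sym (X+ 1ℤ n refl)) ⟩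
        Y (+ k) ∷ X 1ℤ ∷ X n ∷ Y (+ 2 + e) ∷ []
          ≃R.≈⟨ within [] (X n ∷ Y (+ 2 + e) ∷ []) p ⟩
        X i ∷ Y k₁ ∷ X n ∷ Y (+ 2 + e) ∷ []
          ≃R.≡⟨ cong (λ n → X i ∷ Y k₁ ∷ X n ∷ Y (+ 2 + e) ∷ []) n-even ⟩
        X i ∷ Y k₁ ∷ X (+ H * + 2) ∷ Y (+ 2 + e) ∷ []
          ≃R.≈⟨ within (X i ∷ []) (Y (+ 2 + e) ∷ []) q ⟩
        X i ∷ X (i′ * + 2) ∷ Y k₂ ∷ Y (+ 2 + e) ∷ []
          ≃R.≈⟨ within [] (Y k₂ ∷ Y (+ 2 + e) ∷ []) (X+ i (i′ * + 2) refl) ⟩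
        X (i + i′ * + 2) ∷ Y k₂ ∷ Y (+ 2 + e) ∷ []
          ≃R.≈⟨ within (X (i + i′ * + 2) ∷ []) [] (Y+ k₂ (+ 2 + e) refl) ⟩
        X (i + i′ * + 2) ∷ Y (k₂ + (+ 2 + e)) ∷ []
          ≃R.∎)
        where
        sum : ∀ e → + 3 + e + -1ℤ ≡ + 2 + e
        sum = solve-∀

  -- The involutions a x y, a x and x y give y a = a x² y. Each step thus creates only a factor x²,
  -- past which powers of y are already known to move.
  ypow-a : ∀ k → ∃₂ λ p q → Y (+ k) ∷ A 1ℤ ∷ [] ≃ A 1ℤ ∷ X p ∷ Y q ∷ []
  ypow-a zero = 0ℤ , 0ℤ , ≃-trans (within [] (A 1ℤ ∷ []) Y0)
    (≃-sym (≃-trans (within (A 1ℤ ∷ []) (Y 0ℤ ∷ []) X0) (within (A 1ℤ ∷ []) [] Y0)))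
  ypow-a (suc k) = extend (ypow-a k)
    where
    ya : Y 1ℤ ∷ A 1ℤ ∷ [] ≃ A 1ℤ ∷ X (+ 2) ∷ Y 1ℤ ∷ []
    ya = ≃R.begin
      Y 1ℤ ∷ A 1ℤ ∷ []
        ≃R.≈⟨ within (Y 1ℤ ∷ A 1ℤ ∷ []) [] (≃-sym (X± 1ℤ -1ℤ refl)) ⟩
      Y 1ℤ ∷ A 1ℤ ∷ X 1ℤ ∷ X -1ℤ ∷ []
        ≃R.≈⟨ within (Y 1ℤ ∷ A 1ℤ ∷ X 1ℤ ∷ []) (X -1ℤ ∷ []) (≃-sym (Y± 1ℤ -1ℤ refl)) ⟩
      Y 1ℤ ∷ A 1ℤ ∷ X 1ℤ ∷ Y 1ℤ ∷ Y -1ℤ ∷ X -1ℤ ∷ []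
        ≃R.≈⟨ within [] (Y 1ℤ ∷ A 1ℤ ∷ X 1ℤ ∷ Y 1ℤ ∷ Y -1ℤ ∷ X -1ℤ ∷ []) (≃-sym (X± -1ℤ 1ℤ refl)) ⟩
      X -1ℤ ∷ X 1ℤ ∷ Y 1ℤ ∷ A 1ℤ ∷ X 1ℤ ∷ Y 1ℤ ∷ Y -1ℤ ∷ X -1ℤ ∷ []
        ≃R.≈⟨ within (X -1ℤ ∷ []) (X 1ℤ ∷ Y 1ℤ ∷ A 1ℤ ∷ X 1ℤ ∷ Y 1ℤ ∷ Y -1ℤ ∷ X -1ℤ ∷ [])
            (≃-sym (A± -1ℤ 1ℤ refl)) ⟩
      X -1ℤ ∷ A -1ℤ ∷ A 1ℤ ∷ X 1ℤ ∷ Y 1ℤ ∷ A 1ℤ ∷ X 1ℤ ∷ Y 1ℤ ∷ Y -1ℤ ∷ X -1ℤ ∷ []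
        ≃R.≈⟨ within (X -1ℤ ∷ A -1ℤ ∷ []) (Y -1ℤ ∷ X -1ℤ ∷ []) axyaxy ⟩
      X -1ℤ ∷ A -1ℤ ∷ Y -1ℤ ∷ X -1ℤ ∷ []
        ≃R.≈⟨ within [] (Y -1ℤ ∷ X -1ℤ ∷ []) (≃-sym ax) ⟩
      A 1ℤ ∷ X 1ℤ ∷ Y -1ℤ ∷ X -1ℤ ∷ []
        ≃R.≈⟨ within (A 1ℤ ∷ X 1ℤ ∷ []) [] (≃-sym xy) ⟩
      A 1ℤ ∷ X 1ℤ ∷ X 1ℤ ∷ Y 1ℤ ∷ []
        ≃R.≈⟨ within (A 1ℤ ∷ []) (Y 1ℤ ∷ []) (X+ 1ℤ 1ℤ refl) ⟩
      A 1ℤ ∷ X (+ 2) ∷ Y 1ℤ ∷ []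
        ≃R.∎
    extend : (∃₂ λ p q → Y (+ k) ∷ A 1ℤ ∷ [] ≃ A 1ℤ ∷ X p ∷ Y q ∷ []) →
      ∃₂ λ p q → Y (+ suc k) ∷ A 1ℤ ∷ [] ≃ A 1ℤ ∷ X p ∷ Y q ∷ []
    extend (p , q , eq) = finish (y-x² q)
      where
      finish : InX²Y (Y q ∷ X (+ 2) ∷ []) → ∃₂ λ p q → Y (+ suc k) ∷ A 1ℤ ∷ [] ≃ A 1ℤ ∷ X p ∷ Y q ∷ []
      finish (i , q′ , eq′) = p + i * + 2 , q′ + 1ℤ , (≃R.begin
        Y (+ suc k) ∷ A 1ℤ ∷ []
          ≃R.≈⟨ within [] (A 1ℤ ∷ []) (≃-sym (Y+ (+ k) 1ℤ (ℤ.+-comm (+ k) 1ℤ))) ⟩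
        Y (+ k) ∷ Y 1ℤ ∷ A 1ℤ ∷ []
          ≃R.≈⟨ within (Y (+ k) ∷ []) [] ya ⟩
        Y (+ k) ∷ A 1ℤ ∷ X (+ 2) ∷ Y 1ℤ ∷ []
          ≃R.≈⟨ within [] (X (+ 2) ∷ Y 1ℤ ∷ []) eq ⟩
        A 1ℤ ∷ X p ∷ Y q ∷ X (+ 2) ∷ Y 1ℤ ∷ []
          ≃R.≈⟨ within (A 1ℤ ∷ X p ∷ []) (Y 1ℤ ∷ []) eq′ ⟩
        A 1ℤ ∷ X p ∷ X (i * + 2) ∷ Y q′ ∷ Y 1ℤ ∷ []
          ≃R.≈⟨ within (A 1ℤ ∷ []) (Y q′ ∷ Y 1ℤ ∷ []) (X+ p (i * + 2) refl) ⟩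
        A 1ℤ ∷ X (p + i * + 2) ∷ Y q′ ∷ Y 1ℤ ∷ []
          ≃R.≈⟨ within (A 1ℤ ∷ X (p + i * + 2) ∷ []) [] (Y+ q′ 1ℤ refl) ⟩
        A 1ℤ ∷ X (p + i * + 2) ∷ Y (q′ + 1ℤ) ∷ []
          ≃R.∎)

  -- Substituting a⁻¹ = x a x into the relation for x⁻¹ a gives x⁻² a = a x ^ (2 + n). So
  -- conjugation by a preserves the even powers of x.
  x²a : X (+ 2) ∷ A 1ℤ ∷ [] ≃ A 1ℤ ∷ X ((-1ℤ - h) * + 2) ∷ []
  x²a = ≃R.begin
    X (+ 2) ∷ A 1ℤ ∷ []
      ≃R.≈⟨ within (X (+ 2) ∷ A 1ℤ ∷ []) [] (≃-sym (X± (+ 2 + n) (- (+ 2 + n)) (ℤ.+-inverseʳ (+ 2 + n)))) ⟩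
    X (+ 2) ∷ A 1ℤ ∷ X (+ 2 + n) ∷ X (- (+ 2 + n)) ∷ []
      ≃R.≈⟨ within (X (+ 2) ∷ []) (X (- (+ 2 + n)) ∷ []) (≃-sym x⁻²a) ⟩
    X (+ 2) ∷ X (- (+ 2)) ∷ A 1ℤ ∷ X (- (+ 2 + n)) ∷ []
      ≃R.≈⟨ within [] (A 1ℤ ∷ X (- (+ 2 + n)) ∷ []) (X± (+ 2) (- (+ 2)) refl) ⟩
    A 1ℤ ∷ X (- (+ 2 + n)) ∷ []
      ≃R.≡⟨ cong (λ k → A 1ℤ ∷ X k ∷ []) (trans (cong (λ n → - (+ 2 + n)) n≡2h) (halve h)) ⟩
    A 1ℤ ∷ X ((-1ℤ - h) * + 2) ∷ []
      ≃R.∎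
    where
    halve : ∀ h → - (+ 2 + + 2 * h) ≡ (-1ℤ - h) * + 2
    halve = solve-∀
    sum : ∀ n → 1ℤ + (1ℤ + n) ≡ + 2 + n
    sum = solve-∀
    x⁻²a : X (- (+ 2)) ∷ A 1ℤ ∷ [] ≃ A 1ℤ ∷ X (+ 2 + n) ∷ []
    x⁻²a = ≃R.begin
      X (- (+ 2)) ∷ A 1ℤ ∷ []
        ≃R.≈⟨ within [] (A 1ℤ ∷ []) (≃-sym (X+ -1ℤ -1ℤ refl)) ⟩
      X -1ℤ ∷ X -1ℤ ∷ A 1ℤ ∷ []
        ≃R.≈⟨ within (X -1ℤ ∷ []) [] x⁻a ⟩
      X -1ℤ ∷ A -1ℤ ∷ X (1ℤ + n) ∷ []
        ≃R.≈⟨ within (X -1ℤ ∷ []) (X (1ℤ + n) ∷ []) (≃-sym xax) ⟩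
      X -1ℤ ∷ X 1ℤ ∷ A 1ℤ ∷ X 1ℤ ∷ X (1ℤ + n) ∷ []
        ≃R.≈⟨ within [] (A 1ℤ ∷ X 1ℤ ∷ X (1ℤ + n) ∷ []) (X± -1ℤ 1ℤ refl) ⟩
      A 1ℤ ∷ X 1ℤ ∷ X (1ℤ + n) ∷ []
        ≃R.≈⟨ within (A 1ℤ ∷ []) [] (X+ 1ℤ (1ℤ + n) (sum n)) ⟩
      A 1ℤ ∷ X (+ 2 + n) ∷ []
        ≃R.∎

  x-even-a : ∀ s → X (s * + 2) ∷ A 1ℤ ∷ [] ≃ A 1ℤ ∷ X (s * (-1ℤ - h) * + 2) ∷ []
  x-even-a s = ≃-trans (X-shift (A 1ℤ) (+ 2) ((-1ℤ - h) * + 2) x²a s)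
    (≃R.begin
      A 1ℤ ∷ X (s * ((-1ℤ - h) * + 2)) ∷ []
        ≃R.≡⟨ cong (λ k → A 1ℤ ∷ X k ∷ []) (sym (ℤ.*-assoc s (-1ℤ - h) (+ 2))) ⟩
      A 1ℤ ∷ X (s * (-1ℤ - h) * + 2) ∷ []  ≃R.∎)

  a⁻¹≃a³ : A -1ℤ ∷ [] ≃ A 1ℤ ∷ A 1ℤ ∷ A 1ℤ ∷ []
  a⁻¹≃a³ = ≃-trans (≃-sym (equal (∙-congʳ (^ᶻ-mod σ₁ (+ 4) a⁴ -1ℤ 1ℤ))))
    (≃-sym (≃-trans (within [] (A 1ℤ ∷ []) (A+ 1ℤ 1ℤ refl)) (A+ (+ 2) 1ℤ refl)))

  -- Because a⁻¹ = a³, three applications of the rule for a suffice. The inverse of a arises when an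
  -- odd power of x passes a, as x a = a⁻¹ x⁻¹.
  x-even-a⁻¹ : ∀ s → ∃[ t ] (X (s * + 2) ∷ A -1ℤ ∷ [] ≃ A -1ℤ ∷ X t ∷ [])
  x-even-a⁻¹ s = s * u * u * u * + 2 , (≃R.begin
    X (s * + 2) ∷ A -1ℤ ∷ []
      ≃R.≈⟨ within (X (s * + 2) ∷ []) [] a⁻¹≃a³ ⟩
    X (s * + 2) ∷ A 1ℤ ∷ A 1ℤ ∷ A 1ℤ ∷ []
      ≃R.≈⟨ within [] (A 1ℤ ∷ A 1ℤ ∷ []) (x-even-a s) ⟩
    A 1ℤ ∷ X (s * u * + 2) ∷ A 1ℤ ∷ A 1ℤ ∷ []
      ≃R.≈⟨ within (A 1ℤ ∷ []) (A 1ℤ ∷ []) (x-even-a (s * u)) ⟩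
    A 1ℤ ∷ A 1ℤ ∷ X (s * u * u * + 2) ∷ A 1ℤ ∷ []
      ≃R.≈⟨ within (A 1ℤ ∷ A 1ℤ ∷ []) [] (x-even-a (s * u * u)) ⟩
    A 1ℤ ∷ A 1ℤ ∷ A 1ℤ ∷ X (s * u * u * u * + 2) ∷ []
      ≃R.≈⟨ within [] (X (s * u * u * u * + 2) ∷ []) (≃-sym a⁻¹≃a³) ⟩
    A -1ℤ ∷ X (s * u * u * u * + 2) ∷ []
      ≃R.∎)
    where u = -1ℤ - h

  xpow-a : ∀ k → ∃₂ λ i t → X k ∷ A 1ℤ ∷ [] ≃ A i ∷ X t ∷ []
  xpow-a k = by-parity (proj₁ (parity k)) (proj₂ (parity k))
    where
    by-parity : ∀ {k} s → k ≡ s * + 2 ⊎ k ≡ 1ℤ + s * + 2 → ∃₂ λ i t → X k ∷ A 1ℤ ∷ [] ≃ A i ∷ X t ∷ []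
    by-parity s (inj₁ refl) = 1ℤ , _ , x-even-a s
    by-parity s (inj₂ refl) = let t , p = x-even-a⁻¹ s in -1ℤ , t + -1ℤ , (≃R.begin
      X (1ℤ + s * + 2) ∷ A 1ℤ ∷ []
        ≃R.≈⟨ within [] (A 1ℤ ∷ []) (≃-sym (X+ (s * + 2) 1ℤ (ℤ.+-comm (s * + 2) 1ℤ))) ⟩
      X (s * + 2) ∷ X 1ℤ ∷ A 1ℤ ∷ []
        ≃R.≈⟨ within (X (s * + 2) ∷ []) [] xa ⟩
      X (s * + 2) ∷ A -1ℤ ∷ X -1ℤ ∷ []
        ≃R.≈⟨ within [] (X -1ℤ ∷ []) p ⟩
      A -1ℤ ∷ X t ∷ X -1ℤ ∷ []
        ≃R.≈⟨ within (A -1ℤ ∷ []) [] (X+ t -1ℤ refl) ⟩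
      A -1ℤ ∷ X (t + -1ℤ) ∷ []
        ≃R.∎)

  Y-natural : ∀ k → ∃[ l ] (l ℕ.< 2 ℕ.* (2 ℕ.* N) × Y k ∷ [] ≃ Y (+ l) ∷ [])
  Y-natural k = k ℤ.%ℕ (2 ℕ.* (2 ℕ.* N)) , n%ℕd<d k (2 ℕ.* (2 ℕ.* N)) , (≃R.begin
    Y k ∷ [] ≃R.≡⟨ cong (λ k → Y k ∷ []) (a≡a%ℕn+[a/ℕn]*n k (2 ℕ.* (2 ℕ.* N))) ⟩
    _        ≃R.≈⟨ Y-mod (+ (k ℤ.%ℕ (2 ℕ.* (2 ℕ.* N)))) (k ℤ./ℕ (2 ℕ.* (2 ℕ.* N))) ⟩
    _         ≃R.∎)
    where instance _ = ℕ.m^n≢0 2 (5 ℕ.+ j)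

  X-natural : ∀ k → ∃[ l ] (l ℕ.< 2 ℕ.* N × X k ∷ [] ≃ X (+ l) ∷ [])
  X-natural k = k ℤ.%ℕ (2 ℕ.* N) , n%ℕd<d k (2 ℕ.* N) , (≃R.begin
    X k ∷ [] ≃R.≡⟨ cong (λ k → X k ∷ []) (a≡a%ℕn+[a/ℕn]*n k (2 ℕ.* N)) ⟩
    _        ≃R.≈⟨ X-mod (+ (k ℤ.%ℕ (2 ℕ.* N))) (k ℤ./ℕ (2 ℕ.* N)) ⟩
    _         ≃R.∎)
    where instance _ = ℕ.m^n≢0 2 (4 ℕ.+ j)

  A-natural : ∀ k → ∃[ l ] (l ℕ.< 4 × A k ∷ [] ≃ A (+ l) ∷ [])
  A-natural k = k ℤ.%ℕ 4 , n%ℕd<d k 4 , (≃R.begin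
    A k ∷ [] ≃R.≡⟨ cong (λ k → A k ∷ []) (a≡a%ℕn+[a/ℕn]*n k 4) ⟩
    A (+ (k ℤ.%ℕ 4) + (k ℤ./ℕ 4) * + 4) ∷ []
              ≃R.≈⟨ equal (∙-congʳ (^ᶻ-mod σ₁ (+ 4) a⁴ (+ (k ℤ.%ℕ 4)) (k ℤ./ℕ 4))) ⟩
    A (+ (k ℤ.%ℕ 4)) ∷ []
              ≃R.∎)

  record Normal (w : Word 3) : Set where
    constructor normal
    field
      a x y : ℤ
      form : w ≈ val (A a ∷ X x ∷ Y y ∷ [])

  normal-resp : ∀ {u v} → u ≈ v → Normal v → Normal u
  normal-resp p (normal a x y q) = normal a x y (≐-trans p q)

  append : ∀ {w} ss s t {u} → w ≈ val ss → ⟪ s ⟫ ≈ u → ss ++ s ∷ [] ≃ t → w ∙ u ≈ val t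
  append ss s t p q r = ≐-trans (≐-sym (val-∙ ss (s ∷ []) (≐-sym p) (≐-trans (single s) q))) (equality r)

  times-a : ∀ {w} → Normal w → Normal (w ∙ σ₁)
  times-a (normal a x y p) =
    let l , _ , q = Y-natural y ; x₁ , y₁ , r = ypow-a l ; i , t , s = xpow-a x in
    normal (a + i) (t + x₁) y₁
        (append (A a ∷ X x ∷ Y y ∷ []) (A 1ℤ) (A (a + i) ∷ X (t + x₁) ∷ Y y₁ ∷ []) p (identityʳ σ₁) (≃R.begin
      A a ∷ X x ∷ Y y ∷ A 1ℤ ∷ []
        ≃R.≈⟨ within (A a ∷ X x ∷ []) (A 1ℤ ∷ []) q ⟩
      A a ∷ X x ∷ Y (+ l) ∷ A 1ℤ ∷ []
        ≃R.≈⟨ within (A a ∷ X x ∷ []) [] r ⟩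
      A a ∷ X x ∷ A 1ℤ ∷ X x₁ ∷ Y y₁ ∷ []
        ≃R.≈⟨ within (A a ∷ []) (X x₁ ∷ Y y₁ ∷ []) s ⟩
      A a ∷ A i ∷ X t ∷ X x₁ ∷ Y y₁ ∷ []
        ≃R.≈⟨ within [] (X t ∷ X x₁ ∷ Y y₁ ∷ []) (A+ a i refl) ⟩
      A (a + i) ∷ X t ∷ X x₁ ∷ Y y₁ ∷ []
        ≃R.≈⟨ within (A (a + i) ∷ []) (Y y₁ ∷ []) (X+ t x₁ refl) ⟩
      A (a + i) ∷ X (t + x₁) ∷ Y y₁ ∷ []
        ≃R.∎))

  times-x : ∀ {w} → Normal w → Normal (w ∙ σ₂)
  times-x (normal a x y p) = finish (ypow-x l)
    where
    l = proj₁ (Y-natural y)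
    q = proj₂ (proj₂ (Y-natural y))
    finish : InXY (Y (+ l) ∷ X 1ℤ ∷ []) → Normal _
    finish (i , k , r) = normal a (x + i) k
        (append (A a ∷ X x ∷ Y y ∷ []) (X 1ℤ) (A a ∷ X (x + i) ∷ Y k ∷ []) p (identityʳ σ₂) (≃R.begin
      A a ∷ X x ∷ Y y ∷ X 1ℤ ∷ []
        ≃R.≈⟨ within (A a ∷ X x ∷ []) (X 1ℤ ∷ []) q ⟩
      A a ∷ X x ∷ Y (+ l) ∷ X 1ℤ ∷ []
        ≃R.≈⟨ within (A a ∷ X x ∷ []) [] r ⟩
      A a ∷ X x ∷ X i ∷ Y k ∷ []
        ≃R.≈⟨ within (A a ∷ []) (Y k ∷ []) (X+ x i refl) ⟩
      A a ∷ X (x + i) ∷ Y k ∷ []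
        ≃R.∎))

  times-y : ∀ {w} → Normal w → Normal (w ∙ σ₃)
  times-y (normal a x y p) = normal a x (y + 1ℤ)
    (append (A a ∷ X x ∷ Y y ∷ []) (Y 1ℤ) (A a ∷ X x ∷ Y (y + 1ℤ) ∷ []) p (identityʳ σ₃)
        (within (A a ∷ X x ∷ []) [] (Y+ y 1ℤ refl)))

  Preserves : Word 3 → Set
  Preserves u = ∀ {w} → Normal w → Normal (w ∙ u)

  preserves-ε : Preserves ε
  preserves-ε p = normal-resp (identityʳ _) p

  preserves-∙ : ∀ {u v} → Preserves u → Preserves v → Preserves (u ∙ v)
  preserves-∙ P Q p = normal-resp (≐-sym (assoc _ _ _)) (Q (P p))

  preserves-resp : ∀ {u v} → u ≈ v → Preserves u → Preserves v
  preserves-resp e P p = normal-resp (∙-congˡ (≐-sym e)) (P p)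

  preserves-pow : ∀ {u} k → Preserves u → Preserves (pow u k)
  preserves-pow zero    P = preserves-ε
  preserves-pow {u} (suc k) P = preserves-∙ {u} {pow u k} P (preserves-pow k P)

  -- The inverse of a torsion element is a positive power, so no rules for moving inverses of
  -- generators through a normal form are needed.
  inverse-of-torsion : ∀ {u} k → pow u k ≈ ε → 0 ℕ.< k → Preserves u → Preserves (u ⁻¹)
  inverse-of-torsion {u} (suc k) eq _ P = preserves-resp
    (≐-trans (≐-sym (cancelˡ u (pow u k))) (≐-trans (∙-congˡ eq) (identityʳ (u ⁻¹)))) (preserves-pow k P)

  preserves-gen : ∀ i → Preserves (gen i)
  preserves-gen 0F = times-a
  preserves-gen 1F = times-x
  preserves-gen 2F = times-y

  preserves-gen⁻¹ : ∀ i → Preserves (gen i ⁻¹)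
  preserves-gen⁻¹ 0F = inverse-of-torsion 4 a⁴ (s≤s z≤n) times-a
  preserves-gen⁻¹ 1F = inverse-of-torsion (2 ℕ.* N) x²ᴺ (ℕ.m^n>0 2 (4 ℕ.+ j)) times-x
  preserves-gen⁻¹ 2F = inverse-of-torsion (2 ℕ.* (2 ℕ.* N)) y⁴ᴺ (ℕ.m^n>0 2 (5 ℕ.+ j)) times-y

  ε⁻¹ : ε ⁻¹ ≈ ε
  ε⁻¹ = ≐-trans (≐-sym (identityʳ _)) (inverseˡ ε)

  ⁻¹-involutive : ∀ u → u ⁻¹ ⁻¹ ≈ u
  ⁻¹-involutive u = ≐-trans (≐-sym (identityʳ _)) (≐-trans (∙-congˡ (≐-sym (inverseˡ u))) (cancelˡ (u ⁻¹) u))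

  -- Words may contain inverses of arbitrary subwords; proving the claim for `u` and `u ⁻¹` together
  -- lets the induction pass through them.
  preserves-word : ∀ u → Preserves u × Preserves (u ⁻¹)
  preserves-word (gen i) = preserves-gen i , preserves-gen⁻¹ i
  preserves-word ε       = preserves-ε , preserves-resp (≐-sym ε⁻¹) preserves-ε
  preserves-word (u ∙ v) = let P , P⁻ = preserves-word u ; Q , Q⁻ = preserves-word v in
    preserves-∙ {u} {v} P Q , preserves-resp (≐-sym (⁻¹-anti u v)) (preserves-∙ {v ⁻¹} {u ⁻¹} Q⁻ P⁻)
  preserves-word (u ⁻¹)  = let P , P⁻ = preserves-word u in P⁻ , preserves-resp (≐-sym (⁻¹-involutive u)) P

  normal-form : ∀ w → ∃[ a ] ∃[ x ] ∃[ y ] (a ℕ.< 4 × x ℕ.< 2 ℕ.* N × y ℕ.< 2 ℕ.* (2 ℕ.* N) ×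
    w ≈ pow σ₁ a ∙ (pow σ₂ x ∙ pow σ₃ y))
  normal-form w = finish (normal-resp (≐-sym (identityˡ w)) (proj₁ (preserves-word w) trivial))
    where
    trivial : Normal ε
    trivial = normal 0ℤ 0ℤ 0ℤ (≐-sym (≐-trans (identityˡ _) (≐-trans (identityˡ _) (identityˡ _))))
    finish : Normal w → _
    finish (normal a x y p) =
      let a′ , a< , q = A-natural a ; x′ , x< , r = X-natural x ; y′ , y< , s = Y-natural y in
      a′ , x′ , y′ , a< , x< , y< ,
      ≐-trans p (≐-trans (equality (++-cong q (++-cong r s))) (∙-congˡ (∙-congˡ (identityʳ _))))

-- The action of Λ₃

module Representation (j : ℕ) (ϵ : ℤ) (ϵ-unit : ϵ ≡ 1ℤ ⊎ ϵ ≡ -1ℤ) where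
  open import Data.Integer using (_+_; _*_; _-_; -_)
  open Counting j ϵ ϵ-unit public
  private
    module P = Polytope polytope
    module NF = NormalForm j ϵ ϵ-unit
  open Isomorphism using (to)

  generator : Fin 3 → Step Z
  generator 0F = α
  generator 1F = χ
  generator 2F = υ

  steps : Word 3 → List (Step Z)
  steps (gen i) = generator i ∷ []
  steps ε       = []
  steps (u ∙ v) = steps u ++ steps v
  steps (u ⁻¹)  = inverse (steps u)

  Sound : Word 3 × Word 3 → Set
  Sound (u , v) = ∀ F → run (steps u) F ≡ run (steps v) F

  sound : ∀ {R} → (∀ {r} → r ∈ₗ R → Sound r) → ∀ {u v} → Derivable R u v → Sound (u , v)
  sound rel (relation r) = rel r
  sound rel ≐-refl F = refl
  sound rel (≐-sym d) F = sym (sound rel d F)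
  sound rel (≐-trans d d′) F = trans (sound rel d F) (sound rel d′ F)
  sound rel (∙-cong {u} {u′} {v} {v′} d d′) F = begin
    run (steps u ++ steps v) F        ≡⟨ run-++ (steps u) (steps v) F ⟩
    run (steps v) (run (steps u) F)   ≡⟨ cong (run (steps v)) (sound rel d F) ⟩
    run (steps v) (run (steps u′) F)  ≡⟨ sound rel d′ (run (steps u′) F) ⟩
    run (steps v′) (run (steps u′) F) ≡⟨ sym (run-++ (steps u′) (steps v′) F) ⟩
    run (steps u′ ++ steps v′) F         ∎
    where open ≡-Reasoning
  sound rel (⁻¹-cong {u} {v} d) F = sym (pullback (steps u) (trans (sound rel d _) (run-inverseʳ (steps v) F)))
  sound rel (assoc u v w) F = cong (λ gs → run gs F) (++-assoc (steps u) (steps v) (steps w))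
  sound rel (identityˡ u) F = refl
  sound rel (identityʳ u) F = run-++ (steps u) [] F
  sound rel (inverseˡ u) F = trans (run-++ (inverse (steps u)) (steps u) F) (run-inverseʳ (steps u) F)
  sound rel (inverseʳ u) F = trans (run-++ (steps u) (inverse (steps u)) F) (run-inverseˡ (steps u) F)

  steps-pow : ∀ i k → steps (pow (gen i) k) ≡ replicate k (generator i)
  steps-pow i zero    = refl
  steps-pow i (suc k) = cong (generator i ∷_) (steps-pow i k)

  -- The law holds in the free group, so soundness is applied with no relations at all; this avoids
  -- a circle with `relations`.
  run-^ᶻ-+ : ∀ w i k F → run (steps (w ^ᶻ (i + k))) F ≡ run (steps (w ^ᶻ k)) (run (steps (w ^ᶻ i)) F)
  run-^ᶻ-+ w i k F = trans (sound (λ ()) (WordPowers.^ᶻ-+ [] w i k) F) (run-++ (steps (w ^ᶻ i)) (steps (w ^ᶻ k)) F)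

  -- N/2 squares of `χ` translate by N/2 times e - 1, and N/2 acts as h.
  χᴺ : ∀ F → run (steps (σ₂ ^ᶻ (+ N))) F ≡ move (χ² (h· (𝕖 ⊖ 𝟙))) F
  χᴺ F = begin
    run (steps (pow σ₂ N)) F         ≡⟨ cong (λ gs → run gs F) (steps-pow 1F N) ⟩
    run (replicate N χ) F            ≡⟨ cong (λ k → run (replicate k χ) F) (ℕ.*-comm 2 half) ⟩
    run (replicate (half ℕ.* 2) χ) F ≡⟨ χ²-power half F ⟩
    move (χ² (half • (𝕖 ⊖ 𝟙))) F     ≡⟨ cong (λ u → move (χ² u) F) (half• (𝕖 ⊖ 𝟙)) ⟩
    move (χ² (h· (𝕖 ⊖ 𝟙))) F                   ∎
    where open ≡-Reasoning

  υᴺ : ∀ F → run (steps (σ₃ ^ᶻ (+ N))) F ≡ move (υ⁴ (quarter • 𝟙)) F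
  υᴺ F = begin
    run (steps (pow σ₃ N)) F            ≡⟨ cong (λ gs → run gs F) (steps-pow 2F N) ⟩
    run (replicate N υ) F
      ≡⟨ cong (λ k → run (replicate k υ) F) (trans (sym (ℕ.*-assoc 2 2 quarter)) (ℕ.*-comm 4 quarter)) ⟩
    run (replicate (quarter ℕ.* 4) υ) F ≡⟨ υ⁴-power quarter F ⟩
    move (υ⁴ (quarter • 𝟙)) F                  ∎
    where open ≡-Reasoning

  -- The origin of e: ϵ N rotations make ϵ N / 4 full turns of four classes each. The sign must be
  -- treated by cases because a negative exponent is an inverse word.
  υᵉ : ∀ F → run (steps (σ₃ ^ᶻ (ϵ * + N))) F ≡ move (υ⁴ 𝕖) F
  υᵉ F = [ positive , negative ]′ ϵ-unit
    where
    open ≡-Reasoning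
    positive : ϵ ≡ 1ℤ → run (steps (σ₃ ^ᶻ (ϵ * + N))) F ≡ move (υ⁴ 𝕖) F
    positive eq = begin
      run (steps (σ₃ ^ᶻ (ϵ * + N))) F
        ≡⟨ cong (λ k → run (steps (σ₃ ^ᶻ k)) F) (trans (cong (_* + N) eq) (ℤ.*-identityˡ (+ N))) ⟩
      run (steps (σ₃ ^ᶻ (+ N))) F     ≡⟨ υᴺ F ⟩
      move (υ⁴ (quarter • 𝟙)) F       ≡⟨ cong (λ u → move (υ⁴ u) F) (quarter•𝟙≡𝕖 eq) ⟩
      move (υ⁴ 𝕖) F                      ∎
    negative : ϵ ≡ -1ℤ → run (steps (σ₃ ^ᶻ (ϵ * + N))) F ≡ move (υ⁴ 𝕖) F
    negative eq = begin
      run (steps (σ₃ ^ᶻ (ϵ * + N))) F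
        ≡⟨ cong (λ k → run (steps (σ₃ ^ᶻ k)) F) (trans (cong (_* + N) eq) (ℤ.-1*i≡-i (+ N))) ⟩
      run (steps (σ₃ ^ᶻ (- + N))) F         ≡⟨ sound (λ ()) (WordPowers.^ᶻ-neg [] σ₃ (+ N)) F ⟩
      run (inverse (steps (σ₃ ^ᶻ (+ N)))) F ≡⟨ sym (pullback (steps (σ₃ ^ᶻ (+ N))) undone) ⟩
      move (υ⁴ 𝕖) F                            ∎
      where
      undone : run (steps (σ₃ ^ᶻ (+ N))) (move (υ⁴ 𝕖) F) ≡ F
      undone = trans (υᴺ (move (υ⁴ 𝕖) F))
        (trans (cong (λ u → move (υ⁴ u) (move (υ⁴ 𝕖) F)) (quarter•𝟙≡⊝𝕖 eq)) (move-inverseˡ (υ⁴ 𝕖) F))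

  relations : ∀ {r} → r ∈ₗ NF.R → Sound r
  relations (here refl) = from-just (agree? (α ∷ α ∷ α ∷ α ∷ []) []) _ _ (λ _ _ _ → refl) (λ _ _ _ → refl) 𝟘
  relations (there (here refl)) F = begin
    run (steps (pow σ₂ (2 ℕ.* N))) F ≡⟨ cong (λ gs → run gs F) (steps-pow 1F (2 ℕ.* N)) ⟩
    run (replicate (2 ℕ.* N) χ) F    ≡⟨ cong (λ k → run (replicate k χ) F) (ℕ.*-comm 2 N) ⟩
    run (replicate (N ℕ.* 2) χ) F    ≡⟨ χ²-power N F ⟩
    move (χ² (N • (𝕖 ⊖ 𝟙))) F        ≡⟨ cong (λ u → move (χ² u) F) (N•≡𝟘 (𝕖 ⊖ 𝟙)) ⟩
    move (χ² 𝟘) F                    ≡⟨ sym (χ²-power 0 F) ⟩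
    F                                    ∎
    where open ≡-Reasoning
  relations (there (there (here refl))) F = begin
    run (steps (pow σ₃ (2 ℕ.* (2 ℕ.* N)))) F ≡⟨ cong (λ gs → run gs F) (steps-pow 2F (2 ℕ.* (2 ℕ.* N))) ⟩
    run (replicate (2 ℕ.* (2 ℕ.* N)) υ) F
      ≡⟨ cong (λ k → run (replicate k υ) F) (trans (sym (ℕ.*-assoc 2 2 N)) (ℕ.*-comm 4 N)) ⟩
    run (replicate (N ℕ.* 4) υ) F            ≡⟨ υ⁴-power N F ⟩
    move (υ⁴ (N • 𝟙)) F                      ≡⟨ cong (λ u → move (υ⁴ u) F) (N•≡𝟘 𝟙) ⟩
    move (υ⁴ 𝟘) F                            ≡⟨ sym (υ⁴-power 0 F) ⟩
    F                                          ∎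
    where open ≡-Reasoning
  relations (there (there (there (here refl)))) =
    from-just (agree? (α ∷ χ ∷ α ∷ χ ∷ []) []) _ _ (λ _ _ _ → refl) (λ _ _ _ → refl) 𝟘
  relations (there (there (there (there (here refl))))) =
    from-just (agree? (χ ∷ υ ∷ χ ∷ υ ∷ []) []) _ _ (λ _ _ _ → refl) (λ _ _ _ → refl) 𝟘
  relations (there (there (there (there (there (here refl)))))) =
    from-just (agree? (α ∷ χ ∷ υ ∷ α ∷ χ ∷ υ ∷ []) []) _ _ (λ _ _ _ → refl) (λ _ _ _ → refl) 𝟘
  -- `agree?` handles only words of fixed length, so the powers with exponents N and ϵ N are
  -- replaced by translations before the check.
  relations (there (there (there (there (there (there (here refl))))))) F = begin
    run (χ⁻ ∷ α ∷ []) F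
      ≡⟨ from-just (agree? (χ⁻ ∷ α ∷ []) (α⁻ ∷ χ ∷ χ² (:h (ee :+ (:- one))) ∷ [])) _ _ (λ _ _ _ → refl)
          (λ _ _ _ → refl) 𝟘 F ⟩
    move (χ² (h· (𝕖 ⊖ 𝟙))) (move χ (move α⁻ F))
      ≡⟨ sym (χᴺ (move χ (move α⁻ F))) ⟩
    run (steps (σ₂ ^ᶻ (+ N))) (move χ (move α⁻ F))
      ≡⟨ sym (run-^ᶻ-+ σ₂ 1ℤ (+ N) (move α⁻ F)) ⟩
    run (steps (σ₂ ^ᶻ (1ℤ + + N))) (move α⁻ F) ∎
    where open ≡-Reasoning
  relations (there (there (there (there (there (there (there (here refl)))))))) F = begin
    run (υ⁻ ∷ χ ∷ []) F
      ≡⟨ from-just (agree? (υ⁻ ∷ χ ∷ []) (χ⁻ ∷ χ² (:h (ee :+ (:- one))) ∷ υ⁻ ∷ υ⁻ ∷ υ⁻ ∷ υ⁴ ee ∷ [])) _ _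
          (λ _ _ _ → refl) (λ _ _ _ → refl) 𝟘 F ⟩
    move (υ⁴ 𝕖) (run (υ⁻ ∷ υ⁻ ∷ υ⁻ ∷ []) (move (χ² (h· (𝕖 ⊖ 𝟙))) (move χ⁻ F)))
      ≡⟨ cong (λ F → move (υ⁴ 𝕖) (run (υ⁻ ∷ υ⁻ ∷ υ⁻ ∷ []) F))
          (sym (trans (run-^ᶻ-+ σ₂ -1ℤ (+ N) F) (χᴺ (move χ⁻ F)))) ⟩
    move (υ⁴ 𝕖) (run (υ⁻ ∷ υ⁻ ∷ υ⁻ ∷ []) F′)
      ≡⟨ sym (trans (run-^ᶻ-+ σ₃ (- (+ 3)) (ϵ * + N) F′) (υᵉ (run (υ⁻ ∷ υ⁻ ∷ υ⁻ ∷ []) F′))) ⟩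
    run (steps (σ₃ ^ᶻ (- (+ 3) + ϵ * + N))) F′
      ≡⟨ sym (run-++ (steps (σ₂ ^ᶻ (-1ℤ + + N))) (steps (σ₃ ^ᶻ (- (+ 3) + ϵ * + N))) F) ⟩
    run (steps (σ₂ ^ᶻ (-1ℤ + + N) ∙ σ₃ ^ᶻ (- (+ 3) + ϵ * + N))) F ∎
    where
    open ≡-Reasoning
    F′ = run (steps (σ₂ ^ᶻ (-1ℤ + + N))) F
  relations (there (there (there (there (there (there (there (there (here refl))))))))) F = begin
    run (υ ∷ χ⁻ ∷ []) F
      ≡⟨ from-just (agree? (υ ∷ χ⁻ ∷ []) (χ ∷ χ² (:h (ee :+ (:- one))) ∷ υ ∷ υ ∷ υ ∷ υ⁴ ee ∷ [])) _ _
          (λ _ _ _ → refl) (λ _ _ _ → refl) 𝟘 F ⟩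
    move (υ⁴ 𝕖) (run (υ ∷ υ ∷ υ ∷ []) (move (χ² (h· (𝕖 ⊖ 𝟙))) (move χ F)))
      ≡⟨ cong (λ F → move (υ⁴ 𝕖) (run (υ ∷ υ ∷ υ ∷ []) F)) (sym (trans (run-^ᶻ-+ σ₂ 1ℤ (+ N) F) (χᴺ (move χ F)))) ⟩
    move (υ⁴ 𝕖) (run (υ ∷ υ ∷ υ ∷ []) F′)
      ≡⟨ sym (trans (run-^ᶻ-+ σ₃ (+ 3) (ϵ * + N) F′) (υᵉ (run (υ ∷ υ ∷ υ ∷ []) F′))) ⟩
    run (steps (σ₃ ^ᶻ (+ 3 + ϵ * + N))) F′
      ≡⟨ sym (run-++ (steps (σ₂ ^ᶻ (1ℤ + + N))) (steps (σ₃ ^ᶻ (+ 3 + ϵ * + N))) F) ⟩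
    run (steps (σ₂ ^ᶻ (1ℤ + + N) ∙ σ₃ ^ᶻ (+ 3 + ϵ * + N))) F ∎
    where
    open ≡-Reasoning
    F′ = run (steps (σ₂ ^ᶻ (1ℤ + + N))) F

  word : ℕ → ℕ → ℕ → Word 3
  word i k l = pow σ₁ i ∙ (pow σ₂ k ∙ pow σ₃ l)

  steps-word : ∀ i k l → steps (word i k l) ≡ replicate i α ++ replicate k χ ++ replicate l υ
  steps-word i k l = cong₂ _++_ (steps-pow 0F i) (cong₂ _++_ (steps-pow 1F k) (steps-pow 2F l))

  small-𝟙-multiple : ∀ s → s ℕ.< N → s • 𝟙 ≡ 𝟘 → s ≡ 0
  small-𝟙-multiple s s<N eq = residue-unique s<N (ℕ.m^n>0 2 (3 ℕ.+ j)) (red-injective (begin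
    red (+ s)      ≡⟨ cong red (sym (ℤ.*-identityʳ (+ s))) ⟩
    red (+ s * 1ℤ) ≡⟨ sym (•-red s 1ℤ) ⟩
    s • red 1ℤ     ≡⟨ cong (s •_) (sym 𝟙-red) ⟩
    s • 𝟙          ≡⟨ eq ⟩
    𝟘              ≡⟨ 𝟘-red ⟩
    red 0ℤ                  ∎))
    where open ≡-Reasoning

  •-swap : ∀ a b u → a • (b • u) ≡ b • (a • u)
  •-swap a b u = begin
    a • (b • u)             ≡⟨ cong (a •_) (•-ι b u) ⟩
    a • red (+ b * ι u)     ≡⟨ •-red a (+ b * ι u) ⟩
    red (+ a * (+ b * ι u)) ≡⟨ cong red (swap (+ a) (+ b) (ι u)) ⟩
    red (+ b * (+ a * ι u)) ≡⟨ sym (•-red b (+ a * ι u)) ⟩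
    b • red (+ a * ι u)     ≡⟨ cong (b •_) (sym (•-ι a u)) ⟩
    b • (a • u)                      ∎
    where
    open ≡-Reasoning
    swap : ∀ a b u → a * (b * u) ≡ b * (a * u)
    swap = solve-∀

  •-𝟘 : ∀ k → k • 𝟘 ≡ 𝟘
  •-𝟘 zero    = refl
  •-𝟘 (suc k) = trans (cong (𝟘 ⊕_) (•-𝟘 k)) (solve (zer :+ zer) zer 𝟘 𝟘 𝟘)

  small-𝕖⊖𝟙-multiple : ∀ s → s ℕ.< N → s • (𝕖 ⊖ 𝟙) ≡ 𝟘 → s ≡ 0
  small-𝕖⊖𝟙-multiple s s<N eq = let k , unit = multiple-of-𝕖⊖𝟙 𝟙 in small-𝟙-multiple s s<N
    (trans (cong (s •_) (sym unit)) (trans (•-swap s k (𝕖 ⊖ 𝟙)) (trans (cong (k •_) eq) (•-𝟘 k))))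

  -- Writing l = 4 s + r, the remainder r shows in the class of the image facet and s in its
  -- position, where s is below N.
  υ-order : ∀ l → l ℕ.< 2 ℕ.* (2 ℕ.* N) → run (replicate l υ) (cel 0F 𝟘) ≡ cel 0F 𝟘 → l ≡ 0
  υ-order l l< fixed = trans l≡ (cong₂ (λ s r → s ℕ.* 4 ℕ.+ r) s≡0 (proj₁ result))
    where
    s r : ℕ
    s = l ℕ./ 4
    r = l ℕ.% 4
    l≡ : l ≡ s ℕ.* 4 ℕ.+ r
    l≡ = trans (ℕ.m≡m%n+[m/n]*n l 4) (ℕ.+-comm r (s ℕ.* 4))
    s<N : s ℕ.< N
    s<N = ℕ.m<n*o⇒m/o<n (subst (l ℕ.<_) (trans (sym (ℕ.*-assoc 2 2 N)) (ℕ.*-comm 4 N)) l<)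
    moved : run (replicate r υ) (cel 0F (𝟘 ⊕ s • 𝟙)) ≡ cel 0F 𝟘
    moved = trans (cong (run (replicate r υ)) (sym (υ⁴-power s (cel 0F 𝟘))))
      (trans (sym (run-replicate (s ℕ.* 4) r υ (cel 0F 𝟘)))
        (trans (cong (λ l → run (replicate l υ) (cel 0F 𝟘)) (sym l≡)) fixed))
    cel-val : ∀ {ρ} {t u : Z} → cel ρ t ≡ cel ρ u → t ≡ u
    cel-val refl = refl
    stays : ∀ r u → r ℕ.< 4 → run (replicate r υ) (cel 0F u) ≡ cel 0F 𝟘 → r ≡ 0 × u ≡ 𝟘
    stays 0 u _ eq = refl , cel-val eq
    stays 1 u _ ()
    stays 2 u _ ()
    stays 3 u _ ()
    stays (suc (suc (suc (suc r)))) u (s≤s (s≤s (s≤s (s≤s ()))))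
    result = stays r (𝟘 ⊕ s • 𝟙) (ℕ.m%n<n l 4) moved
    s≡0 : s ≡ 0
    s≡0 = small-𝟙-multiple s s<N (trans (solve var₁ (zer :+ var₁) (s • 𝟙) 𝟘 𝟘) (proj₂ result))

  χ-order : ∀ k → k ℕ.< 2 ℕ.* N → run (replicate k χ) (edg 0F 𝟘) ≡ edg 0F 𝟘 → k ≡ 0
  χ-order k k< fixed = trans k≡ (cong₂ (λ s r → s ℕ.* 2 ℕ.+ r) s≡0 (proj₁ result))
    where
    s r : ℕ
    s = k ℕ./ 2
    r = k ℕ.% 2
    k≡ : k ≡ s ℕ.* 2 ℕ.+ r
    k≡ = trans (ℕ.m≡m%n+[m/n]*n k 2) (ℕ.+-comm r (s ℕ.* 2))
    s<N : s ℕ.< N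
    s<N = ℕ.m<n*o⇒m/o<n (subst (k ℕ.<_) (ℕ.*-comm 2 N) k<)
    moved : run (replicate r χ) (edg 0F (𝟘 ⊕ s • (𝕖 ⊖ 𝟙))) ≡ edg 0F 𝟘
    moved = trans (cong (run (replicate r χ)) (sym (χ²-power s (edg 0F 𝟘))))
      (trans (sym (run-replicate (s ℕ.* 2) r χ (edg 0F 𝟘)))
        (trans (cong (λ k → run (replicate k χ) (edg 0F 𝟘)) (sym k≡)) fixed))
    edg-val : ∀ {i} {t u : Z} → edg i t ≡ edg i u → t ≡ u
    edg-val refl = refl
    stays : ∀ r u → r ℕ.< 2 → run (replicate r χ) (edg 0F u) ≡ edg 0F 𝟘 → r ≡ 0 × u ≡ 𝟘
    stays 0 u _ eq = refl , edg-val eq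
    stays 1 u _ ()
    stays (suc (suc r)) u (s≤s (s≤s ()))
    result = stays r (𝟘 ⊕ s • (𝕖 ⊖ 𝟙)) (ℕ.m%n<n k 2) moved
    s≡0 : s ≡ 0
    s≡0 = small-𝕖⊖𝟙-multiple s s<N (trans (solve var₁ (zer :+ var₁) (s • (𝕖 ⊖ 𝟙)) 𝟘 𝟘) (proj₂ result))

  α-order : ∀ i → i ℕ.< 4 → run (replicate i α) (vtx 0F) ≡ vtx 0F → i ≡ 0
  α-order 0 _ _ = refl
  α-order 1 _ ()
  α-order 2 _ ()
  α-order 3 _ ()
  α-order (suc (suc (suc (suc i)))) (s≤s (s≤s (s≤s (s≤s ()))))

  -- The exponents are read off one at a time: `α` and `χ` fix the base facet, which isolates l;
  -- then `χ` fixes the base vertex, which isolates i; the base edge finally gives k.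
  faithful : ∀ i k l → i ℕ.< 4 → k ℕ.< 2 ℕ.* N → l ℕ.< 2 ℕ.* (2 ℕ.* N) →
    (∀ F → run (replicate i α ++ replicate k χ ++ replicate l υ) F ≡ F) → i ≡ 0 × k ≡ 0 × l ≡ 0
  faithful i k l i< k< l< fixed = i≡0 , k≡0 , l≡0
    where
    split : ∀ F → run (replicate l υ) (run (replicate k χ) (run (replicate i α) F)) ≡ F
    split F = trans (sym (trans (run-++ (replicate i α) _ F) (run-++ (replicate k χ) (replicate l υ) _))) (fixed F)
    l≡0 : l ≡ 0
    l≡0 = υ-order l l< (trans (cong (run (replicate l υ)) (sym
      (trans (cong (run (replicate k χ)) (proj₂ (α-fixes i))) (proj₂ (χ-fixes k))))) (split (cel 0F 𝟘)))
    rest : ∀ F → run (replicate k χ) (run (replicate i α) F) ≡ F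
    rest F = subst (λ l → run (replicate l υ) (run (replicate k χ) (run (replicate i α) F)) ≡ F) l≡0 (split F)
    i≡0 : i ≡ 0
    i≡0 = α-order i i< (run-injective (replicate k χ) (trans (rest (vtx 0F)) (sym (proj₁ (χ-fixes k)))))
    k≡0 : k ≡ 0
    k≡0 = χ-order k k< (subst (λ i → run (replicate k χ) (run (replicate i α) (edg 0F 𝟘)) ≡ edg 0F 𝟘) i≡0
        (rest (edg 0F 𝟘)))

  trivial-word : ∀ w → (∀ F → run (steps w) F ≡ F) → Derivable NF.R w ε
  trivial-word w fixed = let i , k , l , i< , k< , l< , eq = NF.normal-form w
                             i≡0 , k≡0 , l≡0 = faithful i k l i< k< l< λ F →
                               trans (cong (λ gs → run gs F) (sym (steps-word i k l)))
                                 (trans (sym (sound relations eq F)) (fixed F))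
                         in ≐-trans eq (subst (λ i → Derivable NF.R (word i k l) ε) (sym i≡0)
                              (subst₂ (λ k l → Derivable NF.R (word 0 k l) ε) (sym k≡0) (sym l≡0)
                                (≐-trans (identityˡ _) (identityˡ _))))

  injective-words : ∀ {u v} → (∀ F → run (steps u) F ≡ run (steps v) F) → Derivable NF.R u v
  injective-words {u} {v} eq = ≐-trans (≐-sym (identityʳ u)) (≐-trans (∙-cong ≐-refl (≐-sym (inverseˡ v)))
    (≐-trans (≐-sym (assoc u (v ⁻¹) v)) (≐-trans (∙-cong (trivial-word (u ∙ v ⁻¹) fixed) ≐-refl) (identityˡ v))))
    where
    fixed : ∀ F → run (steps (u ∙ v ⁻¹)) F ≡ F
    fixed F = trans (run-++ (steps u) (inverse (steps v)) F)
      (trans (cong (run (inverse (steps v))) (eq F)) (run-inverseˡ (steps v) F))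

  represent : Word 3 → Isomorphism polytope polytope
  represent w = auto (steps w)

  -- Some rotation agrees with `g` on the base flag, hence everywhere. The alternative, an image in
  -- the orbit of `Φ₁`, is excluded by chirality.
  surjective-words : ∀ g → ∃[ w ] ∀ F → run (steps w) F ≡ to g F
  surjective-words g = decide (transitive (_·_ polytope Φ₀ g))
    where
    decide : ∃[ gs ] (Rotation gs × (Φ₀ ▸ gs P.≈ _·_ polytope Φ₀ g ⊎ Φ₁ ▸ gs P.≈ _·_ polytope Φ₀ g)) →
      ∃[ w ] ∀ F → run (steps w) F ≡ to g F
    decide (_ , rotation i k l , inj₁ e) = word i k l , λ F → trans (cong (λ gs → run gs F) (steps-word i k l))
      (equal-on-flag (auto (replicate i α ++ replicate k χ ++ replicate l υ)) g Φ₀ e F)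
    decide (gs , _ , inj₂ e) = contradiction
      (PolytopeLemmas.orbit-trans polytope {Φ₀} {_·_ polytope Φ₀ g} {Φ₁} (g , λ _ → refl)
        (PolytopeLemmas.orbit-sym polytope {Φ₁} {_·_ polytope Φ₀ g} (auto gs , e)))
      ¬Φ₀~Φ₁

  isGroupIsomorphism : GroupMorphisms.IsGroupIsomorphism
    (Group.rawGroup (Presented 3 NF.R)) (Group.rawGroup (Aut polytope)) represent
  isGroupIsomorphism = record
    { isGroupMonomorphism = record
      { isGroupHomomorphism = record
        { isMonoidHomomorphism = record
          { isMagmaHomomorphism = record
            { isRelHomomorphism = record { cong = sound relations }
            ; homo = λ u v → run-++ (steps u) (steps v)
            }
          ; ε-homo = λ _ → refl
          }
        ; ⁻¹-homo = λ _ _ → refl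
        }
      ; injective = injective-words
      }
    ; surjective = λ g → let w , eq = surjective-words g in w , λ e F → trans (sound relations e F) (eq F)
    }

  standardGenerators : IsStandardGenerators polytope Φ₀ (represent ∘ gen)
  standardGenerators 0F = flips-α
  standardGenerators 1F = flips-χ
  standardGenerators 2F = flips-υ

theorem5p9 : (β : ℕ) → 5 ≤ β → (ϵ : ℤ) → ϵ ≡ 1ℤ ⊎ ϵ ≡ -1ℤ →
    Σ (Polytope 4) λ P →
    HasType P 4 (2 ^ (β ∸ 1)) (2 ^ β) ×
    IsAtomicChiral P ×
    IsAutGroupWithGenerators (Λ₃ β ϵ) gen P
-- With β = 5 + j, the numbers 2 ^ (β - 1) and 2 ^ β compute to 2 N and 2 (2 N), so the relations of
-- `Λ₃ β ϵ` are definitionally those used for normal forms.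
theorem5p9 _ (s≤s (s≤s (s≤s (s≤s (s≤s (z≤n {j})))))) ϵ ϵ-unit =
  polytope , hasType , (tight , chiral , λ Q _ → no-proper-chiral-quotient Q) ,
  Φ₀ , represent , isGroupIsomorphism , standardGenerators
  where open Representation j ϵ ϵ-unit
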